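{- For every $\epsilon>0$ there is $N_0(\epsilon)$ such that for all $N\ge N_0(\epsilon)$ and all $A,B\subseteq[N]=\{1,\dots,N\}$ with $|A|,|B|\ge(\tfrac38+\epsilon)N$, the sumset $A+B$ contains a perfect square. Quantitatively, $$\#\{(a,b)\in A\times B : a+b\in S\}\ \ge\ 10^{ -6}\epsilon^3N^{3/2},$$ where $S=\{m^2:m\in\mathbb{N}\}$ is the set of positive perfect squares. -}

module Defs where

open import Data.Fin.Base using (Fin; toℕ)
open import Data.Fin.Subset using (Subset; _∈_)
open import Data.Fin.Subset.Properties using (_∈?_)
open import Data.Integer.Base as ℤ using (+_; +[1+_]; +≤+)
import Data.Integer.Properties as ℤ
open import Data.Integer.Tactic.RingSolver using (solve-∀)
open import Data.List.Base using (List; allFin; cartesianProduct; filter; length)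
open import Data.Nat.Base as ℕ using (ℕ; zero; suc; z≤n; s≤s)
import Data.Nat.Properties as ℕ
import Data.Nat.Solver as ℕ
open import Data.Product.Base using (_×_; _,_; ∃-syntax)
open import Data.Rational.Base as ℚ using (ℚ; mkℚ; 0ℚ; 1ℚ; ½; ∣_∣; Positive; _/_; 1/_)
import Data.Rational.Properties as ℚ
open import Data.Rational.Solver using (module +-*-Solver)
open import Data.Rational.Unnormalised.Base as ℚᵘ using (mkℚᵘ)
import Data.Rational.Unnormalised.Properties as ℚᵘ
open import Data.Sum.Base using (inj₁; inj₂)
open import Relation.Binary.PropositionalEquality using (_≡_; refl; sym; trans; cong; cong₂; subst)
open import Relation.Nullary.Decidable using (yes; no; map′; _×-dec_)
open import Relation.Nullary.Negation using (contradiction)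
open import Relation.Unary using (Pred; Decidable)
open import Level using (0ℓ)

∣x-y∣≤δ : ∀ {x y δ} → x ℚ.≤ y ℚ.+ δ → y ℚ.≤ x ℚ.+ δ → ∣ x ℚ.- y ∣ ℚ.≤ δ
∣x-y∣≤δ {x} {y} {δ} x≤y+δ y≤x+δ with ℚ.∣p∣≡p∨∣p∣≡-p (x ℚ.- y)
... | inj₁ eq = begin
  ∣ x ℚ.- y ∣           ≡⟨ eq ⟩
  x ℚ.- y               ≤⟨ ℚ.+-monoˡ-≤ (ℚ.- y) x≤y+δ ⟩
  (y ℚ.+ δ) ℚ.- y       ≡⟨ solve 2 (λ y d → (y :+ d) :+ :- y := d) refl y δ ⟩
  δ                     ∎
  where
  open ℚ.≤-Reasoning
  open +-*-Solver
... | inj₂ eq = begin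
  ∣ x ℚ.- y ∣           ≡⟨ eq ⟩
  ℚ.- (x ℚ.- y)         ≡⟨ solve 2 (λ x y → :- (x :+ :- y) := y :+ :- x) refl x y ⟩
  y ℚ.- x               ≤⟨ ℚ.+-monoˡ-≤ (ℚ.- x) y≤x+δ ⟩
  (x ℚ.+ δ) ℚ.- x       ≡⟨ solve 2 (λ y d → (y :+ d) :+ :- y := d) refl x δ ⟩
  δ                     ∎
  where
  open ℚ.≤-Reasoning
  open +-*-Solver

half+half : ∀ δ → ½ ℚ.* δ ℚ.+ ½ ℚ.* δ ≡ δ
half+half δ = trans (sym (ℚ.*-distribʳ-+ δ ½ ½)) (ℚ.*-identityˡ δ)

*-pos : ∀ {p q} → 0ℚ ℚ.< p → 0ℚ ℚ.< q → 0ℚ ℚ.< p ℚ.* q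
*-pos {p} {q} 0<p 0<q =
  subst (ℚ._< p ℚ.* q) (ℚ.*-zeroˡ q) (ℚ.*-monoˡ-<-pos q {{ℚ.positive 0<q}} 0<p)

half-pos : ∀ {δ} → 0ℚ ℚ.< δ → 0ℚ ℚ.< ½ ℚ.* δ
half-pos = *-pos (ℚ.positive⁻¹ ½)

divideBy : ∀ {b δ} → 0ℚ ℚ.< b → 0ℚ ℚ.< δ → ∃[ η ] 0ℚ ℚ.< η × b ℚ.* η ≡ δ
divideBy {b} {δ} 0<b 0<δ = 1/b ℚ.* δ , *-pos (ℚ.positive⁻¹ 1/b {{ℚ.1/pos⇒pos b}}) 0<δ ,
  trans (sym (ℚ.*-assoc b 1/b δ)) (trans (cong (ℚ._* δ) (ℚ.*-inverseʳ b)) (ℚ.*-identityˡ δ))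
  where
  instance
    b-pos : Positive b
    b-pos = ℚ.positive 0<b
    b-nonZero : ℚ.NonZero b
    b-nonZero = ℚ.pos⇒nonZero b
  1/b : ℚ
  1/b = 1/ b

*-mono-≤-nonNeg : ∀ {p q r s} → 0ℚ ℚ.≤ p → 0ℚ ℚ.≤ s → p ℚ.≤ q → r ℚ.≤ s → p ℚ.* r ℚ.≤ q ℚ.* s
*-mono-≤-nonNeg {p} {q} {r} {s} 0≤p 0≤s p≤q r≤s = ℚ.≤-trans
  (ℚ.*-monoˡ-≤-nonNeg p {{ℚ.nonNegative 0≤p}} r≤s)
  (ℚ.*-monoʳ-≤-nonNeg s {{ℚ.nonNegative 0≤s}} p≤q)

/-mono-≤ : ∀ a k b l → a ℕ.* suc l ℕ.≤ b ℕ.* suc k → (+ a / suc k) ℚ.≤ (+ b / suc l)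
/-mono-≤ a k b l le = ℚ.toℚᵘ-cancel-≤ (begin
  ℚ.toℚᵘ (+ a / suc k)  ≃⟨ ℚ.toℚᵘ-fromℚᵘ (mkℚᵘ (+ a) k) ⟩
  mkℚᵘ (+ a) k          ≤⟨ ℚᵘ.*≤* (ℤ≤ le) ⟩
  mkℚᵘ (+ b) l          ≃⟨ ℚ.toℚᵘ-fromℚᵘ (mkℚᵘ (+ b) l) ⟨
  ℚ.toℚᵘ (+ b / suc l)  ∎)
  where
  open ℚᵘ.≤-Reasoning
  ℤ≤ : a ℕ.* suc l ℕ.≤ b ℕ.* suc k → + a ℤ.* + suc l ℤ.≤ + b ℤ.* + suc k
  ℤ≤ p rewrite sym (ℤ.pos-* a (suc l)) | sym (ℤ.pos-* b (suc k)) = +≤+ p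

suc-/ : ∀ a k → (+ suc a / suc k) ≡ (+ a / suc k) ℚ.+ (+ 1 / suc k)
suc-/ a k = ℚ.toℚᵘ-injective (begin-equality
  ℚ.toℚᵘ (+ suc a / suc k)  ≃⟨ ℚ.toℚᵘ-fromℚᵘ (mkℚᵘ (+ suc a) k) ⟩
  mkℚᵘ (+ suc a) k          ≃⟨ ℚᵘ.*≡* (lemma (+ a) (+ suc k)) ⟩
  mkℚᵘ (+ a) k ℚᵘ.+ mkℚᵘ (+ 1) k
    ≃⟨ ℚᵘ.+-cong (ℚ.toℚᵘ-fromℚᵘ (mkℚᵘ (+ a) k)) (ℚ.toℚᵘ-fromℚᵘ (mkℚᵘ (+ 1) k)) ⟨
  ℚ.toℚᵘ (+ a / suc k) ℚᵘ.+ ℚ.toℚᵘ (+ 1 / suc k)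
    ≃⟨ ℚ.toℚᵘ-homo-+ (+ a / suc k) (+ 1 / suc k) ⟨
  ℚ.toℚᵘ ((+ a / suc k) ℚ.+ (+ 1 / suc k)) ∎)
  where
  open ℚᵘ.≤-Reasoning
  lemma : ∀ a k → (+ 1 ℤ.+ a) ℤ.* (k ℤ.* k) ≡ (a ℤ.* k ℤ.+ + 1 ℤ.* k) ℤ.* k
  lemma = solve-∀

*-/ : ∀ a b k → (+ a / suc k) ℚ.* (+ b / suc k) ≡ (+ (a ℕ.* b) / (suc k ℕ.* suc k))
*-/ a b k = ℚ.toℚᵘ-injective (begin-equality
  ℚ.toℚᵘ ((+ a / suc k) ℚ.* (+ b / suc k))
    ≃⟨ ℚ.toℚᵘ-homo-* (+ a / suc k) (+ b / suc k) ⟩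
  ℚ.toℚᵘ (+ a / suc k) ℚᵘ.* ℚ.toℚᵘ (+ b / suc k)
    ≃⟨ ℚᵘ.*-cong (ℚ.toℚᵘ-fromℚᵘ (mkℚᵘ (+ a) k)) (ℚ.toℚᵘ-fromℚᵘ (mkℚᵘ (+ b) k)) ⟩
  mkℚᵘ (+ a) k ℚᵘ.* mkℚᵘ (+ b) k
    ≡⟨ cong (λ z → mkℚᵘ z (k ℕ.+ k ℕ.* suc k)) (sym (ℤ.pos-* a b)) ⟩
  mkℚᵘ (+ (a ℕ.* b)) (k ℕ.+ k ℕ.* suc k)
    ≃⟨ ℚ.toℚᵘ-fromℚᵘ (mkℚᵘ (+ (a ℕ.* b)) (k ℕ.+ k ℕ.* suc k)) ⟨
  ℚ.toℚᵘ (+ (a ℕ.* b) / (suc k ℕ.* suc k)) ∎)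
  where
  open ℚᵘ.≤-Reasoning

archimedean : ∀ {δ} → 0ℚ ℚ.< δ → ∃[ M ] (∀ k → M ℕ.≤ k → (+ 1 / suc k) ℚ.≤ δ)
archimedean {δ@(mkℚ +[1+ a ] d _)} _ = d , λ k d≤k →
  subst ((+ 1 / suc k) ℚ.≤_) (ℚ.↥p/↧p≡p δ)
    (/-mono-≤ 1 k (suc a) d (ℕ.*-mono-≤ {1} {suc a} (s≤s z≤n) (s≤s d≤k)))
archimedean {mkℚ (+ 0) _ _} 0<δ = contradiction (ℚ.positive 0<δ) λ ()
archimedean {mkℚ ℤ.-[1+ _ ] _ _} 0<δ = contradiction (ℚ.positive 0<δ) λ ()

-- Two Cauchy sequences represent the same real number when they are related by
-- _≃_ below; _<_ and _≤_ compare the limits, not the sequences termwise.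
record ℝ : Set where
  constructor mkℝ
  field
    seq    : ℕ → ℚ
    cauchy : ∀ δ → 0ℚ ℚ.< δ →
             ∃[ M ] (∀ m n → M ℕ.≤ m → M ℕ.≤ n → ∣ seq m ℚ.- seq n ∣ ℚ.≤ δ)

open ℝ public

infix  4 _<_ _≤_ _≃_
infixl 6 _+_
infixl 7 _*_
infixr 8 _^_

_<_ _≤_ _≃_ : ℝ → ℝ → Set
x < y = ∃[ δ ] 0ℚ ℚ.< δ × ∃[ M ] (∀ n → M ℕ.≤ n → seq x n ℚ.+ δ ℚ.≤ seq y n)
x ≤ y = ∀ δ → 0ℚ ℚ.< δ → ∃[ M ] (∀ n → M ℕ.≤ n → seq x n ℚ.≤ seq y n ℚ.+ δ)
x ≃ y = x ≤ y × y ≤ x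

fromℚ : ℚ → ℝ
fromℚ q = mkℝ (λ _ → q) λ δ 0<δ → 0 , λ _ _ _ _ →
  ℚ.≤-trans (ℚ.≤-reflexive (cong ∣_∣ (ℚ.+-inverseʳ q))) (ℚ.<⇒≤ 0<δ)

fromℕ : ℕ → ℝ
fromℕ n = fromℚ (+ n / 1)

0ℝ 1ℝ : ℝ
0ℝ = fromℚ 0ℚ
1ℝ = fromℚ 1ℚ

_+_ : ℝ → ℝ → ℝ
x + y = mkℝ (λ n → seq x n ℚ.+ seq y n) λ δ 0<δ →
  let M₁ , p = cauchy x (½ ℚ.* δ) (half-pos 0<δ)
      M₂ , q = cauchy y (½ ℚ.* δ) (half-pos 0<δ)
  in M₁ ℕ.⊔ M₂ , λ m n M≤m M≤n → begin
    ∣ (seq x m ℚ.+ seq y m) ℚ.- (seq x n ℚ.+ seq y n) ∣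
      ≡⟨ cong ∣_∣ (solve 4 (λ a b c d → (a :+ b) :+ :- (c :+ d) := (a :+ :- c) :+ (b :+ :- d))
                    refl (seq x m) (seq y m) (seq x n) (seq y n)) ⟩
    ∣ (seq x m ℚ.- seq x n) ℚ.+ (seq y m ℚ.- seq y n) ∣
      ≤⟨ ℚ.∣p+q∣≤∣p∣+∣q∣ (seq x m ℚ.- seq x n) (seq y m ℚ.- seq y n) ⟩
    ∣ seq x m ℚ.- seq x n ∣ ℚ.+ ∣ seq y m ℚ.- seq y n ∣
      ≤⟨ ℚ.+-mono-≤ (p m n (ℕ.m⊔n≤o⇒m≤o M₁ M₂ M≤m) (ℕ.m⊔n≤o⇒m≤o M₁ M₂ M≤n))
                    (q m n (ℕ.m⊔n≤o⇒n≤o M₁ M₂ M≤m) (ℕ.m⊔n≤o⇒n≤o M₁ M₂ M≤n)) ⟩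
    ½ ℚ.* δ ℚ.+ ½ ℚ.* δ
      ≡⟨ half+half δ ⟩
    δ ∎
  where
  open ℚ.≤-Reasoning
  open +-*-Solver

eventuallyBounded : ∀ x → ∃[ b ] 0ℚ ℚ.< b × ∃[ M ] (∀ n → M ℕ.≤ n → ∣ seq x n ∣ ℚ.≤ b)
eventuallyBounded x =
  let M , p = cauchy x 1ℚ (ℚ.positive⁻¹ 1ℚ)
  in 1ℚ ℚ.+ ∣ seq x M ∣
   , ℚ.<-≤-trans (ℚ.positive⁻¹ 1ℚ) (begin
       1ℚ                    ≡⟨ ℚ.+-identityʳ 1ℚ ⟨
       1ℚ ℚ.+ 0ℚ             ≤⟨ ℚ.+-monoʳ-≤ 1ℚ (ℚ.0≤∣p∣ (seq x M)) ⟩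
       1ℚ ℚ.+ ∣ seq x M ∣    ∎)
   , M , λ n M≤n → begin
       ∣ seq x n ∣
         ≡⟨ cong ∣_∣ (solve 2 (λ a b → a := (a :+ :- b) :+ b) refl (seq x n) (seq x M)) ⟩
       ∣ (seq x n ℚ.- seq x M) ℚ.+ seq x M ∣
         ≤⟨ ℚ.∣p+q∣≤∣p∣+∣q∣ (seq x n ℚ.- seq x M) (seq x M) ⟩
       ∣ seq x n ℚ.- seq x M ∣ ℚ.+ ∣ seq x M ∣
         ≤⟨ ℚ.+-monoˡ-≤ ∣ seq x M ∣ (p n M M≤n ℕ.≤-refl) ⟩
       1ℚ ℚ.+ ∣ seq x M ∣ ∎
  where
  open ℚ.≤-Reasoning
  open +-*-Solver

_*_ : ℝ → ℝ → ℝ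
x * y = mkℝ (λ n → seq x n ℚ.* seq y n) λ δ 0<δ →
  let b , 0<b , B₁ , x≤b = eventuallyBounded x
      c , 0<c , B₂ , y≤c = eventuallyBounded y
      η , 0<η , bη≡½δ    = divideBy 0<b (half-pos 0<δ)
      θ , 0<θ , cθ≡½δ    = divideBy 0<c (half-pos 0<δ)
      M₁ , p = cauchy x θ 0<θ
      M₂ , q = cauchy y η 0<η
      B = B₁ ℕ.⊔ B₂
      M = M₁ ℕ.⊔ M₂
  in B ℕ.⊔ M , λ m n K≤m K≤n →
    let B≤m = ℕ.m⊔n≤o⇒m≤o B M K≤m
        B≤n = ℕ.m⊔n≤o⇒m≤o B M K≤n
        M≤m = ℕ.m⊔n≤o⇒n≤o B M K≤m
        M≤n = ℕ.m⊔n≤o⇒n≤o B M K≤n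
    in begin
    ∣ seq x m ℚ.* seq y m ℚ.- seq x n ℚ.* seq y n ∣
      ≡⟨ cong ∣_∣ (solve 4 (λ a b c d → a :* b :+ :- (c :* d) := a :* (b :+ :- d) :+ d :* (a :+ :- c))
                    refl (seq x m) (seq y m) (seq x n) (seq y n)) ⟩
    ∣ seq x m ℚ.* (seq y m ℚ.- seq y n) ℚ.+ seq y n ℚ.* (seq x m ℚ.- seq x n) ∣
      ≤⟨ ℚ.∣p+q∣≤∣p∣+∣q∣ (seq x m ℚ.* (seq y m ℚ.- seq y n)) (seq y n ℚ.* (seq x m ℚ.- seq x n)) ⟩
    ∣ seq x m ℚ.* (seq y m ℚ.- seq y n) ∣ ℚ.+ ∣ seq y n ℚ.* (seq x m ℚ.- seq x n) ∣
      ≡⟨ cong₂ ℚ._+_ (ℚ.∣p*q∣≡∣p∣*∣q∣ (seq x m) (seq y m ℚ.- seq y n))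
                     (ℚ.∣p*q∣≡∣p∣*∣q∣ (seq y n) (seq x m ℚ.- seq x n)) ⟩
    ∣ seq x m ∣ ℚ.* ∣ seq y m ℚ.- seq y n ∣ ℚ.+ ∣ seq y n ∣ ℚ.* ∣ seq x m ℚ.- seq x n ∣
      ≤⟨ ℚ.+-mono-≤
           (*-mono-≤-nonNeg (ℚ.0≤∣p∣ (seq x m)) (ℚ.<⇒≤ 0<η) (x≤b m (ℕ.m⊔n≤o⇒m≤o B₁ B₂ B≤m))
             (q m n (ℕ.m⊔n≤o⇒n≤o M₁ M₂ M≤m) (ℕ.m⊔n≤o⇒n≤o M₁ M₂ M≤n)))
           (*-mono-≤-nonNeg (ℚ.0≤∣p∣ (seq y n)) (ℚ.<⇒≤ 0<θ) (y≤c n (ℕ.m⊔n≤o⇒n≤o B₁ B₂ B≤n))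
             (p m n (ℕ.m⊔n≤o⇒m≤o M₁ M₂ M≤m) (ℕ.m⊔n≤o⇒m≤o M₁ M₂ M≤n))) ⟩
    b ℚ.* η ℚ.+ c ℚ.* θ
      ≡⟨ cong₂ ℚ._+_ bη≡½δ cθ≡½δ ⟩
    ½ ℚ.* δ ℚ.+ ½ ℚ.* δ
      ≡⟨ half+half δ ⟩
    δ ∎
  where
  open ℚ.≤-Reasoning
  open +-*-Solver

_^_ : ℝ → ℕ → ℝ
x ^ zero  = 1ℝ
x ^ suc n = x * x ^ n

isqrt : ℕ → ℕ
isqrt zero    = 0
isqrt (suc n) with suc (isqrt n) ℕ.* suc (isqrt n) ℕ.≤? suc n
... | yes _ = suc (isqrt n)
... | no  _ = isqrt n

isqrt-lower : ∀ n → isqrt n ℕ.* isqrt n ℕ.≤ n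
isqrt-lower zero    = z≤n
isqrt-lower (suc n) with suc (isqrt n) ℕ.* suc (isqrt n) ℕ.≤? suc n
... | yes p = p
... | no  _ = ℕ.m≤n⇒m≤1+n (isqrt-lower n)

isqrt-upper : ∀ n → n ℕ.< suc (isqrt n) ℕ.* suc (isqrt n)
isqrt-upper zero    = s≤s z≤n
isqrt-upper (suc n) with suc (isqrt n) ℕ.* suc (isqrt n) ℕ.≤? suc n
... | yes _ = ℕ.≤-<-trans (isqrt-upper n)
                (ℕ.*-mono-< (ℕ.n<1+n (suc (isqrt n))) (ℕ.n<1+n (suc (isqrt n))))
... | no ¬p = ℕ.≰⇒> ¬p

square-cancel-≤ : ∀ a b → a ℕ.* a ℕ.≤ b ℕ.* b → a ℕ.≤ b
square-cancel-≤ a b le with a ℕ.≤? b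
... | yes a≤b = a≤b
... | no  a≰b = contradiction (ℕ.*-mono-< (ℕ.≰⇒> a≰b) (ℕ.≰⇒> a≰b)) (ℕ.≤⇒≯ le)

-- The k-th term is ⌊ (k+1)√n ⌋ / (k+1), which lies within 1/(k+1) of √n.
√-seq : ℕ → ℕ → ℚ
√-seq n k = + isqrt (n ℕ.* (suc k ℕ.* suc k)) / suc k

√-seq-step : ∀ n k l → √-seq n k ℚ.≤ √-seq n l ℚ.+ (+ 1 / suc l)
√-seq-step n k l = subst (√-seq n k ℚ.≤_) (suc-/ b l) (/-mono-≤ a k (suc b) l
    (square-cancel-≤ (a ℕ.* L) (suc b ℕ.* K) (begin
      (a ℕ.* L) ℕ.* (a ℕ.* L)          ≡⟨ swap a L ⟩
      (a ℕ.* a) ℕ.* (L ℕ.* L)          ≤⟨ ℕ.*-monoˡ-≤ (L ℕ.* L) (isqrt-lower (n ℕ.* (K ℕ.* K))) ⟩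
      (n ℕ.* (K ℕ.* K)) ℕ.* (L ℕ.* L)  ≡⟨ shuffle n (K ℕ.* K) (L ℕ.* L) ⟩
      (n ℕ.* (L ℕ.* L)) ℕ.* (K ℕ.* K)  ≤⟨ ℕ.*-monoˡ-≤ (K ℕ.* K) (ℕ.<⇒≤ (isqrt-upper (n ℕ.* (L ℕ.* L)))) ⟩
      (suc b ℕ.* suc b) ℕ.* (K ℕ.* K)  ≡⟨ swap (suc b) K ⟨
      (suc b ℕ.* K) ℕ.* (suc b ℕ.* K)  ∎)))
  where
  open ℕ.≤-Reasoning
  open ℕ.+-*-Solver
  K L a b : ℕ
  K = suc k
  L = suc l
  a = isqrt (n ℕ.* (K ℕ.* K))
  b = isqrt (n ℕ.* (L ℕ.* L))
  swap : ∀ x y → (x ℕ.* y) ℕ.* (x ℕ.* y) ≡ (x ℕ.* x) ℕ.* (y ℕ.* y)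
  swap = solve 2 (λ x y → (x :* y) :* (x :* y) := (x :* x) :* (y :* y)) refl
  shuffle : ∀ x y z → (x ℕ.* y) ℕ.* z ≡ (x ℕ.* z) ℕ.* y
  shuffle = solve 3 (λ x y z → (x :* y) :* z := (x :* z) :* y) refl

√ : ℕ → ℝ
√ n = mkℝ (√-seq n) λ δ 0<δ →
  let M , small = archimedean 0<δ
      le = λ k l M≤l → ℚ.≤-trans (√-seq-step n k l) (ℚ.+-monoʳ-≤ (√-seq n l) (small l M≤l))
  in M , λ k l M≤k M≤l → ∣x-y∣≤δ (le k l M≤l) (le l k M≤k)

0≤√ : ∀ n → 0ℝ ≤ √ n
0≤√ n δ 0<δ = 0 , λ k _ → ℚ.≤-trans (/-mono-≤ 0 0 (isqrt (n ℕ.* (suc k ℕ.* suc k))) k z≤n)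
  (subst (ℚ._≤ √-seq n k ℚ.+ δ) (ℚ.+-identityʳ (√-seq n k)) (ℚ.+-monoʳ-≤ (√-seq n k) (ℚ.<⇒≤ 0<δ)))

√*√≃ : ∀ n → √ n * √ n ≃ fromℕ n
√*√≃ n = below , above
  where
  open ℚ.≤-Reasoning
  module Term (k : ℕ) where
    K a : ℕ
    K = suc k
    a = isqrt (n ℕ.* (K ℕ.* K))
    s r : ℚ
    s = √-seq n k
    r = + 1 / suc k
    s²≤n : s ℚ.* s ℚ.≤ (+ n / 1)
    s²≤n = subst (ℚ._≤ (+ n / 1)) (sym (*-/ a a k))
      (/-mono-≤ (a ℕ.* a) (k ℕ.+ k ℕ.* suc k) n 0
        (subst (ℕ._≤ n ℕ.* (K ℕ.* K)) (sym (ℕ.*-identityʳ (a ℕ.* a))) (isqrt-lower (n ℕ.* (K ℕ.* K)))))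
    n≤[s+r]² : (+ n / 1) ℚ.≤ (s ℚ.+ r) ℚ.* (s ℚ.+ r)
    n≤[s+r]² = subst ((+ n / 1) ℚ.≤_)
      (trans (sym (*-/ (suc a) (suc a) k)) (cong₂ ℚ._*_ (suc-/ a k) (suc-/ a k)))
      (/-mono-≤ n 0 (suc a ℕ.* suc a) (k ℕ.+ k ℕ.* suc k)
        (subst (n ℕ.* (K ℕ.* K) ℕ.≤_) (sym (ℕ.*-identityʳ (suc a ℕ.* suc a)))
          (ℕ.<⇒≤ (isqrt-upper (n ℕ.* (K ℕ.* K))))))
    r≤1 : r ℚ.≤ 1ℚ
    r≤1 = /-mono-≤ 1 k 1 0 (s≤s z≤n)
    0≤r : 0ℚ ℚ.≤ r
    0≤r = /-mono-≤ 0 0 1 k z≤n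

  below : √ n * √ n ≤ fromℕ n
  below δ 0<δ = 0 , λ k _ → begin
    Term.s k ℚ.* Term.s k    ≤⟨ Term.s²≤n k ⟩
    (+ n / 1)                ≡⟨ ℚ.+-identityʳ (+ n / 1) ⟨
    (+ n / 1) ℚ.+ 0ℚ         ≤⟨ ℚ.+-monoʳ-≤ (+ n / 1) (ℚ.<⇒≤ 0<δ) ⟩
    (+ n / 1) ℚ.+ δ          ∎

  above : fromℕ n ≤ √ n * √ n
  above δ 0<δ =
    let b , 0<b , M₁ , s≤b = eventuallyBounded (√ n)
        c = b ℚ.+ b ℚ.+ 1ℚ
        0<c = ℚ.+-mono-< (ℚ.+-mono-< 0<b 0<b) (ℚ.positive⁻¹ 1ℚ)
        η , 0<η , cη≡δ = divideBy 0<c 0<δ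
        M₂ , small = archimedean 0<η
    in M₁ ℕ.⊔ M₂ , λ k M≤k →
      let open Term k
          s≤b′ = ℚ.≤-trans (p≤∣p∣ s) (s≤b k (ℕ.m⊔n≤o⇒m≤o M₁ M₂ M≤k))
          cr≤δ = begin
            (s ℚ.+ s ℚ.+ r) ℚ.* r  ≤⟨ ℚ.*-monoʳ-≤-nonNeg r {{ℚ.nonNegative 0≤r}}
                                        (ℚ.+-mono-≤ (ℚ.+-mono-≤ s≤b′ s≤b′) r≤1) ⟩
            c ℚ.* r                ≤⟨ ℚ.*-monoˡ-≤-nonNeg c {{ℚ.nonNegative (ℚ.<⇒≤ 0<c)}}
                                        (small k (ℕ.m⊔n≤o⇒n≤o M₁ M₂ M≤k)) ⟩
            c ℚ.* η                ≡⟨ cη≡δ ⟩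
            δ                      ∎
      in begin
        (+ n / 1)                            ≤⟨ n≤[s+r]² ⟩
        (s ℚ.+ r) ℚ.* (s ℚ.+ r)              ≡⟨ expand s r ⟩
        s ℚ.* s ℚ.+ (s ℚ.+ s ℚ.+ r) ℚ.* r    ≤⟨ ℚ.+-monoʳ-≤ (s ℚ.* s) cr≤δ ⟩
        s ℚ.* s ℚ.+ δ                        ∎
    where
    open +-*-Solver
    expand : ∀ s r → (s ℚ.+ r) ℚ.* (s ℚ.+ r) ≡ s ℚ.* s ℚ.+ (s ℚ.+ s ℚ.+ r) ℚ.* r
    expand = solve 2 (λ s r → (s :+ r) :* (s :+ r) := s :* s :+ (s :+ s :+ r) :* r) refl
    p≤∣p∣ : ∀ p → p ℚ.≤ ∣ p ∣
    p≤∣p∣ p with ℚ.≤-total 0ℚ p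
    ... | inj₁ 0≤p = ℚ.≤-reflexive (sym (ℚ.0≤p⇒∣p∣≡p 0≤p))
    ... | inj₂ p≤0 = ℚ.≤-trans p≤0 (ℚ.0≤∣p∣ p)

infix 8 _^3/2

_^3/2 : ℕ → ℝ
n ^3/2 = √ (n ℕ.^ 3)

-- A subset of [N] = {1, …, N} is a Subset N, where i : Fin N stands for the
-- integer toℕ i + 1.
⟦_⟧ : ∀ {N} → Fin N → ℕ
⟦ i ⟧ = suc (toℕ i)

infixl 6 _⊕_

_⊕_ : ∀ {N} → Subset N → Subset N → Pred ℕ 0ℓ
(A ⊕ B) n = ∃[ a ] ∃[ b ] a ∈ A × b ∈ B × ⟦ a ⟧ ℕ.+ ⟦ b ⟧ ≡ n

S : Pred ℕ 0ℓ
S n = ∃[ m ] 1 ℕ.≤ m × m ℕ.^ 2 ≡ n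

S? : Decidable S
S? n = map′ (λ (m , _ , p) → m , p) (λ (m , 1≤m , eq) → m , s≤s (bound m 1≤m eq) , 1≤m , eq)
  (ℕ.anyUpTo? (λ m → (1 ℕ.≤? m) ×-dec (m ℕ.^ 2 ℕ.≟ n)) (suc n))
  where
  bound : ∀ m → 1 ℕ.≤ m → m ℕ.^ 2 ≡ n → m ℕ.≤ n
  bound m@(suc _) 1≤m refl = ℕ.m≤m*n m (m ℕ.^ 1) {{ℕ.m^n≢0 m 1}}

squarePairs : ∀ {N} → Subset N → Subset N → List (Fin N × Fin N)
squarePairs {N} A B =
  filter (λ (a , b) → (a ∈? A) ×-dec (b ∈? B) ×-dec S? (⟦ a ⟧ ℕ.+ ⟦ b ⟧))
         (cartesianProduct (allFin N) (allFin N))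

#squarePairs : ∀ {N} → Subset N → Subset N → ℕ
#squarePairs A B = length (squarePairs A B)

{-# OPTIONS --safe #-}
module Submission where

-- For b in the class s modulo 4, the points (2l)² - b and (2l+2)² - b lie in the class -s, and (2l+1)² - b
-- lies in the class 1 - s. Weighting the window of these three squares by its length ω l = 8l + 4 makes the
-- points sweep out [0, n) evenly. Let f be the indicator A minus its averages over residue classes in short
-- blocks. If few pairs sum to a square, then B b A(m² - b) vanishes for most windows. Expanding the nonnegative
-- square (2i(c - B) - 2wX - Z₀ - Z₂)², where X, Z₀, Z₂ are the values of f at the three points, the correlations of
-- f with itself telescope, and a van der Corput argument replaces short blocks by long ones in the terms B · (A - f).
-- With c = (1-e)(1-u) and w = 1 - e for the densities e, u of A in the classes -s, 1 - s, this bounds the density of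
-- B in the class s by T₁(u, e) = (1-e)²(1-u) + ½e(1-e), up to a small error; likewise with A and B exchanged.
-- Applied at the largest of the eight densities, these bounds are incompatible with density above 3/8 for both sets.

open import Data.Bool.Base using (true; false)
open import Data.Fin.Base as F using (Fin; toℕ)
open import Data.Fin.Subset using (Subset; _∈_) renaming (∣_∣ to ∣_∣ˢ)
open import Data.Fin.Subset.Properties using (_∈?_; drop-there; ∣p∣≤n)
open import Data.Integer.Base using (+_)
open import Data.List.Base using (List; []; _∷_; allFin; cartesianProduct; filter; length; map; _++_; tabulate)
import Data.List.Properties as List
open import Data.List.Relation.Unary.All using (All; _∷_)
open import Data.List.Relation.Unary.All.Properties using (all-filter)
open import Data.Maybe.Base using (Maybe)
open import Data.Nat.Base as ℕ using (ℕ; zero; suc; z≤n; s≤s; _!)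
import Data.Nat.DivMod as ℕ
import Data.Nat.Divisibility as ℕ
import Data.Nat.Properties as ℕ
import Data.Nat.Tactic.RingSolver as ℕ
open import Data.Product.Base using (_×_; _,_; ∃-syntax; proj₁; proj₂)
import Data.Rational.Base
import Data.Rational.Properties
open import Data.Sum.Base using (_⊎_; inj₁; inj₂; [_,_]′)
open import Data.Vec.Base using ([]; _∷_; here; there)
import Defs
open import Function.Base using (_∘_; id)
open import Level using (0ℓ)
open import Relation.Binary.Definitions using (tri<; tri≈; tri>)
open import Relation.Binary.PropositionalEquality using (_≡_; _≢_; refl; sym; trans; cong; cong₂; subst; subst₂)
open import Relation.Nullary.Decidable.Core using (Dec; yes; no; _×-dec_; dec⇒maybe)
open import Relation.Nullary.Negation.Core using (¬_; contradiction)
open import Relation.Unary using (Pred; Decidable)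
open import Tactic.RingSolver using (solve-∀)
open import Tactic.RingSolver.Core.AlmostCommutativeRing using (AlmostCommutativeRing; fromCommutativeRing)

-- The constants are tied by c + wu + e = 1. On a window of some b in B without square sums, f
-- equals minus the block density at each of the three points, on average -e, -u and -e, and at
-- these values the form 2(c - 1) + 2wu + 2e is 0: the square is built to be small exactly where
-- pairs are missing. Two block lengths are needed because no single one serves. A correlation
-- between two of the three points costs a block length times a window length, and windows have
-- length of order √n, so blocks must be short against √n. Evaluating the averages themselves costs
-- one window length per block, so the number of blocks must be small against √n as well. Hence f is
-- formed with short blocks, while the averages, which meet B only linearly, may be exchanged for
-- those over long blocks before they are evaluated. The value 3/8 enters only at the end, as four
-- class densities that add up to at least 3/2.

module Rationals where

  open Data.Rational.Base
  open Data.Rational.Properties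

  0≟_ : ∀ x → Maybe (0ℚ ≡ x)
  0≟ x = dec⇒maybe (0ℚ ≟ x)

  ℚ-ring : AlmostCommutativeRing 0ℓ 0ℓ
  ℚ-ring = fromCommutativeRing +-*-commutativeRing 0≟_

  p≤q⇒0≤q-p : ∀ {p q} → p ≤ q → 0ℚ ≤ q - p
  p≤q⇒0≤q-p {p} {q} p≤q = subst (_≤ q - p) (+-inverseʳ p) (+-monoˡ-≤ (- p) p≤q)

  0≤q-p⇒p≤q : ∀ {p q} → 0ℚ ≤ q - p → p ≤ q
  0≤q-p⇒p≤q {p} {q} h = subst₂′ (+-monoˡ-≤ p h)
    where
    eq : ∀ p q → (q - p) + p ≡ q
    eq = solve-∀ ℚ-ring
    subst₂′ : 0ℚ + p ≤ (q - p) + p → p ≤ q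
    subst₂′ h′ = subst (p ≤_) (eq p q) (subst (_≤ (q - p) + p) (+-identityˡ p) h′)

  slack : ∀ {p q} r → 0ℚ ≤ r → q - p ≡ r → p ≤ q
  slack r 0≤r eq = 0≤q-p⇒p≤q (subst (0ℚ ≤_) (sym eq) 0≤r)

  0≤+ : ∀ {p q} → 0ℚ ≤ p → 0ℚ ≤ q → 0ℚ ≤ p + q
  0≤+ = +-mono-≤

  0≤* : ∀ {p q} → 0ℚ ≤ p → 0ℚ ≤ q → 0ℚ ≤ p * q
  0≤* {p} {q} 0≤p 0≤q = subst (_≤ p * q) (*-zeroʳ p) (*-monoˡ-≤-nonNeg p {{nonNegative 0≤p}} 0≤q)

  0≤p*p : ∀ p → 0ℚ ≤ p * p
  0≤p*p p with ≤-total 0ℚ p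
  ... | inj₁ 0≤p = 0≤* 0≤p 0≤p
  ... | inj₂ p≤0 = subst (0ℚ ≤_) (eq p) (0≤* (neg-antimono-≤ p≤0) (neg-antimono-≤ p≤0))
    where
    eq : ∀ p → (- p) * (- p) ≡ p * p
    eq = solve-∀ ℚ-ring

  cancel-pos : ∀ {p q} → 0ℚ < p → 0ℚ ≤ p * q → 0ℚ ≤ q
  cancel-pos {p} {q} 0<p h =
    *-cancelˡ-≤-pos p {{positive 0<p}} (subst (_≤ p * q) (sym (*-zeroʳ p)) h)

-- The inequality between class densities behind the constant 3/8

module DensityInequality where

  open Data.Rational.Base
  open Data.Rational.Properties
  open Rationals

  2ℚ ¾ : ℚ
  2ℚ = + 2 / 1
  ¾ = + 3 / 4

  lit : ∀ p → {{NonNegative p}} → 0ℚ ≤ p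
  lit p = nonNegative⁻¹ p

  -- With `k = ¾ - p`, the part of the slack in `ring-bound` that depends on `w` and `r` once the
  -- excess κ is set to k². It vanishes at k = w = r = 0, so nothing constant can be spared in its
  -- lower bound.
  Φ : ℚ → ℚ → ℚ → ℚ
  Φ k w r = w * w * ((+ 9 / 4) + k - w - r) + w * (r * r) + ½ * (r * (1ℚ - r)) - 2ℚ * k * w - k * k

  k≤k₁-identity : ∀ k r → (¾ - r) - k ≡ ¾ - (k + r)
  k≤k₁-identity = solve-∀ ℚ-ring

  0≤r-R-identity : ∀ w r → (+ 1 / 3) * ((w + (+ 3 / 1) * r) - (+ 3 / 2)) ≡ r - (½ - (+ 1 / 3) * w)
  0≤r-R-identity = solve-∀ ℚ-ring

  0<¾-R-identity : ∀ w → ((+ 1 / 4) + (+ 1 / 3) * w) - (+ 1 / 4) ≡ (+ 1 / 3) * w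
  0<¾-R-identity = solve-∀ ℚ-ring

  k≤k₁-identity₂ : ∀ k w r → ½ * (w + r) - k ≡ ½ * ((w + r) - 2ℚ * k)
  k≤k₁-identity₂ = solve-∀ ℚ-ring

  0≤R-r-identity : ∀ w r → (+ 1 / 3) * ((+ 3 / 2) - (w + (+ 3 / 1) * r)) ≡ (½ - (+ 1 / 3) * w) - r
  0≤R-r-identity = solve-∀ ℚ-ring

  0<R-identity : ∀ w → (½ - (+ 1 / 3) * w) - (+ 1 / 4) ≡ (+ 1 / 3) * ((+ 5 / 8) - w) + (+ 1 / 24)
  0<R-identity = solve-∀ ℚ-ring

  0≤h-identity : ∀ k w → (¾ - (k + w)) + (+ 6 / 5) * (w - (+ 5 / 8)) ≡ (+ 1 / 5) * w - k
  0≤h-identity = solve-∀ ℚ-ring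

  0≤1-w-identity : ∀ k w → (¾ - (k + w)) + k + (+ 1 / 4) ≡ 1ℚ - w
  0≤1-w-identity = solve-∀ ℚ-ring

  0≤1-r-identity : ∀ k r → (¾ - (k + r)) + k + (+ 1 / 4) ≡ 1ℚ - r
  0≤1-r-identity = solve-∀ ℚ-ring

  Φ-small-identity : ∀ k w r → (¾ - (k + r) + k) * (((+ 1 / 4) - (+ 5 / 6) * w) * ((+ 1 / 4) - (+ 5 / 6) * w) + (+ 2 / 9) * (w * w * ((+ 5 / 8) - w)))
    + (r - (½ - (+ 1 / 3) * w)) * ((+ 3 / 32) + (+ 9 / 16) * w + w * w * (½ + (1ℚ - w)))
    + (½ + (1ℚ - w)) * ((r - (½ - (+ 1 / 3) * w)) * (¾ - (k + r) + k) * ((+ 1 / 4) + (+ 1 / 3) * w))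
    ≡ ((+ 1 / 4) + (+ 1 / 3) * w) * (w * w * ((+ 9 / 4) + (¾ - r) - w - r) + w * (r * r) + ½ * (r * (1ℚ - r)) - 2ℚ * (¾ - r) * w - (¾ - r) * (¾ - r))
  Φ-small-identity = solve-∀ ℚ-ring

  Φ-small-identity₂ : ∀ k w r → (½ - (+ 1 / 3) * w - r) * (w * w * (½ + ½ * (1ℚ - w)))
    + r * (((+ 1 / 4) - (+ 5 / 6) * w) * ((+ 1 / 4) - (+ 5 / 6) * w) + (+ 2 / 9) * (w * w * ((+ 5 / 8) - w)))
    + (¾ - (k + w) + k) * (r * (½ - (+ 1 / 3) * w - r) * (½ - (+ 1 / 3) * w))
    ≡ (½ - (+ 1 / 3) * w) * (w * w * ((+ 9 / 4) + (½ * (w + r)) - w - r) + w * (r * r) + ½ * (r * (1ℚ - r)) - 2ℚ * (½ * (w + r)) * w - (½ * (w + r)) * (½ * (w + r)))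
  Φ-small-identity₂ = solve-∀ ℚ-ring

  Φ-antitone-identity : ∀ k k₁ w r → (w * w * ((+ 9 / 4) + k₁ - w - r) + w * (r * r) + ½ * (r * (1ℚ - r)) - 2ℚ * k₁ * w - k₁ * k₁)
    + (k₁ - k) * (w * (1ℚ + (1ℚ - w)) + k + k₁) ≡
    w * w * ((+ 9 / 4) + k - w - r) + w * (r * r) + ½ * (r * (1ℚ - r)) - 2ℚ * k * w - k * k
  Φ-antitone-identity = solve-∀ ℚ-ring

  Φ-large-identity : ∀ k w r → w * w * ((¾ - (k + r)) + (¾ - (k + w)) + (+ 3 / 1) * k)
    + w * (r * r) + ½ * (r * (1ℚ - r)) + (+ 31 / 100) * (w * w)
    + (+ 11 / 5) * (w * ((+ 1 / 5) * w - k)) + ((+ 1 / 5) * w - k) * k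
    ≡ w * w * ((+ 9 / 4) + k - w - r) + w * (r * r) + ½ * (r * (1ℚ - r)) - 2ℚ * k * w - k * k
  Φ-large-identity = solve-∀ ℚ-ring

  module _ {k w r} (0≤k : 0ℚ ≤ k) (0≤w : 0ℚ ≤ w) (0≤r : 0ℚ ≤ r)
    (2k≤w+r : 2ℚ * k ≤ w + r) (k+r≤¾ : k + r ≤ ¾) (k+w≤¾ : k + w ≤ ¾) where

    private
      0≤¾-k-r : 0ℚ ≤ ¾ - (k + r)
      0≤¾-k-r = p≤q⇒0≤q-p k+r≤¾
      0≤¾-k-w : 0ℚ ≤ ¾ - (k + w)
      0≤¾-k-w = p≤q⇒0≤q-p k+w≤¾
      0≤1-r : 0ℚ ≤ 1ℚ - r
      0≤1-r = subst (0ℚ ≤_) (0≤1-r-identity k r) (0≤+ (0≤+ 0≤¾-k-r 0≤k) (lit (+ 1 / 4)))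
      0≤1-w : 0ℚ ≤ 1ℚ - w
      0≤1-w = subst (0ℚ ≤_) (0≤1-w-identity k w) (0≤+ (0≤+ 0≤¾-k-w 0≤k) (lit (+ 1 / 4)))

    -- For w ≥ 5/8 the constraint k ≤ ¾ - w gives k ≤ w/5, and then the negative terms 2kw and k²
    -- are paid for by the multiple of w².
    Φ-large : + 5 / 8 ≤ w → 0ℚ ≤ Φ k w r
    Φ-large 5/8≤w = subst (0ℚ ≤_) (Φ-large-identity k w r)
      (0≤+ (0≤+ (0≤+ (0≤+ (0≤+ (0≤* (0≤* 0≤w 0≤w) (0≤+ (0≤+ 0≤¾-k-r 0≤¾-k-w) (0≤* (lit (+ 3 / 1)) 0≤k)))
        (0≤* 0≤w (0≤* 0≤r 0≤r))) (0≤* (lit ½) (0≤* 0≤r 0≤1-r)))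
        (0≤* (lit (+ 31 / 100)) (0≤* 0≤w 0≤w))) (0≤* (lit (+ 11 / 5)) (0≤* 0≤w 0≤h))) (0≤* 0≤h 0≤k))
      where
      0≤h : 0ℚ ≤ (+ 1 / 5) * w - k
      0≤h = subst (0ℚ ≤_) (0≤h-identity k w) (0≤+ 0≤¾-k-w (0≤* (lit (+ 6 / 5)) (p≤q⇒0≤q-p 5/8≤w)))

    private
      R : ℚ
      R = ½ - (+ 1 / 3) * w

    -- The derivative in `k` is w² - 2w - 2k, which is not positive for 0 ≤ w ≤ 1. Only the largest
    -- admissible `k` has to be examined.
    Φ-antitone : ∀ k₁ → k ≤ k₁ → 0ℚ ≤ Φ k₁ w r → 0ℚ ≤ Φ k w r
    Φ-antitone k₁ k≤k₁ 0≤Φ₁ = subst (0ℚ ≤_) (Φ-antitone-identity k k₁ w r)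
      (0≤+ 0≤Φ₁ (0≤* (p≤q⇒0≤q-p k≤k₁) (0≤+ (0≤+ (0≤* 0≤w (0≤+ (lit 1ℚ) 0≤1-w)) 0≤k) (≤-trans 0≤k k≤k₁))))

    -- The largest admissible `k` is the smaller of ¾ - r and (w + r)/2; these cross at r = `R`.
    -- Along either branch Φ is a concave quadratic in `r` and lies above its chord, taken from 0 to
    -- `R` or from `R` to ¾. The value at the corner is (¼ - 5w/6)² + (2/9)w²(5/8 - w), nonnegative
    -- for w ≤ 5/8. The identities are the chord inequalities multiplied by the length of the chord.
    Φ-small : w ≤ + 5 / 8 → 0ℚ ≤ Φ k w r
    Φ-small w≤5/8 with ≤-total (w + (+ 3 / 1) * r) (+ 3 / 2)
    ... | inj₁ le = Φ-antitone (½ * (w + r)) k≤k₁ (cancel-pos 0<R (subst (0ℚ ≤_) (Φ-small-identity₂ k w r)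
          (0≤+ (0≤+ (0≤* 0≤R-r (0≤* (0≤* 0≤w 0≤w) (0≤+ (lit ½) (0≤* (lit ½) 0≤1-w))))
                    (0≤* 0≤r 0≤HR))
               (0≤* (0≤+ 0≤¾-k-w 0≤k) (0≤* (0≤* 0≤r 0≤R-r) (<⇒≤ 0<R))))))
      where
      0≤5/8-w : 0ℚ ≤ (+ 5 / 8) - w
      0≤5/8-w = p≤q⇒0≤q-p w≤5/8
      0<R : 0ℚ < R
      0<R = <-≤-trans (positive⁻¹ (+ 1 / 4)) (slack ((+ 1 / 3) * ((+ 5 / 8) - w) + (+ 1 / 24))
        (0≤+ (0≤* (lit (+ 1 / 3)) 0≤5/8-w) (lit (+ 1 / 24))) (0<R-identity w))
      0≤R-r : 0ℚ ≤ R - r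
      0≤R-r = subst (0ℚ ≤_) (0≤R-r-identity w r) (0≤* (lit (+ 1 / 3)) (p≤q⇒0≤q-p le))
      k≤k₁ : k ≤ ½ * (w + r)
      k≤k₁ = slack (½ * ((w + r) - 2ℚ * k)) (0≤* (lit ½) (p≤q⇒0≤q-p 2k≤w+r)) (k≤k₁-identity₂ k w r)
      0≤HR : 0ℚ ≤ ((+ 1 / 4) - (+ 5 / 6) * w) * ((+ 1 / 4) - (+ 5 / 6) * w) + (+ 2 / 9) * (w * w * ((+ 5 / 8) - w))
      0≤HR = 0≤+ (0≤p*p ((+ 1 / 4) - (+ 5 / 6) * w)) (0≤* (lit (+ 2 / 9)) (0≤* (0≤* 0≤w 0≤w) 0≤5/8-w))
    ... | inj₂ ge = Φ-antitone (¾ - r) k≤k₁ (cancel-pos 0<¾-R (subst (0ℚ ≤_) (Φ-small-identity k w r)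
          (0≤+ (0≤+ (0≤* (0≤+ 0≤¾-k-r 0≤k) 0≤HR)
                    (0≤* 0≤r-R (0≤+ (0≤+ (lit (+ 3 / 32)) (0≤* (lit (+ 9 / 16)) 0≤w)) (0≤* (0≤* 0≤w 0≤w) (0≤+ (lit ½) 0≤1-w)))))
               (0≤* (0≤+ (lit ½) 0≤1-w) (0≤* (0≤* 0≤r-R (0≤+ 0≤¾-k-r 0≤k)) (<⇒≤ 0<¾-R))))))
      where
      0≤5/8-w : 0ℚ ≤ (+ 5 / 8) - w
      0≤5/8-w = p≤q⇒0≤q-p w≤5/8
      0<¾-R : 0ℚ < (+ 1 / 4) + (+ 1 / 3) * w
      0<¾-R = <-≤-trans (positive⁻¹ (+ 1 / 4)) (slack ((+ 1 / 3) * w) (0≤* (lit (+ 1 / 3)) 0≤w) (0<¾-R-identity w))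
      0≤r-R : 0ℚ ≤ r - (½ - (+ 1 / 3) * w)
      0≤r-R = subst (0ℚ ≤_) (0≤r-R-identity w r) (0≤* (lit (+ 1 / 3)) (p≤q⇒0≤q-p ge))
      k≤k₁ : k ≤ ¾ - r
      k≤k₁ = slack (¾ - (k + r)) 0≤¾-k-r (k≤k₁-identity k r)
      0≤HR : 0ℚ ≤ ((+ 1 / 4) - (+ 5 / 6) * w) * ((+ 1 / 4) - (+ 5 / 6) * w) + (+ 2 / 9) * (w * w * ((+ 5 / 8) - w))
      0≤HR = 0≤+ (0≤p*p ((+ 1 / 4) - (+ 5 / 6) * w)) (0≤* (lit (+ 2 / 9)) (0≤* (0≤* 0≤w 0≤w) 0≤5/8-w))

    0≤Φ : 0ℚ ≤ Φ k w r
    0≤Φ with ≤-total w (+ 5 / 8)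
    ... | inj₁ w≤5/8 = Φ-small w≤5/8
    ... | inj₂ 5/8≤w = Φ-large 5/8≤w

  T₁ : ℚ → ℚ → ℚ
  T₁ u v = (1ℚ - v) * (1ℚ - v) * (1ℚ - u) + ½ * (v * (1ℚ - v))

  total-identity : ∀ ζ p z w r o e y₂ y₃ κ → (1ℚ - p + κ + (+ 4 / 1) * ζ - o - e)
    + (((1ℚ - r) * (1ℚ - r) * (1ℚ - w) + ½ * (r * (1ℚ - r))) + ζ - y₂) + (((1ℚ - w) * (1ℚ - w) * (1ℚ - z) + ½ * (w * (1ℚ - w))) + ζ - y₃) + (1ℚ - w) * (1ℚ - w) * (p + z + w + r - (+ 3 / 2))
    + (w * (2ℚ * p - (+ 3 / 2)) + w * w * ((+ 3 / 1) - p - w - r) + w * (r * r) + ½ * (r * (1ℚ - r)) - κ)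
    ≡ (+ 3 / 2) + (+ 6 / 1) * ζ - (o + e + y₂ + y₃)
  total-identity = solve-∀ ℚ-ring

  first-identity : ∀ ζ p o e κ → ((1ℚ - e) * (1ℚ - e) * (1ℚ - o) + ½ * (e * (1ℚ - e))) + ζ - p + (p - ½ * (e * (1ℚ - e)) + (1ℚ - e) * (1ℚ - e) * (κ - p - e))
    + (+ 4 / 1) * ζ * ((½ - e) * (½ - e) + (½ - e))
    ≡ (1ℚ - e) * (1ℚ - e) * (1ℚ - p + κ + (+ 4 / 1) * ζ - o - e)
  first-identity = solve-∀ ℚ-ring

  0<c-identity : ∀ e → (+ 7 / 4) + ½ * (1ℚ - e) - (+ 7 / 4) ≡ ½ * (1ℚ - e)
  0<c-identity = solve-∀ ℚ-ring

  k+w≤¾-identity : ∀ p r → ¾ - (¾ - p + r) ≡ p - r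
  k+w≤¾-identity = solve-∀ ℚ-ring

  k+r≤¾-identity : ∀ p r → ¾ - (¾ - p + r) ≡ p - r
  k+r≤¾-identity = solve-∀ ℚ-ring

  2k≤w+r-identity : ∀ p z w r → w + r - 2ℚ * (¾ - p) ≡ (p + z + w + r - (+ 3 / 2)) + (p - z)
  2k≤w+r-identity = solve-∀ ℚ-ring

  0<[1-e]²-identity : ∀ e → (1ℚ - e) * (1ℚ - e) - (+ 1 / 4) ≡ (½ - e) * (½ - e) + (½ - e)
  0<[1-e]²-identity = solve-∀ ℚ-ring

  e≤½-identity : ∀ ζ p o e → ((1ℚ - e) * (1ℚ - e) * (1ℚ - o) + ½ * (e * (1ℚ - e))) + ζ - p + (p - e) + ((+ 1 / 10) - ζ) + (1ℚ - e) * (1ℚ - e) * o + (+ 1 / 40)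
    ≡ ((+ 7 / 4) + ½ * (1ℚ - e)) * (½ - e)
  e≤½-identity = solve-∀ ℚ-ring

  ring-bound-identity : ∀ p w r → w * w * ((+ 9 / 4) + (¾ - p) - w - r) + w * (r * r) + ½ * (r * (1ℚ - r)) - 2ℚ * (¾ - p) * w - (¾ - p) * (¾ - p)
    ≡ w * (2ℚ * p - (+ 3 / 2)) + w * w * ((+ 3 / 1) - p - w - r) + w * (r * r) + ½ * (r * (1ℚ - r)) - (¾ - p) * (¾ - p)
  ring-bound-identity = solve-∀ ℚ-ring

  ring-bound-identity₂ : ∀ p e → (e - (¾ - p) * (1ℚ - e)) * (e - (¾ - p) * (1ℚ - e)) + e * e * (p - e)
    ≡ p - ½ * (e * (1ℚ - e)) + (1ℚ - e) * (1ℚ - e) * ((¾ - p) * (¾ - p) - p - e)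
  ring-bound-identity₂ = solve-∀ ℚ-ring

  ring-bound-identity₃ : ∀ p w r → w * (2ℚ * (p - ¾)) + w * w * ((1ℚ - p) + (1ℚ - w) + (1ℚ - r)) + w * (r * r) + ½ * (r * (1ℚ - r))
    ≡ w * (2ℚ * p - (+ 3 / 2)) + w * w * ((+ 3 / 1) - p - w - r) + w * (r * r) + ½ * (r * (1ℚ - r)) - 0ℚ
  ring-bound-identity₃ = solve-∀ ℚ-ring

  ring-bound-identity₄ : ∀ p e → e * e * (¾ + (1ℚ - e)) + (p - ¾) * (e * (1ℚ + (1ℚ - e)))
    ≡ p - ½ * (e * (1ℚ - e)) + (1ℚ - e) * (1ℚ - e) * (0ℚ - p - e)
  ring-bound-identity₄ = solve-∀ ℚ-ring

  -- In the application `p` is the largest of the eight densities, in the class s of its set; `r`,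
  -- `w`, `z` belong to the classes s + 1, s + 2, s + 3 of the same set, and `e`, `o` to the classes
  -- -s and 1 - s of the other set, whose remaining classes have densities `y₃` and `y₂`. For ζ = 0
  -- the bound is attained at p = z = ¾, w = r = e = 0, o = y₃ = ¼, y₂ = 1.
  module _ {ζ p z w r o e y₂ y₃}
    (ζ≤⅒ : ζ ≤ + 1 / 10) (0≤ζ : 0ℚ ≤ ζ) (p≤1 : p ≤ 1ℚ)
    (0≤w : 0ℚ ≤ w) (0≤r : 0ℚ ≤ r) (0≤o : 0ℚ ≤ o) (0≤e : 0ℚ ≤ e)
    (z≤p : z ≤ p) (w≤p : w ≤ p) (r≤p : r ≤ p) (e≤p : e ≤ p)
    (p≤T : p ≤ T₁ o e + ζ) (y₂≤T : y₂ ≤ T₁ w r + ζ) (y₃≤T : y₃ ≤ T₁ z w + ζ)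
    (3/2≤Σ : + 3 / 2 ≤ p + z + w + r) where

    private
      0≤1-e : 0ℚ ≤ 1ℚ - e
      0≤1-e = p≤q⇒0≤q-p (≤-trans e≤p p≤1)
      0≤1-w : 0ℚ ≤ 1ℚ - w
      0≤1-w = p≤q⇒0≤q-p (≤-trans w≤p p≤1)
      0≤1-r : 0ℚ ≤ 1ℚ - r
      0≤1-r = p≤q⇒0≤q-p (≤-trans r≤p p≤1)

      -- For e > ½ the value T₁(o, e) + ζ would drop below `e`, against e ≤ p. The point is that (1
      -- - e)² ≥ ¼, so dividing by it multiplies the error ζ by at most 4.
      e≤½ : 0ℚ ≤ ½ - e
      e≤½ = cancel-pos 0<c (subst (0ℚ ≤_) (e≤½-identity ζ p o e)
        (0≤+ (0≤+ (0≤+ (0≤+ (p≤q⇒0≤q-p p≤T) (p≤q⇒0≤q-p e≤p)) (p≤q⇒0≤q-p ζ≤⅒)) (0≤* (0≤* 0≤1-e 0≤1-e) 0≤o)) (lit (+ 1 / 40))))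
        where
        0<c : 0ℚ < (+ 7 / 4) + ½ * (1ℚ - e)
        0<c = <-≤-trans (positive⁻¹ (+ 7 / 4)) (slack (½ * (1ℚ - e)) (0≤* (lit ½) 0≤1-e) (0<c-identity e))

      0<[1-e]² : 0ℚ < (1ℚ - e) * (1ℚ - e)
      0<[1-e]² = <-≤-trans (positive⁻¹ (+ 1 / 4)) (slack ((½ - e) * (½ - e) + (½ - e)) (0≤+ (0≤p*p (½ - e)) e≤½) (0<[1-e]²-identity e))

      -- κ is the amount by which `o + e` is allowed to exceed 1 - p. The first hypothesis makes the
      -- bound on `p` yield this allowance, the second lets the other two classes compensate for it.
      module Finish (κ : ℚ)
        (0≤e-part : 0ℚ ≤ p - ½ * (e * (1ℚ - e)) + (1ℚ - e) * (1ℚ - e) * (κ - p - e))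
        (0≤w-part : 0ℚ ≤ w * (2ℚ * p - (+ 3 / 2)) + w * w * ((+ 3 / 1) - p - w - r) + w * (r * r) + ½ * (r * (1ℚ - r)) - κ) where

        first : 0ℚ ≤ 1ℚ - p + κ + (+ 4 / 1) * ζ - o - e
        first = cancel-pos 0<[1-e]² (subst (0ℚ ≤_) (first-identity ζ p o e κ)
          (0≤+ (0≤+ (p≤q⇒0≤q-p p≤T) 0≤e-part) (0≤* (0≤* (lit (+ 4 / 1)) 0≤ζ) (0≤+ (0≤p*p (½ - e)) e≤½))))

        total : o + e + y₂ + y₃ ≤ (+ 3 / 2) + (+ 6 / 1) * ζ
        total = 0≤q-p⇒p≤q (subst (0ℚ ≤_) (total-identity ζ p z w r o e y₂ y₃ κ)
          (0≤+ (0≤+ (0≤+ (0≤+ first (p≤q⇒0≤q-p y₂≤T)) (p≤q⇒0≤q-p y₃≤T))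
            (0≤* (0≤* 0≤1-w 0≤1-w) (p≤q⇒0≤q-p 3/2≤Σ))) 0≤w-part))

    ring-bound : o + e + y₂ + y₃ ≤ (+ 3 / 2) + (+ 6 / 1) * ζ
    ring-bound with ≤-total p ¾
    -- For p ≥ ¾ both parts are nonnegative without any excess.
    ... | inj₂ ¾≤p = Finish.total 0ℚ
        (subst (0ℚ ≤_) (ring-bound-identity₄ p e) (0≤+ (0≤* (0≤* 0≤e 0≤e) (0≤+ (lit ¾) 0≤1-e)) (0≤* 0≤p-¾ (0≤* 0≤e (0≤+ (lit 1ℚ) 0≤1-e)))))
        (subst (0ℚ ≤_) (ring-bound-identity₃ p w r) (0≤+ (0≤+ (0≤+ (0≤* 0≤w (0≤* (lit 2ℚ) 0≤p-¾))
          (0≤* (0≤* 0≤w 0≤w) (0≤+ (0≤+ (p≤q⇒0≤q-p p≤1) 0≤1-w) 0≤1-r))) (0≤* 0≤w (0≤* 0≤r 0≤r))) (0≤* (lit ½) (0≤* 0≤r 0≤1-r))))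
      where
      0≤p-¾ : 0ℚ ≤ p - ¾
      0≤p-¾ = p≤q⇒0≤q-p ¾≤p
    -- With κ = (¾ - p)² the first part becomes the square of e - (¾ - p)(1 - e) plus e²(p - e), and
    -- the second part becomes Φ.
    ... | inj₁ p≤¾ = Finish.total ((¾ - p) * (¾ - p))
        (subst (0ℚ ≤_) (ring-bound-identity₂ p e) (0≤+ (0≤p*p (e - (¾ - p) * (1ℚ - e))) (0≤* (0≤* 0≤e 0≤e) (p≤q⇒0≤q-p e≤p))))
        (subst (0ℚ ≤_) (ring-bound-identity p w r) (0≤Φ (p≤q⇒0≤q-p p≤¾) 0≤w 0≤r 2k≤w+r k+r≤¾ k+w≤¾))
      where
      2k≤w+r : 2ℚ * (¾ - p) ≤ w + r
      2k≤w+r = slack ((p + z + w + r - (+ 3 / 2)) + (p - z)) (0≤+ (p≤q⇒0≤q-p 3/2≤Σ) (p≤q⇒0≤q-p z≤p)) (2k≤w+r-identity p z w r)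
      k+r≤¾ : ¾ - p + r ≤ ¾
      k+r≤¾ = slack (p - r) (p≤q⇒0≤q-p r≤p) (k+r≤¾-identity p r)
      k+w≤¾ : ¾ - p + w ≤ ¾
      k+w≤¾ = slack (p - w) (p≤q⇒0≤q-p w≤p) (k+w≤¾-identity p w)

-- Finite sums, cuts of monotone sequences and summation by parts

module Sums where

  open Data.Rational.Base
  open Data.Rational.Properties
  open Rationals
  open Defs using (suc-/)

  opaque
    ι : ℕ → ℚ
    ι n = + n / 1

  opaque
    unfolding ι

    ι≡/1 : ∀ n → ι n ≡ + n / 1
    ι≡/1 n = refl

    ι-suc : ∀ n → ι (suc n) ≡ ι n + 1ℚ
    ι-suc n = suc-/ n 0

  ι-0 : ι 0 ≡ 0ℚ
  ι-0 = ι≡/1 0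

  ι-1 : ι 1 ≡ 1ℚ
  ι-1 = ι≡/1 1

  ι-+ : ∀ m n → ι (m ℕ.+ n) ≡ ι m + ι n
  ι-+ zero    n = trans (sym (+-identityˡ (ι n))) (cong (_+ ι n) (sym ι-0))
  ι-+ (suc m) n = trans (ι-suc (m ℕ.+ n)) (trans (cong (_+ 1ℚ) (ι-+ m n))
    (trans (eq (ι m) (ι n)) (cong (_+ ι n) (sym (ι-suc m)))))
    where
    eq : ∀ a b → a + b + 1ℚ ≡ a + 1ℚ + b
    eq = solve-∀ ℚ-ring

  ι-* : ∀ m n → ι (m ℕ.* n) ≡ ι m * ι n
  ι-* zero    n = trans ι-0 (trans (sym (*-zeroˡ (ι n))) (cong (_* ι n) (sym ι-0)))
  ι-* (suc m) n = trans (ι-+ n (m ℕ.* n)) (trans (cong (λ x → ι n + x) (ι-* m n))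
    (trans (eq (ι m) (ι n)) (cong (_* ι n) (sym (ι-suc m)))))
    where
    eq : ∀ a b → b + a * b ≡ (a + 1ℚ) * b
    eq = solve-∀ ℚ-ring

  0≤ι : ∀ n → 0ℚ ≤ ι n
  0≤ι zero    = ≤-reflexive (sym ι-0)
  0≤ι (suc n) = subst (0ℚ ≤_) (sym (ι-suc n)) (0≤+ (0≤ι n) (nonNegative⁻¹ 1ℚ))

  ι-mono : ∀ {m n} → m ℕ.≤ n → ι m ≤ ι n
  ι-mono {m} m≤n with ℕ.m≤n⇒∃[o]m+o≡n m≤n
  ... | o , refl = slack (ι o) (0≤ι o) (trans (cong (_- ι m) (ι-+ m o)) (eq (ι m) (ι o)))
    where
    eq : ∀ a b → a + b - a ≡ b
    eq = solve-∀ ℚ-ring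

  0<ι : ∀ n .{{_ : ℕ.NonZero n}} → 0ℚ < ι n
  0<ι (suc n) = <-≤-trans (positive⁻¹ 1ℚ) (subst (_≤ ι (suc n)) ι-1 (ι-mono (s≤s z≤n)))

  ∣p∣≤ : ∀ {p q} → p ≤ q → - p ≤ q → ∣ p ∣ ≤ q
  ∣p∣≤ {p} {q} a b with ∣p∣≡p∨∣p∣≡-p p
  ... | inj₁ eq = subst (_≤ q) (sym eq) a
  ... | inj₂ eq = subst (_≤ q) (sym eq) b

  p≤∣p∣ : ∀ p → p ≤ ∣ p ∣
  p≤∣p∣ p with ≤-total 0ℚ p
  ... | inj₁ 0≤p = ≤-reflexive (sym (0≤p⇒∣p∣≡p 0≤p))
  ... | inj₂ p≤0 = ≤-trans p≤0 (0≤∣p∣ p)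

  -p≤∣p∣ : ∀ p → - p ≤ ∣ p ∣
  -p≤∣p∣ p = subst (- p ≤_) (∣-p∣≡∣p∣ p) (p≤∣p∣ (- p))

  ∣p*q∣≤ : ∀ {p q r s} → ∣ p ∣ ≤ r → ∣ q ∣ ≤ s → ∣ p * q ∣ ≤ r * s
  ∣p*q∣≤ {p} {q} {r} {s} a b = subst (_≤ r * s) (sym (∣p*q∣≡∣p∣*∣q∣ p q))
    (≤-trans (*-monoˡ-≤-nonNeg ∣ p ∣ {{nonNegative (0≤∣p∣ p)}} b)
             (*-monoʳ-≤-nonNeg s {{nonNegative (≤-trans (0≤∣p∣ q) b)}} a))

  ∣p+q∣≤ : ∀ {p q r s} → ∣ p ∣ ≤ r → ∣ q ∣ ≤ s → ∣ p + q ∣ ≤ r + s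
  ∣p+q∣≤ {p} {q} a b = ≤-trans (∣p+q∣≤∣p∣+∣q∣ p q) (+-mono-≤ a b)

  ∣p-q∣≤ : ∀ {p q r s} → ∣ p ∣ ≤ r → ∣ q ∣ ≤ s → ∣ p - q ∣ ≤ r + s
  ∣p-q∣≤ {p} {q} a b = ≤-trans (∣p-q∣≤∣p∣+∣q∣ p q) (+-mono-≤ a b)

  *-mono : ∀ {p q r s} → 0ℚ ≤ p → 0ℚ ≤ s → p ≤ q → r ≤ s → p * r ≤ q * s
  *-mono {p} {q} {r} {s} 0≤p 0≤s p≤q r≤s = ≤-trans
    (*-monoˡ-≤-nonNeg p {{nonNegative 0≤p}} r≤s) (*-monoʳ-≤-nonNeg s {{nonNegative 0≤s}} p≤q)

  ∑ : ℕ → (ℕ → ℚ) → ℚ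
  ∑ zero    F = 0ℚ
  ∑ (suc n) F = ∑ n F + F n

  ∑-cong : ∀ n {F G} → (∀ i → i ℕ.< n → F i ≡ G i) → ∑ n F ≡ ∑ n G
  ∑-cong zero    h = refl
  ∑-cong (suc n) h = cong₂ _+_ (∑-cong n (λ i i<n → h i (ℕ.m<n⇒m<1+n i<n))) (h n (ℕ.n<1+n n))

  ∑-ext : ∀ n {F G} → (∀ i → F i ≡ G i) → ∑ n F ≡ ∑ n G
  ∑-ext n h = ∑-cong n (λ i _ → h i)

  ∑-0 : ∀ n → ∑ n (λ _ → 0ℚ) ≡ 0ℚ
  ∑-0 zero    = refl
  ∑-0 (suc n) = trans (+-identityʳ _) (∑-0 n)

  ∑-vanish : ∀ n {F} → (∀ i → i ℕ.< n → F i ≡ 0ℚ) → ∑ n F ≡ 0ℚ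
  ∑-vanish n h = trans (∑-cong n h) (∑-0 n)

  ∑-+ : ∀ n F G → ∑ n (λ i → F i + G i) ≡ ∑ n F + ∑ n G
  ∑-+ zero    F G = refl
  ∑-+ (suc n) F G = trans (cong (_+ (F n + G n)) (∑-+ n F G)) (eq (∑ n F) (∑ n G) (F n) (G n))
    where
    eq : ∀ a b c d → a + b + (c + d) ≡ a + c + (b + d)
    eq = solve-∀ ℚ-ring

  ∑-* : ∀ n c F → ∑ n (λ i → c * F i) ≡ c * ∑ n F
  ∑-* zero    c F = sym (*-zeroʳ c)
  ∑-* (suc n) c F = trans (cong (_+ c * F n) (∑-* n c F)) (sym (*-distribˡ-+ c (∑ n F) (F n)))

  ∑-*ʳ : ∀ n c F → ∑ n (λ i → F i * c) ≡ ∑ n F * c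
  ∑-*ʳ n c F = trans (∑-ext n (λ i → *-comm (F i) c)) (trans (∑-* n c F) (*-comm c (∑ n F)))

  ∑-neg : ∀ n F → ∑ n (λ i → - F i) ≡ - ∑ n F
  ∑-neg zero    F = refl
  ∑-neg (suc n) F = trans (cong (_+ - F n) (∑-neg n F)) (sym (neg-distrib-+ (∑ n F) (F n)))

  ∑-- : ∀ n F G → ∑ n (λ i → F i - G i) ≡ ∑ n F - ∑ n G
  ∑-- n F G = trans (∑-+ n F (λ i → - G i)) (cong (λ x → ∑ n F + x) (∑-neg n G))

  ∑-mono : ∀ n {F G} → (∀ i → i ℕ.< n → F i ≤ G i) → ∑ n F ≤ ∑ n G
  ∑-mono zero    h = ≤-refl
  ∑-mono (suc n) h = +-mono-≤ (∑-mono n (λ i i<n → h i (ℕ.m<n⇒m<1+n i<n))) (h n (ℕ.n<1+n n))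

  ∑-nonNeg : ∀ n {F} → (∀ i → i ℕ.< n → 0ℚ ≤ F i) → 0ℚ ≤ ∑ n F
  ∑-nonNeg n h = subst (_≤ ∑ n _) (∑-0 n) (∑-mono n h)

  ∑-const : ∀ n c → ∑ n (λ _ → c) ≡ ι n * c
  ∑-const zero    c = trans (sym (*-zeroˡ c)) (cong (_* c) (sym ι-0))
  ∑-const (suc n) c = trans (cong (_+ c) (∑-const n c)) (trans (eq (ι n) c) (cong (_* c) (sym (ι-suc n))))
    where
    eq : ∀ a c → a * c + c ≡ (a + 1ℚ) * c
    eq = solve-∀ ℚ-ring

  ∑-≤const : ∀ n {F} c → (∀ i → i ℕ.< n → F i ≤ c) → ∑ n F ≤ ι n * c
  ∑-≤const n c h = subst (∑ n _ ≤_) (∑-const n c) (∑-mono n h)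

  ∣∑∣≤∑∣∣ : ∀ n F → ∣ ∑ n F ∣ ≤ ∑ n (λ i → ∣ F i ∣)
  ∣∑∣≤∑∣∣ zero    F = ≤-refl
  ∣∑∣≤∑∣∣ (suc n) F = ≤-trans (∣p+q∣≤∣p∣+∣q∣ (∑ n F) (F n)) (+-monoˡ-≤ ∣ F n ∣ (∣∑∣≤∑∣∣ n F))

  ∣∑∣≤ : ∀ n {F} c → (∀ i → i ℕ.< n → ∣ F i ∣ ≤ c) → ∣ ∑ n F ∣ ≤ ι n * c
  ∣∑∣≤ n {F} c h = ≤-trans (∣∑∣≤∑∣∣ n F) (∑-≤const n c h)

  ∑-swap : ∀ m n (F : ℕ → ℕ → ℚ) → ∑ m (λ i → ∑ n (λ j → F i j)) ≡ ∑ n (λ j → ∑ m (λ i → F i j))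
  ∑-swap zero    n F = sym (∑-0 n)
  ∑-swap (suc m) n F = trans (cong (_+ ∑ n (F m)) (∑-swap m n F))
    (sym (∑-+ n (λ j → ∑ m (λ i → F i j)) (F m)))

  ∑-++ : ∀ m n F → ∑ (m ℕ.+ n) F ≡ ∑ m F + ∑ n (λ i → F (m ℕ.+ i))
  ∑-++ m zero    F = trans (cong (λ k → ∑ k F) (ℕ.+-identityʳ m)) (sym (+-identityʳ (∑ m F)))
  ∑-++ m (suc n) F = trans (cong (λ k → ∑ k F) (ℕ.+-suc m n))
    (trans (cong (_+ F (m ℕ.+ n)) (∑-++ m n F)) (+-assoc (∑ m F) _ _))

  ∑-blocks : ∀ k m F → ∑ (k ℕ.* m) F ≡ ∑ k (λ i → ∑ m (λ j → F (i ℕ.* m ℕ.+ j)))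
  ∑-blocks zero    m F = refl
  ∑-blocks (suc k) m F = trans (cong (λ x → ∑ x F) (ℕ.+-comm m (k ℕ.* m)))
    (trans (∑-++ (k ℕ.* m) m F) (cong (_+ ∑ m (λ j → F (k ℕ.* m ℕ.+ j))) (∑-blocks k m F)))

  opaque
    lt : ℕ → ℕ → ℚ
    lt x y with x ℕ.<? y
    ... | yes _ = 1ℚ
    ... | no  _ = 0ℚ

  opaque
    unfolding lt

    lt-yes : ∀ {x y} → x ℕ.< y → lt x y ≡ 1ℚ
    lt-yes {x} {y} x<y with x ℕ.<? y
    ... | yes _  = refl
    ... | no x≮y = contradiction x<y x≮y

    lt-no : ∀ {x y} → y ℕ.≤ x → lt x y ≡ 0ℚ
    lt-no {x} {y} y≤x with x ℕ.<? y
    ... | yes x<y = contradiction x<y (ℕ.≤⇒≯ y≤x)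
    ... | no _    = refl

    0≤lt≤1 : ∀ x y → 0ℚ ≤ lt x y × lt x y ≤ 1ℚ
    0≤lt≤1 x y with x ℕ.<? y
    ... | yes _ = nonNegative⁻¹ 1ℚ , ≤-refl
    ... | no  _ = ≤-refl , nonNegative⁻¹ 1ℚ

  -- For a monotone `q` the indices with q l < c form an initial segment. A sum restricted by such a
  -- condition is therefore a sum over a prefix, the form in which `abel` applies.
  record Cut (q : ℕ → ℕ) (c Λ : ℕ) : Set where
    field
      cut   : ℕ
      cut≤Λ : cut ℕ.≤ Λ
      below : ∀ l → l ℕ.< cut → q l ℕ.< c
      above : ∀ l → cut ℕ.≤ l → l ℕ.< Λ → c ℕ.≤ q l
      sum   : ∀ F → ∑ Λ (λ l → lt (q l) c * F l) ≡ ∑ cut F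

  mkCut : ∀ {q} → (∀ {l m} → l ℕ.≤ m → q l ℕ.≤ q m) → ∀ c Λ → Cut q c Λ
  mkCut mono c zero = record
    { cut = 0 ; cut≤Λ = z≤n ; below = λ _ () ; above = λ _ _ () ; sum = λ _ → refl }
  mkCut {q} mono c (suc Λ) with q Λ ℕ.<? c
  ... | yes qΛ<c = record
    { cut = suc Λ ; cut≤Λ = ℕ.≤-refl
    ; below = all
    ; above = λ l Λ<l l<Λ → contradiction l<Λ (ℕ.≤⇒≯ Λ<l)
    ; sum = λ F → ∑-cong (suc Λ) (λ l l≤Λ → trans (cong (_* F l) (lt-yes (all l l≤Λ))) (*-identityˡ (F l))) }
    where
    all : ∀ l → l ℕ.< suc Λ → q l ℕ.< c
    all l (s≤s l≤Λ) = ℕ.≤-<-trans (mono l≤Λ) qΛ<c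
  ... | no qΛ≮c = record
    { cut = C.cut ; cut≤Λ = ℕ.m≤n⇒m≤1+n C.cut≤Λ ; below = C.below
    ; above = above′
    ; sum = λ F → trans (cong₂ _+_ (C.sum F) (trans (cong (_* F Λ) (lt-no (ℕ.≮⇒≥ qΛ≮c))) (*-zeroˡ (F Λ))))
                        (+-identityʳ _) }
    where
    module C = Cut (mkCut {q} mono c Λ)
    above′ : ∀ l → C.cut ℕ.≤ l → l ℕ.< suc Λ → c ℕ.≤ q l
    above′ l cut≤l (s≤s l≤Λ) with ℕ.m≤n⇒m<n∨m≡n l≤Λ
    ... | inj₁ l<Λ  = C.above l cut≤l l<Λ
    ... | inj₂ refl = ℕ.≮⇒≥ qΛ≮c

  rest≤-identity : ∀ a b c M → (b - a) * M + (c - b) * M ≡ (c - a) * M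
  rest≤-identity = solve-∀ ℚ-ring

  parts-identity : ∀ a b s x t → a * s - t + a * x ≡ b * (s + x) - (t + (b - a) * (s + x))
  parts-identity = solve-∀ ℚ-ring

  abel-identity : ∀ a b M → b * M - (b - a) * M ≡ a * M
  abel-identity = solve-∀ ℚ-ring

  module _ (v : ℕ → ℚ) (M : ℚ) (V≤M : ∀ i → ∣ ∑ i v ∣ ≤ M)
    (ω : ℕ → ℚ) (0≤ω : ∀ i → 0ℚ ≤ ω i) (ω↑ : ∀ i → ω i ≤ ω (suc i)) where

    private
      rest : ℕ → ℚ
      rest n = ∑ n (λ i → (ω (suc i) - ω i) * ∑ (suc i) v)

      parts : ∀ n → ∑ n (λ i → ω i * v i) ≡ ω n * ∑ n v - rest n
      parts zero    = trans (sym (+-identityˡ _)) (cong (_- 0ℚ) (sym (*-zeroʳ (ω 0))))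
      parts (suc n) = trans (cong (_+ ω n * v n) (parts n))
        (parts-identity (ω n) (ω (suc n)) (∑ n v) (v n) (rest n))

      rest≤ : ∀ n → ∣ rest n ∣ ≤ (ω n - ω 0) * M
      rest≤ zero    = ≤-reflexive (sym (trans (cong (_* M) (+-inverseʳ (ω 0))) (*-zeroˡ M)))
      rest≤ (suc n) = ≤-trans (∣p+q∣≤ (rest≤ n) (∣p*q∣≤ {p = ω (suc n) - ω n}
          (≤-reflexive (0≤p⇒∣p∣≡p (p≤q⇒0≤q-p (ω↑ n)))) (V≤M (suc n))))
        (≤-reflexive (rest≤-identity (ω 0) (ω n) (ω (suc n)) M))

    -- Summation by parts: the increments of the weights are nonnegative and telescope, so a bound
    -- on the partial sums of `v` is multiplied by the last weight and not by the number of terms.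
    abel : ∀ n → ∣ ∑ n (λ i → ω i * v i) ∣ ≤ ω n * M + ω n * M
    abel n = subst (λ x → ∣ x ∣ ≤ ω n * M + ω n * M) (sym (parts n))
      (∣p-q∣≤ (∣p*q∣≤ {p = ω n} (≤-reflexive (0≤p⇒∣p∣≡p (0≤ω n))) (V≤M n))
        (≤-trans (rest≤ n) (slack (ω 0 * M) (0≤* (0≤ω 0) (≤-trans (0≤∣p∣ (∑ 0 v)) (V≤M 0))) (abel-identity (ω 0) (ω n) M))))

  ZeroOn : ℕ → (ℕ → ℚ) → Set
  ZeroOn m v = ∀ c → ∑ m (λ j → v (c ℕ.* m ℕ.+ j)) ≡ 0ℚ

  -- Complete blocks cancel; fewer than `m` terms of the last block are left.
  prefix≤ : ∀ m .{{_ : ℕ.NonZero m}} {v} → ZeroOn m v → (∀ i → ∣ v i ∣ ≤ 1ℚ) → ∀ i → ∣ ∑ i v ∣ ≤ ι m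
  prefix≤ m {v} zeroOn v≤1 i = subst (λ x → ∣ x ∣ ≤ ι m) (sym eq)
    (≤-trans (∣∑∣≤ (i ℕ.% m) 1ℚ (λ j _ → v≤1 (k ℕ.* m ℕ.+ j)))
      (≤-trans (≤-reflexive (*-identityʳ (ι (i ℕ.% m)))) (ι-mono (ℕ.<⇒≤ (ℕ.m%n<n i m)))))
    where
    k = i ℕ./ m
    eq : ∑ i v ≡ ∑ (i ℕ.% m) (λ j → v (k ℕ.* m ℕ.+ j))
    eq = trans (cong (λ x → ∑ x v) (trans (ℕ.m≡m%n+[m/n]*n i m) (ℕ.+-comm (i ℕ.% m) (k ℕ.* m))))
      (trans (∑-++ (k ℕ.* m) (i ℕ.% m) v)
      (trans (cong (_+ ∑ (i ℕ.% m) (λ j → v (k ℕ.* m ℕ.+ j))) (trans (∑-blocks k m v) (∑-vanish k (λ c _ → zeroOn c)))) (+-identityˡ _)))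

  shift≤ : ∀ {v M} → (∀ i → ∣ ∑ i v ∣ ≤ M) → ∀ i₀ i → ∣ ∑ i (λ j → v (i₀ ℕ.+ j)) ∣ ≤ M + M
  shift≤ {v} {M} V≤M i₀ i = subst (λ x → ∣ x ∣ ≤ M + M) eq (∣p-q∣≤ (V≤M (i₀ ℕ.+ i)) (V≤M i₀))
    where
    ring : ∀ a b → a + b - a ≡ b
    ring = solve-∀ ℚ-ring
    eq : ∑ (i₀ ℕ.+ i) v - ∑ i₀ v ≡ ∑ i (λ j → v (i₀ ℕ.+ j))
    eq = trans (cong (_- ∑ i₀ v) (∑-++ i₀ i v)) (ring (∑ i₀ v) _)

-- Block averages and cancellation along arithmetic progressions

module Averages where

  open Data.Rational.Base
  open Data.Rational.Properties
  open Rationals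
  open Sums

  recip : (p : ℕ) .{{_ : ℕ.NonZero p}} → ℚ
  recip p = (1/ ι p) {{pos⇒nonZero (ι p) {{positive (0<ι p)}}}}

  module _ (p : ℕ) .{{_ : ℕ.NonZero p}} where

    ι*recip : ι p * recip p ≡ 1ℚ
    ι*recip = *-inverseʳ (ι p) {{pos⇒nonZero (ι p) {{positive (0<ι p)}}}}

    0≤recip : 0ℚ ≤ recip p
    0≤recip = <⇒≤ (positive⁻¹ (recip p) {{1/pos⇒pos (ι p) {{positive (0<ι p)}}}})

    [κ*p+j]/p : ∀ κ {j} → j ℕ.< p → (κ ℕ.* p ℕ.+ j) ℕ./ p ≡ κ
    [κ*p+j]/p κ {j} j<p = trans (ℕ.+-distrib-/-∣ˡ j (ℕ.n∣m*n κ))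
      (trans (cong₂ ℕ._+_ (ℕ.m*n/n≡m κ p) (ℕ.m<n⇒m/n≡0 j<p)) (ℕ.+-identityʳ κ))

    [κ*p+j]%p : ∀ κ {j} → j ℕ.< p → (κ ℕ.* p ℕ.+ j) ℕ.% p ≡ j
    [κ*p+j]%p κ {j} j<p = trans (cong (ℕ._% p) (ℕ.+-comm (κ ℕ.* p) j))
      (trans (ℕ.[m+kn]%n≡m%n j κ p) (ℕ.m<n⇒m%n≡m j<p))

    divide : ∀ a → ∃[ κ ] ∃[ j ] j ℕ.< p × a ≡ κ ℕ.* p ℕ.+ j
    divide a = a ℕ./ p , a ℕ.% p , ℕ.m%n<n a p ,
      trans (ℕ.m≡m%n+[m/n]*n a p) (ℕ.+-comm (a ℕ.% p) (a ℕ./ p ℕ.* p))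

  avg : (p : ℕ) .{{_ : ℕ.NonZero p}} → (ℕ → ℚ) → ℕ → ℚ
  avg p F y = recip p * ∑ p (λ j → F (y ℕ./ p ℕ.* p ℕ.+ j))

  ZeroOn-* : ∀ c p {v} → ZeroOn p v → ZeroOn (c ℕ.* p) v
  ZeroOn-* c p {v} zeroOn κ = trans (∑-blocks c p (λ j → v (κ ℕ.* (c ℕ.* p) ℕ.+ j)))
    (∑-vanish c (λ i _ → trans (∑-ext p (λ j → cong v (eq κ c p i j))) (zeroOn (κ ℕ.* c ℕ.+ i))))
    where
    eq : ∀ κ c p i j → κ ℕ.* (c ℕ.* p) ℕ.+ (i ℕ.* p ℕ.+ j) ≡ (κ ℕ.* c ℕ.+ i) ℕ.* p ℕ.+ j
    eq = ℕ.solve-∀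

  ι*x≡0⇒x≡0 : ∀ d .{{_ : ℕ.NonZero d}} x → ι d * x ≡ 0ℚ → x ≡ 0ℚ
  ι*x≡0⇒x≡0 d x eq = trans (sym (*-identityˡ x)) (trans (cong (_* x) (trans (sym (ι*recip d)) (*-comm (ι d) (recip d))))
    (trans (*-assoc (recip d) (ι d) x) (trans (cong (recip d *_) eq) (*-zeroʳ (recip d)))))

  -- Since `v` is constant on blocks of length `d`, each block sum is `d` times the value sampled
  -- from the block. The sampled sum is therefore the full sum over m * d terms divided by `d`.
  ZeroOn-stride : ∀ m d .{{_ : ℕ.NonZero d}} {v} → ZeroOn (m ℕ.* d) v →
    (∀ i r → r ℕ.< d → v (i ℕ.* d ℕ.+ r) ≡ v (i ℕ.* d)) →
    ∀ r → r ℕ.< d → ZeroOn m (λ i → v (i ℕ.* d ℕ.+ r))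
  ZeroOn-stride m d {v} zeroOn flat r r<d κ = trans
    (∑-ext m (λ i → flat (κ ℕ.* m ℕ.+ i) r r<d))
    (ι*x≡0⇒x≡0 d _ (trans (sym (∑-* m (ι d) _)) (trans (sym (trans (∑-blocks m d _) (∑-ext m row))) (zeroOn κ))))
    where
    eq : ∀ κ m d i j → κ ℕ.* (m ℕ.* d) ℕ.+ (i ℕ.* d ℕ.+ j) ≡ (κ ℕ.* m ℕ.+ i) ℕ.* d ℕ.+ j
    eq = ℕ.solve-∀
    row : ∀ i → ∑ d (λ j → v (κ ℕ.* (m ℕ.* d) ℕ.+ (i ℕ.* d ℕ.+ j))) ≡ ι d * v ((κ ℕ.* m ℕ.+ i) ℕ.* d)
    row i = trans (∑-cong d (λ j j<d → trans (cong v (eq κ m d i j)) (flat (κ ℕ.* m ℕ.+ i) j j<d))) (∑-const d _)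

  block-identity : ∀ e μ q → (1ℚ - e - e) * (q * μ) + q * (e * e) - ((1ℚ - μ - μ) * (q * μ) + q * (μ * μ)) ≡ q * ((μ - e) * (μ - e))
  block-identity = solve-∀ ℚ-ring

  avg-flat-identity : ∀ κ m d i₀ → (κ ℕ.* m ℕ.+ i₀) ℕ.* d ≡ κ ℕ.* (m ℕ.* d) ℕ.+ i₀ ℕ.* d
  avg-flat-identity = ℕ.solve-∀

  avg-flat-identity₂ : ∀ κ m d i₀ r → (κ ℕ.* m ℕ.+ i₀) ℕ.* d ℕ.+ r ≡ κ ℕ.* (m ℕ.* d) ℕ.+ (i₀ ℕ.* d ℕ.+ r)
  avg-flat-identity₂ = ℕ.solve-∀

  module _ (p : ℕ) .{{_ : ℕ.NonZero p}} (F : ℕ → ℚ) where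

    avg-block : ∀ κ {j} → j ℕ.< p → avg p F (κ ℕ.* p ℕ.+ j) ≡ recip p * ∑ p (λ i → F (κ ℕ.* p ℕ.+ i))
    avg-block κ j<p = cong (λ k → recip p * ∑ p (λ i → F (k ℕ.* p ℕ.+ i))) ([κ*p+j]/p p κ j<p)

    ι*avg : ∀ κ {j} → j ℕ.< p → ι p * avg p F (κ ℕ.* p ℕ.+ j) ≡ ∑ p (λ i → F (κ ℕ.* p ℕ.+ i))
    ι*avg κ j<p = trans (cong (ι p *_) (avg-block κ j<p)) (trans (sym (*-assoc (ι p) (recip p) _))
      (trans (cong (_* ∑ p (λ i → F (κ ℕ.* p ℕ.+ i))) (ι*recip p)) (*-identityˡ (∑ p (λ i → F (κ ℕ.* p ℕ.+ i))))))

    avg-ZeroOn : ZeroOn p (λ y → F y - avg p F y)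
    avg-ZeroOn κ = trans (∑-- p _ _) (trans (cong (λ x → S - x)
        (trans (∑-cong p (λ j j<p → avg-block κ j<p)) (trans (∑-const p (recip p * S))
          (trans (sym (*-assoc (ι p) (recip p) S)) (trans (cong (_* S) (ι*recip p)) (*-identityˡ S))))))
      (+-inverseʳ S))
      where
      S : ℚ
      S = ∑ p (λ i → F (κ ℕ.* p ℕ.+ i))

    avg-flat : ∀ m d → p ≡ m ℕ.* d → ∀ i r → r ℕ.< d → avg p F (i ℕ.* d ℕ.+ r) ≡ avg p F (i ℕ.* d)
    avg-flat zero    d p≡0 i r r<d = contradiction p≡0 (ℕ.≢-nonZero⁻¹ p)
    avg-flat m@(suc _) d refl i r r<d with divide m i
    ... | κ , i₀ , i₀<m , refl = trans (cong (avg p F) (avg-flat-identity₂ κ m d i₀ r))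
      (trans (avg-block κ lt₁) (sym (trans (cong (avg p F) (avg-flat-identity κ m d i₀)) (avg-block κ lt₀))))
      where
      lt₁ : i₀ ℕ.* d ℕ.+ r ℕ.< m ℕ.* d
      lt₁ = ℕ.<-≤-trans (ℕ.+-monoʳ-< (i₀ ℕ.* d) r<d)
        (ℕ.≤-trans (ℕ.≤-reflexive (ℕ.+-comm (i₀ ℕ.* d) d)) (ℕ.*-monoˡ-≤ d i₀<m))
      lt₀ : i₀ ℕ.* d ℕ.< m ℕ.* d
      lt₀ = ℕ.≤-<-trans (ℕ.m≤m+n (i₀ ℕ.* d) r) lt₁

    module _ (0≤F : ∀ y → 0ℚ ≤ F y) (F≤1 : ∀ y → F y ≤ 1ℚ) where

      0≤avg : ∀ y → 0ℚ ≤ avg p F y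
      0≤avg y = 0≤* (0≤recip p) (∑-nonNeg p (λ j _ → 0≤F _))

      avg≤1 : ∀ y → avg p F y ≤ 1ℚ
      avg≤1 y = ≤-trans (*-monoˡ-≤-nonNeg (recip p) {{nonNegative (0≤recip p)}} (∑-≤const p 1ℚ (λ j _ → F≤1 _)))
        (≤-reflexive (trans (cong (recip p *_) (*-identityʳ (ι p))) (trans (*-comm (recip p) (ι p)) (ι*recip p))))

    module _ (F²≡F : ∀ y → F y * F y ≡ F y) (e : ℚ) where

      private
        block : ∀ κ → ∑ p (λ j → (F (κ ℕ.* p ℕ.+ j) - avg p F (κ ℕ.* p ℕ.+ j)) * (F (κ ℕ.* p ℕ.+ j) - avg p F (κ ℕ.* p ℕ.+ j)))
          ≤ ∑ p (λ j → (1ℚ - e - e) * F (κ ℕ.* p ℕ.+ j) + e * e)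
        block κ = subst₂ _≤_ (sym lhs) (sym rhs) (slack (ι p * ((μ - e) * (μ - e))) (0≤* (0≤ι p) (0≤p*p (μ - e)))
            (trans (cong (λ S → (1ℚ - e - e) * S + ι p * (e * e) - ((1ℚ - μ - μ) * S + ι p * (μ * μ))) S≡)
                   (block-identity e μ (ι p))))
          where
          G : ℕ → ℚ
          G j = F (κ ℕ.* p ℕ.+ j)
          S μ : ℚ
          S = ∑ p G
          μ = recip p * S
          S≡ : S ≡ ι p * μ
          S≡ = sym (trans (sym (*-assoc (ι p) (recip p) S)) (trans (cong (_* S) (ι*recip p)) (*-identityˡ S)))
          affine : ∀ c d → ∑ p (λ j → c * G j + d) ≡ c * S + ι p * d
          affine c d = trans (∑-+ p _ _) (cong₂ _+_ (∑-* p c G) (∑-const p d))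
          sq : ∀ x m → (x - m) * (x - m) ≡ x * x + ((- m - m) * x + m * m)
          sq = solve-∀ ℚ-ring
          sq′ : ∀ x m → x + ((- m - m) * x + m * m) ≡ (1ℚ - m - m) * x + m * m
          sq′ = solve-∀ ℚ-ring
          lhs : _ ≡ (1ℚ - μ - μ) * S + ι p * (μ * μ)
          lhs = trans (∑-cong p (λ j j<p → trans (cong (λ m → (G j - m) * (G j - m)) (avg-block κ j<p))
              (trans (sq (G j) μ) (trans (cong (_+ ((- μ - μ) * G j + μ * μ)) (F²≡F _)) (sq′ (G j) μ)))))
            (affine (1ℚ - μ - μ) (μ * μ))
          rhs : _ ≡ (1ℚ - e - e) * S + ι p * (e * e)
          rhs = affine (1ℚ - e - e) (e * e)

      -- Among all constants the block mean is closest in mean square, and for a function with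
      -- values 0 and 1 the right side is the sum of (F - e)².
      avg-variance : ∀ T → ∑ (T ℕ.* p) (λ y → (F y - avg p F y) * (F y - avg p F y))
        ≤ ∑ (T ℕ.* p) (λ y → (1ℚ - e - e) * F y + e * e)
      avg-variance T = subst₂ _≤_ (sym (∑-blocks T p _)) (sym (∑-blocks T p _)) (∑-mono T (λ κ _ → block κ))

  line : ℕ → (ℕ → ℚ) → ℕ → ℕ → ℚ
  line Q A r y = A (y ℕ.* Q ℕ.+ r)

  -- Averages over the residue classes modulo Q inside the blocks of length Q * p.
  density : (Q p : ℕ) .{{_ : ℕ.NonZero Q}} .{{_ : ℕ.NonZero p}} → (ℕ → ℚ) → ℕ → ℚ
  density Q p A a = avg p (line Q A (a ℕ.% Q)) (a ℕ./ Q)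

  module _ (Q : ℕ) .{{_ : ℕ.NonZero Q}} where

    density-line : ∀ p .{{_ : ℕ.NonZero p}} A y {r} → r ℕ.< Q →
      density Q p A (y ℕ.* Q ℕ.+ r) ≡ avg p (line Q A r) y
    density-line p A y r<Q = cong₂ (λ r y → avg p (line Q A r) y) ([κ*p+j]%p Q y r<Q) ([κ*p+j]/p Q y r<Q)

    module _ (p : ℕ) .{{_ : ℕ.NonZero p}} (A : ℕ → ℚ) (0≤A : ∀ a → 0ℚ ≤ A a) (A≤1 : ∀ a → A a ≤ 1ℚ) where

      0≤density : ∀ a → 0ℚ ≤ density Q p A a
      0≤density a = 0≤avg p (line Q A (a ℕ.% Q)) (λ y → 0≤A (y ℕ.* Q ℕ.+ a ℕ.% Q)) (λ y → A≤1 (y ℕ.* Q ℕ.+ a ℕ.% Q)) (a ℕ./ Q)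

      density≤1 : ∀ a → density Q p A a ≤ 1ℚ
      density≤1 a = avg≤1 p (line Q A (a ℕ.% Q)) (λ y → 0≤A (y ℕ.* Q ℕ.+ a ℕ.% Q)) (λ y → A≤1 (y ℕ.* Q ℕ.+ a ℕ.% Q)) (a ℕ./ Q)

    density-support : ∀ p .{{_ : ℕ.NonZero p}} A T → (∀ a → T ℕ.* (p ℕ.* Q) ℕ.≤ a → A a ≡ 0ℚ) →
      ∀ a → T ℕ.* (p ℕ.* Q) ℕ.≤ a → density Q p A a ≡ 0ℚ
    density-support p A T A≡0 a n≤a = trans (cong (recip p *_) (∑-vanish p (λ j _ → A≡0 _
        (ℕ.≤-trans (ℕ.≤-trans (ℕ.≤-reflexive (sym (ℕ.*-assoc T p Q))) (ℕ.*-monoˡ-≤ Q (ℕ.≤-trans (ℕ.*-monoˡ-≤ p T≤) (ℕ.m≤m+n _ j))))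
          (ℕ.m≤m+n _ (a ℕ.% Q))))))
      (*-zeroʳ (recip p))
      where
      T≤ : T ℕ.≤ a ℕ./ Q ℕ./ p
      T≤ = ℕ.≤-trans (ℕ.≤-reflexive (sym (ℕ.m*n/n≡m T p))) (ℕ./-monoˡ-≤ p
        (ℕ.≤-trans (ℕ.≤-reflexive (sym (ℕ.m*n/n≡m (T ℕ.* p) Q)))
          (ℕ./-monoˡ-≤ Q (ℕ.≤-trans (ℕ.≤-reflexive (ℕ.*-assoc T p Q)) n≤a))))

  ∣p-q∣≤1 : ∀ {p q} → 0ℚ ≤ p → p ≤ 1ℚ → 0ℚ ≤ q → q ≤ 1ℚ → ∣ p - q ∣ ≤ 1ℚ
  ∣p-q∣≤1 {p} {q} 0≤p p≤1 0≤q q≤1 = ∣p∣≤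
    (slack ((1ℚ - p) + q) (0≤+ (p≤q⇒0≤q-p p≤1) 0≤q) (eq₁ p q))
    (slack ((1ℚ - q) + p) (0≤+ (p≤q⇒0≤q-p q≤1) 0≤p) (eq₂ p q))
    where
    eq₁ : ∀ p q → 1ℚ - (p - q) ≡ (1ℚ - p) + q
    eq₁ = solve-∀ ℚ-ring
    eq₂ : ∀ p q → 1ℚ - (- (p - q)) ≡ (1ℚ - q) + p
    eq₂ = solve-∀ ℚ-ring

  run≤ : ∀ m .{{_ : ℕ.NonZero m}} {v} → ZeroOn m v → (∀ i → ∣ v i ∣ ≤ 1ℚ) →
    ∀ i₀ i → ∣ ∑ i (λ j → v (i₀ ℕ.+ j)) ∣ ≤ ι m + ι m
  run≤ m zeroOn v≤1 = shift≤ (prefix≤ m zeroOn v≤1)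

  φ-run-identity : ∀ x a b → a - b ≡ (x - b) - (x - a)
  φ-run-identity = solve-∀ ℚ-ring

  φ-run-identity₂ : ∀ i₀ j d s Q r → ((i₀ ℕ.+ j) ℕ.* d ℕ.+ s) ℕ.* Q ℕ.+ r ≡ (i₀ ℕ.* d ℕ.+ s) ℕ.* Q ℕ.+ r ℕ.+ j ℕ.* (d ℕ.* Q)
  φ-run-identity₂ = ℕ.solve-∀

  balanced-run-identity : ∀ y₀ j Q r → (y₀ ℕ.+ j) ℕ.* Q ℕ.+ r ≡ y₀ ℕ.* Q ℕ.+ r ℕ.+ j ℕ.* Q
  balanced-run-identity = ℕ.solve-∀

  module _ (Q : ℕ) .{{_ : ℕ.NonZero Q}} (A : ℕ → ℚ) (0≤A : ∀ a → 0ℚ ≤ A a) (A≤1 : ∀ a → A a ≤ 1ℚ) where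

    module _ (p : ℕ) .{{_ : ℕ.NonZero p}} where

      balanced : ℕ → ℚ
      balanced a = A a - density Q p A a

      ∣balanced∣≤1 : ∀ a → ∣ balanced a ∣ ≤ 1ℚ
      ∣balanced∣≤1 a = ∣p-q∣≤1 (0≤A a) (A≤1 a) (0≤density Q p A 0≤A A≤1 a) (density≤1 Q p A 0≤A A≤1 a)

      balanced-line : ∀ {r} → r ℕ.< Q → ∀ y → balanced (y ℕ.* Q ℕ.+ r) ≡ line Q A r y - avg p (line Q A r) y
      balanced-line {r} r<Q y = cong (λ x → A (y ℕ.* Q ℕ.+ r) - x) (density-line Q p A y r<Q)

      balanced-ZeroOn : ∀ {r} → r ℕ.< Q → ZeroOn p (λ y → balanced (y ℕ.* Q ℕ.+ r))
      balanced-ZeroOn {r} r<Q κ = trans (∑-ext p (λ j → balanced-line r<Q (κ ℕ.* p ℕ.+ j))) (avg-ZeroOn p (line Q A r) κ)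

      balanced-run : ∀ a i → ∣ ∑ i (λ j → balanced (a ℕ.+ j ℕ.* Q)) ∣ ≤ ι p + ι p
      balanced-run a i with divide Q a
      ... | y₀ , r , r<Q , refl = subst (λ x → ∣ x ∣ ≤ ι p + ι p) (∑-ext i (λ j → cong balanced (balanced-run-identity y₀ j Q r)))
        (run≤ p (balanced-ZeroOn r<Q) (λ y → ∣balanced∣≤1 (y ℕ.* Q ℕ.+ r)) y₀ i)

    module _ (p₁ p₂ c m₁ d : ℕ) .{{_ : ℕ.NonZero p₁}} .{{_ : ℕ.NonZero p₂}} .{{_ : ℕ.NonZero d}}
      (p₂≡ : p₂ ≡ c ℕ.* p₁) (p₁≡ : p₁ ≡ m₁ ℕ.* d) where

      private
        p₂≡′ : p₂ ≡ (c ℕ.* m₁) ℕ.* d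
        p₂≡′ = trans p₂≡ (trans (cong (c ℕ.*_) p₁≡) (sym (ℕ.*-assoc c m₁ d)))

        instance
          cm-nonZero : ℕ.NonZero (c ℕ.* m₁)
          cm-nonZero = ℕ.m*n≢0⇒m≢0 (c ℕ.* m₁) {{subst ℕ.NonZero p₂≡′ it′}}
            where
            it′ : ℕ.NonZero p₂
            it′ = ℕ.≢-nonZero (ℕ.≢-nonZero⁻¹ p₂)

      φ : ℕ → ℚ
      φ a = density Q p₁ A a - density Q p₂ A a

      ∣φ∣≤1 : ∀ a → ∣ φ a ∣ ≤ 1ℚ
      ∣φ∣≤1 a = ∣p-q∣≤1 (0≤density Q p₁ A 0≤A A≤1 a) (density≤1 Q p₁ A 0≤A A≤1 a)
                        (0≤density Q p₂ A 0≤A A≤1 a) (density≤1 Q p₂ A 0≤A A≤1 a)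

      -- `d` divides `p₁` and hence `p₂`, so both averages are constant on blocks of `d` consecutive
      -- points of a residue class. A progression of step d * Q takes one sample from each of these
      -- blocks and inherits the vanishing of φ over long blocks, which are exhausted after c * m₁
      -- samples.
      φ-run : ∀ a i → ∣ ∑ i (λ j → φ (a ℕ.+ j ℕ.* (d ℕ.* Q))) ∣ ≤ ι (c ℕ.* m₁) + ι (c ℕ.* m₁)
      φ-run a i with divide Q a
      ... | y , r , r<Q , refl with divide d y
      ... | i₀ , s , s<d , refl = subst (λ x → ∣ x ∣ ≤ ι (c ℕ.* m₁) + ι (c ℕ.* m₁))
          (∑-ext i (λ j → cong φ (φ-run-identity₂ i₀ j d s Q r)))
          (run≤ (c ℕ.* m₁) strided (λ i → ∣φ∣≤1 ((i ℕ.* d ℕ.+ s) ℕ.* Q ℕ.+ r)) i₀ i)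
        where
        F v : ℕ → ℚ
        F = line Q A r
        v y = φ (y ℕ.* Q ℕ.+ r)
        v≡ : ∀ y → v y ≡ avg p₁ F y - avg p₂ F y
        v≡ y = cong₂ _-_ (density-line Q p₁ A y r<Q) (density-line Q p₂ A y r<Q)
        -- Over a long block both averages have the same sum as `F`: the short one because `p₂` is a
        -- multiple of `p₁`.
        zero₁ : ZeroOn p₂ (λ y → F y - avg p₁ F y)
        zero₁ = subst (λ n → ZeroOn n (λ y → F y - avg p₁ F y)) (sym p₂≡) (ZeroOn-* c p₁ {v = λ y → F y - avg p₁ F y} (avg-ZeroOn p₁ F))
        zeroOn : ZeroOn p₂ v
        zeroOn κ = trans (∑-ext p₂ (λ j → trans (v≡ (κ ℕ.* p₂ ℕ.+ j)) (φ-run-identity (F (κ ℕ.* p₂ ℕ.+ j)) _ _)))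
          (trans (∑-- p₂ _ _) (cong₂ _-_ (avg-ZeroOn p₂ F κ) (zero₁ κ)))
        flat : ∀ i s → s ℕ.< d → v (i ℕ.* d ℕ.+ s) ≡ v (i ℕ.* d)
        flat i s s<d = trans (v≡ _) (trans (cong₂ _-_ (avg-flat p₁ F m₁ d p₁≡ i s s<d) (avg-flat p₂ F (c ℕ.* m₁) d p₂≡′ i s s<d))
          (sym (v≡ (i ℕ.* d))))
        strided : ZeroOn (c ℕ.* m₁) (λ i → v (i ℕ.* d ℕ.+ s))
        strided = ZeroOn-stride (c ℕ.* m₁) d {v = v} (subst (λ n → ZeroOn n v) p₂≡′ zeroOn) flat s s<d

  balanced₈-run₄-identity : ∀ y₀ j r → (y₀ ℕ.+ j) ℕ.* 4 ℕ.+ r ≡ y₀ ℕ.* 4 ℕ.+ r ℕ.+ j ℕ.* 4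
  balanced₈-run₄-identity = ℕ.solve-∀

  module _ (A : ℕ → ℚ) (0≤A : ∀ a → 0ℚ ≤ A a) (A≤1 : ∀ a → A a ≤ 1ℚ) (p : ℕ) .{{_ : ℕ.NonZero p}} where

    private
      e₀ : ∀ κ p i r → (κ ℕ.* (p ℕ.* 2) ℕ.+ (i ℕ.* 2 ℕ.+ 0)) ℕ.* 4 ℕ.+ r ≡ (κ ℕ.* p ℕ.+ i) ℕ.* 8 ℕ.+ r
      e₀ = ℕ.solve-∀
      e₁ : ∀ κ p i r → (κ ℕ.* (p ℕ.* 2) ℕ.+ (i ℕ.* 2 ℕ.+ 1)) ℕ.* 4 ℕ.+ r ≡ (κ ℕ.* p ℕ.+ i) ℕ.* 8 ℕ.+ (4 ℕ.+ r)
      e₁ = ℕ.solve-∀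
      f : ℕ → ℚ
      f = balanced 8 A 0≤A A≤1 p
      <8 : ∀ {r} → r ℕ.< 4 → r ℕ.< 8
      <8 r<4 = ℕ.<-≤-trans r<4 (ℕ.m≤m+n 4 4)

    -- Along a class modulo 4 the two classes modulo 8 alternate.
    balanced₈-ZeroOn₄ : ∀ {r} → r ℕ.< 4 → ZeroOn (p ℕ.* 2) (λ y → f (y ℕ.* 4 ℕ.+ r))
    balanced₈-ZeroOn₄ {r} r<4 κ = trans (∑-blocks p 2 _)
      (trans (∑-ext p (λ i → cong₂ _+_ (trans (+-identityˡ _) (cong f (e₀ κ p i r))) (cong f (e₁ κ p i r))))
      (trans (∑-+ p _ _) (cong₂ _+_ (balanced-ZeroOn 8 A 0≤A A≤1 p (<8 r<4) κ) (balanced-ZeroOn 8 A 0≤A A≤1 p (ℕ.+-monoʳ-< 4 r<4) κ))))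

    balanced₈-run₄ : ∀ a i → ∣ ∑ i (λ j → f (a ℕ.+ j ℕ.* 4)) ∣ ≤ ι (p ℕ.* 2) + ι (p ℕ.* 2)
    balanced₈-run₄ a i with divide 4 a
    ... | y₀ , r , r<4 , refl = subst (λ x → ∣ x ∣ ≤ ι (p ℕ.* 2) + ι (p ℕ.* 2)) (∑-ext i (λ j → cong f (balanced₈-run₄-identity y₀ j r)))
        (run≤ (p ℕ.* 2) {{ℕ.m*n≢0 p 2}} (balanced₈-ZeroOn₄ r<4) (λ y → ∣balanced∣≤1 8 A 0≤A A≤1 p (y ℕ.* 4 ℕ.+ r)) y₀ i)

    module _ (A²≡A : ∀ a → A a * A a ≡ A a) where

      balanced-variance : ∀ Q .{{_ : ℕ.NonZero Q}} e T {r} → r ℕ.< Q →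
        ∑ (T ℕ.* p) (λ y → balanced Q A 0≤A A≤1 p (y ℕ.* Q ℕ.+ r) * balanced Q A 0≤A A≤1 p (y ℕ.* Q ℕ.+ r))
          ≤ ∑ (T ℕ.* p) (λ y → (1ℚ - e - e) * A (y ℕ.* Q ℕ.+ r) + e * e)
      balanced-variance Q e T {r} r<Q = subst (_≤ ∑ (T ℕ.* p) (λ y → (1ℚ - e - e) * A (y ℕ.* Q ℕ.+ r) + e * e))
        (sym (∑-ext (T ℕ.* p) (λ y → cong (λ z → z * z) (balanced-line Q A 0≤A A≤1 p r<Q y))))
        (avg-variance p (line Q A r) (λ y → A²≡A (y ℕ.* Q ℕ.+ r)) e T)

      -- Both halves of a class modulo 4 are compared with the same constant `e`. In this way the
      -- densities modulo 8 stay out of the final inequality, although `f` is balanced modulo 8.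
      balanced₈-variance₄ : ∀ e T {r} → r ℕ.< 4 →
        ∑ (T ℕ.* p ℕ.* 2) (λ y → f (y ℕ.* 4 ℕ.+ r) * f (y ℕ.* 4 ℕ.+ r))
          ≤ ∑ (T ℕ.* p ℕ.* 2) (λ y → (1ℚ - e - e) * A (y ℕ.* 4 ℕ.+ r) + e * e)
      balanced₈-variance₄ e T {r} r<4 = subst₂ _≤_ (sym (pairs (λ a → f a * f a))) (sym (pairs (λ a → (1ℚ - e - e) * A a + e * e)))
        (+-mono-≤ (balanced-variance 8 e T (<8 r<4)) (balanced-variance 8 e T (ℕ.+-monoʳ-< 4 r<4)))
        where
        i₀ : ∀ i r → (i ℕ.* 2 ℕ.+ 0) ℕ.* 4 ℕ.+ r ≡ i ℕ.* 8 ℕ.+ r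
        i₀ = ℕ.solve-∀
        i₁ : ∀ i r → (i ℕ.* 2 ℕ.+ 1) ℕ.* 4 ℕ.+ r ≡ i ℕ.* 8 ℕ.+ (4 ℕ.+ r)
        i₁ = ℕ.solve-∀
        pairs : ∀ (g : ℕ → ℚ) → ∑ (T ℕ.* p ℕ.* 2) (λ y → g (y ℕ.* 4 ℕ.+ r)) ≡ ∑ (T ℕ.* p) (λ i → g (i ℕ.* 8 ℕ.+ r)) + ∑ (T ℕ.* p) (λ i → g (i ℕ.* 8 ℕ.+ (4 ℕ.+ r)))
        pairs g = trans (∑-blocks (T ℕ.* p) 2 _) (trans (∑-ext (T ℕ.* p) (λ i → cong₂ _+_ (trans (+-identityˡ _) (cong g (i₀ i r))) (cong g (i₁ i r)))) (∑-+ (T ℕ.* p) _ _))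

-- The weights of the windows and their even distribution

module Windows where

  open Data.Rational.Base
  open Data.Rational.Properties
  open Rationals
  open Sums
  open Averages

  compare : ∀ b c → (∃[ a ] b ℕ.+ a ≡ c) ⊎ c ℕ.< b
  compare b c with b ℕ.≤? c
  ... | yes b≤c = inj₁ (ℕ.m≤n⇒∃[o]m+o≡n b≤c)
  ... | no  b≰c = inj₂ (ℕ.≰⇒> b≰c)

  -- at F b c is F (c - b), and 0 when c < b.
  opaque
    at : (ℕ → ℚ) → ℕ → ℕ → ℚ
    at F b c with b ℕ.≤? c
    ... | yes _ = F (c ℕ.∸ b)
    ... | no  _ = 0ℚ

  opaque
    unfolding at

    at-+ : ∀ F b a → at F b (b ℕ.+ a) ≡ F a
    at-+ F b a with b ℕ.≤? b ℕ.+ a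
    ... | yes _ = cong F (ℕ.m+n∸m≡n b a)
    ... | no ¬p = contradiction (ℕ.m≤m+n b a) ¬p

    at-< : ∀ F {b c} → c ℕ.< b → at F b c ≡ 0ℚ
    at-< F {b} {c} c<b with b ℕ.≤? c
    ... | yes b≤c = contradiction b≤c (ℕ.<⇒≱ c<b)
    ... | no  _   = refl

    at-elim : ∀ (P : ℚ → Set) F b c → P 0ℚ → (∀ a → P (F a)) → P (at F b c)
    at-elim P F b c P0 PF with b ℕ.≤? c
    ... | yes _ = PF (c ℕ.∸ b)
    ... | no  _ = P0

    at-map₂ : ∀ (h : ℚ → ℚ → ℚ) → h 0ℚ 0ℚ ≡ 0ℚ → ∀ F G b c → at (λ a → h (F a) (G a)) b c ≡ h (at F b c) (at G b c)
    at-map₂ h h0 F G b c with b ℕ.≤? c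
    ... | yes _ = refl
    ... | no  _ = sym h0

  ∣at∣≤1 : ∀ F → (∀ a → ∣ F a ∣ ≤ 1ℚ) → ∀ b c → ∣ at F b c ∣ ≤ 1ℚ
  ∣at∣≤1 F F≤1 b c = at-elim (λ x → ∣ x ∣ ≤ 1ℚ) F b c (nonNegative⁻¹ 1ℚ) F≤1

  0≤at : ∀ F → (∀ a → 0ℚ ≤ F a) → ∀ b c → 0ℚ ≤ at F b c
  0≤at F 0≤F b c = at-elim (0ℚ ≤_) F b c ≤-refl 0≤F

  at-support : ∀ F n → (∀ a → n ℕ.≤ a → F a ≡ 0ℚ) → ∀ b c → b ℕ.+ n ℕ.≤ c → at F b c ≡ 0ℚ
  at-support F n F≡0 b c b+n≤c with compare b c
  ... | inj₁ (a , refl) = trans (at-+ F b a) (F≡0 a (ℕ.+-cancelˡ-≤ b n a b+n≤c))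
  ... | inj₂ c<b = at-< F c<b

  at-* : ∀ F G d b c → at F b c * at G b (c ℕ.+ d) ≡ at (λ a → F a * G (a ℕ.+ d)) b c
  at-* F G d b c with compare b c
  ... | inj₁ (a , refl) = trans (cong₂ _*_ (at-+ F b a) (trans (cong (at G b) (ℕ.+-assoc b a d)) (at-+ G b (a ℕ.+ d))))
                                (sym (at-+ (λ a → F a * G (a ℕ.+ d)) b a))
  ... | inj₂ c<b = trans (cong (_* at G b (c ℕ.+ d)) (at-< F c<b)) (trans (*-zeroˡ (at G b (c ℕ.+ d)))
                         (sym (at-< (λ a → F a * G (a ℕ.+ d)) c<b)))

  at-window : ∀ n b c → at (λ a → lt a n) b c ≡ lt c (b ℕ.+ n) - lt c b
  at-window n b c with compare b c
  ... | inj₂ c<b = trans (at-< (λ a → lt a n) c<b)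
    (sym (cong₂ _-_ (lt-yes (ℕ.<-≤-trans c<b (ℕ.m≤m+n b n))) (lt-yes c<b)))
  ... | inj₁ (a , refl) = trans (at-+ (λ a → lt a n) b a) (sym (trans (cong (λ x → lt (b ℕ.+ a) (b ℕ.+ n) - x) (lt-no (ℕ.m≤m+n b a)))
      (trans (+-identityʳ _) lt-shift)))
    where
    lt-shift : lt (b ℕ.+ a) (b ℕ.+ n) ≡ lt a n
    lt-shift with a ℕ.<? n
    ... | yes a<n = trans (lt-yes (ℕ.+-monoʳ-< b a<n)) (sym (lt-yes a<n))
    ... | no  a≮n = trans (lt-no (ℕ.+-monoʳ-≤ b (ℕ.≮⇒≥ a≮n))) (sym (lt-no (ℕ.≮⇒≥ a≮n)))

  ∑-single : ∀ n {G a₀} → a₀ ℕ.< n → (∀ a → a ≢ a₀ → G a ≡ 0ℚ) → ∑ n G ≡ G a₀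
  ∑-single (suc n) {G} {a₀} a₀<1+n G≡0 with n ℕ.≟ a₀
  ... | yes refl = trans (cong (_+ G n) (∑-vanish n (λ a a<n → G≡0 a (ℕ.<⇒≢ a<n)))) (+-identityˡ (G n))
  ... | no  n≢a₀ = trans (cong₂ _+_ (∑-single n (ℕ.≤∧≢⇒< (ℕ.≤-pred a₀<1+n) (λ eq → n≢a₀ (sym eq))) G≡0) (G≡0 n n≢a₀)) (+-identityʳ (G a₀))

  opaque
    δ : ℕ → ℕ → ℚ
    δ x y with x ℕ.≟ y
    ... | yes _ = 1ℚ
    ... | no  _ = 0ℚ

  opaque
    unfolding δ

    δ-refl : ∀ x → δ x x ≡ 1ℚ
    δ-refl x with x ℕ.≟ x
    ... | yes _ = refl
    ... | no ¬p = contradiction refl ¬p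

    δ-≢ : ∀ {x y} → x ≢ y → δ x y ≡ 0ℚ
    δ-≢ {x} {y} x≢y with x ℕ.≟ y
    ... | yes x≡y = contradiction x≡y x≢y
    ... | no  _   = refl

  at≡∑δ : ∀ n F → (∀ a → n ℕ.≤ a → F a ≡ 0ℚ) → ∀ b c → at F b c ≡ ∑ n (λ a → δ (b ℕ.+ a) c * F a)
  at≡∑δ n F F≡0 b c with compare b c
  ... | inj₂ c<b = trans (at-< F c<b) (sym (∑-vanish n (λ a _ →
        trans (cong (_* F a) (δ-≢ (λ eq → ℕ.<⇒≱ c<b (ℕ.≤-trans (ℕ.m≤m+n b a) (ℕ.≤-reflexive eq))))) (*-zeroˡ (F a)))))
  ... | inj₁ (a₀ , refl) = trans (at-+ F b a₀) (sym eval)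
    where
    off : ∀ a → a ≢ a₀ → δ (b ℕ.+ a) (b ℕ.+ a₀) * F a ≡ 0ℚ
    off a a≢a₀ = trans (cong (_* F a) (δ-≢ (λ eq → a≢a₀ (ℕ.+-cancelˡ-≡ b a a₀ eq)))) (*-zeroˡ (F a))
    eval : ∑ n (λ a → δ (b ℕ.+ a) (b ℕ.+ a₀) * F a) ≡ F a₀
    eval with a₀ ℕ.<? n
    ... | yes a₀<n = trans (∑-single n a₀<n off) (trans (cong (_* F a₀) (δ-refl (b ℕ.+ a₀))) (*-identityˡ (F a₀)))
    ... | no  a₀≮n = trans (∑-vanish n (λ a a<n → off a (λ eq → a₀≮n (subst (ℕ._< n) eq a<n)))) (sym (F≡0 a₀ (ℕ.≮⇒≥ a₀≮n)))

  -- Both sides add up F a * G b over all a + b = c: convolution is commutative.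
  reverse : ∀ n F G → (∀ a → n ℕ.≤ a → F a ≡ 0ℚ) → (∀ a → n ℕ.≤ a → G a ≡ 0ℚ) → ∀ c →
    ∑ n (λ b → G b * at F b c) ≡ ∑ n (λ a → F a * at G a c)
  reverse n F G F≡0 G≡0 c = trans (∑-ext n (λ b → trans (cong (G b *_) (at≡∑δ n F F≡0 b c)) (sym (∑-* n (G b) _))))
    (trans (∑-swap n n _) (sym (∑-ext n (λ a → trans (cong (F a *_) (at≡∑δ n G G≡0 a c))
      (trans (sym (∑-* n (F a) _)) (∑-ext n (λ b → trans (cong (λ x → F a * (δ x c * G b)) (ℕ.+-comm a b)) (eq (F a) (G b) (δ (b ℕ.+ a) c)))))))))
    where
    eq : ∀ f g d → f * (d * g) ≡ g * (d * f)
    eq = solve-∀ ℚ-ring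

  -- The length (2l+2)² - (2l)² of a window.
  ω : ℕ → ℚ
  ω l = ι (8 ℕ.* l ℕ.+ 4)

  0≤ω : ∀ l → 0ℚ ≤ ω l
  0≤ω l = 0≤ι _

  ω↑ : ∀ l → ω l ≤ ω (suc l)
  ω↑ l = ι-mono (ℕ.+-monoˡ-≤ 4 (ℕ.*-monoʳ-≤ 8 (ℕ.n≤1+n l)))

  ∑ω : ∀ l → ∑ l ω ≡ ι (4 ℕ.* (l ℕ.* l))
  ∑ω zero    = sym ι-0
  ∑ω (suc l) = trans (cong (_+ ω l) (∑ω l)) (trans (sym (ι-+ (4 ℕ.* (l ℕ.* l)) (8 ℕ.* l ℕ.+ 4))) (cong ι (eq l)))
    where
    eq : ∀ l → 4 ℕ.* (l ℕ.* l) ℕ.+ (8 ℕ.* l ℕ.+ 4) ≡ 4 ℕ.* (suc l ℕ.* suc l)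
    eq = ℕ.solve-∀

  sq : ℕ → ℕ → ℕ
  sq h l = (2 ℕ.* l ℕ.+ h) ℕ.* (2 ℕ.* l ℕ.+ h)

  sq-mono : ∀ h {l m} → l ℕ.≤ m → sq h l ℕ.≤ sq h m
  sq-mono h l≤m = ℕ.*-mono-≤ le le
    where le = ℕ.+-monoˡ-≤ h (ℕ.*-monoʳ-≤ 2 l≤m)

  bound-identity : ∀ j → 4 ℕ.* (suc j ℕ.* suc j) ℕ.+ 8 ≡ (2 ℕ.* j) ℕ.* (2 ℕ.* j) ℕ.+ (8 ℕ.* suc j ℕ.+ 4)
  bound-identity = ℕ.solve-∀

  tail≤-identity : ∀ Λ h → Λ ℕ.* (8 ℕ.* h) ≡ h ℕ.* (8 ℕ.* Λ)
  tail≤-identity = ℕ.solve-∀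

  lower-identity : ∀ k → (2 ℕ.* k ℕ.+ 2) ℕ.* (2 ℕ.* k ℕ.+ 2) ≡ 4 ℕ.* (k ℕ.* k) ℕ.+ (8 ℕ.* k ℕ.+ 4)
  lower-identity = ℕ.solve-∀

  lower-identity₂ : ∀ x y → y - x ≡ - (x - y)
  lower-identity₂ = solve-∀ ℚ-ring

  to--identity : ∀ x y w → w - (x - y) ≡ y + w - x
  to--identity = solve-∀ ℚ-ring

  c≤-identity : ∀ m → 4 ℕ.* (m ℕ.* m) ≡ (2 ℕ.* m) ℕ.* (2 ℕ.* m)
  c≤-identity = ℕ.solve-∀

  shift-identity : ∀ s d k → s - (k + (s + d)) ≡ - k - d
  shift-identity = solve-∀ ℚ-ring

  ω-shift-identity : ∀ l h → 8 ℕ.* (h ℕ.+ l) ℕ.+ 4 ≡ 8 ℕ.* l ℕ.+ 4 ℕ.+ 8 ℕ.* h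
  ω-shift-identity = ℕ.solve-∀

  marginal-identity : ∀ a n → a + n - a ≡ n
  marginal-identity = solve-∀ ℚ-ring

  gap-marginal-identity : ∀ s t x y → s - t - (y - x) ≡ (s - y) - (t - x)
  gap-marginal-identity = solve-∀ ℚ-ring

  gap-sum-identity : ∀ x y z → (x - y) * z ≡ x * z - y * z
  gap-sum-identity = solve-∀ ℚ-ring

  -- Sums of two numbers below `n` stay below 2n, and the hypothesis says that the first Λ windows,
  -- which end at (2Λ)², reach that far.
  module Range (n Λ : ℕ) (2n≤4Λ² : 2 ℕ.* n ℕ.≤ 4 ℕ.* (Λ ℕ.* Λ)) where

    W : ℚ
    W = ω Λ

    0≤W : 0ℚ ≤ W
    0≤W = 0≤ω Λ

    ω≤W : ∀ {l} → l ℕ.≤ Λ → ω l ≤ W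
    ω≤W l≤Λ = ι-mono (ℕ.+-monoˡ-≤ 4 (ℕ.*-monoʳ-≤ 8 l≤Λ))

    gap : ℕ → ℕ → ℕ → ℚ
    gap x y c = lt c y - lt c x

    window : ℕ → ℕ → ℚ
    window = at (λ a → lt a n)

    cuts : ∀ h c → Cut (sq h) c Λ
    cuts h c = mkCut (sq-mono h) c Λ

    gap-sum : ∀ h x y F → ∑ Λ (λ l → gap x y (sq h l) * F l) ≡ ∑ (Cut.cut (cuts h y)) F - ∑ (Cut.cut (cuts h x)) F
    gap-sum h x y F = trans (∑-ext Λ (λ l → gap-sum-identity (lt (sq h l) y) (lt (sq h l) x) (F l)))
      (trans (∑-- Λ _ _) (cong₂ _-_ (Cut.sum (cuts h y) F) (Cut.sum (cuts h x) F)))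

    -- The `l` whose square lies in [x, y) are the difference of two initial segments, and `abel`
    -- bounds each of them; Λ is below the end of the range where the weights exceed `W`.
    gap-run : ∀ h x y v M → (∀ i → ∣ ∑ i v ∣ ≤ M) →
      ∣ ∑ Λ (λ l → gap x y (sq h l) * (ω l * v l)) ∣ ≤ W * (M + M) + W * (M + M)
    gap-run h x y v M V≤M = subst (λ s → ∣ s ∣ ≤ W * (M + M) + W * (M + M)) (sym (gap-sum h x y _))
      (∣p-q∣≤ (part y) (part x))
      where
      0≤M : 0ℚ ≤ M
      0≤M = ≤-trans (0≤∣p∣ 0ℚ) (V≤M 0)
      part : ∀ c → ∣ ∑ (Cut.cut (cuts h c)) (λ l → ω l * v l) ∣ ≤ W * (M + M)
      part c = ≤-trans (abel v M V≤M ω 0≤ω ω↑ k) (≤-trans (≤-reflexive (sym (*-distribˡ-+ (ω k) M M)))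
          (*-monoʳ-≤-nonNeg (M + M) {{nonNegative (0≤+ 0≤M 0≤M)}} (ω≤W (Cut.cut≤Λ (cuts h c)))))
        where k = Cut.cut (cuts h c)

    window-run : ∀ h a v M → (∀ i → ∣ ∑ i v ∣ ≤ M) →
      ∣ ∑ Λ (λ l → window a (sq h l) * (ω l * v l)) ∣ ≤ W * (M + M) + W * (M + M)
    window-run h a v M V≤M = subst (λ s → ∣ s ∣ ≤ W * (M + M) + W * (M + M))
      (∑-ext Λ (λ l → cong (_* (ω l * v l)) (sym (at-window n a (sq h l))))) (gap-run h a (a ℕ.+ n) v M V≤M)

    -- The weights of the first k windows telescope to (2k)², and the cut k is the place where (2l +
    -- h)² passes `c`. For h ≤ 2 these two numbers differ by at most one window.
    cut-value : ∀ h → h ℕ.≤ 2 → ∀ c → c ℕ.≤ 2 ℕ.* n → ∣ ∑ (Cut.cut (cuts h c)) ω - ι c ∣ ≤ W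
    cut-value h h≤2 c c≤2n = subst (λ x → ∣ x - ι c ∣ ≤ W) (sym (∑ω k)) (∣p∣≤ upper lower)
      where
      open Cut (cuts h c) renaming (cut to k)
      c≤ : c ℕ.≤ sq h k
      c≤ with ℕ.m≤n⇒m<n∨m≡n cut≤Λ
      ... | inj₁ k<Λ  = above k ℕ.≤-refl k<Λ
      ... | inj₂ k≡Λ = ℕ.≤-trans c≤2n (ℕ.≤-trans 2n≤4Λ² (ℕ.≤-trans (ℕ.≤-reflexive (trans (c≤-identity Λ) (cong (λ m → (2 ℕ.* m) ℕ.* (2 ℕ.* m)) (sym k≡Λ))))
          (ℕ.*-mono-≤ (ℕ.m≤m+n (2 ℕ.* k) h) (ℕ.m≤m+n (2 ℕ.* k) h))))
      ≤W : ∀ {x y} → x ℕ.≤ y ℕ.+ (8 ℕ.* k ℕ.+ 4) → ι x ≤ ι y + W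
      ≤W {x} {y} le = ≤-trans (ι-mono le) (≤-trans (≤-reflexive (ι-+ y (8 ℕ.* k ℕ.+ 4))) (+-monoʳ-≤ (ι y) (ω≤W cut≤Λ)))
      to- : ∀ {x y} → x ≤ y + W → x - y ≤ W
      to- {x} {y} le = slack (y + W - x) (p≤q⇒0≤q-p le) (to--identity x y W)
      upper : ι (4 ℕ.* (k ℕ.* k)) - ι c ≤ W
      upper = to- (≤W (bound k below))
        where
        bound : ∀ k → (∀ l → l ℕ.< k → sq h l ℕ.< c) → 4 ℕ.* (k ℕ.* k) ℕ.≤ c ℕ.+ (8 ℕ.* k ℕ.+ 4)
        bound zero    _ = z≤n
        bound (suc j) b = ℕ.≤-trans (ℕ.≤-trans (ℕ.m≤m+n _ 8) (ℕ.≤-reflexive (bound-identity j))) (ℕ.+-monoˡ-≤ (8 ℕ.* suc j ℕ.+ 4)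
            (ℕ.<⇒≤ (ℕ.≤-<-trans (ℕ.*-mono-≤ (ℕ.m≤m+n (2 ℕ.* j) h) (ℕ.m≤m+n (2 ℕ.* j) h)) (b j ℕ.≤-refl))))
      lower : - (ι (4 ℕ.* (k ℕ.* k)) - ι c) ≤ W
      lower = subst (_≤ W) (lower-identity₂ (ι (4 ℕ.* (k ℕ.* k))) (ι c)) (to- (≤W {c} (ℕ.≤-trans c≤ (ℕ.≤-trans
          (ℕ.*-mono-≤ (ℕ.+-monoʳ-≤ (2 ℕ.* k) h≤2) (ℕ.+-monoʳ-≤ (2 ℕ.* k) h≤2)) (ℕ.≤-reflexive (lower-identity k))))))

    a+n≤2n : ∀ {a} → a ℕ.≤ n → a ℕ.+ n ℕ.≤ 2 ℕ.* n
    a+n≤2n a≤n = ℕ.+-mono-≤ a≤n (ℕ.≤-reflexive (sym (ℕ.+-identityʳ n)))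

    gap-marginal : ∀ h → h ℕ.≤ 2 → ∀ x y → x ℕ.≤ 2 ℕ.* n → y ℕ.≤ 2 ℕ.* n →
      ∣ ∑ Λ (λ l → gap x y (sq h l) * ω l) - (ι y - ι x) ∣ ≤ W + W
    gap-marginal h h≤2 x y x≤2n y≤2n = subst (λ s → ∣ s ∣ ≤ W + W) (sym eq)
      (∣p-q∣≤ (cut-value h h≤2 y y≤2n) (cut-value h h≤2 x x≤2n))
      where
      s₁ s₀ : ℚ
      s₁ = ∑ (Cut.cut (cuts h y)) ω
      s₀ = ∑ (Cut.cut (cuts h x)) ω
      eq : ∑ Λ (λ l → gap x y (sq h l) * ω l) - (ι y - ι x) ≡ (s₁ - ι y) - (s₀ - ι x)
      eq = trans (cong (_- (ι y - ι x)) (gap-sum h x y ω)) (gap-marginal-identity s₁ s₀ (ι x) (ι y))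

    marginal : ∀ h → h ℕ.≤ 2 → ∀ a → a ℕ.< n → ∣ ∑ Λ (λ l → window a (sq h l) * ω l) - ι n ∣ ≤ W + W
    marginal h h≤2 a a<n = subst₂ (λ s t → ∣ s - t ∣ ≤ W + W)
      (∑-ext Λ (λ l → cong (_* ω l) (sym (at-window n a (sq h l)))))
      (trans (cong (_- ι a) (ι-+ a n)) (marginal-identity (ι a) (ι n)))
      (gap-marginal h h≤2 a (a ℕ.+ n) (ℕ.≤-trans (ℕ.m≤m+n a n) (a+n≤2n (ℕ.<⇒≤ a<n))) (a+n≤2n (ℕ.<⇒≤ a<n)))

    ω-shift : ∀ l h → ω (h ℕ.+ l) ≡ ω l + ι (8 ℕ.* h)
    ω-shift l h = trans (cong ι (ω-shift-identity l h)) (ι-+ (8 ℕ.* l ℕ.+ 4) (8 ℕ.* h))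

    -- The shift drops the first `h` terms, each at most `W`, and lowers the weight of each other
    -- term by 8h, altogether at most 8hΛ ≤ hW. Nothing enters at the far end, where `G` vanishes.
    shift : ∀ (G : ℕ → ℚ) → (∀ l → ∣ G l ∣ ≤ 1ℚ) → (∀ l → Λ ℕ.≤ l → G l ≡ 0ℚ) → ∀ h → h ℕ.≤ Λ →
      ∣ ∑ Λ (λ l → ω l * G (h ℕ.+ l)) - ∑ Λ (λ l → ω l * G l) ∣ ≤ ι h * W + ι h * W
    shift G G≤1 G≡0 h h≤Λ = subst (λ x → ∣ x ∣ ≤ ι h * W + ι h * W) (sym eq) (∣p-q∣≤ head≤ tail≤)
      where
      K : ℕ → ℚ
      K l = ω l * G l
      head drift : ℚ
      head = - ∑ h K
      drift = ∑ Λ (λ l → ι (8 ℕ.* h) * G (h ℕ.+ l))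
      head≤ : ∣ head ∣ ≤ ι h * W
      head≤ = subst (_≤ ι h * W) (sym (∣-p∣≡∣p∣ (∑ h K))) (∣∑∣≤ h W (λ l l<h → ≤-trans
        (∣p*q∣≤ {p = ω l} (≤-reflexive (0≤p⇒∣p∣≡p (0≤ω l))) (G≤1 l)) (≤-trans (≤-reflexive (*-identityʳ (ω l))) (ω≤W (ℕ.≤-trans (ℕ.<⇒≤ l<h) h≤Λ)))))
      tail≤ : ∣ drift ∣ ≤ ι h * W
      tail≤ = ≤-trans (∣∑∣≤ Λ (ι (8 ℕ.* h)) (λ l _ → ≤-trans (∣p*q∣≤ {p = ι (8 ℕ.* h)} (≤-reflexive (0≤p⇒∣p∣≡p (0≤ι (8 ℕ.* h)))) (G≤1 (h ℕ.+ l))) (≤-reflexive (*-identityʳ (ι (8 ℕ.* h))))))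
        (≤-trans (≤-reflexive (trans (sym (ι-* Λ (8 ℕ.* h))) (trans (cong ι (tail≤-identity Λ h)) (ι-* h (8 ℕ.* Λ)))))
          (*-monoˡ-≤-nonNeg (ι h) {{nonNegative (0≤ι h)}} (ι-mono (ℕ.m≤m+n (8 ℕ.* Λ) 4))))
      total : ∑ h K + ∑ Λ (λ l → K (h ℕ.+ l)) ≡ ∑ Λ K
      total = trans (sym (∑-++ h Λ K)) (trans (cong (λ x → ∑ x K) (ℕ.+-comm h Λ)) (trans (∑-++ Λ h K)
        (trans (cong (λ x → ∑ Λ K + x) (∑-vanish h (λ i _ → trans (cong (ω (Λ ℕ.+ i) *_) (G≡0 _ (ℕ.m≤m+n Λ i))) (*-zeroʳ (ω (Λ ℕ.+ i)))))) (+-identityʳ _))))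
      split : ∑ Λ (λ l → K (h ℕ.+ l)) ≡ ∑ Λ (λ l → ω l * G (h ℕ.+ l)) + drift
      split = trans (∑-ext Λ (λ l → trans (cong (_* G (h ℕ.+ l)) (ω-shift l h)) (*-distribʳ-+ (G (h ℕ.+ l)) (ω l) (ι (8 ℕ.* h))))) (∑-+ Λ _ _)
      eq : ∑ Λ (λ l → ω l * G (h ℕ.+ l)) - ∑ Λ K ≡ head - drift
      eq = trans (cong (λ x → ∑ Λ (λ l → ω l * G (h ℕ.+ l)) - x) (trans (sym total) (cong (λ x → ∑ h K + x) split)))
        (shift-identity (∑ Λ (λ l → ω l * G (h ℕ.+ l))) drift (∑ h K))

-- Evaluation of the block averages over the windows

module Progressions where

  open Data.Rational.Base
  open Data.Rational.Properties
  open Rationals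
  open Sums
  open Averages
  open Windows

  sgn : ℕ → ℚ
  sgn zero    = 1ℚ
  sgn (suc l) = - sgn l

  ∣sgn∣≤1 : ∀ l → ∣ sgn l ∣ ≤ 1ℚ
  ∣sgn∣≤1 zero    = ≤-refl
  ∣sgn∣≤1 (suc l) = subst (_≤ 1ℚ) (sym (∣-p∣≡∣p∣ (sgn l))) (∣sgn∣≤1 l)

  sgn-ZeroOn : ZeroOn 2 sgn
  sgn-ZeroOn c = trans (cong (λ k → 0ℚ + sgn (c ℕ.* 2 ℕ.+ 0) + sgn k) (ℕ.+-suc (c ℕ.* 2) 0)) (eq (sgn (c ℕ.* 2 ℕ.+ 0)))
    where
    eq : ∀ x → 0ℚ + x + - x ≡ 0ℚ
    eq = solve-∀ ℚ-ring

  ∑-telescope : ∀ T (g : ℕ → ℚ) → ∑ T (λ κ → g (suc κ) - g κ) ≡ g T - g 0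
  ∑-telescope zero    g = sym (+-inverseʳ (g 0))
  ∑-telescope (suc T) g = trans (cong (_+ (g (suc T) - g T)) (∑-telescope T g)) (eq (g 0) (g T) (g (suc T)))
    where
    eq : ∀ a b c → b - a + (c - b) ≡ c - a
    eq = solve-∀ ℚ-ring

  ≥-from-∣-∣ : ∀ {p q r} → ∣ p - q ∣ ≤ r → q - r ≤ p
  ≥-from-∣-∣ {p} {q} {r} h = slack (r - (- (p - q))) (p≤q⇒0≤q-p (≤-trans (-p≤∣p∣ (p - q)) h)) (eq p q r)
    where
    eq : ∀ p q r → p - (q - r) ≡ r - (- (p - q))
    eq = solve-∀ ℚ-ring

  ≤-from-∣-∣ : ∀ {p q r} → ∣ p - q ∣ ≤ r → p ≤ q + r
  ≤-from-∣-∣ {p} {q} {r} h = slack (r - (p - q)) (p≤q⇒0≤q-p (≤-trans (p≤∣p∣ (p - q)) h)) (eq p q r)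
    where
    eq : ∀ p q r → q + r - p ≡ r - (p - q)
    eq = solve-∀ ℚ-ring

  second-identity : ∀ z → - (- z) ≡ z
  second-identity = solve-∀ ℚ-ring

  first-identity₂ : ∀ m p u → m * (p - u) - (m * p - u) ≡ (1ℚ - m) * u
  first-identity₂ = solve-∀ ℚ-ring

  ιP-identity : ∀ a p → a + p - a ≡ p
  ιP-identity = solve-∀ ℚ-ring

  block-identity₂ : ∀ g w m a s → g * (w * (m + a * s)) ≡ m * (g * w) + a * (g * (w * s))
  block-identity₂ = solve-∀ ℚ-ring

  block-identity₃ : ∀ m u v → m - (u + v) ≡ (m - u) + (- v)
  block-identity₃ = solve-∀ ℚ-ring

  x-suc-identity : ∀ b P κ → b ℕ.+ suc κ ℕ.* P ≡ b ℕ.+ κ ℕ.* P ℕ.+ P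
  x-suc-identity = ℕ.solve-∀

  block-sum-identity : ∀ g w z → w * (g * z) ≡ g * (w * z)
  block-sum-identity = solve-∀ ℚ-ring

  -- Inside one block the values met at the squares depend on `l` through its parity only, as
  -- `mid κ` plus a multiple of (-1)^l. By summation by parts the alternating part contributes a
  -- bounded multiple of `W` per block; the rest gives `mid κ` times the block length. Hence one
  -- `err` for each of the `T` blocks.
  module BlockSum (n Λ : ℕ) (2n≤4Λ² : 2 ℕ.* n ℕ.≤ 4 ℕ.* (Λ ℕ.* Λ)) (T P : ℕ) (n≡TP : n ≡ T ℕ.* P)
    (D : ℕ → ℚ) (D≡0 : ∀ a → n ℕ.≤ a → D a ≡ 0ℚ)
    (b : ℕ) (b<n : b ℕ.< n) (h : ℕ) (h≤2 : h ℕ.≤ 2) (mid alt : ℕ → ℚ)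
    (0≤mid : ∀ κ → 0ℚ ≤ mid κ) (mid≤1 : ∀ κ → mid κ ≤ 1ℚ) (∣alt∣≤1 : ∀ κ → ∣ alt κ ∣ ≤ 1ℚ)
    (D≡ : ∀ κ j l → j ℕ.< P → b ℕ.+ (κ ℕ.* P ℕ.+ j) ≡ sq h l → D (κ ℕ.* P ℕ.+ j) ≡ mid κ + alt κ * sgn l) where

    open Range n Λ 2n≤4Λ²

    private
      x : ℕ → ℕ
      x κ = b ℕ.+ κ ℕ.* P

      x-suc : ∀ κ → x (suc κ) ≡ x κ ℕ.+ P
      x-suc κ = x-suc-identity b P κ

      cover : ∀ c → at D b c ≡ ∑ T (λ κ → gap (x κ) (x (suc κ)) c * at D b c)
      cover c = sym (trans (∑-*ʳ T (at D b c) _) (trans (cong (_* at D b c) (∑-telescope T (λ κ → lt c (x κ)))) inside))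
        where
        inside : (lt c (x T) - lt c (x 0)) * at D b c ≡ at D b c
        inside with compare b c
        ... | inj₂ c<b = trans (cong ((lt c (x T) - lt c (x 0)) *_) (at-< D c<b)) (trans (*-zeroʳ (lt c (x T) - lt c (x 0))) (sym (at-< D c<b)))
        ... | inj₁ (a , refl) with n ℕ.≤? a
        ...   | yes n≤a = trans (cong ((lt c (x T) - lt c (x 0)) *_) z) (trans (*-zeroʳ (lt (b ℕ.+ a) (x T) - lt (b ℕ.+ a) (x 0))) (sym z))
          where
          z : at D b (b ℕ.+ a) ≡ 0ℚ
          z = trans (at-+ D b a) (D≡0 a n≤a)
        ...   | no  n≰a = trans (cong (_* at D b (b ℕ.+ a)) (cong₂ _-_
            (lt-yes (ℕ.+-monoʳ-< b (subst (a ℕ.<_) n≡TP (ℕ.≰⇒> n≰a)))) (lt-no (ℕ.≤-trans (ℕ.≤-reflexive (ℕ.+-identityʳ b)) (ℕ.m≤m+n b a)))))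
          (*-identityˡ (at D b (b ℕ.+ a)))

      local : ∀ κ l → gap (x κ) (x (suc κ)) (sq h l) * at D b (sq h l) ≡ gap (x κ) (x (suc κ)) (sq h l) * (mid κ + alt κ * sgn l)
      local κ l with compare (x κ) (sq h l)
      ... | inj₂ c<x = trans (kill (at D b (sq h l))) (sym (kill (mid κ + alt κ * sgn l)))
        where
        kill : ∀ z → gap (x κ) (x (suc κ)) (sq h l) * z ≡ 0ℚ
        kill z = trans (cong (_* z) (cong₂ _-_ (lt-yes (ℕ.<-≤-trans c<x (ℕ.≤-trans (ℕ.m≤m+n (x κ) P) (ℕ.≤-reflexive (sym (x-suc κ)))))) (lt-yes c<x))) (*-zeroˡ z)
      ... | inj₁ (j , eq) with j ℕ.<? P
      ...   | yes j<P = cong (gap (x κ) (x (suc κ)) (sq h l) *_)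
          (trans (cong (at D b) (sym eq′)) (trans (at-+ D b (κ ℕ.* P ℕ.+ j)) (D≡ κ j l j<P eq′)))
        where
        eq′ : b ℕ.+ (κ ℕ.* P ℕ.+ j) ≡ sq h l
        eq′ = trans (sym (ℕ.+-assoc b (κ ℕ.* P) j)) eq
      ...   | no  j≮P = trans (kill (at D b (sq h l))) (sym (kill (mid κ + alt κ * sgn l)))
        where
        kill : ∀ z → gap (x κ) (x (suc κ)) (sq h l) * z ≡ 0ℚ
        kill z = trans (cong (_* z) (cong₂ _-_
            (lt-no (ℕ.≤-trans (ℕ.≤-reflexive (x-suc κ)) (ℕ.≤-trans (ℕ.+-monoʳ-≤ (x κ) (ℕ.≮⇒≥ j≮P)) (ℕ.≤-reflexive eq))))
            (lt-no (ℕ.≤-trans (ℕ.m≤m+n (x κ) j) (ℕ.≤-reflexive eq))))) (*-zeroˡ z)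

    err : ℚ
    err = (W + W) + (W * (ι 2 + ι 2) + W * (ι 2 + ι 2))

    private
      block : ∀ κ → κ ℕ.< T → mid κ * ι P - err ≤ ∑ Λ (λ l → gap (x κ) (x (suc κ)) (sq h l) * (ω l * (mid κ + alt κ * sgn l)))
      block κ κ<T = subst (mid κ * ι P - err ≤_) (sym split) (≤-trans (≤-reflexive (block-identity₃ (mid κ * ι P) (W + W) _)) (+-mono-≤ first second))
        where
        g : ℕ → ℚ
        g l = gap (x κ) (x (suc κ)) (sq h l)
        split : ∑ Λ (λ l → g l * (ω l * (mid κ + alt κ * sgn l))) ≡ mid κ * ∑ Λ (λ l → g l * ω l) + alt κ * ∑ Λ (λ l → g l * (ω l * sgn l))
        split = trans (∑-ext Λ (λ l → block-identity₂ (g l) (ω l) (mid κ) (alt κ) (sgn l)))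
          (trans (∑-+ Λ _ _) (cong₂ _+_ (∑-* Λ (mid κ) _) (∑-* Λ (alt κ) _)))
        x≤2n : ∀ κ → κ ℕ.≤ T → x κ ℕ.≤ 2 ℕ.* n
        x≤2n κ κ≤T = ℕ.≤-trans (ℕ.+-monoʳ-≤ b (ℕ.≤-trans (ℕ.*-monoˡ-≤ P κ≤T) (ℕ.≤-reflexive (sym n≡TP)))) (a+n≤2n (ℕ.<⇒≤ b<n))
        ιP : ι (x (suc κ)) - ι (x κ) ≡ ι P
        ιP = trans (cong (_- ι (x κ)) (trans (cong ι (x-suc κ)) (ι-+ (x κ) P))) (ιP-identity (ι (x κ)) (ι P))
        first : mid κ * ι P - (W + W) ≤ mid κ * ∑ Λ (λ l → g l * ω l)
        first = ≤-trans (slack ((1ℚ - mid κ) * (W + W)) (0≤* (p≤q⇒0≤q-p (mid≤1 κ)) (0≤+ 0≤W 0≤W)) (first-identity₂ (mid κ) (ι P) (W + W)))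
          (*-monoˡ-≤-nonNeg (mid κ) {{nonNegative (0≤mid κ)}}
            (≥-from-∣-∣ (subst (λ z → ∣ ∑ Λ (λ l → g l * ω l) - z ∣ ≤ W + W) ιP
              (gap-marginal h h≤2 (x κ) (x (suc κ)) (x≤2n κ (ℕ.<⇒≤ κ<T)) (x≤2n (suc κ) κ<T)))))
        second : - (W * (ι 2 + ι 2) + W * (ι 2 + ι 2)) ≤ alt κ * ∑ Λ (λ l → g l * (ω l * sgn l))
        second = ≤-trans (neg-antimono-≤ (≤-trans (-p≤∣p∣ _) (≤-trans (∣p*q∣≤ (∣alt∣≤1 κ)
            (gap-run h (x κ) (x (suc κ)) sgn (ι 2) (prefix≤ 2 {sgn} sgn-ZeroOn ∣sgn∣≤1))) (≤-reflexive (*-identityˡ _)))))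
          (≤-reflexive (second-identity (alt κ * ∑ Λ (λ l → g l * (ω l * sgn l)))))

    block-sum : ∑ T mid * ι P - ι T * err ≤ ∑ Λ (λ l → ω l * at D b (sq h l))
    block-sum = subst₂ _≤_ lhs (sym rhs) (∑-mono T block)
      where
      lhs : ∑ T (λ κ → mid κ * ι P - err) ≡ ∑ T mid * ι P - ι T * err
      lhs = trans (∑-- T _ _) (cong₂ _-_ (∑-*ʳ T (ι P) mid) (∑-const T err))
      rhs : ∑ Λ (λ l → ω l * at D b (sq h l)) ≡ ∑ T (λ κ → ∑ Λ (λ l → gap (x κ) (x (suc κ)) (sq h l) * (ω l * (mid κ + alt κ * sgn l))))
      rhs = trans (∑-ext Λ (λ l → trans (cong (ω l *_) (cover (sq h l))) (sym (∑-* T (ω l) _))))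
        (trans (∑-swap Λ T _) (∑-ext T (λ κ → ∑-ext Λ (λ l → trans (cong (ω l *_) (local κ l))
          (block-sum-identity (gap (x κ) (x (suc κ)) (sq h l)) (ω l) (mid κ + alt κ * sgn l))))))

  mid≤1-identity : ∀ x y → 1ℚ - ½ * (x + y) ≡ ½ * ((1ℚ - x) + (1ℚ - y))
  mid≤1-identity = solve-∀ ℚ-ring

  D≡-identity : ∀ s t x → s * t * x ≡ s * x * t
  D≡-identity = solve-∀ ℚ-ring

  select-identity : ∀ x → x ≡ - (- x)
  select-identity = solve-∀ ℚ-ring

  select-identity₂ : ∀ x y → y ≡ ½ * (x + y) + (- 1ℚ) * (½ * (x - y))
  select-identity₂ = solve-∀ ℚ-ring

  select-identity₃ : ∀ x y → x ≡ ½ * (x + y) + 1ℚ * (½ * (x - y))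
  select-identity₃ = solve-∀ ℚ-ring

  ring-identity : ∀ m p f → m * (f * p) ≡ f * (p * m)
  ring-identity = solve-∀ ℚ-ring

  even-main-identity : ∀ x y p → ½ * (x + y) * (p * (+ 8 / 1)) ≡ (+ 4 / 1) * (p * x + p * y)
  even-main-identity = solve-∀ ℚ-ring

  -- (2l+1)² - b lies in a fixed class modulo 4, while (2l)² - b alternates between two classes modulo 8.
  module MainTerms (A : ℕ → ℚ) (0≤A : ∀ a → 0ℚ ≤ A a) (A≤1 : ∀ a → A a ≤ 1ℚ)
    (n Λ : ℕ) (2n≤4Λ² : 2 ℕ.* n ℕ.≤ 4 ℕ.* (Λ ℕ.* Λ)) (A≡0 : ∀ a → n ℕ.≤ a → A a ≡ 0ℚ)
    (T p : ℕ) .{{_ : ℕ.NonZero p}} where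

    open Range n Λ 2n≤4Λ²

    blockError : ℚ
    blockError = ι T * ((W + W) + (W * (ι 2 + ι 2) + W * (ι 2 + ι 2)))

    classSum : ℕ → ℕ → ℚ
    classSum m r = ∑ m (λ y → A (y ℕ.* 4 ℕ.+ r))

    odd-main : n ≡ T ℕ.* (p ℕ.* 4) → ∀ b → b ℕ.< n → ∀ r → r ℕ.< 4 →
      (∀ l a → b ℕ.+ a ≡ sq 1 l → a ℕ.% 4 ≡ r) →
      ι 4 * classSum (T ℕ.* p) r - blockError ≤ ∑ Λ (λ l → ω l * at (density 4 p A) b (sq 1 l))
    odd-main n≡ b b<n r r<4 class = subst (_≤ ∑ Λ (λ l → ω l * at (density 4 p A) b (sq 1 l))) (cong (_- blockError) main) block-sum
      where
      F : ℕ → ℚ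
      F = line 4 A r
      mid : ℕ → ℚ
      mid κ = avg p F (κ ℕ.* p)
      idx : ∀ κ p y r → κ ℕ.* (p ℕ.* 4) ℕ.+ (y ℕ.* 4 ℕ.+ r) ≡ (κ ℕ.* p ℕ.+ y) ℕ.* 4 ℕ.+ r
      idx = ℕ.solve-∀
      D≡ : ∀ κ j l → j ℕ.< p ℕ.* 4 → b ℕ.+ (κ ℕ.* (p ℕ.* 4) ℕ.+ j) ≡ sq 1 l → density 4 p A (κ ℕ.* (p ℕ.* 4) ℕ.+ j) ≡ mid κ + 0ℚ * sgn l
      D≡ κ j l j<P eq with divide 4 j
      ... | y , r′ , r′<4 , refl = trans (cong (density 4 p A) (idx κ p y r′))
          (trans (density-line 4 p A (κ ℕ.* p ℕ.+ y) r′<4)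
          (trans (cong (λ r → avg p (line 4 A r) (κ ℕ.* p ℕ.+ y)) r′≡r)
          (trans (avg-block p F κ y<p) (trans (sym (trans (cong (avg p F) (sym (ℕ.+-identityʳ (κ ℕ.* p)))) (avg-block p F κ (ℕ.>-nonZero⁻¹ p))))
            (sym (trans (cong (λ z → mid κ + z) (*-zeroˡ (sgn l))) (+-identityʳ (mid κ))))))))
        where
        r′≡r : r′ ≡ r
        r′≡r = trans (sym (trans (cong (ℕ._% 4) (idx κ p y r′)) ([κ*p+j]%p 4 (κ ℕ.* p ℕ.+ y) r′<4))) (class l _ eq)
        y<p : y ℕ.< p
        y<p = ℕ.*-cancelʳ-< 4 y p (ℕ.≤-<-trans (ℕ.m≤m+n (y ℕ.* 4) r′) j<P)
      open BlockSum n Λ 2n≤4Λ² T (p ℕ.* 4) n≡ (density 4 p A)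
        (λ a n≤a → density-support 4 p A T (λ a le → A≡0 a (ℕ.≤-trans (ℕ.≤-reflexive n≡) le)) a (ℕ.≤-trans (ℕ.≤-reflexive (sym n≡)) n≤a))
        b b<n 1 (s≤s z≤n) mid (λ _ → 0ℚ)
        (λ κ → 0≤avg p F (λ y → 0≤A _) (λ y → A≤1 _) (κ ℕ.* p)) (λ κ → avg≤1 p F (λ y → 0≤A _) (λ y → A≤1 _) (κ ℕ.* p))
        (λ κ → nonNegative⁻¹ 1ℚ) D≡
      ring : ∀ m p → m * (p * ι 4) ≡ ι 4 * (p * m)
      ring m p = trans (cong (m *_) (*-comm p (ι 4))) (ring-identity m p (ι 4))
      main : ∑ T mid * ι (p ℕ.* 4) ≡ ι 4 * classSum (T ℕ.* p) r
      main = trans (sym (∑-*ʳ T (ι (p ℕ.* 4)) mid)) (trans (∑-ext T (λ κ → trans (cong (mid κ *_) (ι-* p 4)) (trans (ring (mid κ) (ι p))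
          (cong (ι 4 *_) (trans (cong (λ y → ι p * avg p F y) (sym (ℕ.+-identityʳ (κ ℕ.* p)))) (ι*avg p F κ (ℕ.>-nonZero⁻¹ p)))))))
        (trans (∑-* T (ι 4) _) (cong (ι 4 *_) (sym (∑-blocks T p F)))))

    even-main : n ≡ T ℕ.* (p ℕ.* 8) → ∀ b → b ℕ.< n → ∀ r → r ℕ.< 4 → (flip : ℕ) →
      (∀ l a → b ℕ.+ a ≡ sq 0 l → a ℕ.% 8 ≡ r ℕ.+ 4 ℕ.* ((flip ℕ.+ l) ℕ.% 2)) →
      ι 4 * classSum (T ℕ.* (p ℕ.* 2)) r - blockError ≤ ∑ Λ (λ l → ω l * at (density 8 p A) b (sq 0 l))
    even-main n≡ b b<n r r<4 flip class = subst (_≤ ∑ Λ (λ l → ω l * at (density 8 p A) b (sq 0 l))) (cong (_- blockError) main) block-sum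
      where
      F : ℕ → ℕ → ℚ
      F ε = line 8 A (r ℕ.+ 4 ℕ.* ε)
      d : ℕ → ℕ → ℚ
      d ε κ = avg p (F ε) (κ ℕ.* p)
      0≤d : ∀ ε κ → 0ℚ ≤ d ε κ
      0≤d ε κ = 0≤avg p (F ε) (λ y → 0≤A _) (λ y → A≤1 _) (κ ℕ.* p)
      d≤1 : ∀ ε κ → d ε κ ≤ 1ℚ
      d≤1 ε κ = avg≤1 p (F ε) (λ y → 0≤A _) (λ y → A≤1 _) (κ ℕ.* p)
      -- The mean of the two densities modulo 8 is the density of the class modulo 4; half of their
      -- difference changes sign with the parity of `l`, and `flip` records the phase.
      mid alt : ℕ → ℚ
      mid κ = ½ * (d 0 κ + d 1 κ)
      alt κ = sgn flip * (½ * (d 0 κ - d 1 κ))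
      idx : ∀ κ p y r → κ ℕ.* (p ℕ.* 8) ℕ.+ (y ℕ.* 8 ℕ.+ r) ≡ (κ ℕ.* p ℕ.+ y) ℕ.* 8 ℕ.+ r
      idx = ℕ.solve-∀
      sgn-+ : ∀ m l → sgn (m ℕ.+ l) ≡ sgn m * sgn l
      sgn-+ zero    l = sym (*-identityˡ (sgn l))
      sgn-+ (suc m) l = trans (cong -_ (sgn-+ m l)) (neg-distribˡ-* (sgn m) (sgn l))
      select : ∀ m κ → d (m ℕ.% 2) κ ≡ ½ * (d 0 κ + d 1 κ) + sgn m * (½ * (d 0 κ - d 1 κ))
      select zero          κ = select-identity₃ (d 0 κ) (d 1 κ)
      select (suc zero)    κ = select-identity₂ (d 0 κ) (d 1 κ)
      select (suc (suc m)) κ = trans (cong (λ z → d z κ) (trans (cong (ℕ._% 2) (ℕ.+-comm 2 m)) (ℕ.[m+n]%n≡m%n m 2))) (trans (select m κ)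
        (cong (λ z → ½ * (d 0 κ + d 1 κ) + z * (½ * (d 0 κ - d 1 κ))) (select-identity (sgn m))))
      D≡ : ∀ κ j l → j ℕ.< p ℕ.* 8 → b ℕ.+ (κ ℕ.* (p ℕ.* 8) ℕ.+ j) ≡ sq 0 l → density 8 p A (κ ℕ.* (p ℕ.* 8) ℕ.+ j) ≡ mid κ + alt κ * sgn l
      D≡ κ j l j<P eq with divide 8 j
      ... | y , r′ , r′<8 , refl = trans (cong (density 8 p A) (idx κ p y r′))
          (trans (density-line 8 p A (κ ℕ.* p ℕ.+ y) r′<8)
          (trans (cong (λ r → avg p (line 8 A r) (κ ℕ.* p ℕ.+ y)) r′≡)
          (trans (avg-block p (F ε) κ y<p) (trans (sym (trans (cong (avg p (F ε)) (sym (ℕ.+-identityʳ (κ ℕ.* p)))) (avg-block p (F ε) κ (ℕ.>-nonZero⁻¹ p))))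
            (trans (select (flip ℕ.+ l) κ) (cong (λ z → mid κ + z) (trans (cong (_* (½ * (d 0 κ - d 1 κ))) (sgn-+ flip l)) (D≡-identity (sgn flip) (sgn l) _))))))))
        where
        ε : ℕ
        ε = (flip ℕ.+ l) ℕ.% 2
        r′≡ : r′ ≡ r ℕ.+ 4 ℕ.* ε
        r′≡ = trans (sym (trans (cong (ℕ._% 8) (idx κ p y r′)) ([κ*p+j]%p 8 (κ ℕ.* p ℕ.+ y) r′<8))) (class l _ eq)
        y<p : y ℕ.< p
        y<p = ℕ.*-cancelʳ-< 8 y p (ℕ.≤-<-trans (ℕ.m≤m+n (y ℕ.* 8) r′) j<P)
      0≤½ : 0ℚ ≤ ½
      0≤½ = nonNegative⁻¹ ½
      ∣alt∣≤1 : ∀ κ → ∣ alt κ ∣ ≤ 1ℚ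
      ∣alt∣≤1 κ = ≤-trans (∣p*q∣≤ (∣sgn∣≤1 flip) (∣p*q∣≤ {p = ½} (≤-reflexive (0≤p⇒∣p∣≡p 0≤½)) (∣p-q∣≤1 (0≤d 0 κ) (d≤1 0 κ) (0≤d 1 κ) (d≤1 1 κ))))
        (slack ½ 0≤½ refl)
      mid≤1 : ∀ κ → mid κ ≤ 1ℚ
      mid≤1 κ = slack (½ * ((1ℚ - d 0 κ) + (1ℚ - d 1 κ))) (0≤* 0≤½ (0≤+ (p≤q⇒0≤q-p (d≤1 0 κ)) (p≤q⇒0≤q-p (d≤1 1 κ)))) (mid≤1-identity (d 0 κ) (d 1 κ))
      open BlockSum n Λ 2n≤4Λ² T (p ℕ.* 8) n≡ (density 8 p A)
        (λ a n≤a → density-support 8 p A T (λ a le → A≡0 a (ℕ.≤-trans (ℕ.≤-reflexive n≡) le)) a (ℕ.≤-trans (ℕ.≤-reflexive (sym n≡)) n≤a))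
        b b<n 0 z≤n mid alt (λ κ → 0≤* 0≤½ (0≤+ (0≤d 0 κ) (0≤d 1 κ))) mid≤1 ∣alt∣≤1 D≡
      S : ℕ → ℕ → ℚ
      S ε κ = ∑ p (λ i → F ε (κ ℕ.* p ℕ.+ i))
      pd : ∀ ε κ → ι p * d ε κ ≡ S ε κ
      pd ε κ = trans (cong (λ y → ι p * avg p (F ε) y) (sym (ℕ.+-identityʳ (κ ℕ.* p)))) (ι*avg p (F ε) κ (ℕ.>-nonZero⁻¹ p))
      e₀ : ∀ κ p i r → (κ ℕ.* (p ℕ.* 2) ℕ.+ (i ℕ.* 2 ℕ.+ 0)) ℕ.* 4 ℕ.+ r ≡ (κ ℕ.* p ℕ.+ i) ℕ.* 8 ℕ.+ (r ℕ.+ 4 ℕ.* 0)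
      e₀ = ℕ.solve-∀
      e₁ : ∀ κ p i r → (κ ℕ.* (p ℕ.* 2) ℕ.+ (i ℕ.* 2 ℕ.+ 1)) ℕ.* 4 ℕ.+ r ≡ (κ ℕ.* p ℕ.+ i) ℕ.* 8 ℕ.+ (r ℕ.+ 4 ℕ.* 1)
      e₁ = ℕ.solve-∀
      pair : ∀ κ → ∑ (p ℕ.* 2) (λ j → A ((κ ℕ.* (p ℕ.* 2) ℕ.+ j) ℕ.* 4 ℕ.+ r)) ≡ S 0 κ + S 1 κ
      pair κ = trans (∑-blocks p 2 _) (trans (∑-ext p (λ i → cong₂ _+_ (trans (+-identityˡ _) (cong A (e₀ κ p i r))) (cong A (e₁ κ p i r)))) (∑-+ p _ _))
      main : ∑ T mid * ι (p ℕ.* 8) ≡ ι 4 * classSum (T ℕ.* (p ℕ.* 2)) r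
      main = trans (sym (∑-*ʳ T (ι (p ℕ.* 8)) mid)) (trans (∑-ext T (λ κ → trans (cong (mid κ *_) (trans (ι-* p 8) (cong (ι p *_) (ι≡/1 8))))
          (trans (even-main-identity (d 0 κ) (d 1 κ) (ι p)) (cong₂ _*_ (sym (ι≡/1 4)) (trans (cong₂ _+_ (pd 0 κ) (pd 1 κ)) (sym (pair κ)))))))
        (trans (∑-* T (ι 4) _) (cong (ι 4 *_) (sym (∑-blocks T (p ℕ.* 2) (λ y → A (y ℕ.* 4 ℕ.+ r)))))))

-- From short to long blocks

module Equidistributed where

  open Data.Rational.Base
  open Data.Rational.Properties
  open Rationals
  open Sums
  open Averages
  open Windows
  open Progressions using (≥-from-∣-∣; ≤-from-∣-∣)

  lhs-identity : ∀ a s l → a * (s * l) ≡ s * (a * l)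
  lhs-identity = solve-∀ ℚ-ring

  each-identity : ∀ s v d → v - (s - d) ≡ d - (s - v)
  each-identity = solve-∀ ℚ-ring

  each-identity₂ : ∀ β k v y d → k * (β * v) - (β * y - d) ≡ β * (k * v - (y - d)) + (1ℚ - β) * d
  each-identity₂ = solve-∀ ℚ-ring

  pointwise-identity : ∀ σ w β y → (σ + σ) * (β * (w * y)) - (- (σ * σ * w + w * (y * y)))
    ≡ w * ((σ * β + y) * (σ * β + y)) + w * (σ * σ * ((1ℚ - β) * (1ℚ + β)))
  pointwise-identity = solve-∀ ℚ-ring

  sq-step-identity : ∀ h g t δ l → (2 ℕ.* (g ℕ.* (t ℕ.+ δ) ℕ.+ l) ℕ.+ h) ℕ.* (2 ℕ.* (g ℕ.* (t ℕ.+ δ) ℕ.+ l) ℕ.+ h)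
    ≡ (2 ℕ.* l ℕ.+ (h ℕ.+ 2 ℕ.* (g ℕ.* t))) ℕ.* (2 ℕ.* l ℕ.+ (h ℕ.+ 2 ℕ.* (g ℕ.* t)))
      ℕ.+ (8 ℕ.* g ℕ.* δ ℕ.* l ℕ.+ 4 ℕ.* (g ℕ.* δ) ℕ.* (g ℕ.* t ℕ.+ g ℕ.* (t ℕ.+ δ) ℕ.+ h))
  sq-step-identity = ℕ.solve-∀

  sq-h′-identity : ∀ h s l → (2 ℕ.* (s ℕ.+ l) ℕ.+ h) ℕ.* (2 ℕ.* (s ℕ.+ l) ℕ.+ h) ≡ (2 ℕ.* l ℕ.+ (h ℕ.+ 2 ℕ.* s)) ℕ.* (2 ℕ.* l ℕ.+ (h ℕ.+ 2 ℕ.* s))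
  sq-h′-identity = ℕ.solve-∀

  step-identity : ∀ a u Q δ l e → a ℕ.+ (u ℕ.* Q ℕ.* δ ℕ.* l ℕ.+ e) ≡ a ℕ.+ e ℕ.+ l ℕ.* (u ℕ.* δ ℕ.* Q)
  step-identity = ℕ.solve-∀

  p₁≡′-identity : ∀ m δ u → m ℕ.* δ ℕ.* u ≡ m ℕ.* (u ℕ.* δ)
  p₁≡′-identity = ℕ.solve-∀

  equidistribution-square-identity : ∀ j N E n d X → (j + j) * (j * j * X) - (- (j * j * N + (j * j * N + j * j * (j * j * E))) - (j + j) * (n * (j * j * d)))
    ≡ (j * j + j * j) * (j * X - (- (N + ½ * (j * j * E) + j * (n * d))))
  equidistribution-square-identity = solve-∀ ℚ-ring

  equidistribution-identity : ∀ s y d → s * (y - d) ≡ s * y - s * d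
  equidistribution-identity = solve-∀ ℚ-ring

  Corr≤-identity : ∀ x e → 0ℚ * x + e ≡ e
  Corr≤-identity = solve-∀ ℚ-ring

  Corr≤-identity₂ : ∀ x e → 0ℚ * x + e ≡ e
  Corr≤-identity₂ = solve-∀ ℚ-ring

  Corr≤-identity₃ : ∀ x e → 1ℚ * x + e - x ≡ e
  Corr≤-identity₃ = solve-∀ ℚ-ring

  Corr-off-identity : ∀ w f f′ z → w * (f * f′ * z) ≡ f * (z * (w * f′))
  Corr-off-identity = solve-∀ ℚ-ring

  G≡0-identity : ∀ m → 4 ℕ.* (m ℕ.* m) ≡ (2 ℕ.* m) ℕ.* (2 ℕ.* m)
  G≡0-identity = ℕ.solve-∀

  Φ≡0-identity : ∀ T c p Q → T ℕ.* (c ℕ.* p ℕ.* Q) ≡ T ℕ.* c ℕ.* (p ℕ.* Q)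
  Φ≡0-identity = ℕ.solve-∀

  -- Van der Corput: after averaging over the shifts of l by g * t with t < k only the diagonal survives,
  -- because for distinct shifts the second point runs along a progression on which φ has mean zero.
  module Equidistribution (Q : ℕ) .{{_ : ℕ.NonZero Q}} (A : ℕ → ℚ) (0≤A : ∀ a → 0ℚ ≤ A a) (A≤1 : ∀ a → A a ≤ 1ℚ)
    (n Λ : ℕ) (2n≤4Λ² : 2 ℕ.* n ℕ.≤ 4 ℕ.* (Λ ℕ.* Λ)) (A≡0 : ∀ a → n ℕ.≤ a → A a ≡ 0ℚ)
    (p₁ p₂ c K u g k : ℕ) .{{_ : ℕ.NonZero p₁}} .{{_ : ℕ.NonZero p₂}}
    (p₂≡ : p₂ ≡ c ℕ.* p₁) (p₁≡ : p₁ ≡ K ℕ.* u) (uQ≡ : u ℕ.* Q ≡ 8 ℕ.* g) (gk≤Λ : g ℕ.* k ℕ.≤ Λ)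
    (divides : ∀ δ → 1 ℕ.≤ δ → δ ℕ.< k → ∃[ m ] K ≡ m ℕ.* δ)
    (T : ℕ) (n≡ : n ≡ T ℕ.* (p₂ ℕ.* Q)) (h : ℕ) where

    open Range n Λ 2n≤4Λ²

    Φ : ℕ → ℚ
    Φ a = density Q p₁ A a - density Q p₂ A a

    -- `ι n * 4Λ²` is the trivial bound for a correlation, used on the diagonal. `M` bounds the
    -- partial sums of `Φ` along the progressions off the diagonal, and `E` is the resulting bound
    -- for such a correlation.
    4Λ² M E : ℚ
    4Λ² = ι (4 ℕ.* (Λ ℕ.* Λ))
    M = ι (c ℕ.* K) + ι (c ℕ.* K)
    E = ι n * (W * (M + M) + W * (M + M))

    private

      Φ≤1 : ∀ a → ∣ Φ a ∣ ≤ 1ℚ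
      Φ≤1 a = ∣p-q∣≤1 (0≤density Q p₁ A 0≤A A≤1 a) (density≤1 Q p₁ A 0≤A A≤1 a)
                      (0≤density Q p₂ A 0≤A A≤1 a) (density≤1 Q p₂ A 0≤A A≤1 a)

      Φ≡0 : ∀ a → n ℕ.≤ a → Φ a ≡ 0ℚ
      Φ≡0 a n≤a = cong₂ _-_
        (density-support Q p₁ A (T ℕ.* c) (λ a le → A≡0 a (ℕ.≤-trans (ℕ.≤-reflexive n≡₁) le)) a (ℕ.≤-trans (ℕ.≤-reflexive (sym n≡₁)) n≤a))
        (density-support Q p₂ A T (λ a le → A≡0 a (ℕ.≤-trans (ℕ.≤-reflexive n≡) le)) a (ℕ.≤-trans (ℕ.≤-reflexive (sym n≡)) n≤a))
        where
        n≡₁ : n ≡ T ℕ.* c ℕ.* (p₁ ℕ.* Q)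
        n≡₁ = trans n≡ (trans (cong (λ p → T ℕ.* (p ℕ.* Q)) p₂≡) (Φ≡0-identity T c p₁ Q))

      G : ℕ → ℕ → ℚ
      G b l = at Φ b (sq h l)

      G≤1 : ∀ b l → ∣ G b l ∣ ≤ 1ℚ
      G≤1 b l = ∣at∣≤1 Φ Φ≤1 b (sq h l)

      G≡0 : ∀ b → b ℕ.< n → ∀ l → Λ ℕ.≤ l → G b l ≡ 0ℚ
      G≡0 b b<n l Λ≤l = at-support Φ n Φ≡0 b (sq h l) (ℕ.≤-trans (a+n≤2n (ℕ.<⇒≤ b<n)) (ℕ.≤-trans 2n≤4Λ²
        (ℕ.≤-trans (ℕ.≤-reflexive (G≡0-identity Λ)) (ℕ.*-mono-≤ le le))))
        where
        le : 2 ℕ.* Λ ℕ.≤ 2 ℕ.* l ℕ.+ h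
        le = ℕ.≤-trans (ℕ.*-monoʳ-≤ 2 Λ≤l) (ℕ.m≤m+n (2 ℕ.* l) h)

      τ : ℕ → ℕ
      τ t = g ℕ.* t

      Corr : ℕ → ℕ → ℚ
      Corr t t′ = ∑ n (λ b → ∑ Λ (λ l → ω l * (G b (τ t ℕ.+ l) * G b (τ t′ ℕ.+ l))))

      0≤M : 0ℚ ≤ M
      0≤M = 0≤+ (0≤ι (c ℕ.* K)) (0≤ι (c ℕ.* K))

      Corr-diag : ∀ t → Corr t t ≤ ι n * 4Λ²
      Corr-diag t = ∑-≤const n 4Λ² (λ b _ → ≤-trans (∑-mono Λ (λ l _ → ≤-trans (*-monoˡ-≤-nonNeg (ω l) {{nonNegative (0≤ω l)}}
          (≤-trans (p≤∣p∣ (G b (τ t ℕ.+ l) * G b (τ t ℕ.+ l))) (∣p*q∣≤ (G≤1 b (τ t ℕ.+ l)) (G≤1 b (τ t ℕ.+ l))))) (≤-reflexive (*-identityʳ (ω l)))))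
        (≤-reflexive (∑ω Λ)))

      Corr-sym : ∀ t t′ → Corr t t′ ≡ Corr t′ t
      Corr-sym t t′ = ∑-ext n (λ b → ∑-ext Λ (λ l → cong (ω l *_) (*-comm (G b (τ t ℕ.+ l)) (G b (τ t′ ℕ.+ l)))))

      -- The difference of the two shifted squares is 8gδl + e, linear in `l`. With the first point
      -- a fixed, the second runs along a progression of step 8gδ = dQ for d = uδ, and `d` divides
      -- p₁ = Ku because δ divides `K`; thus `φ-run` applies.
      Corr-off : ∀ t δ → 1 ℕ.≤ δ → δ ℕ.< k → Corr t (t ℕ.+ δ) ≤ E
      Corr-off t δ 1≤δ δ<k with divides δ 1≤δ δ<k
      ... | m , K≡ = ≤-trans (≤-reflexive toA) (∑-≤const n _ (λ a _ → ≤-trans (p≤∣p∣ _) (≤-trans (∣p*q∣≤ (Φ≤1 a) (inner a)) (≤-reflexive (*-identityˡ _)))))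
        where
        d e : ℕ
        d = u ℕ.* δ
        e = 4 ℕ.* (g ℕ.* δ) ℕ.* (τ t ℕ.+ τ (t ℕ.+ δ) ℕ.+ h)
        p₁≡′ : p₁ ≡ m ℕ.* d
        p₁≡′ = trans p₁≡ (trans (cong (ℕ._* u) K≡) (p₁≡′-identity m δ u))
        d-nonZero : ℕ.NonZero d
        d-nonZero = ℕ.m*n≢0⇒n≢0 m {{subst ℕ.NonZero p₁≡′ (ℕ.≢-nonZero (ℕ.≢-nonZero⁻¹ p₁))}}
        cm≤cK : c ℕ.* m ℕ.≤ c ℕ.* K
        cm≤cK = ℕ.*-monoʳ-≤ c (ℕ.≤-trans (ℕ.m≤m*n m δ {{ℕ.>-nonZero 1≤δ}}) (ℕ.≤-reflexive (sym K≡)))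
        step : ∀ a l → a ℕ.+ (8 ℕ.* g ℕ.* δ ℕ.* l ℕ.+ e) ≡ a ℕ.+ e ℕ.+ l ℕ.* (d ℕ.* Q)
        step a l = trans (cong (λ z → a ℕ.+ (z ℕ.* δ ℕ.* l ℕ.+ e)) (sym uQ≡)) (step-identity a u Q δ l e)
        h′ : ℕ
        h′ = h ℕ.+ 2 ℕ.* τ t
        sq-h′ : ∀ l → sq h (τ t ℕ.+ l) ≡ sq h′ l
        sq-h′ l = sq-h′-identity h (τ t) l
        sq-step : ∀ l → sq h (τ (t ℕ.+ δ) ℕ.+ l) ≡ sq h′ l ℕ.+ (8 ℕ.* g ℕ.* δ ℕ.* l ℕ.+ e)
        sq-step l = sq-step-identity h g t δ l
        inner : ∀ a → ∣ ∑ Λ (λ l → window a (sq h′ l) * (ω l * Φ (a ℕ.+ e ℕ.+ l ℕ.* (d ℕ.* Q)))) ∣ ≤ W * (M + M) + W * (M + M)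
        inner a = window-run h′ a (λ l → Φ (a ℕ.+ e ℕ.+ l ℕ.* (d ℕ.* Q))) M (λ i → ≤-trans
          (φ-run Q A 0≤A A≤1 p₁ p₂ c m d {{it₁}} {{it₂}} {{d-nonZero}} p₂≡ p₁≡′ (a ℕ.+ e) i) (+-mono-≤ (ι-mono cm≤cK) (ι-mono cm≤cK)))
          where
          it₁ : ℕ.NonZero p₁
          it₁ = ℕ.≢-nonZero (ℕ.≢-nonZero⁻¹ p₁)
          it₂ : ℕ.NonZero p₂
          it₂ = ℕ.≢-nonZero (ℕ.≢-nonZero⁻¹ p₂)
        F : ℕ → ℕ → ℚ
        F l a = Φ a * Φ (a ℕ.+ (8 ℕ.* g ℕ.* δ ℕ.* l ℕ.+ e))
        flip : ∀ l → ∑ n (λ b → G b (τ t ℕ.+ l) * G b (τ (t ℕ.+ δ) ℕ.+ l)) ≡ ∑ n (λ a → F l a * window a (sq h′ l))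
        flip l = trans (∑-cong n (λ b b<n → trans (cong₂ (λ x y → at Φ b x * at Φ b y) (sq-h′ l) (sq-step l))
            (trans (at-* Φ Φ (8 ℕ.* g ℕ.* δ ℕ.* l ℕ.+ e) b (sq h′ l)) (sym (trans (cong (_* at (F l) b (sq h′ l)) (lt-yes b<n)) (*-identityˡ _))))))
          (reverse n (F l) (λ b → lt b n) (λ a n≤a → trans (cong (_* Φ (a ℕ.+ (8 ℕ.* g ℕ.* δ ℕ.* l ℕ.+ e))) (Φ≡0 a n≤a)) (*-zeroˡ (Φ (a ℕ.+ (8 ℕ.* g ℕ.* δ ℕ.* l ℕ.+ e)))))
            (λ a n≤a → lt-no n≤a) (sq h′ l))
        toA : Corr t (t ℕ.+ δ) ≡ ∑ n (λ a → Φ a * ∑ Λ (λ l → window a (sq h′ l) * (ω l * Φ (a ℕ.+ e ℕ.+ l ℕ.* (d ℕ.* Q)))))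
        toA = trans (∑-swap n Λ _) (trans (∑-ext Λ (λ l → trans (∑-* n (ω l) _) (trans (cong (ω l *_) (flip l)) (sym (∑-* n (ω l) _)))))
          (trans (∑-swap Λ n _) (∑-ext n (λ a → trans (∑-ext Λ (λ l → trans (Corr-off-identity (ω l) (Φ a) (Φ (a ℕ.+ (8 ℕ.* g ℕ.* δ ℕ.* l ℕ.+ e))) (window a (sq h′ l)))
            (cong (λ z → Φ a * (window a (sq h′ l) * (ω l * Φ z))) (step a l)))) (∑-* Λ (Φ a) _)))))

      Corr≤ : ∀ t t′ → t ℕ.< k → t′ ℕ.< k → Corr t t′ ≤ δ t t′ * (ι n * 4Λ²) + E
      Corr≤ t t′ t<k t′<k with ℕ.<-cmp t t′
      ... | tri≈ _ refl _ = ≤-trans (Corr-diag t) (slack E 0≤E (trans (cong (λ z → z * (ι n * 4Λ²) + E - ι n * 4Λ²) (δ-refl t)) (Corr≤-identity₃ (ι n * 4Λ²) E)))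
        where
        0≤E : 0ℚ ≤ E
        0≤E = 0≤* (0≤ι n) (0≤+ (0≤* 0≤W (0≤+ 0≤M 0≤M)) (0≤* 0≤W (0≤+ 0≤M 0≤M)))
      ... | tri< t<t′ t≢t′ _ = subst (Corr t t′ ≤_) (sym (trans (cong (λ z → z * (ι n * 4Λ²) + E) (δ-≢ t≢t′)) (Corr≤-identity₂ (ι n * 4Λ²) E))) (off (ℕ.m≤n⇒∃[o]m+o≡n (ℕ.<⇒≤ t<t′)))
        where
        off : (∃[ o ] t ℕ.+ o ≡ t′) → Corr t t′ ≤ E
        off (o , refl) = Corr-off t o (ℕ.n≢0⇒n>0 (λ { refl → t≢t′ (sym (ℕ.+-identityʳ t)) })) (ℕ.≤-<-trans (ℕ.m≤n+m o t) t′<k)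
      ... | tri> _ t≢t′ t′<t = subst (Corr t t′ ≤_) (sym (trans (cong (λ z → z * (ι n * 4Λ²) + E) (δ-≢ t≢t′)) (Corr≤-identity (ι n * 4Λ²) E))) (subst (_≤ E) (Corr-sym t′ t) (off (ℕ.m≤n⇒∃[o]m+o≡n (ℕ.<⇒≤ t′<t))))
        where
        off : (∃[ o ] t′ ℕ.+ o ≡ t) → Corr t′ t ≤ E
        off (o , refl) = Corr-off t′ o (ℕ.n≢0⇒n>0 (λ { refl → t≢t′ (ℕ.+-identityʳ t′) })) (ℕ.≤-<-trans (ℕ.m≤n+m o t′) t<k)

      Y : ℕ → ℕ → ℚ
      Y b l = ∑ k (λ t → G b (τ t ℕ.+ l))

      -- Squaring the sum of `k` shifts produces `k` diagonal correlations and at most k² others.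
      -- Since `E` is small, the size is about `k` times the trivial bound instead of k² times.
      second-moment : ∑ n (λ b → ∑ Λ (λ l → ω l * (Y b l * Y b l))) ≤ ι k * (ι n * 4Λ²) + ι k * (ι k * E)
      second-moment = ≤-trans (≤-reflexive expand) (≤-trans (∑-mono k (λ t t<k → ∑-mono k (λ t′ t′<k → Corr≤ t t′ t<k t′<k)))
          (≤-reflexive (trans (∑-cong k row) (trans (∑-const k _) (*-distribˡ-+ (ι k) (ι n * 4Λ²) (ι k * E))))))
        where
        row : ∀ t → t ℕ.< k → ∑ k (λ t′ → δ t t′ * (ι n * 4Λ²) + E) ≡ ι n * 4Λ² + ι k * E
        row t t<k = trans (∑-+ k _ _) (cong₂ _+_ (trans (∑-single k t<k (λ t′ t′≢t → trans (cong (_* (ι n * 4Λ²)) (δ-≢ (λ eq → t′≢t (sym eq)))) (*-zeroˡ (ι n * 4Λ²))))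
          (trans (cong (_* (ι n * 4Λ²)) (δ-refl t)) (*-identityˡ (ι n * 4Λ²)))) (∑-const k E))
        expand : ∑ n (λ b → ∑ Λ (λ l → ω l * (Y b l * Y b l))) ≡ ∑ k (λ t → ∑ k (λ t′ → Corr t t′))
        expand = trans (∑-ext n (λ b → trans (∑-ext Λ (λ l → prod b l)) (trans (∑-swap Λ k _) (∑-ext k (λ t → ∑-swap Λ k _)))))
          (trans (∑-swap n k _) (∑-ext k (λ t → ∑-swap n k _)))
          where
          prod : ∀ b l → ω l * (Y b l * Y b l) ≡ ∑ k (λ t → ∑ k (λ t′ → ω l * (G b (τ t ℕ.+ l) * G b (τ t′ ℕ.+ l))))
          prod b l = trans (cong (ω l *_) (sym (∑-*ʳ k (Y b l) _))) (trans (sym (∑-* k (ω l) _))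
            (∑-ext k (λ t → trans (cong (ω l *_) (sym (∑-* k (G b (τ t ℕ.+ l)) _))) (sym (∑-* k (ω l) _)))))

    module _ (β : ℕ → ℚ) (0≤β : ∀ b → 0ℚ ≤ β b) (β≤1 : ∀ b → β b ≤ 1ℚ) (σ : ℚ) (0≤σ : 0ℚ ≤ σ) where

      drift : ℚ
      drift = ι k * (ι (g ℕ.* k) * W + ι (g ℕ.* k) * W)

      private
        V : ℕ → ℚ
        V b = ∑ Λ (λ l → ω l * G b l)

        V≥ : ∀ b → b ℕ.< n → ∑ Λ (λ l → ω l * Y b l) - drift ≤ ι k * V b
        V≥ b b<n = subst₂ _≤_ lhs (∑-const k (V b)) (∑-mono k each)
          where
          each : ∀ t → t ℕ.< k → ∑ Λ (λ l → ω l * G b (τ t ℕ.+ l)) - (ι (g ℕ.* k) * W + ι (g ℕ.* k) * W) ≤ V b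
          each t t<k = slack (ι (g ℕ.* k) * W + ι (g ℕ.* k) * W - (∑ Λ (λ l → ω l * G b (τ t ℕ.+ l)) - V b))
            (p≤q⇒0≤q-p (≤-trans (p≤∣p∣ _) (≤-trans (shift (G b) (G≤1 b) (G≡0 b b<n) (τ t) (ℕ.≤-trans τ≤ gk≤Λ))
              (+-mono-≤ τW≤ τW≤)))) (each-identity (∑ Λ (λ l → ω l * G b (τ t ℕ.+ l))) (V b) (ι (g ℕ.* k) * W + ι (g ℕ.* k) * W))
            where
            τ≤ : τ t ℕ.≤ g ℕ.* k
            τ≤ = ℕ.*-monoʳ-≤ g (ℕ.<⇒≤ t<k)
            τW≤ : ι (τ t) * W ≤ ι (g ℕ.* k) * W
            τW≤ = *-monoʳ-≤-nonNeg W {{nonNegative 0≤W}} (ι-mono τ≤)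
          lhs : ∑ k (λ t → ∑ Λ (λ l → ω l * G b (τ t ℕ.+ l)) - (ι (g ℕ.* k) * W + ι (g ℕ.* k) * W)) ≡ ∑ Λ (λ l → ω l * Y b l) - drift
          lhs = trans (∑-- k _ _) (cong₂ _-_ (trans (∑-swap k Λ _) (∑-ext Λ (λ l → ∑-* k (ω l) _))) (∑-const k _))

        -- Completing the square takes the place of the Cauchy-Schwarz inequality and avoids roots:
        -- (σβ + Y)² ≥ 0 together with β² ≤ 1.
        pointwise : ∀ b l → - (σ * σ * ω l + ω l * (Y b l * Y b l)) ≤ (σ + σ) * (β b * (ω l * Y b l))
        pointwise b l = slack (ω l * ((σ * β b + Y b l) * (σ * β b + Y b l)) + ω l * (σ * σ * ((1ℚ - β b) * (1ℚ + β b))))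
          (0≤+ (0≤* (0≤ω l) (0≤p*p (σ * β b + Y b l))) (0≤* (0≤ω l) (0≤* (0≤* 0≤σ 0≤σ) (0≤* (p≤q⇒0≤q-p (β≤1 b)) (0≤+ (nonNegative⁻¹ 1ℚ) (0≤β b))))))
          (pointwise-identity σ (ω l) (β b) (Y b l))

        smoothed : - (σ * σ * (ι n * 4Λ²) + (ι k * (ι n * 4Λ²) + ι k * (ι k * E))) ≤ (σ + σ) * ∑ n (λ b → β b * ∑ Λ (λ l → ω l * Y b l))
        smoothed = ≤-trans (neg-antimono-≤ (+-monoʳ-≤ (σ * σ * (ι n * 4Λ²)) second-moment))
          (subst₂ _≤_ lhs rhs (∑-mono n (λ b _ → ∑-mono Λ (λ l _ → pointwise b l))))
          where
          lhs : ∑ n (λ b → ∑ Λ (λ l → - (σ * σ * ω l + ω l * (Y b l * Y b l)))) ≡ - (σ * σ * (ι n * 4Λ²) + ∑ n (λ b → ∑ Λ (λ l → ω l * (Y b l * Y b l))))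
          lhs = trans (∑-ext n (λ b → trans (∑-neg Λ _) (cong -_ (trans (∑-+ Λ _ _) (cong (_+ ∑ Λ (λ l → ω l * (Y b l * Y b l))) (trans (∑-* Λ (σ * σ) ω) (cong (σ * σ *_) (∑ω Λ))))))))
            (trans (∑-neg n _) (cong -_ (trans (∑-+ n _ _) (cong (_+ ∑ n (λ b → ∑ Λ (λ l → ω l * (Y b l * Y b l)))) (trans (∑-const n _) (lhs-identity (ι n) (σ * σ) 4Λ²))))))
          rhs : ∑ n (λ b → ∑ Λ (λ l → (σ + σ) * (β b * (ω l * Y b l)))) ≡ (σ + σ) * ∑ n (λ b → β b * ∑ Λ (λ l → ω l * Y b l))
          rhs = trans (∑-ext n (λ b → trans (∑-* Λ (σ + σ) _) (cong ((σ + σ) *_) (∑-* Λ (β b) _)))) (∑-* n (σ + σ) _)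

      equidistribution :
        - (σ * σ * (ι n * 4Λ²) + (ι k * (ι n * 4Λ²) + ι k * (ι k * E))) - (σ + σ) * (ι n * drift)
          ≤ (σ + σ) * (ι k * ∑ n (λ b → β b * ∑ Λ (λ l → ω l * at Φ b (sq h l))))
      equidistribution = ≤-trans (+-monoˡ-≤ (- ((σ + σ) * (ι n * drift))) smoothed)
        (≤-trans (≤-reflexive (sym (equidistribution-identity (σ + σ) (∑ n (λ b → β b * ∑ Λ (λ l → ω l * Y b l))) (ι n * drift))))
          (*-monoˡ-≤-nonNeg (σ + σ) {{nonNegative (0≤+ 0≤σ 0≤σ)}} (subst₂ _≤_ lhs rhs (∑-mono n each))))
        where
        0≤drift : 0ℚ ≤ drift
        0≤drift = 0≤* (0≤ι k) (0≤+ (0≤* (0≤ι (g ℕ.* k)) 0≤W) (0≤* (0≤ι (g ℕ.* k)) 0≤W))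
        each : ∀ b → b ℕ.< n → β b * ∑ Λ (λ l → ω l * Y b l) - drift ≤ ι k * (β b * V b)
        each b b<n = slack (β b * (ι k * V b - (∑ Λ (λ l → ω l * Y b l) - drift)) + (1ℚ - β b) * drift)
          (0≤+ (0≤* (0≤β b) (p≤q⇒0≤q-p (V≥ b b<n))) (0≤* (p≤q⇒0≤q-p (β≤1 b)) 0≤drift))
          (each-identity₂ (β b) (ι k) (V b) (∑ Λ (λ l → ω l * Y b l)) drift)
        lhs : ∑ n (λ b → β b * ∑ Λ (λ l → ω l * Y b l) - drift) ≡ ∑ n (λ b → β b * ∑ Λ (λ l → ω l * Y b l)) - ι n * drift
        lhs = trans (∑-- n _ _) (cong (λ z → ∑ n (λ b → β b * ∑ Λ (λ l → ω l * Y b l)) - z) (∑-const n drift))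
        rhs : ∑ n (λ b → ι k * (β b * V b)) ≡ ι k * ∑ n (λ b → β b * V b)
        rhs = ∑-* n (ι k) _

      -- The choice σ = √k balances the two diagonal terms σ² and k; taking `k` to be the square of
      -- `j` keeps σ rational. After division by 2j² the diagonal error is n * 4Λ² against `j` times
      -- the sum, a saving of `j`.
      equidistribution-square : ∀ j .{{_ : ℕ.NonZero j}} → k ≡ j ℕ.* j → σ ≡ ι j →
        - (ι n * 4Λ² + ½ * (ι k * E) + ι j * (ι n * (ι (g ℕ.* k) * W + ι (g ℕ.* k) * W)))
          ≤ ι j * ∑ n (λ b → β b * ∑ Λ (λ l → ω l * at Φ b (sq h l)))
      equidistribution-square j k≡ σ≡ = 0≤q-p⇒p≤q (cancel-pos {p = ι j * ι j + ι j * ι j}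
        (+-mono-< 0<j² 0<j²)
        (subst (0ℚ ≤_) eq (p≤q⇒0≤q-p equidistribution)))
        where
        0<j² : 0ℚ < ι j * ι j
        0<j² = subst (0ℚ <_) (ι-* j j) (0<ι (j ℕ.* j) {{ℕ.m*n≢0 j j}})
        ιk : ι k ≡ ι j * ι j
        ιk = trans (cong ι k≡) (ι-* j j)
        X : ℚ
        X = ∑ n (λ b → β b * ∑ Λ (λ l → ω l * at Φ b (sq h l)))
        eq : (σ + σ) * (ι k * X) - (- (σ * σ * (ι n * 4Λ²) + (ι k * (ι n * 4Λ²) + ι k * (ι k * E))) - (σ + σ) * (ι n * drift))
          ≡ (ι j * ι j + ι j * ι j) * (ι j * X - (- (ι n * 4Λ² + ½ * (ι k * E) + ι j * (ι n * (ι (g ℕ.* k) * W + ι (g ℕ.* k) * W)))))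
        eq = trans (cong₂ (λ s κ → (s + s) * (κ * X) - (- (s * s * (ι n * 4Λ²) + (κ * (ι n * 4Λ²) + κ * (κ * E))) - (s + s) * (ι n * (κ * (ι (g ℕ.* k) * W + ι (g ℕ.* k) * W))))) σ≡ ιk)
          (trans (equidistribution-square-identity (ι j) (ι n * 4Λ²) E (ι n) (ι (g ℕ.* k) * W + ι (g ℕ.* k) * W) X)
            (cong (λ κ → (ι j * ι j + ι j * ι j) * (ι j * X - (- (ι n * 4Λ² + ½ * (κ * E) + ι j * (ι n * (ι (g ℕ.* k) * W + ι (g ℕ.* k) * W)))))) (sym ιk)))

-- Rearranging sums over b by the points of the windows

module Transference where

  open Data.Rational.Base
  open Data.Rational.Properties
  open Rationals
  open Sums
  open Averages
  open Windows
  open Progressions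

  cls : ℕ → ℕ → ℚ
  cls r a = δ (a ℕ.% 4) r

  opaque
    unfolding δ
    0≤δ : ∀ x y → 0ℚ ≤ δ x y
    0≤δ x y with x ℕ.≟ y
    ... | yes _ = nonNegative⁻¹ 1ℚ
    ... | no  _ = ≤-refl

    δ≤1 : ∀ x y → δ x y ≤ 1ℚ
    δ≤1 x y with x ℕ.≟ y
    ... | yes _ = ≤-refl
    ... | no  _ = nonNegative⁻¹ 1ℚ

  ∑-cls : ∀ m r → r ℕ.< 4 → ∀ (g : ℕ → ℚ) → ∑ (m ℕ.* 4) (λ a → cls r a * g a) ≡ ∑ m (λ y → g (y ℕ.* 4 ℕ.+ r))
  ∑-cls m r r<4 g = trans (∑-blocks m 4 (λ a → cls r a * g a)) (∑-ext m pick)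
    where
    pick : ∀ y → ∑ 4 (λ j → cls r (y ℕ.* 4 ℕ.+ j) * g (y ℕ.* 4 ℕ.+ j)) ≡ g (y ℕ.* 4 ℕ.+ r)
    pick y = trans
      (∑-cong 4 {λ j → cls r (y ℕ.* 4 ℕ.+ j) * g (y ℕ.* 4 ℕ.+ j)} {λ j → δ j r * g (y ℕ.* 4 ℕ.+ j)}
        (λ j j<4 → cong (λ z → δ z r * g (y ℕ.* 4 ℕ.+ j)) ([κ*p+j]%p 4 y j<4)))
      (trans (∑-single 4 {λ j → δ j r * g (y ℕ.* 4 ℕ.+ j)} r<4 (λ j j≢r → trans (cong (_* g (y ℕ.* 4 ℕ.+ j)) (δ-≢ j≢r)) (*-zeroˡ (g (y ℕ.* 4 ℕ.+ j)))))
        (trans (cong (_* g (y ℕ.* 4 ℕ.+ r)) (δ-refl r)) (*-identityˡ (g (y ℕ.* 4 ℕ.+ r)))))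

  ZeroOn⇒∑≡0 : ∀ T p {v} → ZeroOn p v → ∑ (T ℕ.* p) v ≡ 0ℚ
  ZeroOn⇒∑≡0 T p {v} z = trans (∑-blocks T p v) (∑-vanish T (λ κ _ → z κ))

  row-identity : ∀ c w x → c * (w * x) ≡ w * (c * x)
  row-identity = solve-∀ ℚ-ring

  correlation-identity : ∀ z w f f′ → z * (w * (f * f′)) ≡ f * (z * (w * f′))
  correlation-identity = solve-∀ ℚ-ring

  quadratic-identity : ∀ z w f → z * (w * f) ≡ f * (z * w)
  quadratic-identity = solve-∀ ℚ-ring

  linear-identity : ∀ f s n → f * s ≡ f * (s - n) + n * f
  linear-identity = solve-∀ ℚ-ring

  linear-identity₂ : ∀ z w f → z * (w * f) ≡ f * (z * w)
  linear-identity₂ = solve-∀ ℚ-ring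

  transfer-identity : ∀ w f c z → w * (f * (c * z)) ≡ c * (z * (w * f))
  transfer-identity = solve-∀ ℚ-ring

  -- Sums over b in the class s and over the windows are rearranged by the point a = (2l+h)² - b.
  module Transfer (n Λ : ℕ) (2n≤4Λ² : 2 ℕ.* n ℕ.≤ 4 ℕ.* (Λ ℕ.* Λ)) (m : ℕ) (n≡ : n ≡ m ℕ.* 4) (s : ℕ) (s<4 : s ℕ.< 4)
    (h r : ℕ) (r<4 : r ℕ.< 4) (class : ∀ a b l → a ℕ.+ b ≡ sq h l → cls s b ≡ cls r a) where

    open Range n Λ 2n≤4Λ²

    ⟪_⟫ : (ℕ → ℕ → ℚ) → ℚ
    ⟪ F ⟫ = ∑ n (λ b → cls s b * ∑ Λ (λ l → ω l * F b l))

    transfer : ∀ (F : ℕ → ℕ → ℚ) → (∀ l a → n ℕ.≤ a → F l a ≡ 0ℚ) →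
      ⟪ (λ b l → at (F l) b (sq h l)) ⟫ ≡ ∑ m (λ y → ∑ Λ (λ l → window (y ℕ.* 4 ℕ.+ r) (sq h l) * (ω l * F l (y ℕ.* 4 ℕ.+ r))))
    transfer F F≡0 = trans (∑-cong n row) (trans (∑-swap n Λ _) (trans (∑-ext Λ (λ l → trans (∑-* n (ω l) _) (trans (cong (ω l *_) (flip l)) (sym (∑-* n (ω l) _)))))
      (trans (∑-swap Λ n _) (trans (∑-ext n (λ a → trans (∑-ext Λ (λ l → transfer-identity (ω l) (F l a) (cls r a) (window a (sq h l)))) (∑-* Λ (cls r a) _)))
        (trans (cong (λ k → ∑ k (λ a → cls r a * H a)) n≡) (∑-cls m r r<4 H))))))
      where
      χ H : ℕ → ℚ
      χ b = cls s b * lt b n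
      H a = ∑ Λ (λ l → window a (sq h l) * (ω l * F l a))
      row : ∀ b → b ℕ.< n → cls s b * ∑ Λ (λ l → ω l * at (F l) b (sq h l)) ≡ ∑ Λ (λ l → ω l * (χ b * at (F l) b (sq h l)))
      row b b<n = trans (sym (∑-* Λ (cls s b) _)) (∑-ext Λ (λ l → trans (row-identity (cls s b) (ω l) (at (F l) b (sq h l)))
        (cong (λ z → ω l * (z * at (F l) b (sq h l))) (sym (trans (cong (cls s b *_) (lt-yes b<n)) (*-identityʳ (cls s b)))))))
      swap-class : ∀ a l → at χ a (sq h l) ≡ cls r a * window a (sq h l)
      swap-class a l with compare a (sq h l)
      ... | inj₂ lt′ = trans (at-< χ lt′) (sym (trans (cong (cls r a *_) (at-< (λ a → lt a n) lt′)) (*-zeroʳ (cls r a))))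
      ... | inj₁ (b , eq) = trans (cong (at χ a) (sym eq)) (trans (at-+ χ a b) (trans (cong (_* lt b n) (class a b l eq))
            (cong (cls r a *_) (sym (trans (cong (window a) (sym eq)) (at-+ (λ a → lt a n) a b))))))
      flip : ∀ l → ∑ n (λ b → χ b * at (F l) b (sq h l)) ≡ ∑ n (λ a → F l a * (cls r a * window a (sq h l)))
      flip l = trans (reverse n (F l) χ (F≡0 l) (λ b n≤b → trans (cong (cls s b *_) (lt-no n≤b)) (*-zeroʳ (cls s b))) (sq h l))
        (∑-ext n (λ a → cong (F l a *_) (swap-class a l)))

    private
      <n : ∀ y → y ℕ.< m → y ℕ.* 4 ℕ.+ r ℕ.< n
      <n y y<m = ℕ.<-≤-trans (ℕ.+-monoʳ-< (y ℕ.* 4) r<4) (ℕ.≤-trans (ℕ.≤-reflexive (ℕ.+-comm (y ℕ.* 4) 4))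
        (ℕ.≤-trans (ℕ.*-monoˡ-≤ 4 y<m) (ℕ.≤-reflexive (sym n≡))))

    -- By `marginal` every point carries the same total weight `n` up to 2W. The constant part is
    -- killed by the vanishing sum of `f` over its class, and only the deviations are left.
    linear : h ℕ.≤ 2 → ∀ f → (∀ a → ∣ f a ∣ ≤ 1ℚ) → (∀ a → n ℕ.≤ a → f a ≡ 0ℚ) → ∑ m (λ y → f (y ℕ.* 4 ℕ.+ r)) ≡ 0ℚ →
      ∣ ⟪ (λ b l → at f b (sq h l)) ⟫ ∣ ≤ ι m * (W + W)
    linear h≤2 f f≤1 f≡0 ∑f≡0 = subst (λ z → ∣ z ∣ ≤ ι m * (W + W)) (sym eq) (∣∑∣≤ m (W + W) (λ y y<m →
        ≤-trans (∣p*q∣≤ (f≤1 _) (marginal h h≤2 (y ℕ.* 4 ℕ.+ r) (<n y y<m))) (≤-reflexive (*-identityˡ (W + W)))))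
      where
      S : ℕ → ℚ
      S a = ∑ Λ (λ l → window a (sq h l) * ω l)
      eq : ⟪ (λ b l → at f b (sq h l)) ⟫ ≡ ∑ m (λ y → f (y ℕ.* 4 ℕ.+ r) * (S (y ℕ.* 4 ℕ.+ r) - ι n))
      eq = trans (transfer (λ _ → f) (λ _ → f≡0)) (trans (∑-ext m (λ y → trans (∑-ext Λ (λ l → linear-identity₂ (window (y ℕ.* 4 ℕ.+ r) (sq h l)) (ω l) (f (y ℕ.* 4 ℕ.+ r))))
          (trans (∑-* Λ (f (y ℕ.* 4 ℕ.+ r)) _) (linear-identity (f (y ℕ.* 4 ℕ.+ r)) (S (y ℕ.* 4 ℕ.+ r)) (ι n)))))
        (trans (∑-+ m _ _) (trans (cong (λ z → ∑ m (λ y → f (y ℕ.* 4 ℕ.+ r) * (S (y ℕ.* 4 ℕ.+ r) - ι n)) + z)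
          (trans (∑-* m (ι n) _) (trans (cong (ι n *_) ∑f≡0) (*-zeroʳ (ι n))))) (+-identityʳ _))))

    quadratic : h ℕ.≤ 2 → ∀ f → (∀ a → n ℕ.≤ a → f a ≡ 0ℚ) →
      ⟪ (λ b l → at f b (sq h l) * at f b (sq h l)) ⟫ ≤ (ι n + (W + W)) * ∑ m (λ y → f (y ℕ.* 4 ℕ.+ r) * f (y ℕ.* 4 ℕ.+ r))
    quadratic h≤2 f f≡0 = ≤-trans (≤-reflexive eq) (≤-trans (∑-mono m (λ y y<m → *-monoˡ-≤-nonNeg (f² (y ℕ.* 4 ℕ.+ r)) {{nonNegative (0≤p*p (f (y ℕ.* 4 ℕ.+ r)))}}
        (≤-from-∣-∣ (marginal h h≤2 (y ℕ.* 4 ℕ.+ r) (<n y y<m))))) (≤-reflexive (trans (∑-*ʳ m (ι n + (W + W)) _) (*-comm _ (ι n + (W + W))))))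
      where
      f² : ℕ → ℚ
      f² a = f a * f a
      eq : ⟪ (λ b l → at f b (sq h l) * at f b (sq h l)) ⟫ ≡ ∑ m (λ y → f² (y ℕ.* 4 ℕ.+ r) * ∑ Λ (λ l → window (y ℕ.* 4 ℕ.+ r) (sq h l) * ω l))
      eq = trans (∑-ext n (λ b → cong (cls s b *_) (∑-ext Λ (λ l → cong (ω l *_) (sym (at-map₂ _*_ refl f f b (sq h l)))))))
        (trans (transfer (λ _ → f²) (λ _ a n≤a → trans (cong (_* f a) (f≡0 a n≤a)) (*-zeroˡ (f a))))
          (∑-ext m (λ y → trans (∑-ext Λ (λ l → quadratic-identity (window (y ℕ.* 4 ℕ.+ r) (sq h l)) (ω l) (f² (y ℕ.* 4 ℕ.+ r)))) (∑-* Λ (f² (y ℕ.* 4 ℕ.+ r)) _))))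

    -- The second point moves along a progression when l varies and the first point is fixed.
    correlation : ∀ f f′ h′ step e M → (∀ l → sq h′ l ≡ sq h l ℕ.+ (e ℕ.+ l ℕ.* step)) →
      (∀ a → ∣ f a ∣ ≤ 1ℚ) → (∀ a → n ℕ.≤ a → f a ≡ 0ℚ) → (∀ a i → ∣ ∑ i (λ l → f′ (a ℕ.+ l ℕ.* step)) ∣ ≤ M) →
      ∣ ⟪ (λ b l → at f b (sq h l) * at f′ b (sq h′ l)) ⟫ ∣ ≤ ι m * (W * (M + M) + W * (M + M))
    correlation f f′ h′ step e M sq≡ f≤1 f≡0 run = subst (λ z → ∣ z ∣ ≤ ι m * (W * (M + M) + W * (M + M))) (sym eq)
      (∣∑∣≤ m _ (λ y _ → ≤-trans (∣p*q∣≤ (f≤1 _) (window-run h (y ℕ.* 4 ℕ.+ r) (λ l → f′ (y ℕ.* 4 ℕ.+ r ℕ.+ e ℕ.+ l ℕ.* step)) M (run (y ℕ.* 4 ℕ.+ r ℕ.+ e)))) (≤-reflexive (*-identityˡ _))))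
      where
      eq : ⟪ (λ b l → at f b (sq h l) * at f′ b (sq h′ l)) ⟫ ≡ ∑ m (λ y → f (y ℕ.* 4 ℕ.+ r) * ∑ Λ (λ l → window (y ℕ.* 4 ℕ.+ r) (sq h l) * (ω l * f′ (y ℕ.* 4 ℕ.+ r ℕ.+ e ℕ.+ l ℕ.* step))))
      eq = trans (∑-ext n (λ b → cong (cls s b *_) (∑-ext Λ (λ l → cong (ω l *_) (trans (cong (λ c → at f b (sq h l) * at f′ b c) (sq≡ l)) (at-* f f′ (e ℕ.+ l ℕ.* step) b (sq h l)))))))
        (trans (transfer (λ l a → f a * f′ (a ℕ.+ (e ℕ.+ l ℕ.* step))) (λ l a n≤a → trans (cong (_* f′ (a ℕ.+ (e ℕ.+ l ℕ.* step))) (f≡0 a n≤a)) (*-zeroˡ (f′ (a ℕ.+ (e ℕ.+ l ℕ.* step))))))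
          (∑-ext m (λ y → trans (∑-ext Λ (λ l → trans (cong (λ z → window (y ℕ.* 4 ℕ.+ r) (sq h l) * (ω l * (f (y ℕ.* 4 ℕ.+ r) * f′ z))) (sym (ℕ.+-assoc (y ℕ.* 4 ℕ.+ r) e (l ℕ.* step))))
            (correlation-identity (window (y ℕ.* 4 ℕ.+ r) (sq h l)) (ω l) (f (y ℕ.* 4 ℕ.+ r)) (f′ (y ℕ.* 4 ℕ.+ r ℕ.+ e ℕ.+ l ℕ.* step))))) (∑-* Λ (f (y ℕ.* 4 ℕ.+ r)) _))))

  sq≤-identity : ∀ l → (2 ℕ.* l ℕ.+ 2) ℕ.* (2 ℕ.* l ℕ.+ 2) ≡ (2 ℕ.* suc l ℕ.+ 0) ℕ.* (2 ℕ.* suc l ℕ.+ 0)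
  sq≤-identity = ℕ.solve-∀

  total-identity₂ : ∀ x y → 1ℚ - (- (y - x)) ≡ (1ℚ - x) + y
  total-identity₂ = solve-∀ ℚ-ring

  total-identity₃ : ∀ x y → x - y ≡ - (y - x)
  total-identity₃ = solve-∀ ℚ-ring

  -- Only the last window before b can straddle the point b.
  module _ (n Λ : ℕ) (2n≤4Λ² : 2 ℕ.* n ℕ.≤ 4 ℕ.* (Λ ℕ.* Λ)) where
    open Range n Λ 2n≤4Λ²

    straddle : ∀ h → h ℕ.≤ 2 → ∀ f → (∀ a → ∣ f a ∣ ≤ 1ℚ) → (∀ a → n ℕ.≤ a → f a ≡ 0ℚ) → ∀ b →
      ∑ Λ (λ l → ω l * ((1ℚ - window b (sq 0 l)) * ∣ at f b (sq h l) ∣)) ≤ W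
    straddle h h≤2 f f≤1 f≡0 b = ≤-trans (∑-mono Λ (λ l l<Λ → *-mono (0≤ω l) (0≤diff l) (ω≤W (ℕ.<⇒≤ l<Λ)) (point l)))
      (≤-trans (≤-reflexive (∑-* Λ W _)) (≤-trans (*-monoˡ-≤-nonNeg W {{nonNegative 0≤W}} total) (≤-reflexive (*-identityʳ W))))
      where
      g : ℕ → ℚ
      g l = lt (sq 0 l) b
      0≤diff : ∀ l → 0ℚ ≤ g l - g (suc l)
      0≤diff l with sq 0 l ℕ.<? b
      ... | yes lt₀ = p≤q⇒0≤q-p (subst (g (suc l) ≤_) (sym (lt-yes lt₀)) (proj₂ (0≤lt≤1 (sq 0 (suc l)) b)))
      ... | no ¬lt₀ = ≤-reflexive (sym (cong₂ _-_ (lt-no (ℕ.≮⇒≥ ¬lt₀)) (lt-no (ℕ.≤-trans (ℕ.≮⇒≥ ¬lt₀) (sq-mono 0 (ℕ.n≤1+n l))))))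
      total : ∑ Λ (λ l → g l - g (suc l)) ≤ 1ℚ
      total = ≤-trans (≤-reflexive (trans (∑-ext Λ (λ l → total-identity₃ (g l) (g (suc l)))) (trans (∑-neg Λ _) (cong -_ (∑-telescope Λ g)))))
        (slack ((1ℚ - g 0) + g Λ) (0≤+ (p≤q⇒0≤q-p (proj₂ (0≤lt≤1 (sq 0 0) b))) (proj₁ (0≤lt≤1 (sq 0 Λ) b))) (total-identity₂ (g 0) (g Λ)))
      0≤sq : ∀ l → sq 0 l ℕ.≤ sq h l
      0≤sq l = ℕ.*-mono-≤ (ℕ.+-monoʳ-≤ (2 ℕ.* l) (z≤n {h})) (ℕ.+-monoʳ-≤ (2 ℕ.* l) (z≤n {h}))
      sq≤ : ∀ l → sq h l ℕ.≤ sq 0 (suc l)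
      sq≤ l = ℕ.≤-trans (ℕ.*-mono-≤ (ℕ.+-monoʳ-≤ (2 ℕ.* l) h≤2) (ℕ.+-monoʳ-≤ (2 ℕ.* l) h≤2)) (ℕ.≤-reflexive (sq≤-identity l))
      kill : ∀ l → ∣ at f b (sq h l) ∣ ≡ 0ℚ → (1ℚ - window b (sq 0 l)) * ∣ at f b (sq h l) ∣ ≤ g l - g (suc l)
      kill l eq = ≤-trans (≤-reflexive (trans (cong ((1ℚ - window b (sq 0 l)) *_) eq) (*-zeroʳ (1ℚ - window b (sq 0 l))))) (0≤diff l)
      point : ∀ l → (1ℚ - window b (sq 0 l)) * ∣ at f b (sq h l) ∣ ≤ g l - g (suc l)
      point l with compare b (sq h l)
      ... | inj₂ lt′ = kill l (cong ∣_∣ (at-< f lt′))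
      ... | inj₁ (a , eq) with n ℕ.≤? a
      ...   | yes n≤a = kill l (cong ∣_∣ (trans (cong (at f b) (sym eq)) (trans (at-+ f b a) (f≡0 a n≤a))))
      ...   | no  n≰a with sq 0 l ℕ.<? b
      ...     | yes lt₀ = ≤-trans (≤-trans (≤-reflexive (trans (cong (λ z → (1ℚ - z) * ∣ at f b (sq h l) ∣) (at-< (λ a → lt a n) lt₀)) (*-identityˡ _))) (∣at∣≤1 f f≤1 b (sq h l)))
                (≤-reflexive (sym (cong₂ _-_ (lt-yes lt₀) (lt-no (ℕ.≤-trans (ℕ.≤-trans (ℕ.m≤m+n b a) (ℕ.≤-reflexive eq)) (sq≤ l))))))
      ...     | no ¬lt₀ = ≤-trans (≤-reflexive (trans (cong (λ z → (1ℚ - z) * ∣ at f b (sq h l) ∣) inside) (*-zeroˡ ∣ at f b (sq h l) ∣))) (0≤diff l)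
        where
        inside : window b (sq 0 l) ≡ 1ℚ
        inside = trans (at-window n b (sq 0 l)) (cong₂ _-_
          (lt-yes (ℕ.≤-<-trans (ℕ.≤-trans (0≤sq l) (ℕ.≤-reflexive (sym eq))) (ℕ.+-monoʳ-< b (ℕ.≰⇒> n≰a)))) (lt-no (ℕ.≮⇒≥ ¬lt₀)))

-- Expansion of the nonnegative square

module SquareExpansion where

  open Data.Rational.Base
  open Data.Rational.Properties
  open Rationals
  open Sums
  open Averages
  open DensityInequality using (T₁; lit)

  expanded-square-identity : ∀ S i c B Z → S + ((+ 4 / 1) * (i - i)) * ((c - B) * (c - B)) + (+ 4 / 1) * i * (B - B) - (+ 4 / 1) * (c - B) * (Z - Z) ≡ S
  expanded-square-identity = solve-∀ ℚ-ring

  expanded-square-identity₂ : ∀ c w i B X Z₀ Z₂ aX aZ → ((+ 4 / 1) * (c * c)) * i + ((+ 4 / 1) * (1ℚ - c - c)) * (B * i)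
    + ((+ 4 / 1) * (w * w)) * (X * X) + (Z₀ * Z₀ + Z₂ * Z₂)
    + ((+ 2 / 1) * (Z₀ * Z₂) + ((+ 4 / 1) * w) * (Z₀ * X) + ((+ 4 / 1) * w) * (X * Z₂))
    + ((- ((+ 8 / 1) * w * c)) * X + (- ((+ 4 / 1) * c)) * Z₀ + (- ((+ 4 / 1) * c)) * Z₂)
    + (((+ 8 / 1) * w) * (B * X) + (+ 4 / 1) * (B * Z₀) + (+ 4 / 1) * (B * Z₂))
    + ((+ 8 / 1) * ((1ℚ - i) * aX) + (+ 4 / 1) * ((1ℚ - i) * aZ))
    ≡ ((+ 2 / 1) * i * (c - B) - (+ 2 / 1) * w * X - Z₀ - Z₂) * ((+ 2 / 1) * i * (c - B) - (+ 2 / 1) * w * X - Z₀ - Z₂)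
    + (+ 8 / 1) * (1ℚ - i) * (aX - w * (c - B) * X) + (+ 4 / 1) * (1ℚ - i) * (aZ - (c - B) * Z₂)
    + ((+ 4 / 1) * (i - i * i)) * ((c - B) * (c - B)) + (+ 4 / 1) * i * (B - B * B) - (+ 4 / 1) * (c - B) * (Z₀ - i * Z₀)
  expanded-square-identity₂ = solve-∀ ℚ-ring

  -- Expands (2i(c - B) - 2wX - Z₀ - Z₂)² for 0/1-valued i and B; the last line absorbs the windows with i = 0.
  module _ {c w i B X Z₀ Z₂ : ℚ} (0≤c : 0ℚ ≤ c) (c≤1 : c ≤ 1ℚ) (0≤w : 0ℚ ≤ w) (w≤1 : w ≤ 1ℚ)
    (0≤B : 0ℚ ≤ B) (B≤1 : B ≤ 1ℚ) (i≤1 : i ≤ 1ℚ)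
    (i²≡i : i * i ≡ i) (B²≡B : B * B ≡ B) (iZ₀≡Z₀ : i * Z₀ ≡ Z₀) where

    expanded-square :
      0ℚ ≤ ((+ 4 / 1) * (c * c)) * i + ((+ 4 / 1) * (1ℚ - c - c)) * (B * i)
        + ((+ 4 / 1) * (w * w)) * (X * X) + (Z₀ * Z₀ + Z₂ * Z₂)
        + ((+ 2 / 1) * (Z₀ * Z₂) + ((+ 4 / 1) * w) * (Z₀ * X) + ((+ 4 / 1) * w) * (X * Z₂))
        + ((- ((+ 8 / 1) * w * c)) * X + (- ((+ 4 / 1) * c)) * Z₀ + (- ((+ 4 / 1) * c)) * Z₂)
        + (((+ 8 / 1) * w) * (B * X) + (+ 4 / 1) * (B * Z₀) + (+ 4 / 1) * (B * Z₂))
        + ((+ 8 / 1) * ((1ℚ - i) * ∣ X ∣) + (+ 4 / 1) * ((1ℚ - i) * ∣ Z₂ ∣))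
    expanded-square = subst (0ℚ ≤_) (sym (trans (expanded-square-identity₂ c w i B X Z₀ Z₂ ∣ X ∣ ∣ Z₂ ∣) (trans (cong₂ (λ x y → S + ((+ 4 / 1) * (i - x)) * ((c - B) * (c - B)) + (+ 4 / 1) * i * (B - y) - (+ 4 / 1) * (c - B) * (Z₀ - i * Z₀)) i²≡i B²≡B)
        (trans (cong (λ x → S + ((+ 4 / 1) * (i - i)) * ((c - B) * (c - B)) + (+ 4 / 1) * i * (B - B) - (+ 4 / 1) * (c - B) * (Z₀ - x)) iZ₀≡Z₀) (expanded-square-identity S i c B Z₀)))))
      (0≤+ (0≤+ (0≤p*p ((+ 2 / 1) * i * (c - B) - (+ 2 / 1) * w * X - Z₀ - Z₂)) (0≤* (0≤* (lit (+ 8 / 1)) 0≤1-i) first)) (0≤* (0≤* (lit (+ 4 / 1)) 0≤1-i) second))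
      where
      S : ℚ
      S = ((+ 2 / 1) * i * (c - B) - (+ 2 / 1) * w * X - Z₀ - Z₂) * ((+ 2 / 1) * i * (c - B) - (+ 2 / 1) * w * X - Z₀ - Z₂)
        + (+ 8 / 1) * (1ℚ - i) * (∣ X ∣ - w * (c - B) * X) + (+ 4 / 1) * (1ℚ - i) * (∣ Z₂ ∣ - (c - B) * Z₂)
      0≤1-i : 0ℚ ≤ 1ℚ - i
      0≤1-i = p≤q⇒0≤q-p i≤1
      ∣c-B∣≤1 : ∣ c - B ∣ ≤ 1ℚ
      ∣c-B∣≤1 = ∣p-q∣≤1 0≤c c≤1 0≤B B≤1
      below : ∀ {x} y → ∣ x ∣ ≤ 1ℚ → 0ℚ ≤ ∣ y ∣ - x * y
      below {x} y h = p≤q⇒0≤q-p (≤-trans (p≤∣p∣ (x * y)) (≤-trans (∣p*q∣≤ h ≤-refl) (≤-reflexive (*-identityˡ ∣ y ∣))))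
      second : 0ℚ ≤ ∣ Z₂ ∣ - (c - B) * Z₂
      second = below Z₂ ∣c-B∣≤1
      first : 0ℚ ≤ ∣ X ∣ - w * (c - B) * X
      first = below X (≤-trans (∣p*q∣≤ (≤-trans (≤-reflexive (0≤p⇒∣p∣≡p 0≤w)) w≤1) ∣c-B∣≤1) ≤-refl)

  1-2c≤1-identity : ∀ c → 1ℚ - (- (1ℚ - c - c)) ≡ (1ℚ - c) + (1ℚ - c)
  1-2c≤1-identity = solve-∀ ℚ-ring

  1-2c≤1-identity₂ : ∀ c → 1ℚ - (1ℚ - c - c) ≡ c + c
  1-2c≤1-identity₂ = solve-∀ ℚ-ring

  collect-identity : ∀ e u M N W E C β η S SB V₁ V₀ V₂ C₀₂ C₀₁ C₁₂ L₁ L₀ L₂ BX BZ₀ BZ₂ R₁ R₂ →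
    (+ 4 / 1) * (N * M * ((1ℚ - e) * (1ℚ - e) * (1ℚ - u) + ½ * (e * (1ℚ - e)))) + ((+ 16 / 1) * (W * C) + (+ 72 / 1) * (M * W) + (+ 10 / 1) * (M * E) + (+ 16 / 1) * η)
      - (+ 4 / 1) * (N * β) ≡
    (((+ 4 / 1) * (((1ℚ - e) * (1ℚ - u)) * ((1ℚ - e) * (1ℚ - u)))) * S + ((+ 4 / 1) * (1ℚ - ((1ℚ - e) * (1ℚ - u)) - ((1ℚ - e) * (1ℚ - u)))) * SB
    + ((+ 4 / 1) * ((1ℚ - e) * (1ℚ - e))) * V₁ + (V₀ + V₂)
    + ((+ 2 / 1) * C₀₂ + ((+ 4 / 1) * (1ℚ - e)) * C₀₁ + ((+ 4 / 1) * (1ℚ - e)) * C₁₂)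
    + ((- ((+ 8 / 1) * (1ℚ - e) * ((1ℚ - e) * (1ℚ - u)))) * L₁ + (- ((+ 4 / 1) * ((1ℚ - e) * (1ℚ - u)))) * L₀ + (- ((+ 4 / 1) * ((1ℚ - e) * (1ℚ - u)))) * L₂)
    + (((+ 8 / 1) * (1ℚ - e)) * BX + (+ 4 / 1) * BZ₀ + (+ 4 / 1) * BZ₂)
    + ((+ 8 / 1) * R₁ + (+ 4 / 1) * R₂))
    + ((+ 4 / 1) * (((1ℚ - e) * (1ℚ - u)) * ((1ℚ - e) * (1ℚ - u)))) * (M * (N + (W + W)) - S)
    + (+ 4 / 1) * (M * (W + W) - (1ℚ - ((1ℚ - e) * (1ℚ - u)) - ((1ℚ - e) * (1ℚ - u))) * (SB - N * β))
    + ((+ 4 / 1) * ((1ℚ - e) * (1ℚ - e))) * ((N + (W + W)) * (M * (u - u * u)) - V₁)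
    + (((N + (W + W)) * (M * (e - e * e)) - V₀) + ((N + (W + W)) * (M * (e - e * e)) - V₂))
    + (+ 2 / 1) * (M * E - C₀₂)
    + (+ 4 / 1) * (M * E - (1ℚ - e) * C₀₁)
    + (+ 4 / 1) * (M * E - (1ℚ - e) * C₁₂)
    + (+ 8 / 1) * (M * (W + W) - (- ((1ℚ - e) * (((1ℚ - e) * (1ℚ - u)) * L₁))))
    + (+ 4 / 1) * (M * (W + W) - (- (((1ℚ - e) * (1ℚ - u)) * L₀)))
    + (+ 4 / 1) * (M * (W + W) - (- (((1ℚ - e) * (1ℚ - u)) * L₂)))
    + ((+ 8 / 1) * (1ℚ - e)) * (W * C - u * (N * β) + η - BX)
    + (+ 4 / 1) * (W * C - e * (N * β) + η - BZ₀)
    + (+ 4 / 1) * (W * C - e * (N * β) + η + M * (W + W) - BZ₂)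
    + (+ 8 / 1) * (M * W - R₁)
    + (+ 4 / 1) * (M * W - R₂)
    + ((+ 8 / 1) * e) * (W * C)
    + ((+ 8 / 1) * e) * η
    + ((+ 8 / 1) * (e * (1ℚ + (1ℚ - e)) + (1ℚ - e) * (1ℚ - e) * u) + (+ 4 / 1) * ((1ℚ - e) + e * e)) * (M * W)
  collect-identity = solve-∀ ℚ-ring

  module _ {e u M N W E C β η S SB V₁ V₀ V₂ C₀₂ C₀₁ C₁₂ L₁ L₀ L₂ BX BZ₀ BZ₂ R₁ R₂ : ℚ}
    (0≤e : 0ℚ ≤ e) (e≤1 : e ≤ 1ℚ) (0≤u : 0ℚ ≤ u) (u≤1 : u ≤ 1ℚ) (0≤MW : 0ℚ ≤ M * W) (0≤WC : 0ℚ ≤ W * C) (0≤η : 0ℚ ≤ η)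
    (S≤ : S ≤ M * (N + (W + W))) (SB≤ : ∣ SB - N * β ∣ ≤ M * (W + W))
    (V₁≤ : V₁ ≤ (N + (W + W)) * (M * (u - u * u))) (V₀≤ : V₀ ≤ (N + (W + W)) * (M * (e - e * e))) (V₂≤ : V₂ ≤ (N + (W + W)) * (M * (e - e * e)))
    (C₀₂≤ : ∣ C₀₂ ∣ ≤ M * E) (C₀₁≤ : ∣ C₀₁ ∣ ≤ M * E) (C₁₂≤ : ∣ C₁₂ ∣ ≤ M * E)
    (L₁≤ : ∣ L₁ ∣ ≤ M * (W + W)) (L₀≤ : ∣ L₀ ∣ ≤ M * (W + W)) (L₂≤ : ∣ L₂ ∣ ≤ M * (W + W))
    (BX≤ : BX ≤ W * C - u * (N * β) + η) (BZ₀≤ : BZ₀ ≤ W * C - e * (N * β) + η) (BZ₂≤ : BZ₂ ≤ W * C - e * (N * β) + η + M * (W + W))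
    (R₁≤ : R₁ ≤ M * W) (R₂≤ : R₂ ≤ M * W) where

    private
      c w : ℚ
      c = (1ℚ - e) * (1ℚ - u)
      w = 1ℚ - e
      0≤w : 0ℚ ≤ w
      0≤w = p≤q⇒0≤q-p e≤1
      0≤1-u : 0ℚ ≤ 1ℚ - u
      0≤1-u = p≤q⇒0≤q-p u≤1
      0≤c : 0ℚ ≤ c
      0≤c = 0≤* 0≤w 0≤1-u
      w≤1 : ∣ w ∣ ≤ 1ℚ
      w≤1 = ∣p-q∣≤1 (lit 1ℚ) ≤-refl 0≤e e≤1
      c≤1 : ∣ c ∣ ≤ 1ℚ
      c≤1 = ∣p*q∣≤ w≤1 (∣p-q∣≤1 (lit 1ℚ) ≤-refl 0≤u u≤1)
      1-2c≤1 : ∣ 1ℚ - c - c ∣ ≤ 1ℚ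
      1-2c≤1 = ∣p∣≤ (slack (c + c) (0≤+ 0≤c 0≤c) (1-2c≤1-identity₂ c)) (slack ((1ℚ - c) + (1ℚ - c)) (0≤+ 0≤1-c 0≤1-c) (1-2c≤1-identity c))
        where
        0≤1-c : 0ℚ ≤ 1ℚ - c
        0≤1-c = p≤q⇒0≤q-p (≤-trans (p≤∣p∣ c) c≤1)
      scaled : ∀ {x y b} → ∣ x ∣ ≤ 1ℚ → ∣ y ∣ ≤ b → ∣ x * y ∣ ≤ b
      scaled {x} {y} {b} hx hy = ≤-trans (∣p*q∣≤ hx hy) (≤-reflexive (*-identityˡ b))
      upper : ∀ {x b} → ∣ x ∣ ≤ b → 0ℚ ≤ b - x
      upper {x} h = p≤q⇒0≤q-p (≤-trans (p≤∣p∣ x) h)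
      lower : ∀ {x b} → ∣ x ∣ ≤ b → 0ℚ ≤ b - (- x)
      lower {x} h = p≤q⇒0≤q-p (≤-trans (-p≤∣p∣ x) h)
      4≥0 : 0ℚ ≤ + 4 / 1
      4≥0 = lit (+ 4 / 1)
      8≥0 : 0ℚ ≤ + 8 / 1
      8≥0 = lit (+ 8 / 1)

    -- Here c + wu + e = 1 is used. The terms with Nβ have the total coefficient 4(1 - 2c) - 8wu -
    -- 8e = -4, while 4c² from the constants, 4w²u(1 - u) from the odd point and e(1 - e) from each
    -- even point make up 4 T₁(u, e). Correlations, linear terms and straddling windows are errors.
    collect : 0ℚ ≤ ((+ 4 / 1) * (c * c)) * S + ((+ 4 / 1) * (1ℚ - c - c)) * SB
        + ((+ 4 / 1) * (w * w)) * V₁ + (V₀ + V₂)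
        + ((+ 2 / 1) * C₀₂ + ((+ 4 / 1) * w) * C₀₁ + ((+ 4 / 1) * w) * C₁₂)
        + ((- ((+ 8 / 1) * w * c)) * L₁ + (- ((+ 4 / 1) * c)) * L₀ + (- ((+ 4 / 1) * c)) * L₂)
        + (((+ 8 / 1) * w) * BX + (+ 4 / 1) * BZ₀ + (+ 4 / 1) * BZ₂)
        + ((+ 8 / 1) * R₁ + (+ 4 / 1) * R₂) →
      (+ 4 / 1) * (N * β) ≤ (+ 4 / 1) * (N * M * T₁ u e) + ((+ 16 / 1) * (W * C) + (+ 72 / 1) * (M * W) + (+ 10 / 1) * (M * E) + (+ 16 / 1) * η)
    collect 0≤P = slack _ (0≤+ (0≤+ (0≤+ (0≤+ (0≤+ (0≤+ (0≤+ (0≤+ (0≤+ (0≤+ (0≤+ (0≤+ (0≤+ (0≤+ (0≤+ (0≤+ (0≤+ (0≤+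
        0≤P
        (0≤* (0≤* 4≥0 (0≤* 0≤c 0≤c)) (p≤q⇒0≤q-p S≤)))
        (0≤* 4≥0 (upper (scaled {y = SB - N * β} 1-2c≤1 SB≤))))
        (0≤* (0≤* 4≥0 (0≤* 0≤w 0≤w)) (p≤q⇒0≤q-p V₁≤)))
        (0≤+ (p≤q⇒0≤q-p V₀≤) (p≤q⇒0≤q-p V₂≤)))
        (0≤* (lit (+ 2 / 1)) (upper C₀₂≤)))
        (0≤* 4≥0 (upper (scaled {y = C₀₁} w≤1 C₀₁≤))))
        (0≤* 4≥0 (upper (scaled {y = C₁₂} w≤1 C₁₂≤))))
        (0≤* 8≥0 (lower (scaled {y = c * L₁} w≤1 (scaled {y = L₁} c≤1 L₁≤)))))
        (0≤* 4≥0 (lower (scaled {y = L₀} c≤1 L₀≤))))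
        (0≤* 4≥0 (lower (scaled {y = L₂} c≤1 L₂≤))))
        (0≤* (0≤* 8≥0 0≤w) (p≤q⇒0≤q-p BX≤)))
        (0≤* 4≥0 (p≤q⇒0≤q-p BZ₀≤)))
        (0≤* 4≥0 (p≤q⇒0≤q-p BZ₂≤)))
        (0≤* 8≥0 (p≤q⇒0≤q-p R₁≤)))
        (0≤* 4≥0 (p≤q⇒0≤q-p R₂≤)))
        (0≤* (0≤* 8≥0 0≤e) 0≤WC))
        (0≤* (0≤* 8≥0 0≤e) 0≤η))
        (0≤* (0≤+ (0≤* 8≥0 (0≤+ (0≤* 0≤e (0≤+ (lit 1ℚ) 0≤w)) (0≤* (0≤* 0≤w 0≤w) 0≤u))) (0≤* 4≥0 (0≤+ 0≤w (0≤* 0≤e 0≤e)))) 0≤MW))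
      (collect-identity e u M N W E C β η S SB V₁ V₀ V₂ C₀₂ C₀₁ C₁₂ L₁ L₀ L₂ BX BZ₀ BZ₂ R₁ R₂)

-- The bound for one class, with explicit errors

module Estimates where

  open Data.Rational.Base
  open Data.Rational.Properties
  open Rationals
  open Sums
  open Averages
  open Windows
  open Progressions
  open Transference
  open DensityInequality using (T₁; lit)
  open SquareExpansion

  at-ext : ∀ {F G} → (∀ a → F a ≡ G a) → ∀ b c → at F b c ≡ at G b c
  at-ext {F} {G} F≡G b c with compare b c
  ... | inj₁ (a , refl) = trans (at-+ F b a) (trans (F≡G a) (sym (at-+ G b a)))
  ... | inj₂ c<b = trans (at-< F c<b) (sym (at-< G c<b))

  lt²≡lt : ∀ x y → lt x y * lt x y ≡ lt x y
  lt²≡lt x y with x ℕ.<? y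
  ... | yes x<y = trans (cong₂ _*_ (lt-yes x<y) (lt-yes x<y)) (sym (lt-yes x<y))
  ... | no  x≮y = trans (cong₂ _*_ (lt-no (ℕ.≮⇒≥ x≮y)) (lt-no (ℕ.≮⇒≥ x≮y))) (sym (lt-no (ℕ.≮⇒≥ x≮y)))

  record 𝟘𝟙 (n : ℕ) : Set where
    field
      fun     : ℕ → ℚ
      0≤fun   : ∀ a → 0ℚ ≤ fun a
      fun≤1   : ∀ a → fun a ≤ 1ℚ
      fun²    : ∀ a → fun a * fun a ≡ fun a
      support : ∀ a → n ℕ.≤ a → fun a ≡ 0ℚ

  far-identity : ∀ m → 4 ℕ.* (m ℕ.* m) ≡ (2 ℕ.* m ℕ.+ 0) ℕ.* (2 ℕ.* m ℕ.+ 0)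
  far-identity = ℕ.solve-∀

  cc≤1-identity : ∀ e u → 1ℚ - (1ℚ - e) * (1ℚ - u) ≡ e + (1ℚ - e) * u
  cc≤1-identity = solve-∀ ℚ-ring

  w≤1-identity : ∀ e → 1ℚ - (1ℚ - e) ≡ e
  w≤1-identity = solve-∀ ℚ-ring

  each-identity₃ : ∀ l → (2 ℕ.* suc l ℕ.+ 0) ℕ.* (2 ℕ.* suc l ℕ.+ 0) ≡ (2 ℕ.* l ℕ.+ 2) ℕ.* (2 ℕ.* l ℕ.+ 2)
  each-identity₃ = ℕ.solve-∀

  each-identity₄ : ∀ b x y w → b * x - (b * y - w) ≡ b * (x - (y - w)) + (1ℚ - b) * w
  each-identity₄ = solve-∀ ℚ-ring

  part₂-identity : ∀ β v n m E → β * (v * n - E) - (v * (n * β) - m * E) ≡ (m - β) * E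
  part₂-identity = solve-∀ ℚ-ring

  Vr≡-identity : ∀ m v → (+ 4 / 1) * (m * v) ≡ v * ((+ 4 / 1) * m)
  Vr≡-identity = solve-∀ ℚ-ring

  BZ₂≤-identity : ∀ x y z t → x - (y - z - t) ≡ x - y + z + t
  BZ₂≤-identity = solve-∀ ℚ-ring

  BZ₀≤-identity : ∀ x y z → x - (y - z) ≡ x - y + z
  BZ₀≤-identity = solve-∀ ℚ-ring

  BX≤-identity : ∀ x y z → x - (y - z) ≡ x - y + z
  BX≤-identity = solve-∀ ℚ-ring

  count--identity : ∀ b x y → b * (x - y) ≡ b * x - b * y
  count--identity = solve-∀ ℚ-ring

  D₄≥-identity : ∀ p → p ℕ.* 8 ≡ p ℕ.* 2 ℕ.* 4
  D₄≥-identity = ℕ.solve-∀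

  main-term-identity : ∀ b x y → b * y + b * (x - y) ≡ b * x
  main-term-identity = solve-∀ ℚ-ring

  main-term-identity₂ : ∀ c b w x → c * (w * (b * x)) ≡ c * b * (w * x)
  main-term-identity₂ = solve-∀ ℚ-ring

  main-term-identity₃ : ∀ x y z → x - (y + z) ≡ (x - y) + (- z)
  main-term-identity₃ = solve-∀ ℚ-ring

  SB≤-identity : ∀ b x n → b * x - n * b ≡ b * (x - n)
  SB≤-identity = solve-∀ ℚ-ring

  C₁₂≤-identity : ∀ l → (2 ℕ.* l ℕ.+ 2) ℕ.* (2 ℕ.* l ℕ.+ 2) ≡ (2 ℕ.* l ℕ.+ 1) ℕ.* (2 ℕ.* l ℕ.+ 1) ℕ.+ (3 ℕ.+ l ℕ.* 4)
  C₁₂≤-identity = ℕ.solve-∀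

  C₀₁≤-identity : ∀ l → (2 ℕ.* l ℕ.+ 1) ℕ.* (2 ℕ.* l ℕ.+ 1) ≡ (2 ℕ.* l ℕ.+ 0) ℕ.* (2 ℕ.* l ℕ.+ 0) ℕ.+ (1 ℕ.+ l ℕ.* 4)
  C₀₁≤-identity = ℕ.solve-∀

  C₀₂≤-identity : ∀ l → (2 ℕ.* l ℕ.+ 2) ℕ.* (2 ℕ.* l ℕ.+ 2) ≡ (2 ℕ.* l ℕ.+ 0) ℕ.* (2 ℕ.* l ℕ.+ 0) ℕ.+ (4 ℕ.+ l ℕ.* 8)
  C₀₂≤-identity = ℕ.solve-∀

  affine-identity : ∀ m v → (1ℚ - v - v) * (m * v) + m * (v * v) ≡ m * (v - v * v)
  affine-identity = solve-∀ ℚ-ring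

  m≡-identity : ∀ T c p → T ℕ.* (c ℕ.* p ℕ.* 2) ≡ T ℕ.* c ℕ.* (p ℕ.* 2)
  m≡-identity = ℕ.solve-∀

  n≡₄-identity : ∀ p → p ℕ.* 8 ≡ p ℕ.* 2 ℕ.* 4
  n≡₄-identity = ℕ.solve-∀

  n≡₈-identity : ∀ T c p → T ℕ.* (c ℕ.* p ℕ.* 8) ≡ T ℕ.* c ℕ.* (p ℕ.* 8)
  n≡₈-identity = ℕ.solve-∀

  L-B-identity : ∀ w k f → w * (k * f) ≡ k * (w * f)
  L-B-identity = solve-∀ ℚ-ring

  L---identity : ∀ x y → x - y ≡ x + (- 1ℚ) * y
  L---identity = solve-∀ ℚ-ring

  L-*-identity : ∀ w k f → w * (k * f) ≡ k * (w * f)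
  L-*-identity = solve-∀ ℚ-ring

  n≡4m-identity : ∀ T p → T ℕ.* (p ℕ.* 8) ≡ T ℕ.* (p ℕ.* 2) ℕ.* 4
  n≡4m-identity = ℕ.solve-∀

  module Estimate {n : ℕ} (𝔸 𝔹 : 𝟘𝟙 n)
    (Λ : ℕ) (2n≤4Λ² : 2 ℕ.* n ℕ.≤ 4 ℕ.* (Λ ℕ.* Λ)) (1≤Λ : 1 ℕ.≤ Λ)
    (T p₁ p₂ c : ℕ) .{{_ : ℕ.NonZero p₁}} .{{_ : ℕ.NonZero p₂}} (p₂≡ : p₂ ≡ c ℕ.* p₁) (n≡ : n ≡ T ℕ.* (p₂ ℕ.* 8))
    (s r₀ r₁ : ℕ) (s<4 : s ℕ.< 4) (r₀<4 : r₀ ℕ.< 4) (r₁<4 : r₁ ℕ.< 4)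
    (class₀ : ∀ a b l → a ℕ.+ b ≡ sq 0 l → cls s b ≡ cls r₀ a)
    (class₁ : ∀ a b l → a ℕ.+ b ≡ sq 1 l → cls s b ≡ cls r₁ a)
    (odd-class : ∀ y l a → (y ℕ.* 4 ℕ.+ s) ℕ.+ a ≡ sq 1 l → a ℕ.% 4 ≡ r₁)
    (even-class : ∀ y → ∃[ flip ] (∀ l a → (y ℕ.* 4 ℕ.+ s) ℕ.+ a ≡ sq 0 l → a ℕ.% 8 ≡ r₀ ℕ.+ 4 ℕ.* ((flip ℕ.+ l) ℕ.% 2)))
    where

    open 𝟘𝟙 𝔸 renaming (fun to A; 0≤fun to 0≤A; fun≤1 to A≤1; fun² to A²≡A; support to A≡0)
    open 𝟘𝟙 𝔹 renaming (fun to B; 0≤fun to 0≤B; fun≤1 to B≤1; fun² to B²≡B; support to B≡0)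
    open Range n Λ 2n≤4Λ²

    instance
      2p₁-nonZero : ℕ.NonZero (p₁ ℕ.* 2)
      2p₁-nonZero = ℕ.m*n≢0 p₁ 2
      2p₂-nonZero : ℕ.NonZero (p₂ ℕ.* 2)
      2p₂-nonZero = ℕ.m*n≢0 p₂ 2

    m : ℕ
    m = T ℕ.* (p₂ ℕ.* 2)

    n≡4m : n ≡ m ℕ.* 4
    n≡4m = trans n≡ (n≡4m-identity T p₂)

    ιn : ι n ≡ (+ 4 / 1) * ι m
    ιn = trans (cong ι n≡4m) (trans (ι-* m 4) (trans (cong (ι m *_) (ι≡/1 4)) (*-comm (ι m) (+ 4 / 1))))

    b_ : ℕ → ℕ
    b_ y = y ℕ.* 4 ℕ.+ s

    b<n : ∀ y → y ℕ.< m → b_ y ℕ.< n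
    b<n y y<m = ℕ.<-≤-trans (ℕ.+-monoʳ-< (y ℕ.* 4) s<4) (ℕ.≤-trans (ℕ.≤-reflexive (ℕ.+-comm (y ℕ.* 4) 4))
        (ℕ.≤-trans (ℕ.*-monoˡ-≤ 4 y<m) (ℕ.≤-reflexive (sym n≡4m))))

    -- The positive linear functional that is applied to `expanded-square`; each term of the
    -- expansion is then estimated separately.
    L : (ℕ → ℕ → ℚ) → ℚ
    L F = ∑ n (λ b → cls s b * ∑ Λ (λ l → ω l * F b l))

    L≡ : ∀ F → L F ≡ ∑ m (λ y → ∑ Λ (λ l → ω l * F (b_ y) l))
    L≡ F = trans (cong (λ k → ∑ k (λ b → cls s b * ∑ Λ (λ l → ω l * F b l))) n≡4m) (∑-cls m s s<4 (λ b → ∑ Λ (λ l → ω l * F b l)))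

    L-+ : ∀ F G → L (λ b l → F b l + G b l) ≡ L F + L G
    L-+ F G = trans (∑-ext n (λ b → trans (cong (cls s b *_) (trans (∑-ext Λ (λ l → *-distribˡ-+ (ω l) (F b l) (G b l))) (∑-+ Λ _ _))) (*-distribˡ-+ (cls s b) _ _))) (∑-+ n _ _)

    L-* : ∀ k F → L (λ b l → k * F b l) ≡ k * L F
    L-* k F = trans (∑-ext n (λ b → trans (cong (cls s b *_) (trans (∑-ext Λ (λ l → L-*-identity (ω l) k (F b l))) (∑-* Λ k _))) (L-*-identity (cls s b) k _))) (∑-* n k _)

    L-nonNeg : ∀ F → (∀ b l → 0ℚ ≤ F b l) → 0ℚ ≤ L F
    L-nonNeg F 0≤F = ∑-nonNeg n (λ b _ → 0≤* (0≤δ (b ℕ.% 4) s) (∑-nonNeg Λ (λ l _ → 0≤* (0≤ω l) (0≤F b l))))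

    L-ext : ∀ {F G} → (∀ b l → F b l ≡ G b l) → L F ≡ L G
    L-ext F≡G = ∑-ext n (λ b → cong (cls s b *_) (∑-ext Λ (λ l → cong (ω l *_) (F≡G b l))))

    L-- : ∀ F G → L (λ b l → F b l - G b l) ≡ L F - L G
    L-- F G = trans (L-ext (λ b l → L---identity (F b l) (G b l))) (trans (L-+ F (λ b l → (- 1ℚ) * G b l)) (trans (cong (λ x → L F + x) (L-* (- 1ℚ) G)) (sym (L---identity (L F) (L G)))))

    L-B : ∀ (F : ℕ → ℕ → ℚ) → L (λ b l → B b * F b l) ≡ ∑ m (λ y → B (b_ y) * ∑ Λ (λ l → ω l * F (b_ y) l))
    L-B F = trans (L≡ (λ b l → B b * F b l)) (∑-ext m (λ y → trans (∑-ext Λ (λ l → L-B-identity (ω l) (B (b_ y)) (F (b_ y) l))) (∑-* Λ (B (b_ y)) _)))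

    -- Two moduli are needed. The even points of a window differ by 8l + 4, a progression of step 8,
    -- so `f` must cancel on classes modulo 8. The odd point differs from its neighbours by 4l + 1
    -- and 4l + 3, of step 4: there `f̃` cancels modulo 4, and so does `f`, as both classes modulo 8
    -- are balanced. The blocks have the same length 8 * p₁.
    f f̃ : ℕ → ℚ
    f = balanced 8 A 0≤A A≤1 p₁
    f̃ = balanced 4 A 0≤A A≤1 (p₁ ℕ.* 2)

    private
      n≡₈ : n ≡ T ℕ.* c ℕ.* (p₁ ℕ.* 8)
      n≡₈ = trans n≡ (trans (cong (λ p → T ℕ.* (p ℕ.* 8)) p₂≡) (n≡₈-identity T c p₁))
      n≡₄ : n ≡ T ℕ.* c ℕ.* (p₁ ℕ.* 2 ℕ.* 4)
      n≡₄ = trans n≡₈ (cong (T ℕ.* c ℕ.*_) (n≡₄-identity p₁))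
      m≡ : m ≡ T ℕ.* c ℕ.* (p₁ ℕ.* 2)
      m≡ = trans (cong (λ p → T ℕ.* (p ℕ.* 2)) p₂≡) (m≡-identity T c p₁)
      m≡′ : m ≡ T ℕ.* c ℕ.* p₁ ℕ.* 2
      m≡′ = trans m≡ (sym (ℕ.*-assoc (T ℕ.* c) p₁ 2))

    D₁≡0 : ∀ a → n ℕ.≤ a → density 8 p₁ A a ≡ 0ℚ
    D₁≡0 a n≤a = density-support 8 p₁ A (T ℕ.* c) (λ a le → A≡0 a (ℕ.≤-trans (ℕ.≤-reflexive n≡₈) le)) a (ℕ.≤-trans (ℕ.≤-reflexive (sym n≡₈)) n≤a)

    f≡0 : ∀ a → n ℕ.≤ a → f a ≡ 0ℚ
    f≡0 a n≤a = cong₂ _-_ (A≡0 a n≤a) (D₁≡0 a n≤a)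

    f̃≡0 : ∀ a → n ℕ.≤ a → f̃ a ≡ 0ℚ
    f̃≡0 a n≤a = cong₂ _-_ (A≡0 a n≤a) (density-support 4 (p₁ ℕ.* 2) A (T ℕ.* c) (λ a le → A≡0 a (ℕ.≤-trans (ℕ.≤-reflexive n≡₄) le)) a (ℕ.≤-trans (ℕ.≤-reflexive (sym n≡₄)) n≤a))

    f≤1 : ∀ a → ∣ f a ∣ ≤ 1ℚ
    f≤1 = ∣balanced∣≤1 8 A 0≤A A≤1 p₁

    f̃≤1 : ∀ a → ∣ f̃ a ∣ ≤ 1ℚ
    f̃≤1 = ∣balanced∣≤1 4 A 0≤A A≤1 (p₁ ℕ.* 2)

    classSum : ℕ → ℚ
    classSum r = ∑ m (λ y → A (y ℕ.* 4 ℕ.+ r))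

    β : ℚ
    β = ∑ m (λ y → B (b_ y))

    β≤m : β ≤ ι m
    β≤m = ≤-trans (∑-≤const m 1ℚ (λ y _ → B≤1 (b_ y))) (≤-reflexive (*-identityʳ (ι m)))

    bE : ℚ
    bE = ι T * ((W + W) + (W * (ι 2 + ι 2) + W * (ι 2 + ι 2)))

    module _ (e u C εφ : ℚ) (0≤e : 0ℚ ≤ e) (e≤1 : e ≤ 1ℚ) (0≤u : 0ℚ ≤ u) (u≤1 : u ≤ 1ℚ)
      (e≡ : classSum r₀ ≡ ι m * e) (u≡ : classSum r₁ ≡ ι m * u) (0≤C : 0ℚ ≤ C) (0≤εφ : 0ℚ ≤ εφ)
      (count≤ : ∀ h → h ℕ.≤ 2 → L (λ b l → B b * at A b (sq h l)) ≤ W * C)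
      (equi₈ : - εφ ≤ ∑ n (λ b → (cls s b * B b) * ∑ Λ (λ l → ω l * at (λ a → density 8 p₁ A a - density 8 p₂ A a) b (sq 0 l))))
      (equi₄ : - εφ ≤ ∑ n (λ b → (cls s b * B b) * ∑ Λ (λ l → ω l * at (λ a → density 4 (p₁ ℕ.* 2) A a - density 4 (p₂ ℕ.* 2) A a) b (sq 1 l))))
      where

      private
        cc w : ℚ
        cc = (1ℚ - e) * (1ℚ - u)
        w = 1ℚ - e
        i X Z₀ Z₂ : ℕ → ℕ → ℚ
        i b l = window b (sq 0 l)
        X b l = at f̃ b (sq 1 l)
        Z₀ b l = at f b (sq 0 l)
        Z₂ b l = at f b (sq 2 l)

        class₂ : ∀ a b l → a ℕ.+ b ≡ sq 2 l → cls s b ≡ cls r₀ a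
        class₂ a b l eq = class₀ a b (suc l) (trans eq (sq₂ l))
          where
          sq₂ : ∀ l → (2 ℕ.* l ℕ.+ 2) ℕ.* (2 ℕ.* l ℕ.+ 2) ≡ (2 ℕ.* suc l ℕ.+ 0) ℕ.* (2 ℕ.* suc l ℕ.+ 0)
          sq₂ = ℕ.solve-∀

        module T0 = Transfer n Λ 2n≤4Λ² m n≡4m s s<4 0 r₀ r₀<4 class₀
        module T1 = Transfer n Λ 2n≤4Λ² m n≡4m s s<4 1 r₁ r₁<4 class₁
        module T2 = Transfer n Λ 2n≤4Λ² m n≡4m s s<4 2 r₀ r₀<4 class₂

        ∑f : ∑ m (λ y → f (y ℕ.* 4 ℕ.+ r₀)) ≡ 0ℚ
        ∑f = trans (cong (λ k → ∑ k (λ y → f (y ℕ.* 4 ℕ.+ r₀))) m≡) (ZeroOn⇒∑≡0 (T ℕ.* c) (p₁ ℕ.* 2) {λ y → f (y ℕ.* 4 ℕ.+ r₀)} (balanced₈-ZeroOn₄ A 0≤A A≤1 p₁ r₀<4))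
        ∑f̃ : ∑ m (λ y → f̃ (y ℕ.* 4 ℕ.+ r₁)) ≡ 0ℚ
        ∑f̃ = trans (cong (λ k → ∑ k (λ y → f̃ (y ℕ.* 4 ℕ.+ r₁))) m≡) (ZeroOn⇒∑≡0 (T ℕ.* c) (p₁ ℕ.* 2) {λ y → f̃ (y ℕ.* 4 ℕ.+ r₁)} (balanced-ZeroOn 4 A 0≤A A≤1 (p₁ ℕ.* 2) r₁<4))

        affine : ∀ r v → classSum r ≡ ι m * v → ∑ m (λ y → (1ℚ - v - v) * A (y ℕ.* 4 ℕ.+ r) + v * v) ≡ ι m * (v - v * v)
        affine r v eq = trans (∑-+ m _ _) (trans (cong₂ _+_ (trans (∑-* m (1ℚ - v - v) _) (cong ((1ℚ - v - v) *_) eq)) (∑-const m (v * v))) (affine-identity (ι m) v))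

        var-f : ∑ m (λ y → f (y ℕ.* 4 ℕ.+ r₀) * f (y ℕ.* 4 ℕ.+ r₀)) ≤ ι m * (e - e * e)
        var-f = ≤-trans (subst (λ k → ∑ k (λ y → f (y ℕ.* 4 ℕ.+ r₀) * f (y ℕ.* 4 ℕ.+ r₀)) ≤ ∑ k (λ y → (1ℚ - e - e) * A (y ℕ.* 4 ℕ.+ r₀) + e * e)) (sym m≡′)
          (balanced₈-variance₄ A 0≤A A≤1 p₁ A²≡A e (T ℕ.* c) r₀<4)) (≤-reflexive (affine r₀ e e≡))

        var-f̃ : ∑ m (λ y → f̃ (y ℕ.* 4 ℕ.+ r₁) * f̃ (y ℕ.* 4 ℕ.+ r₁)) ≤ ι m * (u - u * u)
        var-f̃ = ≤-trans (subst (λ k → ∑ k (λ y → f̃ (y ℕ.* 4 ℕ.+ r₁) * f̃ (y ℕ.* 4 ℕ.+ r₁)) ≤ ∑ k (λ y → (1ℚ - u - u) * A (y ℕ.* 4 ℕ.+ r₁) + u * u)) (sym m≡)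
          (balanced-variance A 0≤A A≤1 (p₁ ℕ.* 2) A²≡A 4 u (T ℕ.* c) r₁<4)) (≤-reflexive (affine r₁ u u≡))

        0≤N+2W : 0ℚ ≤ ι n + (W + W)
        0≤N+2W = 0≤+ (0≤ι n) (0≤+ 0≤W 0≤W)

        times : ∀ {x y} → x ≤ y → (ι n + (W + W)) * x ≤ (ι n + (W + W)) * y
        times = *-monoˡ-≤-nonNeg (ι n + (W + W)) {{nonNegative 0≤N+2W}}

        V₁≤ : L (λ b l → X b l * X b l) ≤ (ι n + (W + W)) * (ι m * (u - u * u))
        V₁≤ = ≤-trans (T1.quadratic (s≤s z≤n) f̃ f̃≡0) (times var-f̃)
        V₀≤ : L (λ b l → Z₀ b l * Z₀ b l) ≤ (ι n + (W + W)) * (ι m * (e - e * e))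
        V₀≤ = ≤-trans (T0.quadratic z≤n f f≡0) (times var-f)
        V₂≤ : L (λ b l → Z₂ b l * Z₂ b l) ≤ (ι n + (W + W)) * (ι m * (e - e * e))
        V₂≤ = ≤-trans (T2.quadratic ℕ.≤-refl f f≡0) (times var-f)

        M₁ E₁ : ℚ
        M₁ = ι (p₁ ℕ.* 2) + ι (p₁ ℕ.* 2)
        E₁ = W * (M₁ + M₁) + W * (M₁ + M₁)

        run₈ : ∀ a k → ∣ ∑ k (λ l → f (a ℕ.+ l ℕ.* 8)) ∣ ≤ M₁
        run₈ a k = ≤-trans (balanced-run 8 A 0≤A A≤1 p₁ a k) (+-mono-≤ le le)
          where le = ι-mono (ℕ.m≤m*n p₁ 2)

        C₀₂≤ : ∣ L (λ b l → Z₀ b l * Z₂ b l) ∣ ≤ ι m * E₁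
        C₀₂≤ = T0.correlation f f 2 8 4 M₁ C₀₂≤-identity f≤1 f≡0 run₈
        C₀₁≤ : ∣ L (λ b l → Z₀ b l * X b l) ∣ ≤ ι m * E₁
        C₀₁≤ = T0.correlation f f̃ 1 4 1 M₁ C₀₁≤-identity f≤1 f≡0 (balanced-run 4 A 0≤A A≤1 (p₁ ℕ.* 2))
        C₁₂≤ : ∣ L (λ b l → X b l * Z₂ b l) ∣ ≤ ι m * E₁
        C₁₂≤ = T1.correlation f̃ f 2 4 3 M₁ C₁₂≤-identity f̃≤1 f̃≡0 (balanced₈-run₄ A 0≤A A≤1 p₁)

        winSum : ℕ → ℚ
        winSum b = ∑ Λ (λ l → ω l * i b l)
        winSum≈ : ∀ y → y ℕ.< m → ∣ winSum (b_ y) - ι n ∣ ≤ W + W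
        winSum≈ y y<m = subst (λ z → ∣ z - ι n ∣ ≤ W + W) (∑-ext Λ (λ l → *-comm (i (b_ y) l) (ω l))) (marginal 0 z≤n (b_ y) (b<n y y<m))

        S≤ : L i ≤ ι m * (ι n + (W + W))
        S≤ = ≤-trans (≤-reflexive (L≡ i)) (∑-≤const m _ (λ y y<m → ≤-from-∣-∣ (winSum≈ y y<m)))

        SB≤ : ∣ L (λ b l → B b * i b l) - ι n * β ∣ ≤ ι m * (W + W)
        SB≤ = subst (λ z → ∣ z ∣ ≤ ι m * (W + W)) (sym eq) (∣∑∣≤ m (W + W) (λ y y<m → ≤-trans
            (∣p*q∣≤ (≤-trans (≤-reflexive (0≤p⇒∣p∣≡p (0≤B (b_ y)))) (B≤1 (b_ y))) (winSum≈ y y<m)) (≤-reflexive (*-identityˡ (W + W)))))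
          where
          eq : L (λ b l → B b * i b l) - ι n * β ≡ ∑ m (λ y → B (b_ y) * (winSum (b_ y) - ι n))
          eq = trans (cong₂ _-_ (L-B i) (sym (∑-* m (ι n) _))) (trans (sym (∑-- m _ _)) (∑-ext m (λ y → SB≤-identity (B (b_ y)) (winSum (b_ y)) (ι n))))

        R₁≤ : L (λ b l → (1ℚ - i b l) * ∣ X b l ∣) ≤ ι m * W
        R₁≤ = ≤-trans (≤-reflexive (L≡ (λ b l → (1ℚ - i b l) * ∣ X b l ∣))) (∑-≤const m W (λ y _ → straddle n Λ 2n≤4Λ² 1 (s≤s z≤n) f̃ f̃≤1 f̃≡0 (b_ y)))
        R₂≤ : L (λ b l → (1ℚ - i b l) * ∣ Z₂ b l ∣) ≤ ι m * W
        R₂≤ = ≤-trans (≤-reflexive (L≡ (λ b l → (1ℚ - i b l) * ∣ Z₂ b l ∣))) (∑-≤const m W (λ y _ → straddle n Λ 2n≤4Λ² 2 ℕ.≤-refl f f≤1 f≡0 (b_ y)))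

        η : ℚ
        η = ι m * bE + εφ

        0≤bE : 0ℚ ≤ bE
        0≤bE = 0≤* (0≤ι T) (0≤+ (0≤+ 0≤W 0≤W) (0≤+ (0≤* 0≤W (0≤+ (0≤ι 2) (0≤ι 2))) (0≤* 0≤W (0≤+ (0≤ι 2) (0≤ι 2)))))

        0≤η : 0ℚ ≤ η
        0≤η = 0≤+ (0≤* (0≤ι m) 0≤bE) 0≤εφ

        at-- : ∀ F G b c → at (λ a → F a - G a) b c ≡ at F b c - at G b c
        at-- F G = at-map₂ _-_ refl F G

        -- The big blocks contribute the density v, the difference of the scales is small on average.
        main-term : ∀ h D₁ D₂ v r → classSum r ≡ ι m * v →
          (∀ y → y ℕ.< m → ι 4 * classSum r - bE ≤ ∑ Λ (λ l → ω l * at D₂ (b_ y) (sq h l))) →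
          - εφ ≤ ∑ n (λ b → (cls s b * B b) * ∑ Λ (λ l → ω l * at (λ a → D₁ a - D₂ a) b (sq h l))) →
          v * (ι n * β) - η ≤ L (λ b l → B b * at D₁ b (sq h l))
        main-term h D₁ D₂ v r v≡ blocks equi = ≤-trans (≤-reflexive (main-term-identity₃ (v * (ι n * β)) (ι m * bE) εφ))
          (≤-trans (+-mono-≤ part₂ (≤-trans equi (≤-reflexive equi≡))) (≤-reflexive (trans (sym (L-+ _ _)) (L-ext sumup))))
          where
          equi≡ : ∑ n (λ b → (cls s b * B b) * ∑ Λ (λ l → ω l * at (λ a → D₁ a - D₂ a) b (sq h l))) ≡ L (λ b l → B b * at (λ a → D₁ a - D₂ a) b (sq h l))
          equi≡ = ∑-ext n (λ b → trans (sym (∑-* Λ (cls s b * B b) _)) (trans (∑-ext Λ (λ l → sym (main-term-identity₂ (cls s b) (B b) (ω l) (at (λ a → D₁ a - D₂ a) b (sq h l))))) (∑-* Λ (cls s b) _)))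
          sumup : ∀ b l → B b * at D₂ b (sq h l) + B b * at (λ a → D₁ a - D₂ a) b (sq h l) ≡ B b * at D₁ b (sq h l)
          sumup b l = trans (cong (λ z → B b * at D₂ b (sq h l) + B b * z) (at-- D₁ D₂ b (sq h l))) (main-term-identity (B b) (at D₁ b (sq h l)) (at D₂ b (sq h l)))
          Vr : ℚ
          Vr = ι 4 * classSum r
          Vr≡ : Vr ≡ v * ι n
          Vr≡ = trans (cong₂ _*_ (ι≡/1 4) v≡) (trans (Vr≡-identity (ι m) v) (cong (v *_) (sym ιn)))
          part₂ : v * (ι n * β) - ι m * bE ≤ L (λ b l → B b * at D₂ b (sq h l))
          part₂ = ≤-trans (slack ((ι m - β) * bE) (0≤* (p≤q⇒0≤q-p β≤m) 0≤bE) (trans (cong (λ z → β * (z - bE) - (v * (ι n * β) - ι m * bE)) Vr≡) (part₂-identity β v (ι n) (ι m) bE)))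
            (subst₂ _≤_ (∑-*ʳ m (Vr - bE) _) (sym (L-B (λ b l → at D₂ b (sq h l)))) (∑-mono m (λ y y<m → *-monoˡ-≤-nonNeg (B (b_ y)) {{nonNegative (0≤B (b_ y))}} (blocks y y<m))))

        D₈≥ : e * (ι n * β) - η ≤ L (λ b l → B b * at (density 8 p₁ A) b (sq 0 l))
        D₈≥ = main-term 0 (density 8 p₁ A) (density 8 p₂ A) e r₀ e≡ (λ y y<m → MainTerms.even-main A 0≤A A≤1 n Λ 2n≤4Λ² A≡0 T p₂ n≡ (b_ y) (b<n y y<m) r₀ r₀<4 (proj₁ (even-class y)) (proj₂ (even-class y))) equi₈

        D₄≥ : u * (ι n * β) - η ≤ L (λ b l → B b * at (density 4 (p₁ ℕ.* 2) A) b (sq 1 l))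
        D₄≥ = main-term 1 (density 4 (p₁ ℕ.* 2) A) (density 4 (p₂ ℕ.* 2) A) u r₁ u≡ (λ y y<m → MainTerms.odd-main A 0≤A A≤1 n Λ 2n≤4Λ² A≡0 T (p₂ ℕ.* 2) (trans n≡ (cong (T ℕ.*_) (D₄≥-identity p₂))) (b_ y) (b<n y y<m) r₁ r₁<4 (odd-class y)) equi₄

        -- The last square of a window is the first square of the next, so the estimate at the first
        -- point carries over; shifting `l` by one costs 2W.
        D₈′≥ : e * (ι n * β) - η - ι m * (W + W) ≤ L (λ b l → B b * at (density 8 p₁ A) b (sq 2 l))
        D₈′≥ = ≤-trans (+-monoˡ-≤ (- (ι m * (W + W))) (≤-trans D₈≥ (≤-reflexive (L-B (λ b l → at D b (sq 0 l))))))
          (subst₂ _≤_ (trans (∑-- m _ _) (cong (λ z → ∑ m (λ y → B (b_ y) * ∑ Λ (λ l → ω l * at D (b_ y) (sq 0 l))) - z) (∑-const m (W + W)))) (sym (L-B (λ b l → at D b (sq 2 l)))) (∑-mono m each))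
          where
          D : ℕ → ℚ
          D = density 8 p₁ A
          each : ∀ y → y ℕ.< m → B (b_ y) * ∑ Λ (λ l → ω l * at D (b_ y) (sq 0 l)) - (W + W) ≤ B (b_ y) * ∑ Λ (λ l → ω l * at D (b_ y) (sq 2 l))
          each y y<m = slack (B (b_ y) * (s₂ - (s₀ - (W + W))) + (1ℚ - B (b_ y)) * (W + W))
              (0≤+ (0≤* (0≤B (b_ y)) (p≤q⇒0≤q-p (≥-from-∣-∣ {p = s₂} {q = s₀} near))) (0≤* (p≤q⇒0≤q-p (B≤1 (b_ y))) (0≤+ 0≤W 0≤W))) (each-identity₄ (B (b_ y)) s₂ s₀ (W + W))
            where
            s₀ s₂ : ℚ
            s₀ = ∑ Λ (λ l → ω l * at D (b_ y) (sq 0 l))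
            s₂ = ∑ Λ (λ l → ω l * at D (b_ y) (sq 2 l))
            ∣D∣≤1 : ∀ a → ∣ D a ∣ ≤ 1ℚ
            ∣D∣≤1 a = ≤-trans (≤-reflexive (0≤p⇒∣p∣≡p (0≤density 8 p₁ A 0≤A A≤1 a))) (density≤1 8 p₁ A 0≤A A≤1 a)
            far : ∀ l → Λ ℕ.≤ l → at D (b_ y) (sq 0 l) ≡ 0ℚ
            far l Λ≤l = at-support D n D₁≡0 (b_ y) (sq 0 l) (ℕ.≤-trans (a+n≤2n (ℕ.<⇒≤ (b<n y y<m))) (ℕ.≤-trans 2n≤4Λ² (ℕ.≤-trans (ℕ.≤-reflexive (far-identity Λ)) (sq-mono 0 Λ≤l))))
            near : ∣ s₂ - s₀ ∣ ≤ W + W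
            near = subst₂ (λ x z → ∣ x - s₀ ∣ ≤ z) (∑-ext Λ (λ l → cong (λ c → ω l * at D (b_ y) c) (each-identity₃ l)))
              (cong₂ _+_ one one)
              (shift (λ l → at D (b_ y) (sq 0 l)) (λ l → ∣at∣≤1 D ∣D∣≤1 (b_ y) (sq 0 l)) far 1 1≤Λ)
              where
              one : ι 1 * W ≡ W
              one = trans (cong (_* W) ι-1) (*-identityˡ W)

        -- The pairing of B with f splits into its pairing with A, which is small when there are few
        -- pairs, minus its pairing with the block averages, which is bounded below.
        count- : ∀ h D x → h ℕ.≤ 2 → x ≤ L (λ b l → B b * at D b (sq h l)) → L (λ b l → B b * at (λ a → A a - D a) b (sq h l)) ≤ W * C - x
        count- h D x h≤2 x≤ = ≤-trans (≤-reflexive (trans (L-ext (λ b l → trans (cong (B b *_) (at-- A D b (sq h l))) (count--identity (B b) (at A b (sq h l)) (at D b (sq h l))))) (L-- _ _)))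
          (+-mono-≤ (count≤ h h≤2) (neg-antimono-≤ x≤))

        BX≤ : L (λ b l → B b * X b l) ≤ W * C - u * (ι n * β) + η
        BX≤ = ≤-trans (count- 1 (density 4 (p₁ ℕ.* 2) A) _ (s≤s z≤n) D₄≥) (≤-reflexive (BX≤-identity (W * C) (u * (ι n * β)) η))
        BZ₀≤ : L (λ b l → B b * Z₀ b l) ≤ W * C - e * (ι n * β) + η
        BZ₀≤ = ≤-trans (count- 0 (density 8 p₁ A) _ z≤n D₈≥) (≤-reflexive (BZ₀≤-identity (W * C) (e * (ι n * β)) η))
        BZ₂≤ : L (λ b l → B b * Z₂ b l) ≤ W * C - e * (ι n * β) + η + ι m * (W + W)
        BZ₂≤ = ≤-trans (count- 2 (density 8 p₁ A) _ ℕ.≤-refl D₈′≥) (≤-reflexive (BZ₂≤-identity (W * C) (e * (ι n * β)) η (ι m * (W + W))))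

        k₁ k₂ k₃ k₄ k₅ k₆ : ℚ
        k₁ = (+ 4 / 1) * (cc * cc)
        k₂ = (+ 4 / 1) * (1ℚ - cc - cc)
        k₃ = (+ 4 / 1) * (w * w)
        k₄ = (+ 4 / 1) * w
        k₅ = - ((+ 8 / 1) * w * cc)
        k₆ = - ((+ 4 / 1) * cc)

        total : 0ℚ ≤ k₁ * L i + k₂ * L (λ b l → B b * i b l) + k₃ * L (λ b l → X b l * X b l)
          + (L (λ b l → Z₀ b l * Z₀ b l) + L (λ b l → Z₂ b l * Z₂ b l))
          + ((+ 2 / 1) * L (λ b l → Z₀ b l * Z₂ b l) + k₄ * L (λ b l → Z₀ b l * X b l) + k₄ * L (λ b l → X b l * Z₂ b l))
          + (k₅ * L X + k₆ * L Z₀ + k₆ * L Z₂)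
          + (((+ 8 / 1) * w) * L (λ b l → B b * X b l) + (+ 4 / 1) * L (λ b l → B b * Z₀ b l) + (+ 4 / 1) * L (λ b l → B b * Z₂ b l))
          + ((+ 8 / 1) * L (λ b l → (1ℚ - i b l) * ∣ X b l ∣) + (+ 4 / 1) * L (λ b l → (1ℚ - i b l) * ∣ Z₂ b l ∣))
        total = subst (0ℚ ≤_) linear (L-nonNeg _ (λ b l → expanded-square (0≤* 0≤w (p≤q⇒0≤q-p u≤1)) cc≤1 0≤w w≤1 (0≤B b) (B≤1 b) (i≤1 b l) (i² b l) (B²≡B b) (iZ b l)))
          where
          0≤w : 0ℚ ≤ w
          0≤w = p≤q⇒0≤q-p e≤1
          w≤1 : w ≤ 1ℚ
          w≤1 = slack e 0≤e (w≤1-identity e)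
          cc≤1 : cc ≤ 1ℚ
          cc≤1 = slack (e + (1ℚ - e) * u) (0≤+ 0≤e (0≤* 0≤w 0≤u)) (cc≤1-identity e u)
          i≤1 : ∀ b l → i b l ≤ 1ℚ
          i≤1 b l = at-elim (_≤ 1ℚ) (λ a → lt a n) b (sq 0 l) (nonNegative⁻¹ 1ℚ) (λ a → proj₂ (0≤lt≤1 a n))
          i² : ∀ b l → i b l * i b l ≡ i b l
          i² b l = at-elim (λ x → x * x ≡ x) (λ a → lt a n) b (sq 0 l) refl (λ a → lt²≡lt a n)
          -- `i` tests the first square of the window, the one at which `Z₀` is evaluated, so it is
          -- 1 wherever `Z₀` is not 0. For the other two points the discrepancy is estimated by
          -- `straddle`.
          iZ : ∀ b l → i b l * Z₀ b l ≡ Z₀ b l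
          iZ b l = trans (sym (at-map₂ _*_ refl (λ a → lt a n) f b (sq 0 l))) (at-ext inside b (sq 0 l))
            where
            inside : ∀ a → lt a n * f a ≡ f a
            inside a with a ℕ.<? n
            ... | yes a<n = trans (cong (_* f a) (lt-yes a<n)) (*-identityˡ (f a))
            ... | no  a≮n = trans (cong (lt a n *_) (f≡0 a (ℕ.≮⇒≥ a≮n))) (trans (*-zeroʳ (lt a n)) (sym (f≡0 a (ℕ.≮⇒≥ a≮n))))
          _⊹_ : ∀ {F G x y} → L F ≡ x → L G ≡ y → L (λ b l → F b l + G b l) ≡ x + y
          _⊹_ {F} {G} p q = trans (L-+ F G) (cong₂ _+_ p q)
          linear : _ ≡ _
          linear = ((((((L-* k₁ i ⊹ L-* k₂ (λ b l → B b * i b l)) ⊹ L-* k₃ (λ b l → X b l * X b l))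
            ⊹ (refl {x = L (λ b l → Z₀ b l * Z₀ b l)} ⊹ refl {x = L (λ b l → Z₂ b l * Z₂ b l)}))
            ⊹ ((L-* (+ 2 / 1) (λ b l → Z₀ b l * Z₂ b l) ⊹ L-* k₄ (λ b l → Z₀ b l * X b l)) ⊹ L-* k₄ (λ b l → X b l * Z₂ b l)))
            ⊹ ((L-* k₅ X ⊹ L-* k₆ Z₀) ⊹ L-* k₆ Z₂))
            ⊹ ((L-* ((+ 8 / 1) * w) (λ b l → B b * X b l) ⊹ L-* (+ 4 / 1) (λ b l → B b * Z₀ b l)) ⊹ L-* (+ 4 / 1) (λ b l → B b * Z₂ b l)))
            ⊹ (L-* (+ 8 / 1) (λ b l → (1ℚ - i b l) * ∣ X b l ∣) ⊹ L-* (+ 4 / 1) (λ b l → (1ℚ - i b l) * ∣ Z₂ b l ∣))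

      estimate : (+ 4 / 1) * (ι n * β) ≤ (+ 4 / 1) * (ι n * ι m * T₁ u e)
        + ((+ 16 / 1) * (W * C) + (+ 72 / 1) * (ι m * W) + (+ 10 / 1) * (ι m * (W * ((ι (p₁ ℕ.* 2) + ι (p₁ ℕ.* 2)) + (ι (p₁ ℕ.* 2) + ι (p₁ ℕ.* 2))) + W * ((ι (p₁ ℕ.* 2) + ι (p₁ ℕ.* 2)) + (ι (p₁ ℕ.* 2) + ι (p₁ ℕ.* 2)))))
          + (+ 16 / 1) * (ι m * bE + εφ))
      estimate = collect {M = ι m} {N = ι n} {W = W} {E = E₁} {C = C} {β = β} {η = η} 0≤e e≤1 0≤u u≤1 (0≤* (0≤ι m) 0≤W) (0≤* 0≤W 0≤C) 0≤η S≤ SB≤ V₁≤ V₀≤ V₂≤ C₀₂≤ C₀₁≤ C₁₂≤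
        (T1.linear (s≤s z≤n) f̃ f̃≤1 f̃≡0 ∑f̃) (T0.linear z≤n f f≤1 f≡0 ∑f) (T2.linear ℕ.≤-refl f f≤1 f≡0 ∑f) BX≤ BZ₀≤ BZ₂≤ R₁≤ R₂≤ total

-- Residues of squares, and the two-sided density bound

module Residues where

  open Data.Rational.Base
  open Data.Rational.Properties
  open Rationals
  open Averages
  open Windows
  open Transference
  open DensityInequality

  -- Adding b * q completes `b` to b * (q + 1), which vanishes modulo q + 1; this replaces a
  -- subtraction.
  %-cancelˡ : ∀ q b x y → (b ℕ.+ x) ℕ.% suc q ≡ (b ℕ.+ y) ℕ.% suc q → x ℕ.% suc q ≡ y ℕ.% suc q
  %-cancelˡ q b x y eq = trans (back x) (trans (cong (λ z → (b ℕ.* q ℕ.% suc q ℕ.+ z) ℕ.% suc q) eq) (sym (back y)))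
    where
    ring : ∀ q b x → x ℕ.+ b ℕ.* suc q ≡ b ℕ.* q ℕ.+ (b ℕ.+ x)
    ring = ℕ.solve-∀
    back : ∀ x → x ℕ.% suc q ≡ (b ℕ.* q ℕ.% suc q ℕ.+ (b ℕ.+ x) ℕ.% suc q) ℕ.% suc q
    back x = trans (sym (ℕ.[m+kn]%n≡m%n x b (suc q))) (trans (cong (ℕ._% suc q) (ring q b x)) (ℕ.%-distribˡ-+ (b ℕ.* q) (b ℕ.+ x) (suc q)))

  %-determined : ∀ {a b s r t} → r ℕ.< 4 → (s ℕ.+ r) ℕ.% 4 ≡ t → (a ℕ.+ b) ℕ.% 4 ≡ t → b ℕ.% 4 ≡ s → a ℕ.% 4 ≡ r
  %-determined {a} {b} {s} {r} {t} r<4 sr≡t ab≡t b≡s = trans (%-cancelˡ 3 b a r (trans (cong (ℕ._% 4) (ℕ.+-comm b a)) (trans ab≡t (sym br≡t)))) (ℕ.m<n⇒m%n≡m r<4)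
    where
    br≡t : (b ℕ.+ r) ℕ.% 4 ≡ t
    br≡t = trans (ℕ.%-distribˡ-+ b r 4) (trans (cong₂ (λ x y → (x ℕ.+ y) ℕ.% 4) b≡s (ℕ.m<n⇒m%n≡m r<4)) sr≡t)

  cls-swap : ∀ {a b s r t} → s ℕ.< 4 → r ℕ.< 4 → (s ℕ.+ r) ℕ.% 4 ≡ t → (a ℕ.+ b) ℕ.% 4 ≡ t → cls s b ≡ cls r a
  cls-swap {a} {b} {s} {r} {t} s<4 r<4 sr≡t ab≡t with b ℕ.% 4 ℕ.≟ s
  ... | yes b≡s = trans (trans (cong (λ z → δ z s) b≡s) (δ-refl s)) (sym (trans (cong (λ z → δ z r) (%-determined {a} {b} r<4 sr≡t ab≡t b≡s)) (δ-refl r)))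
  ... | no  b≢s = trans (δ-≢ b≢s) (sym (δ-≢ (λ a≡r → b≢s (%-determined {b} {a} s<4 (trans (cong (ℕ._% 4) (ℕ.+-comm r s)) sr≡t) (trans (cong (ℕ._% 4) (ℕ.+-comm b a)) ab≡t) a≡r))))

  sq₀%4 : ∀ l → sq 0 l ℕ.% 4 ≡ 0
  sq₀%4 l = trans (cong (ℕ._% 4) (eq l)) (ℕ.m*n%n≡0 (l ℕ.* l) 4)
    where
    eq : ∀ l → (2 ℕ.* l ℕ.+ 0) ℕ.* (2 ℕ.* l ℕ.+ 0) ≡ l ℕ.* l ℕ.* 4
    eq = ℕ.solve-∀

  sq₁%4 : ∀ l → sq 1 l ℕ.% 4 ≡ 1
  sq₁%4 l = trans (cong (ℕ._% 4) (eq l)) (ℕ.[m+kn]%n≡m%n 1 (l ℕ.* l ℕ.+ l) 4)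
    where
    eq : ∀ l → (2 ℕ.* l ℕ.+ 1) ℕ.* (2 ℕ.* l ℕ.+ 1) ≡ 1 ℕ.+ (l ℕ.* l ℕ.+ l) ℕ.* 4
    eq = ℕ.solve-∀

  l²%2 : ∀ l → (l ℕ.* l) ℕ.% 2 ≡ l ℕ.% 2
  l²%2 l = trans (ℕ.%-distribˡ-* l l 2) (bit (l ℕ.% 2) (ℕ.m%n<n l 2))
    where
    bit : ∀ x → x ℕ.< 2 → (x ℕ.* x) ℕ.% 2 ≡ x
    bit 0 _ = refl
    bit 1 _ = refl
    bit (suc (suc _)) (s≤s (s≤s ()))

  module Classes (s r₀ r₁ t : ℕ) (s<4 : s ℕ.< 4) (r₀<4 : r₀ ℕ.< 4) (r₁<4 : r₁ ℕ.< 4)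
    (s+r₀≡4t : s ℕ.+ r₀ ≡ t ℕ.* 4) (s+r₁≡1 : (s ℕ.+ r₁) ℕ.% 4 ≡ 1) where

    class₀ : ∀ a b l → a ℕ.+ b ≡ sq 0 l → cls s b ≡ cls r₀ a
    class₀ a b l eq = cls-swap {a} {b} s<4 r₀<4 (trans (cong (ℕ._% 4) s+r₀≡4t) (ℕ.m*n%n≡0 t 4)) (trans (cong (ℕ._% 4) eq) (sq₀%4 l))

    class₁ : ∀ a b l → a ℕ.+ b ≡ sq 1 l → cls s b ≡ cls r₁ a
    class₁ a b l eq = cls-swap {a} {b} s<4 r₁<4 s+r₁≡1 (trans (cong (ℕ._% 4) eq) (sq₁%4 l))

    odd-class : ∀ y l a → (y ℕ.* 4 ℕ.+ s) ℕ.+ a ≡ sq 1 l → a ℕ.% 4 ≡ r₁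
    odd-class y l a eq = %-determined {a} {y ℕ.* 4 ℕ.+ s} r₁<4 s+r₁≡1 (trans (cong (ℕ._% 4) (trans (ℕ.+-comm a (y ℕ.* 4 ℕ.+ s)) eq)) (sq₁%4 l)) ([κ*p+j]%p 4 y s<4)

    -- Modulo 8 the square (2l)² = 4l² is congruent to 4l, since l² and l have the same parity. For
    -- b = 4y + s and s + r₀ = 4t this makes (2l)² - b alternate between r₀ and r₀ + 4, with phase y
    -- + t.
    even-class : ∀ y → ∃[ flip ] (∀ l a → (y ℕ.* 4 ℕ.+ s) ℕ.+ a ≡ sq 0 l → a ℕ.% 8 ≡ r₀ ℕ.+ 4 ℕ.* ((flip ℕ.+ l) ℕ.% 2))
    even-class y = y ℕ.+ t , λ l a eq →
      let ε = (y ℕ.+ t ℕ.+ l) ℕ.% 2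
          ε<2 = ℕ.m%n<n (y ℕ.+ t ℕ.+ l) 2
          r′<8 : r₀ ℕ.+ 4 ℕ.* ε ℕ.< 8
          r′<8 = ℕ.+-mono-<-≤ r₀<4 (ℕ.*-monoʳ-≤ 4 (ℕ.≤-pred ε<2))
      in trans (%-cancelˡ 7 (y ℕ.* 4 ℕ.+ s) a (r₀ ℕ.+ 4 ℕ.* ε) (trans (cong (ℕ._% 8) eq) (sym (same l)))) (ℕ.m<n⇒m%n≡m r′<8)
      where
      same : ∀ l → ((y ℕ.* 4 ℕ.+ s) ℕ.+ (r₀ ℕ.+ 4 ℕ.* ((y ℕ.+ t ℕ.+ l) ℕ.% 2))) ℕ.% 8 ≡ sq 0 l ℕ.% 8
      same l = trans (cong (ℕ._% 8) (trans (e₁ y s r₀ ε) (trans (cong (λ z → y ℕ.* 4 ℕ.+ z ℕ.+ ε ℕ.* 4) s+r₀≡4t) (e₂ y t ε))))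
        (trans (sym (ℕ.m%n*o≡m*o%[n*o] (y ℕ.+ t ℕ.+ ε) 2 4)) (trans (cong (ℕ._* 4) parity)
          (trans (ℕ.m%n*o≡m*o%[n*o] (l ℕ.* l) 2 4) (cong (ℕ._% 8) (sym (e₃ l))))))
        where
        ε : ℕ
        ε = (y ℕ.+ t ℕ.+ l) ℕ.% 2
        e₁ : ∀ y s r ε → (y ℕ.* 4 ℕ.+ s) ℕ.+ (r ℕ.+ 4 ℕ.* ε) ≡ y ℕ.* 4 ℕ.+ (s ℕ.+ r) ℕ.+ ε ℕ.* 4
        e₁ = ℕ.solve-∀
        e₂ : ∀ y t ε → y ℕ.* 4 ℕ.+ t ℕ.* 4 ℕ.+ ε ℕ.* 4 ≡ (y ℕ.+ t ℕ.+ ε) ℕ.* 4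
        e₂ = ℕ.solve-∀
        e₃ : ∀ l → (2 ℕ.* l ℕ.+ 0) ℕ.* (2 ℕ.* l ℕ.+ 0) ≡ l ℕ.* l ℕ.* 4
        e₃ = ℕ.solve-∀
        e₄ : ∀ z l → z ℕ.+ (z ℕ.+ l) ≡ l ℕ.+ z ℕ.* 2
        e₄ = ℕ.solve-∀
        z : ℕ
        z = y ℕ.+ t
        parity : (z ℕ.+ ε) ℕ.% 2 ≡ (l ℕ.* l) ℕ.% 2
        parity = trans (ℕ.%-distribˡ-+ z ε 2) (trans (cong (λ x → (z ℕ.% 2 ℕ.+ x) ℕ.% 2) (ℕ.m%n%n≡m%n (z ℕ.+ l) 2))
          (trans (sym (ℕ.%-distribˡ-+ z (z ℕ.+ l) 2)) (trans (cong (ℕ._% 2) (e₄ z l)) (trans (ℕ.[m+kn]%n≡m%n l z 2) (sym (l²%2 l))))))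

  maximum : ∀ (a b c d : ℚ) → (b ≤ a × c ≤ a × d ≤ a) ⊎ (a ≤ b × c ≤ b × d ≤ b) ⊎ (a ≤ c × b ≤ c × d ≤ c) ⊎ (a ≤ d × b ≤ d × c ≤ d)
  maximum a b c d with ≤-total a b | ≤-total c d
  ... | inj₁ a≤b | inj₁ c≤d with ≤-total b d
  ...   | inj₁ b≤d = inj₂ (inj₂ (inj₂ (≤-trans a≤b b≤d , b≤d , c≤d)))
  ...   | inj₂ d≤b = inj₂ (inj₁ (a≤b , ≤-trans c≤d d≤b , d≤b))
  maximum a b c d | inj₁ a≤b | inj₂ d≤c with ≤-total b c
  ...   | inj₁ b≤c = inj₂ (inj₂ (inj₁ (≤-trans a≤b b≤c , b≤c , d≤c)))
  ...   | inj₂ c≤b = inj₂ (inj₁ (a≤b , c≤b , ≤-trans d≤c c≤b))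
  maximum a b c d | inj₂ b≤a | inj₁ c≤d with ≤-total a d
  ...   | inj₁ a≤d = inj₂ (inj₂ (inj₂ (a≤d , ≤-trans b≤a a≤d , c≤d)))
  ...   | inj₂ d≤a = inj₁ (b≤a , ≤-trans c≤d d≤a , d≤a)
  maximum a b c d | inj₂ b≤a | inj₂ d≤c with ≤-total a c
  ...   | inj₁ a≤c = inj₂ (inj₂ (inj₁ (a≤c , ≤-trans b≤a a≤c , d≤c)))
  ...   | inj₂ c≤a = inj₁ (b≤a , c≤a , ≤-trans d≤c c≤a)

  record Unit (x : ℚ) : Set where
    constructor unit
    field
      0≤ : 0ℚ ≤ x
      ≤1 : x ≤ 1ℚ

  open Unit

  x-dominates-identity : ∀ a b c d → a + b + c + d ≡ d + a + b + c
  x-dominates-identity = solve-∀ ℚ-ring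

  x-dominates-identity₂ : ∀ a b c d → b + c + d + a ≡ a + b + c + d
  x-dominates-identity₂ = solve-∀ ℚ-ring

  x-dominates-identity₃ : ∀ a b c d → a + b + c + d ≡ c + d + a + b
  x-dominates-identity₃ = solve-∀ ℚ-ring

  x-dominates-identity₄ : ∀ a b c d → c + d + a + b ≡ a + b + c + d
  x-dominates-identity₄ = solve-∀ ℚ-ring

  x-dominates-identity₅ : ∀ a b c d → a + b + c + d ≡ b + c + d + a
  x-dominates-identity₅ = solve-∀ ℚ-ring

  x-dominates-identity₆ : ∀ a b c d → d + a + b + c ≡ a + b + c + d
  x-dominates-identity₆ = solve-∀ ℚ-ring

  dominated-identity : ∀ a b c d → a + b + c + d ≡ a + d + c + b
  dominated-identity = solve-∀ ℚ-ring

  dominated-identity₂ : ∀ a b c d → b + a + d + c ≡ a + b + c + d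
  dominated-identity₂ = solve-∀ ℚ-ring

  module _ {ζ : ℚ} (0≤ζ : 0ℚ ≤ ζ) (ζ≤⅒ : ζ ≤ + 1 / 10) where

    dominated : ∀ {x₀ x₁ x₂ x₃ y₀ y₁ y₂ y₃} → Unit x₀ → Unit x₁ → Unit x₂ → Unit x₃ → Unit y₀ → Unit y₁ →
      x₁ ≤ x₀ → x₂ ≤ x₀ → x₃ ≤ x₀ → y₀ ≤ x₀ →
      x₀ ≤ T₁ y₁ y₀ + ζ → y₃ ≤ T₁ x₂ x₁ + ζ → y₂ ≤ T₁ x₃ x₂ + ζ →
      + 3 / 2 ≤ x₀ + x₁ + x₂ + x₃ → y₀ + y₁ + y₂ + y₃ ≤ (+ 3 / 2) + (+ 6 / 1) * ζ
    dominated {x₀} {x₁} {x₂} {x₃} {y₀} {y₁} {y₂} {y₃} u₀ u₁ u₂ u₃ v₀ v₁ x₁≤ x₂≤ x₃≤ y₀≤ h₀ h₃ h₂ Σ≥ =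
      subst (_≤ (+ 3 / 2) + (+ 6 / 1) * ζ) (dominated-identity₂ y₀ y₁ y₂ y₃)
        (ring-bound ζ≤⅒ 0≤ζ (≤1 u₀) (0≤ u₂) (0≤ u₁) (0≤ v₁) (0≤ v₀) x₃≤ x₂≤ x₁≤ y₀≤ h₀ h₃ h₂
          (subst (+ 3 / 2 ≤_) (dominated-identity x₀ x₁ x₂ x₃) Σ≥))

    module _ {x₀ x₁ x₂ x₃ y₀ y₁ y₂ y₃ : ℚ} (u₀ : Unit x₀) (u₁ : Unit x₁) (u₂ : Unit x₂) (u₃ : Unit x₃)
      (v₀ : Unit y₀) (v₁ : Unit y₁) (v₂ : Unit y₂) (v₃ : Unit y₃)
      (hx₀ : x₀ ≤ T₁ y₁ y₀ + ζ) (hx₁ : x₁ ≤ T₁ y₀ y₃ + ζ) (hx₂ : x₂ ≤ T₁ y₃ y₂ + ζ) (hx₃ : x₃ ≤ T₁ y₂ y₁ + ζ)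
      (hy₀ : y₀ ≤ T₁ x₁ x₀ + ζ) (hy₁ : y₁ ≤ T₁ x₀ x₃ + ζ) (hy₂ : y₂ ≤ T₁ x₃ x₂ + ζ) (hy₃ : y₃ ≤ T₁ x₂ x₁ + ζ)
      (Σx≥ : + 3 / 2 ≤ x₀ + x₁ + x₂ + x₃) where

      -- The eight relations are preserved when all indices of x are raised by one and all indices
      -- of y are lowered by one modulo 4, so the class of the largest density may be moved to 0.
      x-dominates : ∀ {q} → y₀ ≤ q → y₁ ≤ q → y₂ ≤ q → y₃ ≤ q → (q ≤ x₀ ⊎ q ≤ x₁ ⊎ q ≤ x₂ ⊎ q ≤ x₃) → y₀ + y₁ + y₂ + y₃ ≤ (+ 3 / 2) + (+ 6 / 1) * ζ
      x-dominates {q} l₀ l₁ l₂ l₃ q≤ with maximum x₀ x₁ x₂ x₃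
      ... | inj₁ (a , b , c) = dominated u₀ u₁ u₂ u₃ v₀ v₁ a b c (≤-trans l₀ (top q≤)) hx₀ hy₃ hy₂ Σx≥
        where
        top : q ≤ x₀ ⊎ q ≤ x₁ ⊎ q ≤ x₂ ⊎ q ≤ x₃ → q ≤ x₀
        top (inj₁ h) = h
        top (inj₂ (inj₁ h)) = ≤-trans h a
        top (inj₂ (inj₂ (inj₁ h))) = ≤-trans h b
        top (inj₂ (inj₂ (inj₂ h))) = ≤-trans h c
      ... | inj₂ (inj₁ (a , b , c)) = subst (_≤ (+ 3 / 2) + (+ 6 / 1) * ζ) (x-dominates-identity₆ y₀ y₁ y₂ y₃)
          (dominated u₁ u₂ u₃ u₀ v₃ v₀ b c a (≤-trans l₃ (top q≤)) hx₁ hy₂ hy₁ (subst (+ 3 / 2 ≤_) (x-dominates-identity₅ x₀ x₁ x₂ x₃) Σx≥))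
        where
        top : q ≤ x₀ ⊎ q ≤ x₁ ⊎ q ≤ x₂ ⊎ q ≤ x₃ → q ≤ x₁
        top (inj₁ h) = ≤-trans h a
        top (inj₂ (inj₁ h)) = h
        top (inj₂ (inj₂ (inj₁ h))) = ≤-trans h b
        top (inj₂ (inj₂ (inj₂ h))) = ≤-trans h c
      ... | inj₂ (inj₂ (inj₁ (a , b , c))) = subst (_≤ (+ 3 / 2) + (+ 6 / 1) * ζ) (x-dominates-identity₄ y₀ y₁ y₂ y₃)
          (dominated u₂ u₃ u₀ u₁ v₂ v₃ c a b (≤-trans l₂ (top q≤)) hx₂ hy₁ hy₀ (subst (+ 3 / 2 ≤_) (x-dominates-identity₃ x₀ x₁ x₂ x₃) Σx≥))
        where
        top : q ≤ x₀ ⊎ q ≤ x₁ ⊎ q ≤ x₂ ⊎ q ≤ x₃ → q ≤ x₂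
        top (inj₁ h) = ≤-trans h a
        top (inj₂ (inj₁ h)) = ≤-trans h b
        top (inj₂ (inj₂ (inj₁ h))) = h
        top (inj₂ (inj₂ (inj₂ h))) = ≤-trans h c
      ... | inj₂ (inj₂ (inj₂ (a , b , c))) = subst (_≤ (+ 3 / 2) + (+ 6 / 1) * ζ) (x-dominates-identity₂ y₀ y₁ y₂ y₃)
          (dominated u₃ u₀ u₁ u₂ v₁ v₂ a b c (≤-trans l₁ (top q≤)) hx₃ hy₀ hy₃ (subst (+ 3 / 2 ≤_) (x-dominates-identity x₀ x₁ x₂ x₃) Σx≥))
        where
        top : q ≤ x₀ ⊎ q ≤ x₁ ⊎ q ≤ x₂ ⊎ q ≤ x₃ → q ≤ x₃
        top (inj₁ h) = ≤-trans h a
        top (inj₂ (inj₁ h)) = ≤-trans h b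
        top (inj₂ (inj₂ (inj₁ h))) = ≤-trans h c
        top (inj₂ (inj₂ (inj₂ h))) = h

    max-of : ∀ a b c d → ∃[ q ] a ≤ q × b ≤ q × c ≤ q × d ≤ q × (q ≤ a ⊎ q ≤ b ⊎ q ≤ c ⊎ q ≤ d)
    max-of a b c d with maximum a b c d
    ... | inj₁ (x , y , z)               = a , ≤-refl , x , y , z , inj₁ ≤-refl
    ... | inj₂ (inj₁ (x , y , z))        = b , x , ≤-refl , y , z , inj₂ (inj₁ ≤-refl)
    ... | inj₂ (inj₂ (inj₁ (x , y , z))) = c , x , y , ≤-refl , z , inj₂ (inj₂ (inj₁ ≤-refl))
    ... | inj₂ (inj₂ (inj₂ (x , y , z))) = d , x , y , z , ≤-refl , inj₂ (inj₂ (inj₂ ≤-refl))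

    raise : ∀ {p q a b c d} → p ≤ q → q ≤ a ⊎ q ≤ b ⊎ q ≤ c ⊎ q ≤ d → p ≤ a ⊎ p ≤ b ⊎ p ≤ c ⊎ p ≤ d
    raise p≤q (inj₁ h)               = inj₁ (≤-trans p≤q h)
    raise p≤q (inj₂ (inj₁ h))        = inj₂ (inj₁ (≤-trans p≤q h))
    raise p≤q (inj₂ (inj₂ (inj₁ h))) = inj₂ (inj₂ (inj₁ (≤-trans p≤q h)))
    raise p≤q (inj₂ (inj₂ (inj₂ h))) = inj₂ (inj₂ (inj₂ (≤-trans p≤q h)))

    -- The set that contains the largest of the eight densities controls the total of the other set.
    -- It is not known in advance which one this is, hence the alternative in the conclusion.
    two-sided : ∀ {x₀ x₁ x₂ x₃ y₀ y₁ y₂ y₃ : ℚ} → Unit x₀ → Unit x₁ → Unit x₂ → Unit x₃ → Unit y₀ → Unit y₁ → Unit y₂ → Unit y₃ →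
      x₀ ≤ T₁ y₁ y₀ + ζ → x₁ ≤ T₁ y₀ y₃ + ζ → x₂ ≤ T₁ y₃ y₂ + ζ → x₃ ≤ T₁ y₂ y₁ + ζ →
      y₀ ≤ T₁ x₁ x₀ + ζ → y₁ ≤ T₁ x₀ x₃ + ζ → y₂ ≤ T₁ x₃ x₂ + ζ → y₃ ≤ T₁ x₂ x₁ + ζ →
      + 3 / 2 ≤ x₀ + x₁ + x₂ + x₃ → + 3 / 2 ≤ y₀ + y₁ + y₂ + y₃ →
      y₀ + y₁ + y₂ + y₃ ≤ (+ 3 / 2) + (+ 6 / 1) * ζ ⊎ x₀ + x₁ + x₂ + x₃ ≤ (+ 3 / 2) + (+ 6 / 1) * ζ
    two-sided {x₀} {x₁} {x₂} {x₃} {y₀} {y₁} {y₂} {y₃} u₀ u₁ u₂ u₃ v₀ v₁ v₂ v₃ hx₀ hx₁ hx₂ hx₃ hy₀ hy₁ hy₂ hy₃ Σx Σy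
      with max-of x₀ x₁ x₂ x₃ | max-of y₀ y₁ y₂ y₃
    ... | p , k₀ , k₁ , k₂ , k₃ , p≤ | q , l₀ , l₁ , l₂ , l₃ , q≤ with ≤-total q p
    ...   | inj₁ q≤p = inj₁ (x-dominates u₀ u₁ u₂ u₃ v₀ v₁ v₂ v₃ hx₀ hx₁ hx₂ hx₃ hy₀ hy₁ hy₂ hy₃ Σx l₀ l₁ l₂ l₃ (raise q≤p p≤))
    ...   | inj₂ p≤q = inj₂ (x-dominates v₀ v₁ v₂ v₃ u₀ u₁ u₂ u₃ hy₀ hy₁ hy₂ hy₃ hx₀ hx₁ hx₂ hx₃ Σy k₀ k₁ k₂ k₃ (raise p≤q q≤))

-- Indicators, pairs and weighted counts

module Counting where

  open Data.Rational.Base hiding (∣_∣)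
  open Data.Rational.Properties
  open Rationals
  open Sums
  open Windows
  open Transference
  open Estimates
  open Defs using (S?; #squarePairs; ⟦_⟧)

  ∑-front : ∀ n F → ∑ (suc n) F ≡ F 0 + ∑ n (λ i → F (suc i))
  ∑-front n F = trans (∑-++ 1 n F) (cong (_+ ∑ n (λ i → F (suc i))) (+-identityˡ (F 0)))

  opaque
    [_]ᵈ : ∀ {P : Set} → Dec P → ℚ
    [ yes _ ]ᵈ = 1ℚ
    [ no  _ ]ᵈ = 0ℚ

    [yes] : ∀ {P : Set} (d : Dec P) → P → [ d ]ᵈ ≡ 1ℚ
    [yes] (yes _) p = refl
    [yes] (no ¬p) p = contradiction p ¬p

    [no] : ∀ {P : Set} (d : Dec P) → ¬ P → [ d ]ᵈ ≡ 0ℚ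
    [no] (yes p) ¬p = contradiction p ¬p
    [no] (no _)  ¬p = refl

    0≤[] : ∀ {P : Set} (d : Dec P) → 0ℚ ≤ [ d ]ᵈ
    0≤[] (yes _) = nonNegative⁻¹ 1ℚ
    0≤[] (no  _) = ≤-refl

    []≤1 : ∀ {P : Set} (d : Dec P) → [ d ]ᵈ ≤ 1ℚ
    []≤1 (yes _) = ≤-refl
    []≤1 (no  _) = nonNegative⁻¹ 1ℚ

    []² : ∀ {P : Set} (d : Dec P) → [ d ]ᵈ * [ d ]ᵈ ≡ [ d ]ᵈ
    []² (yes _) = refl
    []² (no  _) = refl

    [⇔] : ∀ {P Q : Set} (d : Dec P) (d′ : Dec Q) → (P → Q) → (Q → P) → [ d ]ᵈ ≡ [ d′ ]ᵈ
    [⇔] (yes p) (yes q) f g = refl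
    [⇔] (yes p) (no ¬q) f g = contradiction (f p) ¬q
    [⇔] (no ¬p) (yes q) f g = contradiction (g q) ¬p
    [⇔] (no ¬p) (no ¬q) f g = refl

    [×] : ∀ {P Q : Set} (d : Dec P) (d′ : Dec Q) → [ d ×-dec d′ ]ᵈ ≡ [ d ]ᵈ * [ d′ ]ᵈ
    [×] (yes p) (yes q) = refl
    [×] (yes p) (no ¬q) = refl
    [×] (no ¬p) (yes q) = refl
    [×] (no ¬p) (no ¬q) = refl

  -- Extends the indicator of the i + 1 with i ∈ X by zero.
  indicator : ∀ {N} → Subset N → ℕ → ℚ
  indicator {N} X zero    = 0ℚ
  indicator {N} X (suc a) with a ℕ.<? N
  ... | yes a<N = [ F.fromℕ< a<N ∈? X ]ᵈ
  ... | no  _   = 0ℚ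

  ∑L : ∀ {A : Set} → (A → ℚ) → List A → ℚ
  ∑L f []       = 0ℚ
  ∑L f (x ∷ xs) = f x + ∑L f xs

  ∑L-++ : ∀ {A : Set} (f : A → ℚ) xs ys → ∑L f (xs ++ ys) ≡ ∑L f xs + ∑L f ys
  ∑L-++ f []       ys = sym (+-identityˡ (∑L f ys))
  ∑L-++ f (x ∷ xs) ys = trans (cong (λ z → f x + z) (∑L-++ f xs ys)) (sym (+-assoc (f x) (∑L f xs) (∑L f ys)))

  ∑L-map : ∀ {A B : Set} (f : B → ℚ) (g : A → B) xs → ∑L f (map g xs) ≡ ∑L (λ x → f (g x)) xs
  ∑L-map f g []       = refl
  ∑L-map f g (x ∷ xs) = cong (λ z → f (g x) + z) (∑L-map f g xs)

  ∑L-product : ∀ {A B : Set} (f : A × B → ℚ) xs ys → ∑L f (cartesianProduct xs ys) ≡ ∑L (λ x → ∑L (λ y → f (x , y)) ys) xs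
  ∑L-product f []       ys = refl
  ∑L-product f (x ∷ xs) ys = trans (∑L-++ f (map (x ,_) ys) (cartesianProduct xs ys)) (cong₂ _+_ (∑L-map f (x ,_) ys) (∑L-product f xs ys))

  ∑L-filter : ∀ {A : Set} {P : Pred A 0ℓ} (P? : Decidable P) xs → ι (length (filter P? xs)) ≡ ∑L (λ x → [ P? x ]ᵈ) xs
  ∑L-filter P? [] = ι-0
  ∑L-filter P? (x ∷ xs) with P? x
  ... | yes p = trans (ι-suc _) (trans (+-comm (ι (length (filter P? xs))) 1ℚ) (cong₂ _+_ (sym ([yes] (yes p) p)) (∑L-filter P? xs)))
  ... | no ¬p = trans (∑L-filter P? xs) (trans (sym (+-identityˡ _)) (cong (_+ ∑L (λ x → [ P? x ]ᵈ) xs) (sym ([no] (no ¬p) ¬p))))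

  ∑L-tabulate : ∀ N {A : Set} (g : Fin N → A) (f : A → ℚ) (F : ℕ → ℚ) → (∀ i → f (g i) ≡ F (toℕ i)) → ∑L f (tabulate g) ≡ ∑ N F
  ∑L-tabulate zero    g f F h = refl
  ∑L-tabulate (suc N) g f F h = trans (cong₂ _+_ (h F.zero) (∑L-tabulate N (g ∘ F.suc) f (F ∘ suc) (λ i → h (F.suc i)))) (sym (∑-front N F))

  fromℕ<-toℕ′ : ∀ {N} (i : Fin N) (lt : toℕ i ℕ.< N) → F.fromℕ< lt ≡ i
  fromℕ<-toℕ′ {suc N} F.zero    lt       = refl
  fromℕ<-toℕ′ {suc N} (F.suc i) (s≤s lt) = cong F.suc (fromℕ<-toℕ′ i lt)

  indicator-∈ : ∀ {N} (X : Subset N) i → indicator X (suc (toℕ i)) ≡ [ i ∈? X ]ᵈ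
  indicator-∈ {N} X i with toℕ i ℕ.<? N
  ... | yes lt = cong (λ j → [ j ∈? X ]ᵈ) (fromℕ<-toℕ′ i lt)
  ... | no ¬lt = contradiction (toℕ<n i) ¬lt
    where
    toℕ<n : ∀ {N} (i : Fin N) → toℕ i ℕ.< N
    toℕ<n F.zero    = s≤s z≤n
    toℕ<n (F.suc i) = s≤s (toℕ<n i)

  indicator𝟘𝟙 : ∀ {N n} → N ℕ.< n → Subset N → 𝟘𝟙 n
  indicator𝟘𝟙 {N} {n} N<n X = record { fun = indicator X ; 0≤fun = nonneg ; fun≤1 = le1 ; fun² = idem ; support = supp }
    where
    nonneg : ∀ a → 0ℚ ≤ indicator X a
    nonneg zero = ≤-refl
    nonneg (suc a) with a ℕ.<? N
    ... | yes lt = 0≤[] (F.fromℕ< lt ∈? X)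
    ... | no  _  = ≤-refl
    le1 : ∀ a → indicator X a ≤ 1ℚ
    le1 zero = nonNegative⁻¹ 1ℚ
    le1 (suc a) with a ℕ.<? N
    ... | yes lt = []≤1 (F.fromℕ< lt ∈? X)
    ... | no  _  = nonNegative⁻¹ 1ℚ
    idem : ∀ a → indicator X a * indicator X a ≡ indicator X a
    idem zero = refl
    idem (suc a) with a ℕ.<? N
    ... | yes lt = []² (F.fromℕ< lt ∈? X)
    ... | no  _  = refl
    supp : ∀ a → n ℕ.≤ a → indicator X a ≡ 0ℚ
    supp zero    _ = refl
    supp (suc a) n≤ with a ℕ.<? N
    ... | yes lt = contradiction (ℕ.≤-trans (ℕ.≤-trans N<n n≤) lt) (ℕ.<-irrefl refl)
    ... | no  _  = refl

  ∑-support : ∀ N n F → N ℕ.≤ n → (∀ i → N ℕ.≤ i → F i ≡ 0ℚ) → ∑ n F ≡ ∑ N F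
  ∑-support N n F N≤n F≡0 with ℕ.m≤n⇒∃[o]m+o≡n N≤n
  ... | o , refl = trans (∑-++ N o F) (trans (cong (λ z → ∑ N F + z) (∑-vanish o (λ i _ → F≡0 (N ℕ.+ i) (ℕ.m≤m+n N i)))) (+-identityʳ (∑ N F)))

  module _ {N n : ℕ} (N<n : N ℕ.< n) where

    private
      tail-sum : ∀ (G : ℕ → ℚ) → G 0 ≡ 0ℚ → (∀ a → suc N ℕ.≤ a → G a ≡ 0ℚ) → ∑ n G ≡ ∑ N (λ i → G (suc i))
      tail-sum G G0 G≡0 = trans (∑-support (suc N) n G N<n G≡0) (trans (∑-front N G) (trans (cong (_+ ∑ N (λ i → G (suc i))) G0) (+-identityˡ _)))

      indicator-support : ∀ (X : Subset N) a → suc N ℕ.≤ a → indicator X a ≡ 0ℚ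
      indicator-support X = 𝟘𝟙.support (indicator𝟘𝟙 (ℕ.n<1+n N) X)

    ∑indicator : (X : Subset N) → ∑ n (indicator X) ≡ ι ∣ X ∣ˢ
    ∑indicator X = trans (tail-sum (indicator X) refl (indicator-support X)) (trans (sym (∑L-tabulate N id (λ i → [ i ∈? X ]ᵈ) (λ i → indicator X (suc i)) (λ i → sym (indicator-∈ X i)))) (card X))
      where
      shift-∈ : ∀ {N} x (X : Subset N) i → [ F.suc i ∈? (x ∷ X) ]ᵈ ≡ [ i ∈? X ]ᵈ
      shift-∈ x X i = [⇔] (F.suc i ∈? (x ∷ X)) (i ∈? X) drop-there there
      same : ∀ {N} (f g : Fin N → ℚ) → (∀ i → f i ≡ g i) → ∀ {M} (h : Fin M → Fin N) → ∑L f (tabulate h) ≡ ∑L g (tabulate h)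
      same f g f≡g {zero}  h = refl
      same f g f≡g {suc M} h = cong₂ _+_ (f≡g (h F.zero)) (same f g f≡g (h ∘ F.suc))
      step : ∀ {N} x (X : Subset N) → ∑L (λ i → [ i ∈? (x ∷ X) ]ᵈ) (tabulate id) ≡ [ F.zero ∈? (x ∷ X) ]ᵈ + ∑L (λ i → [ i ∈? X ]ᵈ) (tabulate id)
      step {N} x X = cong (λ z → [ F.zero ∈? (x ∷ X) ]ᵈ + z) (trans (cong (∑L (λ i → [ i ∈? (x ∷ X) ]ᵈ)) (sym (List.map-tabulate id F.suc)))
        (trans (∑L-map (λ i → [ i ∈? (x ∷ X) ]ᵈ) F.suc (tabulate id)) (same _ _ (shift-∈ x X) id)))
      card : ∀ {N} (X : Subset N) → ∑L (λ i → [ i ∈? X ]ᵈ) (tabulate id) ≡ ι ∣ X ∣ˢ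
      card [] = sym ι-0
      card (true ∷ X) = trans (step true X) (trans (cong₂ _+_ ([yes] (F.zero ∈? (true ∷ X)) here) (card X)) (trans (+-comm 1ℚ (ι ∣ X ∣ˢ)) (sym (ι-suc ∣ X ∣ˢ))))
      card (false ∷ X) = trans (step false X) (trans (cong₂ _+_ ([no] (F.zero ∈? (false ∷ X)) (λ ())) (card X)) (+-identityˡ (ι ∣ X ∣ˢ)))

    square? : ℕ → ℚ
    square? x = [ S? x ]ᵈ

    pair-count : (X Y : Subset N) → ι (#squarePairs X Y) ≡ ∑ n (λ a → ∑ n (λ b → indicator X a * indicator Y b * square? (a ℕ.+ b)))
    pair-count X Y = trans (∑L-filter _ (cartesianProduct (allFin N) (allFin N))) (trans (∑L-product _ (allFin N) (allFin N))
      (trans (∑L-tabulate N id _ (λ i → ∑ n (λ b → indicator X (suc i) * indicator Y b * square? (suc i ℕ.+ b))) outer)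
        (sym (tail-sum (λ a → ∑ n (λ b → indicator X a * indicator Y b * square? (a ℕ.+ b)))
          (∑-vanish n (λ b _ → trans (cong (_* square? b) (*-zeroˡ (indicator Y b))) (*-zeroˡ (square? b))))
          (λ a N<a → ∑-vanish n (λ b _ → trans (cong (λ z → z * indicator Y b * square? (a ℕ.+ b)) (indicator-support X a N<a))
            (trans (cong (_* square? (a ℕ.+ b)) (*-zeroˡ (indicator Y b))) (*-zeroˡ (square? (a ℕ.+ b))))))))))
      where
      outer : ∀ i → ∑L (λ j → [ (i ∈? X) ×-dec (j ∈? Y) ×-dec S? (⟦ i ⟧ ℕ.+ ⟦ j ⟧) ]ᵈ) (allFin N)
        ≡ ∑ n (λ b → indicator X (suc (toℕ i)) * indicator Y b * square? (suc (toℕ i) ℕ.+ b))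
      outer i = trans (∑L-tabulate N id _ (λ j → indicator X (suc (toℕ i)) * indicator Y (suc j) * square? (suc (toℕ i) ℕ.+ suc j)) inner)
        (sym (tail-sum (λ b → indicator X (suc (toℕ i)) * indicator Y b * square? (suc (toℕ i) ℕ.+ b))
          (trans (cong (_* square? (suc (toℕ i) ℕ.+ 0)) (*-zeroʳ (indicator X (suc (toℕ i))))) (*-zeroˡ (square? (suc (toℕ i) ℕ.+ 0))))
          (λ b N<b → trans (cong (λ z → indicator X (suc (toℕ i)) * z * square? (suc (toℕ i) ℕ.+ b)) (indicator-support Y b N<b))
            (trans (cong (_* square? (suc (toℕ i) ℕ.+ b)) (*-zeroʳ (indicator X (suc (toℕ i))))) (*-zeroˡ (square? (suc (toℕ i) ℕ.+ b)))))))
        where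
        inner : ∀ j → [ (i ∈? X) ×-dec (j ∈? Y) ×-dec S? (⟦ i ⟧ ℕ.+ ⟦ j ⟧) ]ᵈ ≡ indicator X (suc (toℕ i)) * indicator Y (suc (toℕ j)) * square? (suc (toℕ i) ℕ.+ suc (toℕ j))
        inner j = trans ([×] (i ∈? X) ((j ∈? Y) ×-dec S? (⟦ i ⟧ ℕ.+ ⟦ j ⟧))) (trans (cong ([ i ∈? X ]ᵈ *_) ([×] (j ∈? Y) (S? (⟦ i ⟧ ℕ.+ ⟦ j ⟧))))
          (trans (sym (*-assoc [ i ∈? X ]ᵈ [ j ∈? Y ]ᵈ [ S? (⟦ i ⟧ ℕ.+ ⟦ j ⟧) ]ᵈ)) (cong₂ (λ x y → x * y * square? (suc (toℕ i) ℕ.+ suc (toℕ j))) (sym (indicator-∈ X i)) (sym (indicator-∈ Y j)))))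

  ∑δ≤ : ∀ x (q : ℕ → ℕ) → (∀ {l m} → q l ≡ q m → l ≡ m) → ∀ z → 0ℚ ≤ z → (∀ l → x ≡ q l → 1ℚ ≤ z) → ∀ Λ → ∑ Λ (λ l → δ x (q l)) ≤ z
  ∑δ≤ x q inj z 0≤z h zero    = 0≤z
  ∑δ≤ x q inj z 0≤z h (suc Λ) with x ℕ.≟ q Λ
  ... | yes x≡ = ≤-trans (≤-reflexive (trans (cong₂ _+_ (∑-vanish Λ (λ l l<Λ → δ-≢ (λ eq → ℕ.<⇒≢ l<Λ (inj (trans (sym eq) x≡))))) (trans (cong (λ w → δ w (q Λ)) x≡) (δ-refl (q Λ)))) (+-identityˡ 1ℚ))) (h Λ x≡)
  ... | no x≢ = ≤-trans (≤-reflexive (trans (cong (λ w → ∑ Λ (λ l → δ x (q l)) + w) (δ-≢ x≢)) (+-identityʳ _))) (∑δ≤ x q inj z 0≤z h Λ)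

  sq-inj : ∀ h {l m} → sq h l ≡ sq h m → l ≡ m
  sq-inj h {l} {m} eq with ℕ.<-cmp l m
  ... | tri≈ _ l≡m _ = l≡m
  ... | tri< l<m _ _ = contradiction eq (ℕ.<⇒≢ (ℕ.*-mono-< (grow l<m) (grow l<m)))
    where
    grow : ∀ {l m} → l ℕ.< m → 2 ℕ.* l ℕ.+ h ℕ.< 2 ℕ.* m ℕ.+ h
    grow l<m = ℕ.+-monoˡ-< h (ℕ.*-monoʳ-< 2 l<m)
  ... | tri> _ _ m<l = contradiction (sym eq) (ℕ.<⇒≢ (ℕ.*-mono-< (grow m<l) (grow m<l)))
    where
    grow : ∀ {l m} → l ℕ.< m → 2 ℕ.* l ℕ.+ h ℕ.< 2 ℕ.* m ℕ.+ h
    grow l<m = ℕ.+-monoˡ-< h (ℕ.*-monoʳ-< 2 l<m)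

  weighted≤pairs-identity : ∀ g f z → g * (f * z) ≡ f * g * z
  weighted≤pairs-identity = solve-∀ ℚ-ring

  module PairSum (n Λ : ℕ) (2n≤4Λ² : 2 ℕ.* n ℕ.≤ 4 ℕ.* (Λ ℕ.* Λ)) where

    open Range n Λ 2n≤4Λ²

    pairs : (ℕ → ℚ) → (ℕ → ℚ) → ℚ
    pairs F G = ∑ n (λ a → ∑ n (λ b → F a * G b * [ S? (a ℕ.+ b) ]ᵈ))

    pairs-comm : ∀ F G → pairs F G ≡ pairs G F
    pairs-comm F G = trans (∑-swap n n _) (∑-ext n (λ b → ∑-ext n (λ a → cong₂ _*_ (*-comm (F a) (G b)) (cong (λ x → [ S? x ]ᵈ) (ℕ.+-comm a b)))))

    -- For fixed `h` the squares (2l + h)² are distinct, so each pair with a square sum is met by at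
    -- most one `l`, and its weight is at most `W`.
    weighted≤pairs : ∀ F G → (∀ a → 0ℚ ≤ F a) → F 0 ≡ 0ℚ → (∀ a → n ℕ.≤ a → F a ≡ 0ℚ) → (∀ b → 0ℚ ≤ G b) → ∀ s h →
      ∑ n (λ b → cls s b * ∑ Λ (λ l → ω l * (G b * at F b (sq h l)))) ≤ W * pairs F G
    weighted≤pairs F G 0≤F F0 F≡0 0≤G s h = ≤-trans (∑-mono n (λ b _ → each b)) (≤-reflexive (trans (∑-* n W _)
        (cong (W *_) (trans (∑-ext n (λ b → sym (∑-* n (G b) _))) (trans (∑-swap n n _) (∑-ext n (λ a → ∑-ext n (λ b → weighted≤pairs-identity (G b) (F a) [ S? (a ℕ.+ b) ]ᵈ))))))))
      where
      inner : ℕ → ℚ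
      inner b = ∑ Λ (λ l → ω l * (G b * at F b (sq h l)))
      0≤inner : ∀ b → 0ℚ ≤ inner b
      0≤inner b = ∑-nonNeg Λ (λ l _ → 0≤* (0≤ω l) (0≤* (0≤G b) (0≤at F 0≤F b (sq h l))))
      hit : ∀ a b → F a * ∑ Λ (λ l → δ (b ℕ.+ a) (sq h l)) ≤ F a * [ S? (a ℕ.+ b) ]ᵈ
      -- The point a = 0 is handled by F 0 = 0: otherwise the sum 0 could be met by the windows,
      -- while `S` contains positive squares only.
      hit zero    b = ≤-reflexive (trans (cong (_* ∑ Λ (λ l → δ (b ℕ.+ 0) (sq h l))) F0) (trans (*-zeroˡ (∑ Λ (λ l → δ (b ℕ.+ 0) (sq h l)))) (sym (trans (cong (_* [ S? b ]ᵈ) F0) (*-zeroˡ [ S? b ]ᵈ)))))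
      hit (suc a) b = *-monoˡ-≤-nonNeg (F (suc a)) {{nonNegative (0≤F (suc a))}}
        (∑δ≤ (b ℕ.+ suc a) (sq h) (sq-inj h) [ S? (suc a ℕ.+ b) ]ᵈ (0≤[] (S? (suc a ℕ.+ b))) isSquare Λ)
        where
        isSquare : ∀ l → b ℕ.+ suc a ≡ sq h l → 1ℚ ≤ [ S? (suc a ℕ.+ b) ]ᵈ
        isSquare l eq = ≤-reflexive (sym ([yes] (S? (suc a ℕ.+ b)) (2 ℕ.* l ℕ.+ h , root≥1 (2 ℕ.* l ℕ.+ h) eq , trans (cong ((2 ℕ.* l ℕ.+ h) ℕ.*_) (ℕ.*-identityʳ (2 ℕ.* l ℕ.+ h))) (trans (sym eq) (ℕ.+-comm b (suc a))))))
          where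
          root≥1 : ∀ m → b ℕ.+ suc a ≡ m ℕ.* m → 1 ℕ.≤ m
          root≥1 zero    eq = contradiction (trans (sym (ℕ.+-suc b a)) eq) (λ ())
          root≥1 (suc m) eq = s≤s z≤n
      each : ∀ b → cls s b * inner b ≤ W * (G b * ∑ n (λ a → F a * [ S? (a ℕ.+ b) ]ᵈ))
      each b = ≤-trans (≤-trans (*-monoʳ-≤-nonNeg (inner b) {{nonNegative (0≤inner b)}} (δ≤1 (b ℕ.% 4) s)) (≤-reflexive (*-identityˡ (inner b))))
        (≤-trans (∑-mono Λ (λ l l<Λ → *-monoʳ-≤-nonNeg (G b * at F b (sq h l)) {{nonNegative (0≤* (0≤G b) (0≤at F 0≤F b (sq h l)))}} (ω≤W (ℕ.<⇒≤ l<Λ))))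
        (≤-trans (≤-reflexive (trans (∑-* Λ W _) (cong (W *_) (trans (∑-* Λ (G b) _) (cong (G b *_) expand)))))
          (*-monoˡ-≤-nonNeg W {{nonNegative 0≤W}} (*-monoˡ-≤-nonNeg (G b) {{nonNegative (0≤G b)}} (∑-mono n (λ a _ → hit a b))))))
        where
        expand : ∑ Λ (λ l → at F b (sq h l)) ≡ ∑ n (λ a → F a * ∑ Λ (λ l → δ (b ℕ.+ a) (sq h l)))
        expand = trans (∑-ext Λ (λ l → at≡∑δ n F F≡0 b (sq h l))) (trans (∑-swap Λ n _)
          (∑-ext n (λ a → trans (∑-ext Λ (λ l → *-comm (δ (b ℕ.+ a) (sq h l)) (F a))) (∑-* Λ (F a) _))))

-- The relation between densities with all errors absorbed

module DensityRelations where

  open Data.Rational.Base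
  open Data.Rational.Properties
  open Rationals
  open Sums
  open Averages
  open Windows
  open Transference
  open DensityInequality
  open Estimates
  open Residues
  open Equidistributed
  open Counting

  absorb-identity : ∀ m b T z d W C ε P₁ t →
    d * ((+ 4 / 1) * ((+ 4 / 1) * m * m * T) + ((+ 16 / 1) * (W * C) + (+ 72 / 1) * (m * W) + (+ 160 / 1) * (m * (W * P₁)) + (+ 16 / 1) * (m * ((+ 10 / 1) * (t * W)) + ε)) - (+ 4 / 1) * ((+ 4 / 1) * m * (m * b)))
    + d * (z * ((+ 4 / 1) * m * ((+ 4 / 1) * m)) - (+ 16 / 1) * (W * C))
    + (+ 9 / 50) * m * ((+ 4 / 1) * m - (+ 400 / 1) * (d * W)) + (+ 2 / 5) * m * ((+ 4 / 1) * m - (+ 400 / 1) * (d * (P₁ * W)))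
    + (+ 2 / 5) * m * ((+ 4 / 1) * m - (+ 400 / 1) * (d * (t * W))) + (+ 1 / 10) * ((+ 3 / 1) * ((+ 4 / 1) * m * ((+ 4 / 1) * m)) - (+ 160 / 1) * (d * ε))
    + (+ 182 / 25) * (m * m)
    ≡ (+ 4 / 1) * m * ((+ 4 / 1) * m) * (d * (T + z - b) + 1ℚ)
  absorb-identity = solve-∀ ℚ-ring

  -- All errors together are at most n²/D.
  absorb : ∀ {n m β b T z d W C ε P₁ t} → 0ℚ ≤ m → 0ℚ ≤ d → n ≡ (+ 4 / 1) * m → β ≡ m * b →
    (+ 4 / 1) * (n * β) ≤ (+ 4 / 1) * (n * m * T) + ((+ 16 / 1) * (W * C) + (+ 72 / 1) * (m * W) + (+ 160 / 1) * (m * (W * P₁)) + (+ 16 / 1) * (m * ((+ 10 / 1) * (t * W)) + ε)) →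
    (+ 16 / 1) * (W * C) ≤ z * (n * n) → (+ 400 / 1) * (d * W) ≤ n → (+ 400 / 1) * (d * (P₁ * W)) ≤ n → (+ 400 / 1) * (d * (t * W)) ≤ n →
    (+ 160 / 1) * (d * ε) ≤ (+ 3 / 1) * (n * n) → 0ℚ ≤ n * n * (d * (T + z - b) + 1ℚ)
  absorb {m = m} {b = b} {T} {z} {d} {W} {C} {ε} {P₁} {t} 0≤m 0≤d refl refl main hz h₁ h₂ h₃ hε = subst (0ℚ ≤_) (absorb-identity m b T z d W C ε P₁ t)
    (0≤+ (0≤+ (0≤+ (0≤+ (0≤+ (0≤+ (0≤* 0≤d (p≤q⇒0≤q-p main)) (0≤* 0≤d (p≤q⇒0≤q-p hz)))
      (0≤* (0≤* (lit (+ 9 / 50)) 0≤m) (p≤q⇒0≤q-p h₁))) (0≤* (0≤* (lit (+ 2 / 5)) 0≤m) (p≤q⇒0≤q-p h₂)))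
      (0≤* (0≤* (lit (+ 2 / 5)) 0≤m) (p≤q⇒0≤q-p h₃))) (0≤* (lit (+ 1 / 10)) (p≤q⇒0≤q-p hε))) (0≤* (lit (+ 182 / 25)) (0≤* 0≤m 0≤m)))

  finish-identity : ∀ d T z b r → d * (T + z - b) + d * r ≡ d * (T + (z + r) - b)
  finish-identity = solve-∀ ℚ-ring

  shape-identity : ∀ W C m p t ε → (+ 16 / 1) * (W * C) + (+ 72 / 1) * (m * W) + (+ 10 / 1) * (m * (W * ((p * (+ 2 / 1) + p * (+ 2 / 1)) + (p * (+ 2 / 1) + p * (+ 2 / 1))) + W * ((p * (+ 2 / 1) + p * (+ 2 / 1)) + (p * (+ 2 / 1) + p * (+ 2 / 1)))))
    + (+ 16 / 1) * (m * (t * ((W + W) + (W * ((+ 2 / 1) + (+ 2 / 1)) + W * ((+ 2 / 1) + (+ 2 / 1))))) + ε)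
    ≡ (+ 16 / 1) * (W * C) + (+ 72 / 1) * (m * W) + (+ 160 / 1) * (m * (W * p)) + (+ 16 / 1) * (m * ((+ 10 / 1) * (t * W)) + ε)
  shape-identity = solve-∀ ℚ-ring

  relation-identity : ∀ T p → T ℕ.* (p ℕ.* 8) ≡ T ℕ.* (p ℕ.* 2 ℕ.* 4)
  relation-identity = ℕ.solve-∀

  relation-identity₂ : ∀ g → g ℕ.* 2 ℕ.* 4 ≡ 8 ℕ.* g
  relation-identity₂ = ℕ.solve-∀

  mass-identity : ∀ m a b c d → (+ 4 / 1) * m * (a + b + c + d) ≡ (+ 4 / 1) * (m * a + m * b + m * c + m * d)
  mass-identity = solve-∀ ℚ-ring

  from-equi-identity : ∀ J Y e → J * Y - (- (J * e)) ≡ J * (Y - (- e))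
  from-equi-identity = solve-∀ ℚ-ring

  ε≤-identity : ∀ J d e n → J * n - (+ 160 / 1) * d * (J * e) ≡ J * (n - (+ 160 / 1) * (d * e))
  ε≤-identity = solve-∀ ℚ-ring

  ε≤-identity₂ : ∀ N L W Q G J d → N * (J * N - (+ 160 / 1) * (d * L)) + J * N * (N - (+ 640 / 1) * (d * (J * (W * Q)))) + J * N * (N - (+ 320 / 1) * (d * (G * W)))
    ≡ J * ((+ 3 / 1) * (N * N)) - (+ 160 / 1) * d * (N * L + ½ * (J * J * (N * (W * ((Q + Q) + (Q + Q)) + W * ((Q + Q) + (Q + Q))))) + J * (N * (G * W + G * W)))
  ε≤-identity₂ = solve-∀ ℚ-ring

  ιn≡4ιm-identity : ∀ T p → T ℕ.* (p ℕ.* 8) ≡ 4 ℕ.* (T ℕ.* (p ℕ.* 2))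
  ιn≡4ιm-identity = ℕ.solve-∀

  -- The long blocks have length 8 * p₂ = 4800 * D * Λ. The factor 600 is matched to W ≤ 12Λ: from
  -- 400 * 12 = 600 * 8 it follows that the `T` block errors of size `W` amount to at most n / (400
  -- D).
  module Parameters (D j K g ρ T : ℕ) .{{_ : ℕ.NonZero D}} .{{_ : ℕ.NonZero j}} .{{_ : ℕ.NonZero K}} .{{_ : ℕ.NonZero g}} .{{_ : ℕ.NonZero ρ}} .{{_ : ℕ.NonZero T}} where

    p₁ Λ c p₂ n Wℕ : ℕ
    p₁ = K ℕ.* g
    Λ  = p₁ ℕ.* ρ
    c  = 600 ℕ.* D ℕ.* ρ
    p₂ = c ℕ.* p₁
    n  = T ℕ.* (p₂ ℕ.* 8)
    Wℕ = 8 ℕ.* Λ ℕ.+ 4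

    instance
      p₁-nonZero : ℕ.NonZero p₁
      p₁-nonZero = ℕ.m*n≢0 K g
      c-nonZero : ℕ.NonZero c
      c-nonZero = ℕ.m*n≢0 (600 ℕ.* D) ρ {{ℕ.m*n≢0 600 D}}
      p₂-nonZero : ℕ.NonZero p₂
      p₂-nonZero = ℕ.m*n≢0 c p₁
      p₁2-nonZero : ℕ.NonZero (p₁ ℕ.* 2)
      p₁2-nonZero = ℕ.m*n≢0 p₁ 2
      p₂2-nonZero : ℕ.NonZero (p₂ ℕ.* 2)
      p₂2-nonZero = ℕ.m*n≢0 p₂ 2
      m-nonZero : ℕ.NonZero (T ℕ.* (p₂ ℕ.* 2))
      m-nonZero = ℕ.m*n≢0 T (p₂ ℕ.* 2)
      n-nonZero : ℕ.NonZero n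
      n-nonZero = ℕ.m*n≢0 T (p₂ ℕ.* 8) {{it}} {{ℕ.m*n≢0 p₂ 8}}
        where
        it : ℕ.NonZero T
        it = ℕ.≢-nonZero (ℕ.≢-nonZero⁻¹ T)

    -- Each inequality tames one source of error: `a₂` the diagonal in the van der Corput step, `a₃`
    -- its off-diagonal terms, `a₄` the shifts, `a₅` the correlations of the three points, `a₆` the
    -- ends of the long blocks. `a₁` and `a₇` say that the windows reach 2n and that the shifts stay
    -- within their range.
    module Relations
      (divides : ∀ δ → 1 ℕ.≤ δ → δ ℕ.< j ℕ.* j → ∃[ q ] K ≡ q ℕ.* δ)
      (a₁ : 2 ℕ.* n ℕ.≤ 4 ℕ.* (Λ ℕ.* Λ))
      (a₂ : 160 ℕ.* (D ℕ.* (4 ℕ.* (Λ ℕ.* Λ))) ℕ.≤ j ℕ.* n)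
      (a₃ : 640 ℕ.* (D ℕ.* (j ℕ.* (Wℕ ℕ.* (c ℕ.* K)))) ℕ.≤ n)
      (a₄ : 320 ℕ.* (D ℕ.* ((g ℕ.* (j ℕ.* j)) ℕ.* Wℕ)) ℕ.≤ n)
      (a₅ : 400 ℕ.* (D ℕ.* (p₁ ℕ.* Wℕ)) ℕ.≤ n)
      (a₆ : 400 ℕ.* (D ℕ.* (T ℕ.* Wℕ)) ℕ.≤ n)
      (a₇ : g ℕ.* (j ℕ.* j) ℕ.≤ Λ)
      where

      open Range n Λ a₁ using (W; 0≤W)

      m : ℕ
      m = T ℕ.* (p₂ ℕ.* 2)

      private
        d J : ℚ
        d = ι D
        J = ι j

      ι-lit* : ∀ k x → ι (k ℕ.* x) ≡ (+ k / 1) * ι x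
      ι-lit* k x = trans (ι-* k x) (cong (_* ι x) (ι≡/1 k))

      ιn≡4ιm : ι n ≡ (+ 4 / 1) * ι m
      ιn≡4ιm = trans (cong ι (ιn≡4ιm-identity T p₂)) (ι-lit* 4 m)

      -- `X` is the error of `equidistribution-square`, which speaks of `j` times the sum; ε is
      -- therefore X / j.
      E X ε : ℚ
      E = ι n * (W * ((ι (c ℕ.* K) + ι (c ℕ.* K)) + (ι (c ℕ.* K) + ι (c ℕ.* K))) + W * ((ι (c ℕ.* K) + ι (c ℕ.* K)) + (ι (c ℕ.* K) + ι (c ℕ.* K))))
      X = ι n * ι (4 ℕ.* (Λ ℕ.* Λ)) + ½ * (ι (j ℕ.* j) * E) + J * (ι n * (ι (g ℕ.* (j ℕ.* j)) * W + ι (g ℕ.* (j ℕ.* j)) * W))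
      ε = recip j * X

      Jε : J * ε ≡ X
      Jε = trans (sym (*-assoc J (recip j) X)) (trans (cong (_* X) (ι*recip j)) (*-identityˡ X))

      0≤E : 0ℚ ≤ E
      0≤E = 0≤* (0≤ι n) (0≤+ q q)
        where
        q : 0ℚ ≤ W * ((ι (c ℕ.* K) + ι (c ℕ.* K)) + (ι (c ℕ.* K) + ι (c ℕ.* K)))
        q = 0≤* 0≤W (0≤+ (0≤+ (0≤ι (c ℕ.* K)) (0≤ι (c ℕ.* K))) (0≤+ (0≤ι (c ℕ.* K)) (0≤ι (c ℕ.* K))))

      0≤ε : 0ℚ ≤ ε
      0≤ε = 0≤* (0≤recip j) (0≤+ (0≤+ (0≤* (0≤ι n) (0≤ι (4 ℕ.* (Λ ℕ.* Λ)))) (0≤* (lit ½) (0≤* (0≤ι (j ℕ.* j)) 0≤E)))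
        (0≤* (0≤ι j) (0≤* (0≤ι n) (0≤+ (0≤* (0≤ι (g ℕ.* (j ℕ.* j))) 0≤W) (0≤* (0≤ι (g ℕ.* (j ℕ.* j))) 0≤W)))))

      ε≤ : (+ 160 / 1) * (d * ε) ≤ (+ 3 / 1) * (ι n * ι n)
      ε≤ = 0≤q-p⇒p≤q (cancel-pos (0<ι j) (subst (0ℚ ≤_) eq
          (0≤+ (0≤+ (0≤* (0≤ι n) (p≤q⇒0≤q-p b₂)) (0≤* (0≤* (0≤ι j) (0≤ι n)) (p≤q⇒0≤q-p b₃))) (0≤* (0≤* (0≤ι j) (0≤ι n)) (p≤q⇒0≤q-p b₄)))))
        where
        b₂ : (+ 160 / 1) * (d * ι (4 ℕ.* (Λ ℕ.* Λ))) ≤ J * ι n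
        b₂ = subst₂ _≤_ (trans (ι-lit* 160 (D ℕ.* (4 ℕ.* (Λ ℕ.* Λ)))) (cong ((+ 160 / 1) *_) (ι-* D (4 ℕ.* (Λ ℕ.* Λ))))) (ι-* j n) (ι-mono a₂)
        b₃ : (+ 640 / 1) * (d * (J * (W * ι (c ℕ.* K)))) ≤ ι n
        b₃ = subst (_≤ ι n) (trans (ι-lit* 640 _) (cong ((+ 640 / 1) *_) (trans (ι-* D _) (cong (d *_) (trans (ι-* j _) (cong (J *_) (ι-* Wℕ (c ℕ.* K)))))))) (ι-mono a₃)
        b₄ : (+ 320 / 1) * (d * (ι (g ℕ.* (j ℕ.* j)) * W)) ≤ ι n
        b₄ = subst (_≤ ι n) (trans (ι-lit* 320 _) (cong ((+ 320 / 1) *_) (trans (ι-* D _) (cong (d *_) (ι-* (g ℕ.* (j ℕ.* j)) Wℕ))))) (ι-mono a₄)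
        eq : ι n * (J * ι n - (+ 160 / 1) * (d * ι (4 ℕ.* (Λ ℕ.* Λ)))) + J * ι n * (ι n - (+ 640 / 1) * (d * (J * (W * ι (c ℕ.* K))))) + J * ι n * (ι n - (+ 320 / 1) * (d * (ι (g ℕ.* (j ℕ.* j)) * W)))
          ≡ J * ((+ 3 / 1) * (ι n * ι n) - (+ 160 / 1) * (d * ε))
        eq = trans (ε≤-identity₂ (ι n) (ι (4 ℕ.* (Λ ℕ.* Λ))) W (ι (c ℕ.* K)) (ι (g ℕ.* (j ℕ.* j))) J d)
          (trans (cong (λ z → J * ((+ 3 / 1) * (ι n * ι n)) - (+ 160 / 1) * d * (ι n * ι (4 ℕ.* (Λ ℕ.* Λ)) + ½ * (z * E) + J * (ι n * (ι (g ℕ.* (j ℕ.* j)) * W + ι (g ℕ.* (j ℕ.* j)) * W)))) (sym (ι-* j j)))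
            (trans (cong (λ z → J * ((+ 3 / 1) * (ι n * ι n)) - (+ 160 / 1) * d * z) (sym Jε)) (ε≤-identity J d ε ((+ 3 / 1) * (ι n * ι n)))))

      from-equi : ∀ {Y} → - X ≤ J * Y → - ε ≤ Y
      from-equi {Y} h = 0≤q-p⇒p≤q (cancel-pos (0<ι j) (subst (0ℚ ≤_) (trans (cong (λ z → J * Y - (- z)) (sym Jε)) (from-equi-identity J Y ε)) (p≤q⇒0≤q-p h)))

      density′ : 𝟘𝟙 n → ℕ → ℚ
      density′ 𝔽 r = recip m * ∑ m (λ y → 𝟘𝟙.fun 𝔽 (y ℕ.* 4 ℕ.+ r))

      density≡ : ∀ 𝔽 r → ∑ m (λ y → 𝟘𝟙.fun 𝔽 (y ℕ.* 4 ℕ.+ r)) ≡ ι m * density′ 𝔽 r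
      density≡ 𝔽 r = sym (trans (sym (*-assoc (ι m) (recip m) _)) (trans (cong (_* ∑ m (λ y → 𝟘𝟙.fun 𝔽 (y ℕ.* 4 ℕ.+ r))) (ι*recip m)) (*-identityˡ _)))

      mass : ∀ 𝔽 → ι n * (density′ 𝔽 0 + density′ 𝔽 1 + density′ 𝔽 2 + density′ 𝔽 3) ≡ (+ 4 / 1) * ∑ n (𝟘𝟙.fun 𝔽)
      mass 𝔽 = trans (cong (_* (density′ 𝔽 0 + density′ 𝔽 1 + density′ 𝔽 2 + density′ 𝔽 3)) ιn≡4ιm)
        (trans (mass-identity (ι m) (density′ 𝔽 0) (density′ 𝔽 1) (density′ 𝔽 2) (density′ 𝔽 3)) (cong ((+ 4 / 1) *_)
          (trans (cong₂ _+_ (cong₂ _+_ (cong₂ _+_ (sym (density≡ 𝔽 0)) (sym (density≡ 𝔽 1))) (sym (density≡ 𝔽 2))) (sym (density≡ 𝔽 3))) (sym classes))))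
        where
        F : ℕ → ℚ
        F = 𝟘𝟙.fun 𝔽
        n≡m4 : ∀ T p → T ℕ.* (p ℕ.* 8) ≡ T ℕ.* (p ℕ.* 2) ℕ.* 4
        n≡m4 = ℕ.solve-∀
        classes : ∑ n F ≡ ∑ m (λ y → F (y ℕ.* 4 ℕ.+ 0)) + ∑ m (λ y → F (y ℕ.* 4 ℕ.+ 1)) + ∑ m (λ y → F (y ℕ.* 4 ℕ.+ 2)) + ∑ m (λ y → F (y ℕ.* 4 ℕ.+ 3))
        classes = trans (cong (λ k → ∑ k F) (n≡m4 T p₂)) (trans (∑-blocks m 4 F)
          (trans (∑-ext m (λ y → cong (λ z → z + F (y ℕ.* 4 ℕ.+ 1) + F (y ℕ.* 4 ℕ.+ 2) + F (y ℕ.* 4 ℕ.+ 3)) (+-identityˡ (F (y ℕ.* 4 ℕ.+ 0)))))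
          (trans (∑-+ m _ _) (cong (_+ ∑ m (λ y → F (y ℕ.* 4 ℕ.+ 3))) (trans (∑-+ m _ _) (cong (_+ ∑ m (λ y → F (y ℕ.* 4 ℕ.+ 2))) (∑-+ m _ _)))))))

      density-unit : ∀ 𝔽 r → Unit (density′ 𝔽 r)
      density-unit 𝔽 r = unit (0≤* (0≤recip m) (∑-nonNeg m (λ y _ → 𝟘𝟙.0≤fun 𝔽 _)))
        (≤-trans (*-monoˡ-≤-nonNeg (recip m) {{nonNegative (0≤recip m)}} (∑-≤const m 1ℚ (λ y _ → 𝟘𝟙.fun≤1 𝔽 _)))
          (≤-reflexive (trans (cong (recip m *_) (*-identityʳ (ι m))) (trans (*-comm (recip m) (ι m)) (ι*recip m)))))

      module _ (𝔸 𝔹 : 𝟘𝟙 n) (A0 : 𝟘𝟙.fun 𝔸 0 ≡ 0ℚ) (z : ℚ)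
        (few : (+ 16 / 1) * (W * PairSum.pairs n Λ a₁ (𝟘𝟙.fun 𝔸) (𝟘𝟙.fun 𝔹)) ≤ z * (ι n * ι n)) where

        relation : ∀ s r₀ r₁ t → s ℕ.< 4 → r₀ ℕ.< 4 → r₁ ℕ.< 4 → s ℕ.+ r₀ ≡ t ℕ.* 4 → (s ℕ.+ r₁) ℕ.% 4 ≡ 1 →
          density′ 𝔹 s ≤ T₁ (density′ 𝔸 r₁) (density′ 𝔸 r₀) + (z + recip D)
        relation s r₀ r₁ t s<4 r₀<4 r₁<4 s+r₀ s+r₁ = finish (cancel-pos 0<n² (absorb {W = W} {C = C} {P₁ = ι p₁} {t = ι T} (0≤ι m) (0≤ι D) ιn≡4ιm (density≡ 𝔹 s)
            (≤-trans (Estimate.estimate 𝔸 𝔹 Λ a₁ 1≤Λ T p₁ p₂ c refl refl s r₀ r₁ s<4 r₀<4 r₁<4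
                (Classes.class₀ s r₀ r₁ t s<4 r₀<4 r₁<4 s+r₀ s+r₁)
                (Classes.class₁ s r₀ r₁ t s<4 r₀<4 r₁<4 s+r₀ s+r₁)
                (Classes.odd-class s r₀ r₁ t s<4 r₀<4 r₁<4 s+r₀ s+r₁)
                (Classes.even-class s r₀ r₁ t s<4 r₀<4 r₁<4 s+r₀ s+r₁)
                e u C ε (Unit.0≤ e∈) (Unit.≤1 e∈) (Unit.0≤ u∈) (Unit.≤1 u∈) (density≡ 𝔸 r₀) (density≡ 𝔸 r₁) 0≤C 0≤ε
              (λ h _ → weighted≤pairs A B 0≤A A0 A≡0 0≤B s h)
              -- The same `K`, `g` and `j` serve both moduli: uQ = 8g holds with u = g for Q = 8 and
              -- with u = 2g for Q = 4.
              (from-equi (Equidistribution.equidistribution-square 8 A 0≤A A≤1 n Λ a₁ A≡0 p₁ p₂ c K g g (j ℕ.* j) refl refl (ℕ.*-comm g 8) a₇ divides T refl 0 βs 0≤βs βs≤1 J (0≤ι j) j refl refl))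
              (from-equi (Equidistribution.equidistribution-square 4 A 0≤A A≤1 n Λ a₁ A≡0 (p₁ ℕ.* 2) (p₂ ℕ.* 2) c K (g ℕ.* 2) g (j ℕ.* j) (ℕ.*-assoc c p₁ 2) (ℕ.*-assoc K g 2) (relation-identity₂ g) a₇ divides T (relation-identity T p₂) 1 βs 0≤βs βs≤1 J (0≤ι j) j refl refl)))
              (≤-reflexive (cong (λ q → (+ 4 / 1) * (ι n * ι m * T₁ u e) + q) shape)))
            few b₁ b₅ b₆ ε≤))
          where
          open 𝟘𝟙 𝔸 renaming (fun to A; 0≤fun to 0≤A; fun≤1 to A≤1; fun² to A²≡A; support to A≡0)
          open 𝟘𝟙 𝔹 renaming (fun to B; 0≤fun to 0≤B; fun≤1 to B≤1; fun² to B²≡B; support to B≡0)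
          open PairSum n Λ a₁
          1≤Λ : 1 ℕ.≤ Λ
          1≤Λ = ℕ.>-nonZero⁻¹ Λ {{ℕ.m*n≢0 p₁ ρ}}
          C e u : ℚ
          C = pairs A B
          e = density′ 𝔸 r₀
          u = density′ 𝔸 r₁
          e∈ : Unit e
          e∈ = density-unit 𝔸 r₀
          u∈ : Unit u
          u∈ = density-unit 𝔸 r₁
          0≤C : 0ℚ ≤ C
          0≤C = ∑-nonNeg n (λ a _ → ∑-nonNeg n (λ b _ → 0≤* (0≤* (0≤A a) (0≤B b)) (0≤[] _)))
          βs : ℕ → ℚ
          βs b = cls s b * B b
          0≤βs : ∀ b → 0ℚ ≤ βs b
          0≤βs b = 0≤* (0≤δ (b ℕ.% 4) s) (0≤B b)
          βs≤1 : ∀ b → βs b ≤ 1ℚ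
          βs≤1 b = ≤-trans (*-mono (0≤δ (b ℕ.% 4) s) (lit 1ℚ) (δ≤1 (b ℕ.% 4) s) (B≤1 b)) (≤-reflexive refl)
          0<n² : 0ℚ < ι n * ι n
          0<n² = subst (0ℚ <_) (ι-* n n) (0<ι (n ℕ.* n) {{ℕ.m*n≢0 n n}})
          b₅ : (+ 400 / 1) * (d * (ι p₁ * W)) ≤ ι n
          b₅ = subst (_≤ ι n) (trans (ι-lit* 400 _) (cong ((+ 400 / 1) *_) (trans (ι-* D _) (cong (d *_) (ι-* p₁ Wℕ))))) (ι-mono a₅)
          b₆ : (+ 400 / 1) * (d * (ι T * W)) ≤ ι n
          b₆ = subst (_≤ ι n) (trans (ι-lit* 400 _) (cong ((+ 400 / 1) *_) (trans (ι-* D _) (cong (d *_) (ι-* T Wℕ))))) (ι-mono a₆)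
          b₁ : (+ 400 / 1) * (d * W) ≤ ι n
          b₁ = subst (_≤ ι n) (trans (ι-lit* 400 _) (cong ((+ 400 / 1) *_) (ι-* D Wℕ))) (ι-mono (ℕ.≤-trans (ℕ.*-monoʳ-≤ 400 (ℕ.*-monoʳ-≤ D (ℕ.m≤n*m Wℕ p₁))) a₅))
          shape : (+ 16 / 1) * (W * C) + (+ 72 / 1) * (ι m * W) + (+ 10 / 1) * (ι m * (W * ((ι (p₁ ℕ.* 2) + ι (p₁ ℕ.* 2)) + (ι (p₁ ℕ.* 2) + ι (p₁ ℕ.* 2))) + W * ((ι (p₁ ℕ.* 2) + ι (p₁ ℕ.* 2)) + (ι (p₁ ℕ.* 2) + ι (p₁ ℕ.* 2)))))
              + (+ 16 / 1) * (ι m * (ι T * ((W + W) + (W * (ι 2 + ι 2) + W * (ι 2 + ι 2)))) + ε)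
            ≡ (+ 16 / 1) * (W * C) + (+ 72 / 1) * (ι m * W) + (+ 160 / 1) * (ι m * (W * ι p₁)) + (+ 16 / 1) * (ι m * ((+ 10 / 1) * (ι T * W)) + ε)
          shape = trans (cong₂ (λ x y → (+ 16 / 1) * (W * C) + (+ 72 / 1) * (ι m * W) + (+ 10 / 1) * (ι m * (W * ((x + x) + (x + x)) + W * ((x + x) + (x + x)))) + (+ 16 / 1) * (ι m * (ι T * ((W + W) + (W * (y + y) + W * (y + y)))) + ε))
              (trans (ι-* p₁ 2) (cong (ι p₁ *_) (ι≡/1 2))) (ι≡/1 2))
            (shape-identity W C (ι m) (ι p₁) (ι T) ε)
          finish : 0ℚ ≤ d * (T₁ u e + z - density′ 𝔹 s) + 1ℚ → density′ 𝔹 s ≤ T₁ u e + (z + recip D)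
          finish h = 0≤q-p⇒p≤q (cancel-pos (0<ι D) (subst (0ℚ ≤_) (trans (cong (λ q → d * (T₁ u e + z - density′ 𝔹 s) + q) (sym (ι*recip D))) (finish-identity d (T₁ u e) z (density′ 𝔹 s) (recip D))) h))

-- Choice of the parameters

module ParameterChoice where

  open Data.Rational.Base
  open Data.Rational.Properties
  open DensityRelations
  open Defs using (isqrt; isqrt-lower; isqrt-upper)

  !-divides : ∀ k δ → 1 ℕ.≤ δ → δ ℕ.≤ k → ∃[ q ] k ! ≡ q ℕ.* δ
  !-divides zero    δ 1≤δ δ≤0 = contradiction (ℕ.≤-trans 1≤δ δ≤0) (λ ())
  !-divides (suc k) δ 1≤δ δ≤1+k with ℕ.m≤n⇒m<n∨m≡n δ≤1+k
  ... | inj₂ refl = k ! , ℕ.*-comm (suc k) (k !)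
  ... | inj₁ (s≤s δ≤k) with !-divides k δ 1≤δ δ≤k
  ...   | q , eq = suc k ℕ.* q , trans (cong (suc k ℕ.*_) eq) (sym (ℕ.*-assoc (suc k) q δ))

  suc-quotient : ∀ a b .{{_ : ℕ.NonZero b}} → a ℕ.< suc (a ℕ./ b) ℕ.* b
  suc-quotient a b = ℕ.≤-<-trans (ℕ.≤-reflexive (ℕ.m≡m%n+[m/n]*n a b)) (ℕ.+-monoˡ-< (a ℕ./ b ℕ.* b) (ℕ.m%n<n a b))

  Dn≤-identity : ∀ D r → D ℕ.* (D ℕ.* 4800 ℕ.* (2 ℕ.* r)) ≡ D ℕ.* D ℕ.* 9600 ℕ.* r
  Dn≤-identity = ℕ.solve-∀

  a₆-identity : ∀ D T l → 400 ℕ.* (D ℕ.* (T ℕ.* (l ℕ.* 12))) ≡ T ℕ.* (D ℕ.* 4800 ℕ.* l)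
  a₆-identity = ℕ.solve-∀

  a₅-identity : ∀ D x r → 400 ℕ.* (D ℕ.* (x ℕ.* (r ℕ.* 24))) ≡ D ℕ.* x ℕ.* 9600 ℕ.* r
  a₅-identity = ℕ.solve-∀

  a₄-identity : ∀ D x r → 320 ℕ.* (D ℕ.* (x ℕ.* (r ℕ.* 24))) ≡ D ℕ.* x ℕ.* 7680 ℕ.* r
  a₄-identity = ℕ.solve-∀

  a₃-identity : ∀ x n → x ℕ.* 4608000 ℕ.* (4 ℕ.* n) ≡ n ℕ.* (x ℕ.* 18432000)
  a₃-identity = ℕ.solve-∀

  a₃-identity₂ : ∀ D j ρ p → 640 ℕ.* (D ℕ.* (j ℕ.* (p ℕ.* ρ ℕ.* 12 ℕ.* (600 ℕ.* D ℕ.* ρ ℕ.* p)))) ≡ D ℕ.* D ℕ.* j ℕ.* 4608000 ℕ.* (p ℕ.* ρ ℕ.* (p ℕ.* ρ))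
  a₃-identity₂ = ℕ.solve-∀

  a₃-identity₃ : ∀ D j W c K g → 640 ℕ.* (D ℕ.* (j ℕ.* (W ℕ.* (c ℕ.* K)))) ℕ.* g ≡ 640 ℕ.* (D ℕ.* (j ℕ.* (W ℕ.* (c ℕ.* (K ℕ.* g)))))
  a₃-identity₃ = ℕ.solve-∀

  a₂-identity : ∀ D n → 160 ℕ.* (D ℕ.* (4 ℕ.* (4 ℕ.* n))) ≡ D ℕ.* 2560 ℕ.* n
  a₂-identity = ℕ.solve-∀

  a₁-identity : ∀ x → 2 ℕ.* (x ℕ.+ x) ≡ 4 ℕ.* x
  a₁-identity = ℕ.solve-∀

  W≤24R-identity : ∀ r → 2 ℕ.* r ℕ.* 12 ≡ r ℕ.* 24
  W≤24R-identity = ℕ.solve-∀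

  W≤12Λ-identity : ∀ l → 8 ℕ.* l ℕ.+ 4 ℕ.* l ≡ l ℕ.* 12
  W≤12Λ-identity = ℕ.solve-∀

  8p₂≡-identity : ∀ D ρ p → 600 ℕ.* D ℕ.* ρ ℕ.* p ℕ.* 8 ≡ D ℕ.* 4800 ℕ.* (p ℕ.* ρ)
  8p₂≡-identity = ℕ.solve-∀

  Λ²≤4N-identity : ∀ r → (2 ℕ.* r) ℕ.* (2 ℕ.* r) ≡ 4 ℕ.* (r ℕ.* r)
  Λ²≤4N-identity = ℕ.solve-∀

  9600D²≤R-identity : ∀ a b c d e f → (a ℕ.+ b ℕ.+ c ℕ.+ d ℕ.+ f) ℕ.+ e ≡ a ℕ.+ b ℕ.+ c ℕ.+ d ℕ.+ e ℕ.+ f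
  9600D²≤R-identity = ℕ.solve-∀

  9600p₁≤R-identity : ∀ a b c d e f → (a ℕ.+ b ℕ.+ c ℕ.+ e ℕ.+ f) ℕ.+ d ≡ a ℕ.+ b ℕ.+ c ℕ.+ d ℕ.+ e ℕ.+ f
  9600p₁≤R-identity = ℕ.solve-∀

  7680≤R-identity : ∀ a b c d e f → (a ℕ.+ b ℕ.+ d ℕ.+ e ℕ.+ f) ℕ.+ c ≡ a ℕ.+ b ℕ.+ c ℕ.+ d ℕ.+ e ℕ.+ f
  7680≤R-identity = ℕ.solve-∀

  4800D≤R-identity : ∀ a b c d e f → (a ℕ.+ c ℕ.+ d ℕ.+ e ℕ.+ f) ℕ.+ b ≡ a ℕ.+ b ℕ.+ c ℕ.+ d ℕ.+ e ℕ.+ f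
  4800D≤R-identity = ℕ.solve-∀

  module Choose (D : ℕ) .{{_ : ℕ.NonZero D}} where

    -- K is divisible by every shift below j².
    j K g : ℕ
    j = D ℕ.* 2560
    K = (j ℕ.* j) !
    g = D ℕ.* D ℕ.* j ℕ.* 18432000

    instance
      j-nonZero : ℕ.NonZero j
      j-nonZero = ℕ.m*n≢0 D 2560
      K-nonZero : ℕ.NonZero K
      K-nonZero = (j ℕ.* j) ℕ.!≢0
      DD-nonZero : ℕ.NonZero (D ℕ.* D)
      DD-nonZero = ℕ.m*n≢0 D D
      g-nonZero : ℕ.NonZero g
      g-nonZero = ℕ.m*n≢0 (D ℕ.* D ℕ.* j) 18432000 {{ℕ.m*n≢0 (D ℕ.* D) j}}
      Kg-nonZero : ℕ.NonZero (K ℕ.* g)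
      Kg-nonZero = ℕ.m*n≢0 K g

    gk : ℕ
    gk = g ℕ.* (j ℕ.* j)

    -- The sum of all lower bounds for √N that are used below, so that each single one is at most
    -- `R`.
    threshold : ℕ
    threshold = K ℕ.* g ℕ.+ D ℕ.* 4800 ℕ.+ D ℕ.* gk ℕ.* 7680 ℕ.+ D ℕ.* (K ℕ.* g) ℕ.* 9600 ℕ.+ D ℕ.* D ℕ.* 9600 ℕ.+ gk

    module For (N : ℕ) (big : threshold ℕ.* threshold ℕ.≤ N) where

      R : ℕ
      R = isqrt N

      threshold≤R : threshold ℕ.≤ R
      threshold≤R = ℕ.≮⇒≥ (λ R<t → ℕ.<-irrefl refl (ℕ.<-≤-trans (isqrt-upper N) (ℕ.≤-trans (ℕ.*-mono-≤ R<t R<t) big)))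

      opaque
        -- Makes Λ = K * g * ρ the first multiple of `p₁` above ⌊√N⌋.
        ρ : ℕ
        ρ = suc (R ℕ./ (K ℕ.* g))

        ρ-nonZero : ℕ.NonZero ρ
        ρ-nonZero = _

        ρ-above : R ℕ.< K ℕ.* g ℕ.* ρ
        ρ-above = ℕ.<-≤-trans (suc-quotient R (K ℕ.* g)) (ℕ.≤-reflexive (ℕ.*-comm (suc (R ℕ./ (K ℕ.* g))) (K ℕ.* g)))

        ρ-below : K ℕ.* g ℕ.* ρ ℕ.≤ K ℕ.* g ℕ.+ R
        ρ-below = ℕ.≤-trans (ℕ.≤-reflexive (ℕ.*-comm (K ℕ.* g) ρ)) (ℕ.+-monoʳ-≤ (K ℕ.* g) (ℕ.m/n*n≤m R (K ℕ.* g)))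

      period : ℕ
      period = 600 ℕ.* D ℕ.* ρ ℕ.* (K ℕ.* g) ℕ.* 8

      instance
        ρ-nonZero′ : ℕ.NonZero ρ
        ρ-nonZero′ = ρ-nonZero
        period-nonZero : ℕ.NonZero period
        period-nonZero = ℕ.m*n≢0 (600 ℕ.* D ℕ.* ρ ℕ.* (K ℕ.* g)) 8 {{ℕ.m*n≢0 (600 ℕ.* D ℕ.* ρ) (K ℕ.* g) {{ℕ.m*n≢0 (600 ℕ.* D) ρ {{ℕ.m*n≢0 600 D}}}}}}

      opaque
        -- Makes `n` the first multiple of the long block length above `N`; the strict inequality
        -- leaves room for the elements 1, ..., N below `n`.
        T : ℕ
        T = suc (N ℕ./ period)

        T-nonZero : ℕ.NonZero T
        T-nonZero = _

        T-above : N ℕ.< T ℕ.* period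
        T-above = suc-quotient N period

        T-below : T ℕ.* period ℕ.≤ N ℕ.+ period
        T-below = ℕ.≤-trans (ℕ.+-monoʳ-≤ period (ℕ.m/n*n≤m N period)) (ℕ.≤-reflexive (ℕ.+-comm period N))

      instance
        T-nonZero′ : ℕ.NonZero T
        T-nonZero′ = T-nonZero

      open Parameters D j K g ρ T public

      R<Λ : R ℕ.< Λ
      R<Λ = ρ-above

      p₁≤R : p₁ ℕ.≤ R
      p₁≤R = ℕ.≤-trans (ℕ.≤-trans (ℕ.m≤m+n p₁ _) (ℕ.≤-reflexive (sym (assoc p₁ (D ℕ.* 4800) (D ℕ.* gk ℕ.* 7680) (D ℕ.* p₁ ℕ.* 9600) (D ℕ.* D ℕ.* 9600) gk)))) threshold≤R
        where
        assoc : ∀ a b c d e f → a ℕ.+ b ℕ.+ c ℕ.+ d ℕ.+ e ℕ.+ f ≡ a ℕ.+ (b ℕ.+ c ℕ.+ d ℕ.+ e ℕ.+ f)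
        assoc = ℕ.solve-∀

      private
        pick : ∀ {x} → (∃[ o ] o ℕ.+ x ≡ threshold) → x ℕ.≤ R
        pick {x} (o , eq) = ℕ.≤-trans (ℕ.≤-trans (ℕ.m≤n+m x o) (ℕ.≤-reflexive eq)) threshold≤R

      4800D≤R : D ℕ.* 4800 ℕ.≤ R
      4800D≤R = pick (_ , 4800D≤R-identity p₁ (D ℕ.* 4800) (D ℕ.* gk ℕ.* 7680) (D ℕ.* p₁ ℕ.* 9600) (D ℕ.* D ℕ.* 9600) gk)
      7680≤R : D ℕ.* gk ℕ.* 7680 ℕ.≤ R
      7680≤R = pick (_ , 7680≤R-identity p₁ (D ℕ.* 4800) (D ℕ.* gk ℕ.* 7680) (D ℕ.* p₁ ℕ.* 9600) (D ℕ.* D ℕ.* 9600) gk)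
      9600p₁≤R : D ℕ.* p₁ ℕ.* 9600 ℕ.≤ R
      9600p₁≤R = pick (_ , 9600p₁≤R-identity p₁ (D ℕ.* 4800) (D ℕ.* gk ℕ.* 7680) (D ℕ.* p₁ ℕ.* 9600) (D ℕ.* D ℕ.* 9600) gk)
      9600D²≤R : D ℕ.* D ℕ.* 9600 ℕ.≤ R
      9600D²≤R = pick (_ , 9600D²≤R-identity p₁ (D ℕ.* 4800) (D ℕ.* gk ℕ.* 7680) (D ℕ.* p₁ ℕ.* 9600) (D ℕ.* D ℕ.* 9600) gk)
      gk≤R : gk ℕ.≤ R
      gk≤R = pick (_ , refl)

      Λ≤2R : Λ ℕ.≤ 2 ℕ.* R
      Λ≤2R = ℕ.≤-trans ρ-below (ℕ.+-mono-≤ p₁≤R (ℕ.≤-reflexive (sym (ℕ.+-identityʳ R))))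

      R²≤N : R ℕ.* R ℕ.≤ N
      R²≤N = isqrt-lower N

      Λ²≤4N : Λ ℕ.* Λ ℕ.≤ 4 ℕ.* N
      Λ²≤4N = ℕ.≤-trans (ℕ.*-mono-≤ Λ≤2R Λ≤2R) (ℕ.≤-trans (ℕ.≤-reflexive (Λ²≤4N-identity R)) (ℕ.*-monoʳ-≤ 4 R²≤N))

      N≤Λ² : N ℕ.≤ Λ ℕ.* Λ
      N≤Λ² = ℕ.≤-trans (ℕ.<⇒≤ (isqrt-upper N)) (ℕ.*-mono-≤ R<Λ R<Λ)

      N<n : N ℕ.< n
      N<n = T-above

      8p₂≡ : p₂ ℕ.* 8 ≡ D ℕ.* 4800 ℕ.* Λ
      8p₂≡ = 8p₂≡-identity D ρ p₁

      n≤ : n ℕ.≤ N ℕ.+ D ℕ.* 4800 ℕ.* Λ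
      n≤ = ℕ.≤-trans T-below (ℕ.≤-reflexive (cong (N ℕ.+_) 8p₂≡))

      W≤12Λ : Wℕ ℕ.≤ Λ ℕ.* 12
      W≤12Λ = ℕ.≤-trans (ℕ.+-monoʳ-≤ (8 ℕ.* Λ) (ℕ.*-monoʳ-≤ 4 (ℕ.≤-trans (s≤s z≤n) R<Λ))) (ℕ.≤-reflexive (W≤12Λ-identity Λ))

      W≤24R : Wℕ ℕ.≤ R ℕ.* 24
      W≤24R = ℕ.≤-trans W≤12Λ (ℕ.≤-trans (ℕ.*-monoˡ-≤ 12 Λ≤2R) (ℕ.≤-reflexive (W≤24R-identity R)))

      private
        via-R : ∀ x y → x ℕ.≤ y ℕ.* R → y ℕ.≤ R → x ℕ.≤ n
        via-R x y x≤ y≤ = ℕ.≤-trans x≤ (ℕ.≤-trans (ℕ.*-monoˡ-≤ R y≤) (ℕ.≤-trans R²≤N (ℕ.<⇒≤ N<n)))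

      a₁ : 2 ℕ.* n ℕ.≤ 4 ℕ.* (Λ ℕ.* Λ)
      a₁ = ℕ.≤-trans (ℕ.*-monoʳ-≤ 2 (ℕ.≤-trans n≤ (ℕ.+-mono-≤ N≤Λ² (ℕ.*-monoˡ-≤ Λ (ℕ.≤-trans 4800D≤R (ℕ.<⇒≤ R<Λ)))))) (ℕ.≤-reflexive (a₁-identity (Λ ℕ.* Λ)))

      -- With Λ² ≤ 4N the factor is 160 * 4 * 4 = 2560, which is why j = 2560 * D.
      a₂ : 160 ℕ.* (D ℕ.* (4 ℕ.* (Λ ℕ.* Λ))) ℕ.≤ j ℕ.* n
      a₂ = ℕ.≤-trans (ℕ.*-monoʳ-≤ 160 (ℕ.*-monoʳ-≤ D (ℕ.*-monoʳ-≤ 4 (ℕ.≤-trans Λ²≤4N (ℕ.*-monoʳ-≤ 4 (ℕ.<⇒≤ N<n)))))) (ℕ.≤-reflexive (a₂-identity D n))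

      -- Multiplied by `g`, the run length c * K becomes p₂ = c * K * g, and p₂W is of order D * n.
      -- The factor `g` is what makes the off-diagonal terms small, and 640 * 12 * 600 * 4 =
      -- 18432000 is its constant.
      a₃ : 640 ℕ.* (D ℕ.* (j ℕ.* (Wℕ ℕ.* (c ℕ.* K)))) ℕ.≤ n
      a₃ = ℕ.*-cancelʳ-≤ _ n g (ℕ.≤-trans (ℕ.≤-reflexive (a₃-identity₃ D j Wℕ c K g)) (ℕ.≤-trans
          (ℕ.*-monoʳ-≤ 640 (ℕ.*-monoʳ-≤ D (ℕ.*-monoʳ-≤ j (ℕ.*-monoˡ-≤ p₂ W≤12Λ))))
          (ℕ.≤-trans (ℕ.≤-reflexive (a₃-identity₂ D j ρ p₁)) (ℕ.≤-trans (ℕ.*-monoʳ-≤ (D ℕ.* D ℕ.* j ℕ.* 4608000) (ℕ.≤-trans Λ²≤4N (ℕ.*-monoʳ-≤ 4 (ℕ.<⇒≤ N<n)))) (ℕ.≤-reflexive (a₃-identity (D ℕ.* D ℕ.* j) n))))))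

      a₄ : 320 ℕ.* (D ℕ.* (gk ℕ.* Wℕ)) ℕ.≤ n
      a₄ = via-R _ (D ℕ.* gk ℕ.* 7680) (ℕ.≤-trans (ℕ.*-monoʳ-≤ 320 (ℕ.*-monoʳ-≤ D (ℕ.*-monoʳ-≤ gk W≤24R))) (ℕ.≤-reflexive (a₄-identity D gk R))) 7680≤R

      a₅ : 400 ℕ.* (D ℕ.* (p₁ ℕ.* Wℕ)) ℕ.≤ n
      a₅ = via-R _ (D ℕ.* p₁ ℕ.* 9600) (ℕ.≤-trans (ℕ.*-monoʳ-≤ 400 (ℕ.*-monoʳ-≤ D (ℕ.*-monoʳ-≤ p₁ W≤24R))) (ℕ.≤-reflexive (a₅-identity D p₁ R))) 9600p₁≤R

      a₆ : 400 ℕ.* (D ℕ.* (T ℕ.* Wℕ)) ℕ.≤ n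
      a₆ = ℕ.≤-trans (ℕ.*-monoʳ-≤ 400 (ℕ.*-monoʳ-≤ D (ℕ.*-monoʳ-≤ T W≤12Λ))) (ℕ.≤-trans (ℕ.≤-reflexive (a₆-identity D T Λ)) (ℕ.≤-reflexive (cong (T ℕ.*_) (sym 8p₂≡))))

      a₇ : gk ℕ.≤ Λ
      a₇ = ℕ.≤-trans gk≤R (ℕ.<⇒≤ R<Λ)

      -- Rounding up adds at most one long block, 4800DΛ ≤ 9600DR, and 9600D² ≤ R turns this into at
      -- most N / D.
      Dn≤ : D ℕ.* n ℕ.≤ D ℕ.* N ℕ.+ N
      Dn≤ = ℕ.≤-trans (ℕ.*-monoʳ-≤ D n≤) (ℕ.≤-trans (ℕ.≤-reflexive (ℕ.*-distribˡ-+ D N (D ℕ.* 4800 ℕ.* Λ))) (ℕ.+-monoʳ-≤ (D ℕ.* N)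
        (ℕ.≤-trans (ℕ.*-monoʳ-≤ D (ℕ.*-monoʳ-≤ (D ℕ.* 4800) Λ≤2R)) (ℕ.≤-trans (ℕ.≤-reflexive (Dn≤-identity D R)) (ℕ.≤-trans (ℕ.*-monoˡ-≤ R 9600D²≤R) R²≤N)))))

      open Relations (λ δ 1≤δ δ<k → !-divides (j ℕ.* j) δ 1≤δ (ℕ.<⇒≤ δ<k)) a₁ a₂ a₃ a₄ a₅ a₆ a₇ public

-- Few pairs contradict the density hypothesis

module DensityContradiction where

  open Data.Rational.Base
  open Data.Rational.Properties
  open Rationals
  open Sums
  open Averages
  open DensityInequality
  open Residues
  open Defs using (#squarePairs; *-pos)

  clash-identity : ∀ δ ζ → 0ℚ - δ ≡ (+ 4 / 5) * ((+ 3 / 2) + (+ 6 / 1) * ζ - ((+ 3 / 2) + (+ 2 / 1) * δ)) + (+ 24 / 5) * ((+ 1 / 8) * δ - ζ)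
  clash-identity = solve-∀ ℚ-ring

  weaken-identity : ∀ δ → (+ 3 / 2) + (+ 2 / 1) * δ - (+ 3 / 2) ≡ (+ 2 / 1) * δ
  weaken-identity = solve-∀ ℚ-ring

  ζ≤⅒-identity : ∀ δ → (+ 1 / 10) - (+ 1 / 8) * δ ≡ (+ 1 / 8) * ((+ 5 / 8) - δ) + (+ 7 / 320)
  ζ≤⅒-identity = solve-∀ ℚ-ring

  ζ≤-identity : ∀ δ → (+ 1 / 16) * δ + (+ 1 / 16) * δ ≡ (+ 1 / 8) * δ
  ζ≤-identity = solve-∀ ℚ-ring

  0≤n-identity : ∀ d N n r q → d * N + N - d * n + d * N * (q - r) ≡ d * (N + N * q - n) + N * (1ℚ - d * r)
  0≤n-identity = solve-∀ ℚ-ring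

  0≤1-δ-identity : ∀ δ → (+ 5 / 8) - δ + (+ 3 / 8) ≡ 1ℚ - δ
  0≤1-δ-identity = solve-∀ ℚ-ring

  total≥-identity : ∀ n s x → n * s - n * x ≡ n * (s - x)
  total≥-identity = solve-∀ ℚ-ring

  total≥-identity₂ : ∀ δ N n Z → (+ 4 / 1) * (Z - ((+ 3 / 8) + δ) * N) + ((+ 3 / 2) + (+ 2 / 1) * δ) * (N + N * ((+ 1 / 16) * δ) - n) + δ * N * ((+ 117 / 64) + (+ 1 / 8) * ((+ 5 / 8) - δ))
    ≡ (+ 4 / 1) * Z - n * ((+ 3 / 2) + (+ 2 / 1) * δ)
  total≥-identity₂ = solve-∀ ℚ-ring

  δ≤5/8-identity : ∀ δ N → N - ((+ 3 / 8) + δ) * N ≡ N * ((+ 5 / 8) - δ)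
  δ≤5/8-identity = solve-∀ ℚ-ring

  pairs≥-identity : ∀ δ N R n W C →
    (+ 1 / 24) * ((R * (+ 24 / 1) - W) * C) + (+ 1 / 384) * ((+ 16 / 1) * (W * C) - (+ 1 / 16) * δ * (n * n))
    + (+ 1 / 6144) * (δ * ((n - N) * (n + N)))
    + (+ 16 / 1000000) * (δ * ((1ℚ - δ) * (1ℚ + δ)) * (N * N))
    + (+ 8 / 1000000) * (δ * (δ * δ) * (N * ((N - R * R) + (N - R * R) + R * (R - 1ℚ))))
    + ((+ 1 / 6144) - (+ 16 / 1000000)) * (δ * (N * N))
    ≡ R * (C - (+ 8 / 1000000) * (δ * (δ * δ)) * (N * (R + 1ℚ)))
  pairs≥-identity = solve-∀ ℚ-ring

  module Conclusion (D N n R : ℕ) .{{_ : ℕ.NonZero D}} .{{_ : ℕ.NonZero n}} (W : ℚ) {δ : ℚ} (0<δ : 0ℚ < δ) (D≥ : recip D ≤ (+ 1 / 16) * δ)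
    (comm : ∀ (X Y : Subset N) → ι (#squarePairs X Y) ≡ ι (#squarePairs Y X)) (1≤R : 1 ℕ.≤ R) (R²≤N : R ℕ.* R ℕ.≤ N) (N<n : N ℕ.< n) (Dn≤ : D ℕ.* n ℕ.≤ D ℕ.* N ℕ.+ N) (W≤24R : W ≤ ι (R ℕ.* 24))
    (dens : Subset N → ℕ → ℚ) (dens-unit : ∀ Z r → Unit (dens Z r))
    (mass : ∀ Z → ι n * (dens Z 0 + dens Z 1 + dens Z 2 + dens Z 3) ≡ (+ 4 / 1) * ι ∣ Z ∣ˢ)
    (relation : ∀ (X Y : Subset N) → (+ 16 / 1) * (W * ι (#squarePairs X Y)) ≤ (+ 1 / 16) * δ * (ι n * ι n) →
      ∀ s r₀ r₁ t → s ℕ.< 4 → r₀ ℕ.< 4 → r₁ ℕ.< 4 → s ℕ.+ r₀ ≡ t ℕ.* 4 → (s ℕ.+ r₁) ℕ.% 4 ≡ 1 →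
      dens Y s ≤ T₁ (dens X r₁) (dens X r₀) + ((+ 1 / 16) * δ + recip D))
    where

    module _ (X Y : Subset N)
      (dense-X : ((+ 3 / 8) + δ) * ι N ≤ ι ∣ X ∣ˢ) (dense-Y : ((+ 3 / 8) + δ) * ι N ≤ ι ∣ Y ∣ˢ) where

      private
        C : ℚ
        C = ι (#squarePairs X Y)

        0<N : 0ℚ < ι N
        0<N = <-≤-trans (positive⁻¹ 1ℚ) (subst (_≤ ι N) ι-1 (ι-mono (ℕ.≤-trans (ℕ.*-mono-≤ 1≤R 1≤R) R²≤N)))

        0≤δ′ : 0ℚ ≤ δ
        0≤δ′ = <⇒≤ 0<δ

        δ≤5/8 : 0ℚ ≤ (+ 5 / 8) - δ
        δ≤5/8 = cancel-pos 0<N (subst (0ℚ ≤_) (δ≤5/8-identity δ (ι N)) (p≤q⇒0≤q-p (≤-trans dense-X (ι-mono (∣p∣≤n X)))))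

        total : Subset N → ℚ
        total Z = dens Z 0 + dens Z 1 + dens Z 2 + dens Z 3

        -- Relative to `N` the four densities would add up to 3/2 + 4δ. They are taken relative to n
        -- ≤ N(1 + δ/16), and this loses at most half of the margin.
        total≥ : ∀ (Z : Subset N) → ((+ 3 / 8) + δ) * ι N ≤ ι ∣ Z ∣ˢ → (+ 3 / 2) + (+ 2 / 1) * δ ≤ total Z
        total≥ Z dense = 0≤q-p⇒p≤q (cancel-pos (0<ι n) (subst (0ℚ ≤_) eq
            (0≤+ (0≤+ (0≤* (lit (+ 4 / 1)) (p≤q⇒0≤q-p dense)) (0≤* (0≤+ (lit (+ 3 / 2)) (0≤* (lit (+ 2 / 1)) 0≤δ′)) 0≤n)) (0≤* (0≤* 0≤δ′ (<⇒≤ 0<N)) (0≤+ (lit (+ 117 / 64)) (0≤* (lit (+ 1 / 8)) δ≤5/8))))))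
          where
          s : ℚ
          s = total Z
          nZ : ι n * s ≡ (+ 4 / 1) * ι ∣ Z ∣ˢ
          nZ = mass Z
          0≤n : 0ℚ ≤ ι N + ι N * ((+ 1 / 16) * δ) - ι n
          0≤n = cancel-pos (0<ι D) (subst (0ℚ ≤_) eq₁ (0≤+ (p≤q⇒0≤q-p (subst₂ _≤_ (ι-* D n) (trans (ι-+ (D ℕ.* N) N) (cong (_+ ι N) (ι-* D N))) (ι-mono Dn≤)))
              (0≤* (0≤* (0≤ι D) (0≤ι N)) (p≤q⇒0≤q-p D≥))))
            where
            eq₁ : ι D * ι N + ι N - ι D * ι n + ι D * ι N * ((+ 1 / 16) * δ - recip D) ≡ ι D * (ι N + ι N * ((+ 1 / 16) * δ) - ι n)
            eq₁ = trans (0≤n-identity (ι D) (ι N) (ι n) (recip D) ((+ 1 / 16) * δ)) (trans (cong (λ z → ι D * (ι N + ι N * ((+ 1 / 16) * δ) - ι n) + ι N * (1ℚ - z)) (ι*recip D))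
              (trans (cong (λ z → ι D * (ι N + ι N * ((+ 1 / 16) * δ) - ι n) + z) (*-zeroʳ (ι N))) (+-identityʳ _)))
          eq : (+ 4 / 1) * (ι ∣ Z ∣ˢ - ((+ 3 / 8) + δ) * ι N) + ((+ 3 / 2) + (+ 2 / 1) * δ) * (ι N + ι N * ((+ 1 / 16) * δ) - ι n) + δ * ι N * ((+ 117 / 64) + (+ 1 / 8) * ((+ 5 / 8) - δ))
            ≡ ι n * (s - ((+ 3 / 2) + (+ 2 / 1) * δ))
          eq = trans (total≥-identity₂ δ (ι N) (ι n) (ι ∣ Z ∣ˢ)) (trans (cong (_- ι n * ((+ 3 / 2) + (+ 2 / 1) * δ)) (sym nZ)) (total≥-identity (ι n) s ((+ 3 / 2) + (+ 2 / 1) * δ)))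

        -- With few pairs the error ζ is at most δ/8, so one of the two totals is at most 3/2 + 6ζ ≤
        -- 3/2 + (3/4)δ, while both are at least 3/2 + 2δ.
        impossible : ¬ ((+ 16 / 1) * (W * C) ≤ (+ 1 / 16) * δ * (ι n * ι n))
        impossible few = <-irrefl refl (<-≤-trans 0<δ δ≤0)
          where
          ζ : ℚ
          ζ = (+ 1 / 16) * δ + recip D
          0≤ζ : 0ℚ ≤ ζ
          0≤ζ = 0≤+ (0≤* (lit (+ 1 / 16)) 0≤δ′) (0≤recip D)
          ζ≤ : ζ ≤ (+ 1 / 8) * δ
          ζ≤ = ≤-trans (+-monoʳ-≤ ((+ 1 / 16) * δ) D≥) (≤-reflexive (ζ≤-identity δ))
          ζ≤⅒ : ζ ≤ + 1 / 10
          ζ≤⅒ = ≤-trans ζ≤ (slack ((+ 1 / 8) * ((+ 5 / 8) - δ) + (+ 7 / 320)) (0≤+ (0≤* (lit (+ 1 / 8)) δ≤5/8) (lit (+ 7 / 320))) (ζ≤⅒-identity δ))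
          relB = relation X Y few
          relA = relation Y X (subst (λ c → (+ 16 / 1) * (W * c) ≤ (+ 1 / 16) * δ * (ι n * ι n)) (comm X Y) few)
          <4 : ∀ k → k ℕ.≤ 3 → k ℕ.< 4
          <4 k k≤3 = s≤s k≤3
          0<4 = <4 0 z≤n
          1<4 = <4 1 (s≤s z≤n)
          2<4 = <4 2 (s≤s (s≤s z≤n))
          3<4 = <4 3 (s≤s (s≤s (s≤s z≤n)))
          ΣX : (+ 3 / 2) + (+ 2 / 1) * δ ≤ total X
          ΣX = total≥ X dense-X
          ΣY : (+ 3 / 2) + (+ 2 / 1) * δ ≤ total Y
          ΣY = total≥ Y dense-Y
          weaken : ∀ {t} → (+ 3 / 2) + (+ 2 / 1) * δ ≤ t → + 3 / 2 ≤ t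
          weaken = ≤-trans (slack ((+ 2 / 1) * δ) (0≤* (lit (+ 2 / 1)) 0≤δ′) (weaken-identity δ))
          clash : ∀ {t} → (+ 3 / 2) + (+ 2 / 1) * δ ≤ t → t ≤ (+ 3 / 2) + (+ 6 / 1) * ζ → δ ≤ 0ℚ
          clash lo hi = slack _ (0≤+ (0≤* (lit (+ 4 / 5)) (p≤q⇒0≤q-p (≤-trans lo hi))) (0≤* (lit (+ 24 / 5)) (p≤q⇒0≤q-p ζ≤))) (clash-identity δ ζ)
          δ≤0 : δ ≤ 0ℚ
          δ≤0 = [ clash ΣY , clash ΣX ]′ (two-sided 0≤ζ ζ≤⅒
            (dens-unit X 0) (dens-unit X 1) (dens-unit X 2) (dens-unit X 3)
            (dens-unit Y 0) (dens-unit Y 1) (dens-unit Y 2) (dens-unit Y 3)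
            -- The numbers are s, r₀, r₁, t with s + r₀ = 4t and s + r₁ congruent to 1 modulo 4.
            (relA 0 0 1 0 0<4 0<4 1<4 refl refl) (relA 1 3 0 1 1<4 3<4 0<4 refl refl) (relA 2 2 3 1 2<4 2<4 3<4 refl refl) (relA 3 1 2 1 3<4 1<4 2<4 refl refl)
            (relB 0 0 1 0 0<4 0<4 1<4 refl refl) (relB 1 3 0 1 1<4 3<4 0<4 refl refl) (relB 2 2 3 1 2<4 2<4 3<4 refl refl) (relB 3 1 2 1 3<4 1<4 2<4 refl refl)
            (weaken ΣX) (weaken ΣY))

        many : (+ 1 / 16) * δ * (ι n * ι n) ≤ (+ 16 / 1) * (W * C)
        many with ≤-total ((+ 1 / 16) * δ * (ι n * ι n)) ((+ 16 / 1) * (W * C))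
        ... | inj₁ h = h
        ... | inj₂ h = contradiction h impossible

      -- From 16WC ≥ (δ/16)n² and W ≤ 24R the count C is at least δn² / (6144R), already linear in
      -- δ. It is weakened by δ³ ≤ δ and by R(R + 1) ≤ 2R² ≤ 2N to the form needed later, where R +
      -- 1 stands in for √N.
      pairs≥ : (+ 8 / 1000000) * (δ * (δ * δ)) * ι (N ℕ.* suc R) ≤ C
      pairs≥ = 0≤q-p⇒p≤q (cancel-pos (0<ι R {{ℕ.>-nonZero 1≤R}}) (subst (0ℚ ≤_) (trans (pairs≥-identity δ (ι N) (ι R) (ι n) W C) (cong (λ z → ι R * (C - (+ 8 / 1000000) * (δ * (δ * δ)) * z)) (sym ιNR)))
        (0≤+ (0≤+ (0≤+ (0≤+ (0≤+ (0≤* (lit (+ 1 / 24)) (0≤* (p≤q⇒0≤q-p W≤) (0≤ι (#squarePairs X Y)))) (0≤* (lit (+ 1 / 384)) (p≤q⇒0≤q-p many)))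
          (0≤* (lit (+ 1 / 6144)) (0≤* 0≤δ′ (0≤* 0≤n-N (0≤+ (0≤ι n) (0≤ι N))))))
          (0≤* (lit (+ 16 / 1000000)) (0≤* (0≤* 0≤δ′ (0≤* 0≤1-δ (0≤+ (lit 1ℚ) 0≤δ′))) (0≤* (0≤ι N) (0≤ι N)))))
          (0≤* (lit (+ 8 / 1000000)) (0≤* (0≤* 0≤δ′ (0≤* 0≤δ′ 0≤δ′)) (0≤* (0≤ι N) (0≤+ (0≤+ 0≤N-R² 0≤N-R²) (0≤* (0≤ι R) 0≤R-1))))))
          (0≤* (lit ((+ 1 / 6144) - (+ 16 / 1000000))) (0≤* 0≤δ′ (0≤* (0≤ι N) (0≤ι N)))))))
        where
        ιNR : ι (N ℕ.* suc R) ≡ ι N * (ι R + 1ℚ)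
        ιNR = trans (ι-* N (suc R)) (cong (ι N *_) (ι-suc R))
        W≤ : W ≤ ι R * (+ 24 / 1)
        W≤ = ≤-trans W≤24R (≤-reflexive (trans (ι-* R 24) (cong (ι R *_) (ι≡/1 24))))
        0≤n-N : 0ℚ ≤ ι n - ι N
        0≤n-N = p≤q⇒0≤q-p (ι-mono (ℕ.<⇒≤ N<n))
        0≤N-R² : 0ℚ ≤ ι N - ι R * ι R
        0≤N-R² = p≤q⇒0≤q-p (≤-trans (≤-reflexive (sym (ι-* R R))) (ι-mono R²≤N))
        0≤R-1 : 0ℚ ≤ ι R - 1ℚ
        0≤R-1 = p≤q⇒0≤q-p (subst (_≤ ι R) ι-1 (ι-mono 1≤R))
        0≤1-δ : 0ℚ ≤ 1ℚ - δ
        0≤1-δ = subst (0ℚ ≤_) (0≤1-δ-identity δ) (0≤+ δ≤5/8 (lit (+ 3 / 8)))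

      pairs>0 : 1 ℕ.≤ #squarePairs X Y
      pairs>0 = ℕ.≮⇒≥ (λ C<1 → <-irrefl refl (<-≤-trans positive′ (≤-trans pairs≥ (≤-reflexive (trans (cong ι (ℕ.n<1⇒n≡0 C<1)) ι-0)))))
        where
        positive′ : 0ℚ < (+ 8 / 1000000) * (δ * (δ * δ)) * ι (N ℕ.* suc R)
        positive′ = *-pos (*-pos (positive⁻¹ (+ 8 / 1000000)) (*-pos 0<δ (*-pos 0<δ 0<δ)))
          (0<ι (N ℕ.* suc R) {{ℕ.m*n≢0 N (suc R) {{ℕ.>-nonZero (ℕ.≤-trans (ℕ.*-mono-≤ 1≤R 1≤R) R²≤N)}}}})

-- Assembly for a rational margin

module RationalTheorem where

  open Data.Rational.Base
  open Data.Rational.Properties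
  open Sums
  open Averages
  open Windows
  open Counting
  open ParameterChoice
  open DensityContradiction
  open Defs using (isqrt; #squarePairs)

  module _ (D : ℕ) .{{_ : ℕ.NonZero D}} {δ : ℚ} (0<δ : 0ℚ < δ) (D≥ : recip D ≤ (+ 1 / 16) * δ) where

    open Choose D

    module _ (N : ℕ) (big : threshold ℕ.* threshold ℕ.≤ N) (X Y : Subset N)
      (dense-X : ((+ 3 / 8) + δ) * ι N ≤ ι ∣ X ∣ˢ) (dense-Y : ((+ 3 / 8) + δ) * ι N ≤ ι ∣ Y ∣ˢ) where

      open For N big hiding (X; E; ε)

      private
        W : ℚ
        W = Range.W n Λ a₁

        comm : ∀ (X Y : Subset N) → ι (#squarePairs X Y) ≡ ι (#squarePairs Y X)
        comm X Y = trans (pair-count N<n X Y) (trans (PairSum.pairs-comm n Λ a₁ (indicator X) (indicator Y)) (sym (pair-count N<n Y X)))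

        dens : Subset N → ℕ → ℚ
        dens Z = density′ (indicator𝟘𝟙 N<n Z)

        mass′ : ∀ Z → ι n * (dens Z 0 + dens Z 1 + dens Z 2 + dens Z 3) ≡ (+ 4 / 1) * ι ∣ Z ∣ˢ
        mass′ Z = trans (mass (indicator𝟘𝟙 N<n Z)) (cong ((+ 4 / 1) *_) (∑indicator N<n Z))

        module C = Conclusion D N n R W 0<δ D≥ comm (ℕ.≤-trans (ℕ.>-nonZero⁻¹ (K ℕ.* g)) p₁≤R) R²≤N N<n Dn≤ (ι-mono W≤24R) dens
          (λ Z → density-unit (indicator𝟘𝟙 N<n Z)) mass′
          (λ X Y few → relation (indicator𝟘𝟙 N<n X) (indicator𝟘𝟙 N<n Y) refl ((+ 1 / 16) * δ)
            (subst (λ c → (+ 16 / 1) * (W * c) ≤ (+ 1 / 16) * δ * (ι n * ι n)) (pair-count N<n X Y) few))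

      pairs≥ : (+ 8 / 1000000) * (δ * (δ * δ)) * ι (N ℕ.* suc (isqrt N)) ≤ ι (#squarePairs X Y)
      pairs≥ = C.pairs≥ X Y dense-X dense-Y

      pairs>0 : 1 ℕ.≤ #squarePairs X Y
      pairs>0 = C.pairs>0 X Y dense-X dense-Y

-- Passage to a real margin

module RealApproximation where

  open Data.Rational.Base
  open Data.Rational.Properties
  open Rationals
  open Sums
  open Averages
  open DensityInequality
  open Progressions
  open ParameterChoice
  open RationalTheorem
  open Defs using (isqrt; isqrt-lower; isqrt-upper; square-cancel-≤; /-mono-≤; suc-/; archimedean; squarePairs; #squarePairs; √-seq; ℝ; seq; cauchy; *-pos; *-mono-≤-nonNeg; 0ℝ; fromℚ; fromℕ; S; ⟦_⟧; _⊕_)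

  ≤-from-slack : ∀ {p q} → (∀ η → 0ℚ < η → p ≤ q + η) → p ≤ q
  ≤-from-slack {p} {q} h = ≮⇒≥ (λ q<p → let m , q<m , m<p = <-dense q<p in
    <-irrefl refl (<-≤-trans m<p (≤-trans (h (m - q) (subst (_< m - q) (+-inverseʳ q) (+-monoˡ-< (- q) q<m))) (≤-reflexive (ring q m)))))
    where
    ring : ∀ q m → q + (m - q) ≡ m
    ring = solve-∀ ℚ-ring

  recip≤ : ∀ k {q} → + 1 / suc k ≤ q → recip (suc k) ≤ q
  recip≤ k {q} h = 0≤q-p⇒p≤q (cancel-pos (0<ι (suc k)) (subst (0ℚ ≤_) eq (p≤q⇒0≤q-p (≤-trans one (*-monoˡ-≤-nonNeg (ι (suc k)) {{nonNegative (0≤ι (suc k))}} h)))))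
    where
    scale : ∀ m → ι m * (+ 1 / suc k) ≡ + m / suc k
    scale zero    = trans (cong (_* (+ 1 / suc k)) ι-0) (trans (*-zeroˡ (+ 1 / suc k)) (≤-antisym (/-mono-≤ 0 0 0 k z≤n) (/-mono-≤ 0 k 0 0 z≤n)))
    scale (suc m) = trans (cong (_* (+ 1 / suc k)) (ι-suc m)) (trans (ring (ι m) (+ 1 / suc k)) (trans (cong (_+ (+ 1 / suc k)) (scale m)) (sym (suc-/ m k))))
      where
      ring : ∀ m r → (m + 1ℚ) * r ≡ m * r + r
      ring = solve-∀ ℚ-ring
    one : 1ℚ ≤ ι (suc k) * (+ 1 / suc k)
    one = ≤-trans (/-mono-≤ 1 0 (suc k) k (ℕ.≤-reflexive (ℕ.*-comm 1 (suc k)))) (≤-reflexive (sym (scale (suc k))))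
    ring : ∀ d q r → d * q - d * r ≡ d * (q - r)
    ring = solve-∀ ℚ-ring
    eq : ι (suc k) * q - 1ℚ ≡ ι (suc k) * (q - recip (suc k))
    eq = trans (cong (λ z → ι (suc k) * q - z) (sym (ι*recip (suc k)))) (ring (ι (suc k)) q (recip (suc k)))

  √-seq≤ : ∀ x y → x ℕ.≤ y ℕ.* y → ∀ k → √-seq x k ≤ ι y
  √-seq≤ x y x≤y² k = ≤-trans (/-mono-≤ a k y 0 (ℕ.≤-trans (ℕ.≤-reflexive (ℕ.*-identityʳ a)) (square-cancel-≤ a (y ℕ.* suc k)
      (ℕ.≤-trans (isqrt-lower (x ℕ.* (suc k ℕ.* suc k))) (ℕ.≤-trans (ℕ.*-monoˡ-≤ (suc k ℕ.* suc k) x≤y²) (ℕ.≤-reflexive (eq y (suc k)))))))) (≤-reflexive (sym (ι≡/1 y)))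
    where
    a : ℕ
    a = isqrt (x ℕ.* (suc k ℕ.* suc k))
    eq : ∀ y k → y ℕ.* y ℕ.* (k ℕ.* k) ≡ y ℕ.* k ℕ.* (y ℕ.* k)
    eq = ℕ.solve-∀


  -- ⌊√N⌋ + 1 exceeds √N, so N * (⌊√N⌋ + 1) is an integer above the square root of N³.
  N³≤ : ∀ N → N ℕ.^ 3 ℕ.≤ N ℕ.* suc (isqrt N) ℕ.* (N ℕ.* suc (isqrt N))
  N³≤ N = ℕ.≤-trans (ℕ.≤-reflexive (eq N)) (ℕ.≤-trans (ℕ.*-monoʳ-≤ (N ℕ.* N) (ℕ.<⇒≤ (isqrt-upper N))) (ℕ.≤-reflexive (eq₂ N (suc (isqrt N)))))
    where
    eq : ∀ N → N ℕ.* (N ℕ.* (N ℕ.* 1)) ≡ N ℕ.* N ℕ.* N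
    eq = ℕ.solve-∀
    eq₂ : ∀ N s → N ℕ.* N ℕ.* (s ℕ.* s) ≡ N ℕ.* s ℕ.* (N ℕ.* s)
    eq₂ = ℕ.solve-∀

  squarePair-exists : ∀ {N} (A B : Subset N) → 1 ℕ.≤ #squarePairs A B → ∃[ n ] ((A ⊕ B) n × S n)
  squarePair-exists {N} A B = pick (squarePairs A B) (all-filter _ (cartesianProduct (allFin N) (allFin N)))
    where
    pick : ∀ xs → All (λ (a , b) → a ∈ A × b ∈ B × S (⟦ a ⟧ ℕ.+ ⟦ b ⟧)) xs → 1 ℕ.≤ length xs → ∃[ n ] ((A ⊕ B) n × S n)
    pick ((a , b) ∷ _) ((a∈A , b∈B , square) ∷ _) _ = ⟦ a ⟧ ℕ.+ ⟦ b ⟧ , (a , b , a∈A , b∈B , refl) , square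

  bound-identity₂ : ∀ d → (+ 1 / 1000000) * ((+ 2 / 1) * d * ((+ 2 / 1) * d * ((+ 2 / 1) * d * 1ℚ))) ≡ (+ 8 / 1000000) * (d * (d * d))
  bound-identity₂ = solve-∀ ℚ-ring

  ¾δ₀≤δ-identity : ∀ e d → e - (+ 1 / 4) * d - (+ 3 / 4) * d ≡ e - d
  ¾δ₀≤δ-identity = solve-∀ ℚ-ring

  ε≤2δ-identity : ∀ e d → (+ 2 / 1) * (e - (+ 1 / 4) * d) - (e + (+ 1 / 4) * d) ≡ (e - (+ 1 / 4) * d - (+ 3 / 4) * d) + (+ 1 / 4) * d
  ε≤2δ-identity = solve-∀ ℚ-ring

  module Approximation (ε : ℝ) (0<ε : 0ℝ Defs.< ε) where

    private
      δ₀ : ℚ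
      δ₀ = proj₁ 0<ε
      0<δ₀ : 0ℚ < δ₀
      0<δ₀ = proj₁ (proj₂ 0<ε)
      M₀ : ℕ
      M₀ = proj₁ (proj₂ (proj₂ 0<ε))
      0<¼δ₀ : 0ℚ < (+ 1 / 4) * δ₀
      0<¼δ₀ = *-pos (positive⁻¹ (+ 1 / 4)) 0<δ₀
      M₁ : ℕ
      M₁ = proj₁ (cauchy ε ((+ 1 / 4) * δ₀) 0<¼δ₀)

    M : ℕ
    M = M₀ ℕ.⊔ M₁

    private
      e : ℚ
      e = seq ε M
      δ₀≤e : δ₀ ≤ e
      δ₀≤e = subst (_≤ e) (+-identityˡ δ₀) (proj₂ (proj₂ (proj₂ 0<ε)) M (ℕ.m≤m⊔n M₀ M₁))
      close : ∀ n → M ℕ.≤ n → ∣ seq ε n - e ∣ ≤ (+ 1 / 4) * δ₀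
      close n M≤n = proj₂ (cauchy ε ((+ 1 / 4) * δ₀) 0<¼δ₀) n M (ℕ.m⊔n≤o⇒n≤o M₀ M₁ M≤n) (ℕ.m≤n⊔m M₀ M₁)

    -- From `M` on the terms of ε stay within δ₀/4 of `e`, and e ≥ δ₀. Subtracting δ₀/4 gives a
    -- rational that satisfies δ ≤ ε ≤ 2δ termwise; the cube of this factor 2 is the 8 in `pairs≥`.
    δ : ℚ
    δ = e - (+ 1 / 4) * δ₀

    private
      ¾δ₀≤δ : (+ 3 / 4) * δ₀ ≤ δ
      ¾δ₀≤δ = slack _ (p≤q⇒0≤q-p δ₀≤e) (¾δ₀≤δ-identity e δ₀)

    0<δ : 0ℚ < δ
    0<δ = <-≤-trans (*-pos (positive⁻¹ (+ 3 / 4)) 0<δ₀) ¾δ₀≤δ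

    δ≤ε : ∀ n → M ℕ.≤ n → δ ≤ seq ε n
    δ≤ε n M≤n = ≥-from-∣-∣ (close n M≤n)

    ε≤2δ : ∀ n → M ℕ.≤ n → seq ε n ≤ (+ 2 / 1) * δ
    ε≤2δ n M≤n = ≤-trans (≤-from-∣-∣ (close n M≤n)) (slack ((e - (+ 1 / 4) * δ₀ - (+ 3 / 4) * δ₀) + (+ 1 / 4) * δ₀) (0≤+ (p≤q⇒0≤q-p ¾δ₀≤δ) (<⇒≤ 0<¼δ₀)) (ε≤2δ-identity e δ₀))

    private
      0<δ/16 : 0ℚ < (+ 1 / 16) * δ
      0<δ/16 = *-pos (positive⁻¹ (+ 1 / 16)) 0<δ

    -- Opaque, because the factorial in the threshold would unfold on a successor.
    opaque
      D : ℕ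
      D = suc (proj₁ (archimedean 0<δ/16))
      D-nonZero : ℕ.NonZero D
      D-nonZero = _
      D≥ : recip D {{D-nonZero}} ≤ (+ 1 / 16) * δ
      D≥ = recip≤ _ (proj₂ (archimedean 0<δ/16) _ ℕ.≤-refl)

    private
      instance
        nz : ℕ.NonZero D
        nz = D-nonZero

    N₀ : ℕ
    N₀ = Choose.threshold D ℕ.* Choose.threshold D

    -- The terms of ε are eventually at least δ. The order on ℝ leaves a slack η, which disappears
    -- because the inequality between the two rationals holds for every η > 0.
    rational-density : ∀ N k → (fromℚ (+ 3 / 8) Defs.+ ε) Defs.* fromℕ N Defs.≤ fromℕ k → ((+ 3 / 8) + δ) * ι N ≤ ι k
    rational-density N k h = ≤-from-slack (λ η 0<η → let L , p = h η 0<η ; n = M ℕ.⊔ L in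
      ≤-trans (≤-trans (*-monoʳ-≤-nonNeg (ι N) {{nonNegative (0≤ι N)}} (+-monoʳ-≤ (+ 3 / 8) (δ≤ε n (ℕ.m≤m⊔n M L)))) (≤-reflexive (cong (((+ 3 / 8) + seq ε n) *_) (ι≡/1 N))))
        (≤-trans (p n (ℕ.m≤n⊔m M L)) (≤-reflexive (cong (_+ η) (sym (ι≡/1 k))))))

    module _ {N} (N₀≤N : N₀ ℕ.≤ N) (A B : Subset N) (dense-A : (fromℚ (+ 3 / 8) Defs.+ ε) Defs.* fromℕ N Defs.≤ fromℕ ∣ A ∣ˢ)
      (dense-B : (fromℚ (+ 3 / 8) Defs.+ ε) Defs.* fromℕ N Defs.≤ fromℕ ∣ B ∣ˢ) where

      private
        rA : ((+ 3 / 8) + δ) * ι N ≤ ι ∣ A ∣ˢ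
        rA = rational-density N ∣ A ∣ˢ dense-A
        rB : ((+ 3 / 8) + δ) * ι N ≤ ι ∣ B ∣ˢ
        rB = rational-density N ∣ B ∣ˢ dense-B

      meets-squares : ∃[ n ] ((A ⊕ B) n × S n)
      meets-squares = squarePair-exists A B (pairs>0 D 0<δ D≥ N N₀≤N A B rA rB)

      many-pairs : fromℚ (+ 1 / 1000000) Defs.* ε Defs.^ 3 Defs.* N Defs.^3/2 Defs.≤ fromℕ (#squarePairs A B)
      many-pairs η 0<η = M , λ n M≤n → ≤-trans (bound n M≤n) (≤-trans (pairs≥ D 0<δ D≥ N N₀≤N A B rA rB)
          (≤-trans (≤-reflexive (trans (ι≡/1 (#squarePairs A B)) (sym (+-identityʳ (+ #squarePairs A B / 1))))) (+-monoʳ-≤ (+ #squarePairs A B / 1) (<⇒≤ 0<η))))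
        where
        bound : ∀ n → M ℕ.≤ n → (+ 1 / 1000000) * (seq ε n * (seq ε n * (seq ε n * 1ℚ))) * √-seq (N ℕ.^ 3) n
          ≤ (+ 8 / 1000000) * (δ * (δ * δ)) * ι (N ℕ.* suc (isqrt N))
        bound n M≤n = *-mono-≤-nonNeg (0≤* (lit (+ 1 / 1000000)) (0≤* 0≤x (0≤* 0≤x (0≤* 0≤x (lit 1ℚ))))) (0≤ι (N ℕ.* suc (isqrt N)))
            (≤-trans (*-monoˡ-≤-nonNeg (+ 1 / 1000000) cube) (≤-reflexive (bound-identity₂ δ))) (√-seq≤ (N ℕ.^ 3) (N ℕ.* suc (isqrt N)) (N³≤ N) n)
          where
          x y : ℚ
          x = seq ε n
          y = (+ 2 / 1) * δ
          0≤x : 0ℚ ≤ x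
          0≤x = ≤-trans (<⇒≤ 0<δ) (δ≤ε n M≤n)
          0≤y : 0ℚ ≤ y
          0≤y = 0≤* (lit (+ 2 / 1)) (<⇒≤ 0<δ)
          x≤y : x ≤ y
          x≤y = ε≤2δ n M≤n
          cube : x * (x * (x * 1ℚ)) ≤ y * (y * (y * 1ℚ))
          cube = *-mono-≤-nonNeg 0≤x (0≤* 0≤y (0≤* 0≤y (lit 1ℚ))) x≤y (*-mono-≤-nonNeg 0≤x (0≤* 0≤y (lit 1ℚ)) x≤y (*-mono-≤-nonNeg 0≤x (lit 1ℚ) x≤y ≤-refl))

open import Data.Fin.Subset using (∣_∣)
open import Data.Rational.Base using (_/_)
open import Defs

theorem1p1 : (ε : ℝ) → 0ℝ < ε →
    ∃[ N₀ ] ((N : ℕ) → N₀ ℕ.≤ N →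
    (A B : Subset N) →
    (fromℚ (+ 3 / 8) + ε) * fromℕ N ≤ fromℕ ∣ A ∣ →
    (fromℚ (+ 3 / 8) + ε) * fromℕ N ≤ fromℕ ∣ B ∣ →
    (∃[ n ] ((A ⊕ B) n × S n)) ×
    (fromℚ (+ 1 / 1000000) * ε ^ 3 * N ^3/2 ≤ fromℕ (#squarePairs A B)))
theorem1p1 ε 0<ε = N₀ , λ N N₀≤N A B dense-A dense-B →
  meets-squares N₀≤N A B dense-A dense-B , many-pairs N₀≤N A B dense-A dense-B
  where
  open RealApproximation.Approximation ε 0<ε
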